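{- For every $\eta>0$ there exists a positive integer $N_0$ such that for every integer $N>N_0$ the following holds. Let $\alpha_1>\alpha_2>0$ with $\alpha_1+\alpha_2=1$. Let $G[X,Y]$ be a balanced bipartite graph with $|X|=|Y|=N-1$ and minimum degree $\delta(G)\geq(\frac{3}{4}+3\eta)(N-1)$. Then for every red-blue-edge-coloring of $G$, either for every even integer $\ell$ with $4\le \ell\le (2-3\eta^2)\alpha_1N$ there is a red cycle of length $\ell$ in $G$, or for every even integer $\ell$ with $4\le \ell\le (2-3\eta^2)\alpha_2N$ there is a blue cycle of length $\ell$ in $G$.
   Context: A red (resp. blue) cycle is a cycle all of whose edges are colored red (resp. blue).
   Formalization: The parameters η, α₁ and α₂ are taken to be rational rather than real; the real case follows by taking a slightly smaller rational η and rational α₁, α₂ close to the given ones. -}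

module Defs where

open import Data.Nat using (ℕ; zero; suc)
open import Data.Fin using (Fin; toℕ)
open import Data.Bool using (Bool; true; false; T; if_then_else_)
open import Data.List using (List; map; allFin)
open import Data.Nat.ListAction using (sum)
open import Data.Sum using (_⊎_; inj₁; inj₂)
open import Data.Product using (Σ; _×_)
open import Data.Empty using (⊥)
open import Data.Integer using (+_)
open import Data.Rational using (ℚ; _/_)
open import Function.Definitions using (Injective)
open import Relation.Binary.PropositionalEquality using (_≡_)

data Colour : Set where
  red blue : Colour

ℕtoℚ : ℕ → ℚ
ℕtoℚ n = + n / 1

-- A bipartite graph G[X,Y] with |X| = |Y| = m, X = Y = Fin m as index sets.
-- adj x y = true  iff  x ∈ X is adjacent to y ∈ Y.
record BipGraph (m : ℕ) : Set where
  field
    adj : Fin m → Fin m → Bool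

open BipGraph public

Vertex : ℕ → Set
Vertex m = Fin m ⊎ Fin m

degX : ∀ {m} → BipGraph m → Fin m → ℕ
degX {m} G x = sum (map (λ y → if adj G x y then 1 else 0) (allFin m))

degY : ∀ {m} → BipGraph m → Fin m → ℕ
degY {m} G y = sum (map (λ x → if adj G x y then 1 else 0) (allFin m))

MinDegree≥ : ∀ {m} → BipGraph m → ℚ → Set
MinDegree≥ {m} G d =
  ((x : Fin m) → d Data.Rational.≤ ℕtoℚ (degX G x)) ×
  ((y : Fin m) → d Data.Rational.≤ ℕtoℚ (degY G y))

-- A red-blue edge colouring: colour of the (potential) edge xy, x ∈ X, y ∈ Y
-- (only its values on edges of G matter).
Colouring : ℕ → Set
Colouring m = Fin m → Fin m → Colour

ColEdge : ∀ {m} → BipGraph m → Colouring m → Colour → Vertex m → Vertex m → Set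
ColEdge G col c (inj₁ x) (inj₂ y) = T (adj G x y) × (col x y ≡ c)
ColEdge G col c (inj₂ y) (inj₁ x) = T (adj G x y) × (col x y ≡ c)
ColEdge G col c (inj₁ _) (inj₁ _) = ⊥
ColEdge G col c (inj₂ _) (inj₂ _) = ⊥

CycSucc : ∀ {ℓ} → Fin ℓ → Fin ℓ → Set
CycSucc {ℓ} i j = (toℕ j ≡ suc (toℕ i)) ⊎ ((toℕ j ≡ 0) × (suc (toℕ i) ≡ ℓ))

MonoCycle : ∀ {m} → BipGraph m → Colouring m → Colour → ℕ → Set
MonoCycle {m} G col c ℓ =
  (3 Data.Nat.≤ ℓ) ×
  Σ (Fin ℓ → Vertex m) λ v →
    Injective _≡_ _≡_ v ×
    ((i j : Fin ℓ) → CycSucc i j → ColEdge G col c (v i) (v j))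

{-# OPTIONS --safe #-}
module Submission where

-- Idea.  Fix a colour and suppose it has no cycle of length 2k.  Deleting few edges, one can split it into
-- "components" each of which has a vertex cover of size about k (`removal`).  If both colours fail, one obtains
-- two such structures whose covers have total size less than N, and this contradicts the minimum degree
-- (`no-config`): by the covers, the large cells cut out by a red and a blue component cannot exist on both sides,
-- while the degree condition forces them to exist.
--
-- The removal statement avoids the regularity lemma.  A greedily chosen reserve R ⊆ Y sees degrees and codegrees
-- in proportion; call x, x′ linked if they have many common neighbours in R.  Independent sets of the linking
-- graph Q are bounded, so Q either splits along a sparse cut of the graph (recurse) or has many disjoint
-- connected dominating sets of bounded size, and, by Ramsey, a clique.  In the latter case take a maximum
-- subgraph of degree at most B = cn.  By duality it yields the small cover, or it has at least B(k + n/e) edges.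
-- Then split the vertices equitably into 2t layers; weighted König in the split digraph gives about k/t disjoint
-- paths through all layers.  Ends of paths that are linked in Q are joined through R until boundedly many paths
-- remain; these are closed up through the dominating sets, and the clique adjusts the length to exactly 2k.

open import Data.Bool using (Bool; true; false; not; _∧_; _∨_; if_then_else_)
open import Data.Bool.Properties using (∧-zeroʳ) renaming (_≟_ to _≟ᴮ_)
open import Data.Empty using (⊥; ⊥-elim)
open import Data.Fin as Fin using (Fin; zero; suc; toℕ; fromℕ<; inject≤; splitAt; _↑ˡ_; _↑ʳ_)
open import Data.Fin.Properties using (toℕ-injective; toℕ<n; toℕ-fromℕ<; inject≤-injective; splitAt-↑ˡ; splitAt-↑ʳ; splitAt⁻¹-↑ˡ; splitAt⁻¹-↑ʳ)
import Data.Integer as ℤ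
import Data.Integer.Properties as ℤ
open import Data.Integer.Tactic.RingSolver using () renaming (solve-∀ to solveℤ)
open import Data.List using (List; []; _∷_; length; _++_; concat; map; [_]; take; drop; allFin; lookup; tabulate)
open import Data.List.Membership.Propositional using (_∈_; _∉_)
open import Data.List.Membership.Propositional.Properties using (∈-++⁺ˡ; ∈-++⁺ʳ; ∈-++⁻; ∈-map⁻; ∈-map⁺; ∈-lookup)
open import Data.List.Properties using (length-++; length-map; length-take; ++-assoc; ++-identityʳ; map-++; concat-++; take++drop≡id; map-tabulate; ≡-dec)
open import Data.List.Relation.Binary.Disjoint.Propositional using (Disjoint)
open import Data.List.Relation.Binary.Permutation.Propositional as ↭ using (_↭_; ↭-refl; ↭-sym; ↭-trans; prep; ↭⇒↭ₛ)
open import Data.List.Relation.Binary.Permutation.Propositional.Properties using (∈-resp-↭; shift; shifts; ++-comm; ++⁺ˡ; ++⁺ʳ; ↭-length)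
import Data.List.Relation.Binary.Permutation.Setoid.Properties as PermSetoid
open import Data.List.Relation.Unary.All as All using (All; []; _∷_)
import Data.List.Relation.Unary.All.Properties as All
open import Data.List.Relation.Unary.AllPairs as AllPairs using (AllPairs; []; _∷_)
import Data.List.Relation.Unary.AllPairs.Properties as AllPairs
open import Data.List.Relation.Unary.Any using (here; there)
open import Data.List.Relation.Unary.Unique.Propositional using (Unique)
import Data.List.Relation.Unary.Unique.Propositional.Properties as Unique
open import Data.Nat using (ℕ; zero; suc; _+_; _*_; _∸_; _^_; ∣_-_∣; _≤_; _<_; z≤n; s≤s; _≤ᵇ_; _≡ᵇ_; _≤?_)
open import Data.Nat.Divisibility using (_∣_; divides)
open import Data.Nat.DivMod using (_/_; m/n*n≤m; m≡m%n+[m/n]*n; m%n<n; _%_; m*n/n≡m; /-monoˡ-≤)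
open import Data.Nat.ListAction using () renaming (sum to sumᴸ)
open import Data.Nat.Properties
open import Data.Nat.Tactic.RingSolver using (solve-∀)
open import Data.Product using (Σ; ∃; _×_; _,_; proj₁; proj₂)
open import Data.Rational as ℚ using (ℚ; mkℚ; 0ℚ; 1ℚ; toℚᵘ)
import Data.Rational.Properties as ℚ
open import Data.Rational.Solver using (module +-*-Solver)
open import Data.Rational.Unnormalised using (mkℚᵘ; *≡*)
import Data.Rational.Unnormalised as ℚᵘ
import Data.Rational.Unnormalised.Properties as ℚᵘ
open import Data.Sum as Sum using (_⊎_; inj₁; inj₂; map₂; [_,_]′)
open import Data.Sum.Properties using (inj₁-injective; inj₂-injective)
open import Data.Unit using (tt)
open import Function using (id; _|>_)
open import Relation.Binary.PropositionalEquality using (_≡_; _≢_; refl; sym; trans; cong; cong₂; subst; subst₂)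
open import Relation.Binary.PropositionalEquality.Properties using (setoid)
open import Relation.Nullary using (¬_; Dec; yes; no; does)

-- Certificates for polynomial inequalities over ℕ

-- A cycle lies in one component, so a missing length bounds the cover of each component separately,
-- while the covers of all components of one colour may together exceed N by far. This is why
-- structures carry labels, and why the last part has to play the labels of the two colours against
-- each other before one cover of each colour can be added up. The lengths enter only through that
-- sum: two missing lengths 2k₁ and 2k₂ satisfy k₁ + k₂ ≤ (1 - 3η²/2) N because α₁ + α₂ = 1, and the
-- gain 3η²/2 pays for all errors of the removal statement, which is applied with e = 8h³ for η =
-- ν/h. Without regularity there is no reduced graph in which to find connected matchings. The
-- linking graph takes its place: a link can be realised by a fresh reserve vertex whenever fewer
-- than `B` are in use, so that long paths need only be considered through their ends. A separation
-- lowers the bound on independent sets on both of its sides, which keeps the depth of the recursion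
-- independent of n.

infixl 6 _:+_
infixl 7 _:*_
data Expr : Set where
  K : ℕ → Expr
  var : ℕ → Expr
  Suc : Expr → Expr
  _:+_ _:*_ : Expr → Expr → Expr

nth : List ℕ → ℕ → ℕ
nth [] _ = 0
nth (x ∷ xs) zero = x
nth (x ∷ xs) (suc k) = nth xs k

⟦_⟧ : Expr → List ℕ → ℕ
⟦ K n ⟧ ρ = n
⟦ var k ⟧ ρ = nth ρ k
⟦ Suc a ⟧ ρ = suc (⟦ a ⟧ ρ)
⟦ a :+ b ⟧ ρ = ⟦ a ⟧ ρ + ⟦ b ⟧ ρ
⟦ a :* b ⟧ ρ = ⟦ a ⟧ ρ * ⟦ b ⟧ ρ

Mono Poly : Set
Mono = List ℕ
Poly = List (Mono × ℕ)

evalM : List ℕ → Mono → ℕ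
evalM ρ [] = 1
evalM ρ (i ∷ m) = nth ρ i * evalM ρ m

evalP : List ℕ → Poly → ℕ
evalP ρ [] = 0
evalP ρ ((m , c) ∷ p) = c * evalM ρ m + evalP ρ p

-- Monomials are kept as sorted lists of variable indices, so that products differing only in the
-- order of their factors become equal lists and `addT` can merge them.
insI : ℕ → Mono → Mono
insI i [] = i ∷ []
insI i (j ∷ m) = if i ≤ᵇ j then i ∷ j ∷ m else j ∷ insI i m

private
  swap* : ∀ a b c → b * (a * c) ≡ a * (b * c)
  swap* = solve-∀

insI-ok : ∀ ρ i m → evalM ρ (insI i m) ≡ nth ρ i * evalM ρ m
insI-ok ρ i [] = refl
insI-ok ρ i (j ∷ m) with i ≤ᵇ j
... | true = refl
... | false = trans (cong (nth ρ j *_) (insI-ok ρ i m)) (swap* (nth ρ i) (nth ρ j) (evalM ρ m))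

mulM : Mono → Mono → Mono
mulM [] m = m
mulM (i ∷ l) m = insI i (mulM l m)

mulM-ok : ∀ ρ l m → evalM ρ (mulM l m) ≡ evalM ρ l * evalM ρ m
mulM-ok ρ [] m = sym (*-identityˡ _)
mulM-ok ρ (i ∷ l) m = trans (insI-ok ρ i (mulM l m))
  (trans (cong (nth ρ i *_) (mulM-ok ρ l m)) (sym (*-assoc (nth ρ i) (evalM ρ l) (evalM ρ m))))

eqM : Mono → Mono → Bool
eqM [] [] = true
eqM (i ∷ l) (j ∷ m) = (i ≡ᵇ j) ∧ eqM l m
eqM _ _ = false

eqM-ok : ∀ l m → eqM l m ≡ true → l ≡ m
eqM-ok [] [] _ = refl
eqM-ok (i ∷ l) (j ∷ m) e with i ≡ᵇ j in eq
... | true = cong₂ _∷_ (≡ᵇ⇒≡ i j (subst Data.Bool.T (sym eq) tt)) (eqM-ok l m e)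

addT : Mono → ℕ → Poly → Poly
addT m c [] = (m , c) ∷ []
addT m c ((l , d) ∷ p) = if eqM m l then (l , c + d) ∷ p else (l , d) ∷ addT m c p

private
  addT₁ : ∀ c d e x → (c + d) * e + x ≡ c * e + (d * e + x)
  addT₁ = solve-∀
  addT₂ : ∀ a b c → a + (b + c) ≡ b + (a + c)
  addT₂ = solve-∀

addT-ok : ∀ ρ m c p → evalP ρ (addT m c p) ≡ c * evalM ρ m + evalP ρ p
addT-ok ρ m c [] = refl
addT-ok ρ m c ((l , d) ∷ p) with eqM m l in eq
... | true rewrite eqM-ok m l eq = addT₁ c d (evalM ρ l) (evalP ρ p)
... | false = trans (cong (d * evalM ρ l +_) (addT-ok ρ m c p)) (addT₂ (d * evalM ρ l) (c * evalM ρ m) (evalP ρ p))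

addP : Poly → Poly → Poly
addP [] q = q
addP ((m , c) ∷ p) q = addT m c (addP p q)

addP-ok : ∀ ρ p q → evalP ρ (addP p q) ≡ evalP ρ p + evalP ρ q
addP-ok ρ [] q = refl
addP-ok ρ ((m , c) ∷ p) q = trans (addT-ok ρ m c (addP p q))
  (trans (cong (c * evalM ρ m +_) (addP-ok ρ p q)) (sym (+-assoc (c * evalM ρ m) _ _)))

scaleP : Mono → ℕ → Poly → Poly
scaleP m c [] = []
scaleP m c ((l , d) ∷ p) = (mulM m l , c * d) ∷ scaleP m c p

private
  scale₁ : ∀ c d m l x → (c * d) * (m * l) + (c * m) * x ≡ (c * m) * (d * l + x)
  scale₁ = solve-∀

scaleP-ok : ∀ ρ m c p → evalP ρ (scaleP m c p) ≡ (c * evalM ρ m) * evalP ρ p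
scaleP-ok ρ m c [] = sym (*-zeroʳ (c * evalM ρ m))
scaleP-ok ρ m c ((l , d) ∷ p) = trans (cong₂ (λ a b → (c * d) * a + b) (mulM-ok ρ m l) (scaleP-ok ρ m c p))
  (scale₁ c d (evalM ρ m) (evalM ρ l) (evalP ρ p))

mulP : Poly → Poly → Poly
mulP [] q = []
mulP ((m , c) ∷ p) q = addP (scaleP m c q) (mulP p q)

mulP-ok : ∀ ρ p q → evalP ρ (mulP p q) ≡ evalP ρ p * evalP ρ q
mulP-ok ρ [] q = refl
mulP-ok ρ ((m , c) ∷ p) q = trans (addP-ok ρ (scaleP m c q) (mulP p q))
  (trans (cong₂ _+_ (scaleP-ok ρ m c q) (mulP-ok ρ p q)) (sym (*-distribʳ-+ (evalP ρ q) (c * evalM ρ m) (evalP ρ p))))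

norm : Expr → Poly
norm (K n) = ([] , n) ∷ []
norm (var k) = ((k ∷ []) , 1) ∷ []
norm (Suc a) = addT [] 1 (norm a)
norm (a :+ b) = addP (norm a) (norm b)
norm (a :* b) = mulP (norm a) (norm b)

norm-ok : ∀ ρ e → evalP ρ (norm e) ≡ ⟦ e ⟧ ρ
norm-ok ρ (K n) = trans (+-identityʳ (n * 1)) (*-identityʳ n)
norm-ok ρ (var k) = trans (+-identityʳ _) (trans (+-identityʳ _) (*-identityʳ _))
norm-ok ρ (Suc a) = trans (addT-ok ρ [] 1 (norm a)) (cong suc (norm-ok ρ a))
norm-ok ρ (a :+ b) = trans (addP-ok ρ (norm a) (norm b)) (cong₂ _+_ (norm-ok ρ a) (norm-ok ρ b))
norm-ok ρ (a :* b) = trans (mulP-ok ρ (norm a) (norm b)) (cong₂ _*_ (norm-ok ρ a) (norm-ok ρ b))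

coefOK : Mono → ℕ → Poly → Bool
coefOK m zero p = true
coefOK m (suc c) [] = false
coefOK m (suc c) ((l , d) ∷ p) = if eqM m l then (suc c ≤ᵇ d) else coefOK m (suc c) p

subT : Mono → ℕ → Poly → Poly
subT m c [] = []
subT m c ((l , d) ∷ p) = if eqM m l then (l , d ∸ c) ∷ p else (l , d) ∷ subT m c p

subT-ok : ∀ ρ m c p → coefOK m c p ≡ true → c * evalM ρ m + evalP ρ (subT m c p) ≤ evalP ρ p
subT-ok ρ m zero [] _ = z≤n
subT-ok ρ m zero ((l , d) ∷ p) _ with eqM m l
... | true = ≤-refl
... | false = +-monoʳ-≤ (d * evalM ρ l) (subT-ok ρ m zero p refl)
subT-ok ρ m (suc c) ((l , d) ∷ p) e with eqM m l in eq
... | true rewrite eqM-ok m l eq = ≤-reflexive (trans (sym (+-assoc (suc c * evalM ρ l) ((d ∸ suc c) * evalM ρ l) (evalP ρ p)))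
      (cong (_+ evalP ρ p) (trans (sym (*-distribʳ-+ (evalM ρ l) (suc c) (d ∸ suc c)))
      (cong (_* evalM ρ l) (m+[n∸m]≡n (≤ᵇ⇒≤ (suc c) d (subst Data.Bool.T (sym e) tt)))))))
... | false = ≤-trans (≤-reflexive (addT₂ (suc c * evalM ρ m) (d * evalM ρ l) _))
      (+-monoʳ-≤ (d * evalM ρ l) (subT-ok ρ m (suc c) p e))

-- Coefficientwise comparison. What a monomial of `p` consumes is subtracted from `q` before the
-- next one is treated, so a monomial listed twice in `p` is also paid for twice.
leP : Poly → Poly → Bool
leP [] q = true
leP ((m , c) ∷ p) q = coefOK m c q ∧ leP p (subT m c q)

leP-ok : ∀ ρ p q → leP p q ≡ true → evalP ρ p ≤ evalP ρ q
leP-ok ρ [] q _ = z≤n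
leP-ok ρ ((m , c) ∷ p) q e with coefOK m c q in eq
... | true = ≤-trans (+-monoʳ-≤ (c * evalM ρ m) (leP-ok ρ p (subT m c q) e)) (subT-ok ρ m c q eq)

infixr 3 _·_≼_⇒_
infix 4 ⊢_·_≼_
-- A goal  g · A ≼ B  preceded by hypotheses  h · L ≼ U ; the numbers are the multipliers of a
-- nonnegative polynomial combination proving  g A + Σ h U ≤ g B + Σ h L  coefficientwise.
data Prob : Set where
  _·_≼_⇒_ : Expr → Expr → Expr → Prob → Prob
  ⊢_·_≼_ : ℕ → Expr → Expr → Prob

Sem : Prob → List ℕ → Set
Sem (h · l ≼ u ⇒ p) ρ = ⟦ l ⟧ ρ ≤ ⟦ u ⟧ ρ → Sem p ρ
Sem (⊢ g · a ≼ b) ρ = ⟦ a ⟧ ρ ≤ ⟦ b ⟧ ρ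

-- The accumulators hold the weighted right and left sides of the hypotheses seen so far. The
-- conclusion comes from adding them to the two sides of the goal, cancelling the common term and
-- dividing by `g`; hence `g = 0` is rejected.
checkE : Expr → Expr → Prob → Bool
checkE us ls (h · l ≼ u ⇒ p) = checkE (us :+ h :* u) (ls :+ h :* l) p
checkE us ls (⊢ zero · a ≼ b) = false
checkE us ls (⊢ suc g · a ≼ b) = leP (norm (K (suc g) :* a :+ us)) (norm (K (suc g) :* b :+ ls))

checkE-ok : ∀ ρ us ls p → ⟦ ls ⟧ ρ ≤ ⟦ us ⟧ ρ → checkE us ls p ≡ true → Sem p ρ
checkE-ok ρ us ls (h · l ≼ u ⇒ p) h≤ e l≤u =
  checkE-ok ρ (us :+ h :* u) (ls :+ h :* l) p (+-mono-≤ h≤ (*-monoʳ-≤ (⟦ h ⟧ ρ) l≤u)) e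
checkE-ok ρ us ls (⊢ suc g · a ≼ b) h≤ e = *-cancelˡ-≤ (suc g) (+-cancelʳ-≤ (⟦ us ⟧ ρ) _ _ (≤-trans
  (subst₂′ (norm-ok ρ (K (suc g) :* a :+ us)) (norm-ok ρ (K (suc g) :* b :+ ls)) (leP-ok ρ (norm (K (suc g) :* a :+ us)) (norm (K (suc g) :* b :+ ls)) e))
  (+-monoʳ-≤ (suc g * ⟦ b ⟧ ρ) h≤)))
  where
  subst₂′ : ∀ {a b c d} → a ≡ c → b ≡ d → a ≤ b → c ≤ d
  subst₂′ refl refl h = h

Curr : ℕ → Set
Curr zero = Prob
Curr (suc n) = Expr → Curr n

app : ∀ n → ℕ → Curr n → Prob
app zero k p = p
app (suc n) k f = app n (suc k) (f (var k))

All∀ : ℕ → (List ℕ → Set) → Set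
All∀ zero P = P []
All∀ (suc n) P = ∀ x → All∀ n (λ xs → P (x ∷ xs))

all∀ : ∀ n {P : List ℕ → Set} → (∀ xs → P xs) → All∀ n P
all∀ zero h = h []
all∀ (suc n) h x = all∀ n (λ xs → h (x ∷ xs))

-- abstract, so that with-abstraction does not unfold certificates
abstract
  lin : ∀ n (f : Curr n) → checkE (K 0) (K 0) (app n 0 f) ≡ true → All∀ n (Sem (app n 0 f))
  lin n f e = all∀ n (λ ρ → checkE-ok ρ (K 0) (K 0) (app n 0 f) z≤n e)

-- Booleans

𝟙 : Bool → ℕ
𝟙 true = 1
𝟙 false = 0

𝟙≤1 : ∀ b → 𝟙 b ≤ 1
𝟙≤1 true = ≤-refl
𝟙≤1 false = z≤n

true≢false : ∀ {b} → b ≡ true → b ≡ false → ⊥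
true≢false refl ()

∧-intro : ∀ {a b} → a ≡ true → b ≡ true → a ∧ b ≡ true
∧-intro refl refl = refl

∧-fst : ∀ {a b} → a ∧ b ≡ true → a ≡ true
∧-fst {true} _ = refl

∧-snd : ∀ {a b} → a ∧ b ≡ true → b ≡ true
∧-snd {true} e = e

not-true : ∀ {b} → b ≡ false → not b ≡ true
not-true refl = refl

if-true₂ : ∀ {A B : Set} (P : A → B → Set) {a b} {u u′ : A} {v v′ : B} → a ≡ true × b ≡ true → P u v → P (if a then u else u′) (if b then v else v′)
if-true₂ _ (refl , refl) p = p

if-false₂ : ∀ {A B : Set} (P : A → B → Set) {a b} {u u′ : A} {v v′ : B} → a ≡ false × b ≡ false → P u′ v′ → P (if a then u else u′) (if b then v else v′)
if-false₂ _ (refl , refl) p = p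

not-false⁻ : ∀ {b} → not b ≡ false → b ≡ true
not-false⁻ {true} _ = refl

∧-falseʳ : ∀ a {b} → b ≡ false → a ∧ b ≡ false
∧-falseʳ a refl = ∧-zeroʳ a

not-false : ∀ {b} → not b ≡ true → b ≡ false
not-false {false} _ = refl

∨-case : ∀ {a b} → a ∨ b ≡ true → a ≡ true ⊎ b ≡ true
∨-case {true} _ = inj₁ refl
∨-case {false} e = inj₂ e

∨-inl : ∀ {a b} → a ≡ true → a ∨ b ≡ true
∨-inl refl = refl

∨-inr : ∀ {a b} → b ≡ true → a ∨ b ≡ true
∨-inr {true} _ = refl
∨-inr {false} e = e

≤ᵇ-true : ∀ {m n} → (m ≤ᵇ n) ≡ true → m ≤ n
≤ᵇ-true {m} {n} e = ≤ᵇ⇒≤ m n (subst Data.Bool.T (sym e) tt)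

≤ᵇ-intro : ∀ {m n} → m ≤ n → (m ≤ᵇ n) ≡ true
≤ᵇ-intro {m} {n} h with m ≤ᵇ n | ≤⇒≤ᵇ h
... | true | _ = refl

≤ᵇ-false : ∀ {m n} → (m ≤ᵇ n) ≡ false → n < m
≤ᵇ-false {m} {n} e = ≰⇒> λ h → true≢false (≤ᵇ-intro h) e

does-true : ∀ {P : Set} (d : Dec P) → does d ≡ true → P
does-true (yes p) _ = p

does-intro : ∀ {P : Set} (d : Dec P) → P → does d ≡ true
does-intro (yes _) _ = refl
does-intro (no ¬p) p = ⊥-elim (¬p p)

does-false : ∀ {P : Set} (d : Dec P) → does d ≡ false → ¬ P
does-false (no ¬p) _ = ¬p

does-no : ∀ {P : Set} (d : Dec P) → ¬ P → does d ≡ false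
does-no (yes p) ¬p = ⊥-elim (¬p p)
does-no (no _) _ = refl

-- Finite sums

∑ : ∀ {n} → (Fin n → ℕ) → ℕ
∑ {zero} f = 0
∑ {suc n} f = f zero + ∑ (λ i → f (suc i))

∑-mono : ∀ {n} {f g : Fin n → ℕ} → (∀ i → f i ≤ g i) → ∑ f ≤ ∑ g
∑-mono {zero} h = z≤n
∑-mono {suc n} h = +-mono-≤ (h zero) (∑-mono (λ i → h (suc i)))

∑-cong : ∀ {n} {f g : Fin n → ℕ} → (∀ i → f i ≡ g i) → ∑ f ≡ ∑ g
∑-cong {zero} h = refl
∑-cong {suc n} h = cong₂ _+_ (h zero) (∑-cong (λ i → h (suc i)))

private
  +-swap : ∀ a b c d → (a + b) + (c + d) ≡ (a + c) + (b + d)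
  +-swap = solve-∀

∑-+ : ∀ {n} (f g : Fin n → ℕ) → ∑ (λ i → f i + g i) ≡ ∑ f + ∑ g
∑-+ {zero} f g = refl
∑-+ {suc n} f g = trans (cong ((f zero + g zero) +_) (∑-+ (λ i → f (suc i)) (λ i → g (suc i))))
  (+-swap (f zero) (g zero) _ _)

∑-*ˡ : ∀ {n} c (f : Fin n → ℕ) → ∑ (λ i → c * f i) ≡ c * ∑ f
∑-*ˡ {zero} c f = sym (*-zeroʳ c)
∑-*ˡ {suc n} c f = trans (cong (c * f zero +_) (∑-*ˡ c (λ i → f (suc i)))) (sym (*-distribˡ-+ c (f zero) _))

∑-*ʳ : ∀ {n} c (f : Fin n → ℕ) → ∑ (λ i → f i * c) ≡ ∑ f * c
∑-*ʳ c f = trans (∑-cong (λ i → *-comm (f i) c)) (trans (∑-*ˡ c f) (*-comm c (∑ f)))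

∑-const : ∀ n c → ∑ {n} (λ _ → c) ≡ n * c
∑-const zero c = refl
∑-const (suc n) c = cong (c +_) (∑-const n c)

∑-0 : ∀ n → ∑ {n} (λ _ → 0) ≡ 0
∑-0 n = trans (∑-const n 0) (*-zeroʳ n)

∑-swap : ∀ {m n} (f : Fin m → Fin n → ℕ) → ∑ (λ i → ∑ (f i)) ≡ ∑ (λ j → ∑ (λ i → f i j))
∑-swap {zero} {n} f = sym (∑-0 n)
∑-swap {suc m} f = trans (cong (∑ (f zero) +_) (∑-swap (λ i → f (suc i))))
  (sym (∑-+ (f zero) (λ j → ∑ (λ i → f (suc i) j))))

∑-≤-const : ∀ {n} (f : Fin n → ℕ) c → (∀ i → f i ≤ c) → ∑ f ≤ n * c
∑-≤-const {n} f c h = ≤-trans (∑-mono h) (≤-reflexive (∑-const n c))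

∑-member : ∀ {n} (f : Fin n → ℕ) i → f i ≤ ∑ f
∑-member f zero = m≤m+n _ _
∑-member f (suc i) = ≤-trans (∑-member (λ j → f (suc j)) i) (m≤n+m _ (f zero))

∑-mono₂ : ∀ {m n} {f g : Fin m → Fin n → ℕ} → (∀ i j → f i j ≤ g i j) → ∑ (λ i → ∑ (f i)) ≤ ∑ (λ i → ∑ (g i))
∑-mono₂ h = ∑-mono (λ i → ∑-mono (h i))

∑-+₂ : ∀ {m n} (f g : Fin m → Fin n → ℕ) →
  ∑ (λ i → ∑ (λ j → f i j + g i j)) ≡ ∑ (λ i → ∑ (f i)) + ∑ (λ i → ∑ (g i))
∑-+₂ f g = trans (∑-cong (λ i → ∑-+ (f i) (g i))) (∑-+ (λ i → ∑ (f i)) (λ i → ∑ (g i)))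

∑-min : ∀ {n} → 0 < n → (f : Fin n → ℕ) → ∃ λ i → n * f i ≤ ∑ f
∑-min {suc n} _ f = let i , h = go f in i , ≤-trans (≤-reflexive (sym (∑-const (suc n) (f i)))) (∑-mono h)
  where
  go : ∀ {n} (f : Fin (suc n) → ℕ) → ∃ λ i → ∀ j → f i ≤ f j
  go {zero} f = zero , λ { zero → ≤-refl }
  go {suc n} f with go (λ i → f (suc i))
  ... | i , h with f zero ≤? f (suc i)
  ... | yes p = zero , λ { zero → ≤-refl ; (suc j) → ≤-trans p (h j) }
  ... | no p = suc i , λ { zero → <⇒≤ (≰⇒> p) ; (suc j) → h j }

-- Counting

# : ∀ {n} → (Fin n → Bool) → ℕ
# P = ∑ (λ i → 𝟙 (P i))

module _ {n : ℕ} where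

  private variable
    P Q R : Fin n → Bool

  𝟙-≤ : ∀ {a b} → (a ≡ true → b ≡ true) → 𝟙 a ≤ 𝟙 b
  𝟙-≤ {false} h = z≤n
  𝟙-≤ {true} h rewrite h refl = ≤-refl

  𝟙-∪ : ∀ {a b c} → (a ≡ true → b ≡ true ⊎ c ≡ true) → 𝟙 a ≤ 𝟙 b + 𝟙 c
  𝟙-∪ {false} h = z≤n
  𝟙-∪ {true} {b} h with h refl
  ... | inj₁ refl = s≤s z≤n
  ... | inj₂ refl = m≤n+m 1 (𝟙 b)

  #-⊆ : (∀ i → P i ≡ true → Q i ≡ true) → # P ≤ # Q
  #-⊆ h = ∑-mono (λ i → 𝟙-≤ (h i))

  #-∪ : (∀ i → P i ≡ true → Q i ≡ true ⊎ R i ≡ true) → # P ≤ # Q + # R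
  #-∪ {Q = Q} {R = R} h = ≤-trans (∑-mono (λ i → 𝟙-∪ (h i))) (≤-reflexive (∑-+ (λ i → 𝟙 (Q i)) (λ i → 𝟙 (R i))))

  #-disj : (∀ i → P i ≡ true → R i ≡ true) → (∀ i → Q i ≡ true → R i ≡ true) →
    (∀ i → P i ≡ true → Q i ≡ true → ⊥) → # P + # Q ≤ # R
  #-disj {P = P} {R = R} {Q = Q} p q d = ≤-trans (≤-reflexive (sym (∑-+ (λ i → 𝟙 (P i)) (λ i → 𝟙 (Q i))))) (∑-mono pt)
    where
    pt : ∀ i → 𝟙 (P i) + 𝟙 (Q i) ≤ 𝟙 (R i)
    pt i with P i in e₁ | Q i in e₂
    ... | true | true = ⊥-elim (d i e₁ e₂)
    ... | true | false rewrite p i e₁ = ≤-refl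
    ... | false | true rewrite q i e₂ = ≤-refl
    ... | false | false = z≤n

  #-≤n : ∀ (P : Fin n → Bool) → # P ≤ n
  #-≤n P = ≤-trans (∑-≤-const _ 1 (λ i → 𝟙≤1 (P i))) (≤-reflexive (*-identityʳ n))

  #-compl : ∀ (P : Fin n → Bool) → # P + # (λ i → not (P i)) ≡ n
  #-compl P = trans (sym (∑-+ (λ i → 𝟙 (P i)) (λ i → 𝟙 (not (P i)))))
    (trans (∑-cong pt) (trans (∑-const n 1) (*-identityʳ n)))
    where
    pt : ∀ i → 𝟙 (P i) + 𝟙 (not (P i)) ≡ 1
    pt i with P i
    ... | true = refl
    ... | false = refl

  #-all : (∀ i → P i ≡ true) → n ≤ # P
  #-all {P = P} h = ≤-trans (≤-reflexive (sym (trans (∑-const n 1) (*-identityʳ n)))) (∑-mono (λ i → ≤-reflexive (cong 𝟙 (sym (h i)))))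

  #-none : (∀ i → P i ≡ false) → # P ≡ 0
  #-none {P = P} h = trans (∑-cong (λ i → cong 𝟙 (h i))) (∑-0 n)

  #-member : ∀ (P : Fin n → Bool) i → P i ≡ true → 1 ≤ # P
  #-member P i e = ≤-trans (≤-reflexive (cong 𝟙 (sym e))) (∑-member (λ i → 𝟙 (P i)) i)

search : ∀ {n} (P : Fin n → Bool) → (∃ λ i → P i ≡ true) ⊎ (∀ i → P i ≡ false)
search {zero} P = inj₂ (λ ())
search {suc n} P with P zero in e
... | true = inj₁ (zero , e)
... | false with search (λ i → P (suc i))
... | inj₁ (i , h) = inj₁ (suc i , h)
... | inj₂ h = inj₂ λ { zero → e ; (suc i) → h i }

#-ex : ∀ {n} (P Q : Fin n → Bool) → # Q < # P → ∃ λ i → P i ≡ true × Q i ≡ false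
#-ex P Q h with search (λ i → P i ∧ not (Q i))
... | inj₁ (i , e) = i , ∧-fst e , not-false (∧-snd e)
... | inj₂ f = ⊥-elim (<⇒≱ h (#-⊆ λ i e → lem i e))
  where
  lem : ∀ i → P i ≡ true → Q i ≡ true
  lem i e with Q i | f i
  ... | true | _ = refl
  ... | false | g rewrite e = ⊥-elim (true≢false refl g)

#-ex₁ : ∀ {n} (P : Fin n → Bool) → 0 < # P → ∃ λ i → P i ≡ true
#-ex₁ {n} P h with #-ex P (λ _ → false) (≤-trans (s≤s (≤-reflexive (∑-0 n))) h)
... | i , e , _ = i , e

infix 4 _==_
_==_ : ∀ {n} → Fin n → Fin n → Bool
i == j = does (i Fin.≟ j)

==-refl : ∀ {n} (i : Fin n) → (i == i) ≡ true
==-refl i = does-intro (i Fin.≟ i) refl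

==-true : ∀ {n} (i j : Fin n) → (i == j) ≡ true → i ≡ j
==-true i j = does-true (i Fin.≟ j)

∑-point : ∀ {n} (i : Fin n) (h : Fin n → ℕ) → ∑ (λ j → 𝟙 (j == i) * h j) ≡ h i
∑-point {suc n} zero h = trans (cong (h zero + 0 +_) (∑-0 n)) (trans (+-identityʳ _) (+-identityʳ _))
∑-point {suc n} (suc i) h = trans (∑-cong pt) (∑-point i (λ j → h (suc j)))
  where
  pt : ∀ j → 𝟙 (suc j == suc i) * h (suc j) ≡ 𝟙 (j == i) * h (suc j)
  pt j with j Fin.≟ i
  ... | yes _ = refl
  ... | no _ = refl

-- Degree-constrained subgraphs

module _ {a b : ℕ} where

  private
    E Sub : Set
    E = Fin a → Fin b → Bool

    Sub = (Fin a → Bool) × (Fin b → Bool)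

  ∣_∣ᴱ : E → ℕ
  ∣ H ∣ᴱ = ∑ (λ x → ∑ (λ y → 𝟙 (H x y)))

  uncov : E → (Fin a → Bool) → (Fin b → Bool) → E
  uncov H C D x y = H x y ∧ (not (C x) ∧ not (D y))

  -- The dual of a simple b-matching: a chosen vertex costs its capacity, and an edge left uncovered
  -- costs 1 because it can be used only once.
  cutValue : E → (Fin a → ℕ) → (Fin b → ℕ) → (Fin a → Bool) → (Fin b → Bool) → ℕ
  cutValue H cX cY C D = ∑ (λ x → cX x * 𝟙 (C x)) + ∑ (λ y → cY y * 𝟙 (D y)) + ∣ uncov H C D ∣ᴱ

  record BMatching (H : E) (cX : Fin a → ℕ) (cY : Fin b → ℕ) (ν : ℕ) : Set where
    field
      F : E
      F⊆H : ∀ x y → F x y ≡ true → H x y ≡ true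
      degX≤ : ∀ x → # (F x) ≤ cX x
      degY≤ : ∀ y → # (λ x → F x y) ≤ cY y
      size : ν ≤ ∣ F ∣ᴱ

  -- Submodularity of cuts in the network source → X → Y → sink. The source side of a cut is the
  -- complement of `C` together with `D`, which is why joining the `C`s goes with intersecting the
  -- `D`s.
  uncross : ∀ H cX cY C D C′ D′ →
    cutValue H cX cY (λ x → C x ∨ C′ x) (λ y → D y ∧ D′ y) + cutValue H cX cY (λ x → C x ∧ C′ x) (λ y → D y ∨ D′ y)
    ≤ cutValue H cX cY C D + cutValue H cX cY C′ D′
  uncross H cX cY C D C′ D′ = lin 12 (λ p q r s t u p′ q′ r′ s′ t′ u′ →
      K 1 · p :+ q ≼ p′ :+ q′ ⇒ K 1 · r :+ s ≼ r′ :+ s′ ⇒ K 1 · t :+ u ≼ t′ :+ u′ ⇒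
      ⊢ 1 · p :+ r :+ t :+ (q :+ s :+ u) ≼ p′ :+ r′ :+ t′ :+ (q′ :+ s′ :+ u′)) refl
      (∑ pX) (∑ qX) (∑ pY) (∑ qY) (∣ p ∣ᴱ) (∣ q ∣ᴱ) (∑ (wX C)) (∑ (wX C′)) (∑ (wY D)) (∑ (wY D′)) (∣ uncov H C D ∣ᴱ) (∣ uncov H C′ D′ ∣ᴱ)
      (sum pX qX (wX C) (wX C′) (λ x → ∨∧ (cX x) (C x) (C′ x))) (sum pY qY (wY D) (wY D′) (λ y → ∧∨ (cY y) (D y) (D′ y)))
      (≤-trans (≤-reflexive (sym (∑-+₂ (λ x y → 𝟙 (p x y)) (λ x y → 𝟙 (q x y))))) (≤-trans (∑-mono₂ (λ x y → edge (H x y) (C x) (C′ x) (D y) (D′ y)))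
        (≤-reflexive (∑-+₂ (λ x y → 𝟙 (uncov H C D x y)) (λ x y → 𝟙 (uncov H C′ D′ x y))))))
    where
    wX : (Fin a → Bool) → Fin a → ℕ
    wX C x = cX x * 𝟙 (C x)
    wY : (Fin b → Bool) → Fin b → ℕ
    wY D y = cY y * 𝟙 (D y)
    pX = wX (λ x → C x ∨ C′ x)
    qX = wX (λ x → C x ∧ C′ x)
    pY = wY (λ y → D y ∧ D′ y)
    qY = wY (λ y → D y ∨ D′ y)
    p = uncov H (λ x → C x ∨ C′ x) (λ y → D y ∧ D′ y)
    q = uncov H (λ x → C x ∧ C′ x) (λ y → D y ∨ D′ y)
    sum : ∀ {n} (f g f′ g′ : Fin n → ℕ) → (∀ i → f i + g i ≤ f′ i + g′ i) → ∑ f + ∑ g ≤ ∑ f′ + ∑ g′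
    sum f g f′ g′ h = ≤-trans (≤-reflexive (sym (∑-+ f g))) (≤-trans (∑-mono h) (≤-reflexive (∑-+ f′ g′)))
    ∨∧ : ∀ n c c′ → n * 𝟙 (c ∨ c′) + n * 𝟙 (c ∧ c′) ≤ n * 𝟙 c + n * 𝟙 c′
    ∨∧ n true true = ≤-refl
    ∨∧ n true false = ≤-refl
    ∨∧ n false true = ≤-reflexive (+-comm (n * 1) (n * 0))
    ∨∧ n false false = ≤-refl
    ∧∨ : ∀ n c c′ → n * 𝟙 (c ∧ c′) + n * 𝟙 (c ∨ c′) ≤ n * 𝟙 c + n * 𝟙 c′
    ∧∨ n c c′ = ≤-trans (≤-reflexive (+-comm (n * 𝟙 (c ∧ c′)) _)) (∨∧ n c c′)
    edge : ∀ h c c′ d d′ → 𝟙 (h ∧ (not (c ∨ c′) ∧ not (d ∧ d′))) + 𝟙 (h ∧ (not (c ∧ c′) ∧ not (d ∨ d′)))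
      ≤ 𝟙 (h ∧ (not c ∧ not d)) + 𝟙 (h ∧ (not c′ ∧ not d′))
    edge false c c′ d d′ = z≤n
    edge true true true d d′ = z≤n
    edge true true false true true = z≤n
    edge true true false true false = z≤n
    edge true true false false true = z≤n
    edge true true false false false = ≤-refl
    edge true false true true true = z≤n
    edge true false true true false = z≤n
    edge true false true false true = z≤n
    edge true false true false false = ≤-refl
    edge true false false true true = z≤n
    edge true false false true false = ≤-refl
    edge true false false false true = ≤-refl
    edge true false false false false = ≤-refl

  private
    module Edge (H : E) (x₀ : Fin a) (y₀ : Fin b) (e₀ : H x₀ y₀ ≡ true) where

      δ : E
      δ x y = (x == x₀) ∧ (y == y₀)

      H′ : E
      H′ x y = H x y ∧ not (δ x y)

      dec : (Fin a → ℕ) → Fin a → ℕ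
      dec c x = c x ∸ 𝟙 (x == x₀)

      decY : (Fin b → ℕ) → Fin b → ℕ
      decY c y = c y ∸ 𝟙 (y == y₀)

      δ-sum : ∀ (f : Fin a → Fin b → ℕ) → ∑ (λ x → ∑ (λ y → 𝟙 (x == x₀) * (𝟙 (y == y₀) * f x y))) ≡ f x₀ y₀
      δ-sum f = trans (∑-cong (λ x → trans (∑-*ˡ (𝟙 (x == x₀)) (λ y → 𝟙 (y == y₀) * f x y))
        (cong (𝟙 (x == x₀) *_) (∑-point y₀ (f x))))) (∑-point x₀ (λ x → f x y₀))

      split : ∀ (G G′ : E) → (∀ x y → G x y ≡ true → G′ x y ≡ true ⊎ (x ≡ x₀ × y ≡ y₀ × G x₀ y₀ ≡ true)) →
        ∣ G ∣ᴱ ≤ ∣ G′ ∣ᴱ + 𝟙 (G x₀ y₀)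
      split G G′ h = ≤-trans (∑-mono₂ pt) (≤-reflexive (trans (∑-+₂ (λ x y → 𝟙 (G′ x y)) _)
        (cong (∣ G′ ∣ᴱ +_) (δ-sum (λ x y → 𝟙 (G x y))))))
        where
        pt : ∀ x y → 𝟙 (G x y) ≤ 𝟙 (G′ x y) + 𝟙 (x == x₀) * (𝟙 (y == y₀) * 𝟙 (G x y))
        pt x y with G x y in e
        ... | false = z≤n
        ... | true with h x y e
        ... | inj₁ e′ rewrite e′ = s≤s z≤n
        ... | inj₂ (refl , refl , _) rewrite ==-refl x₀ | ==-refl y₀ = m≤n+m 1 (𝟙 (G′ x₀ y₀))

      H′⊆ : ∀ x y → H x y ≡ true → H′ x y ≡ true ⊎ (x ≡ x₀ × y ≡ y₀)
      H′⊆ x y h with δ x y in e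
      ... | true = inj₂ (==-true x x₀ (∧-fst e) , ==-true y y₀ (∧-snd {x == x₀} e))
      ... | false rewrite h = inj₁ refl

      fewer : ∀ {m} → ∣ H ∣ᴱ ≤ suc m → ∣ H′ ∣ᴱ ≤ m
      fewer {m} h = lin 3 (λ u v m → K 1 · v :+ K 1 ≼ u ⇒ K 1 · u ≼ Suc m ⇒ ⊢ 1 · v ≼ m) refl ∣ H ∣ᴱ ∣ H′ ∣ᴱ m
        (≤-trans (≤-reflexive (sym (trans (∑-+₂ (λ x y → 𝟙 (H′ x y)) _) (cong (∣ H′ ∣ᴱ +_) (δ-sum (λ _ _ → 1)))))) (∑-mono₂ pt)) h
        where
        pt : ∀ x y → 𝟙 (H′ x y) + 𝟙 (x == x₀) * (𝟙 (y == y₀) * 1) ≤ 𝟙 (H x y)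
        pt x y with x Fin.≟ x₀ | y Fin.≟ y₀
        ... | yes refl | yes refl rewrite e₀ = ≤-refl
        ... | yes _ | no _ with H x y
        ...   | true = ≤-refl
        ...   | false = ≤-refl
        pt x y | no _ | _ with H x y
        ...   | true = ≤-refl
        ...   | false = ≤-refl

      cut-H : ∀ cX cY C D → cutValue H cX cY C D ≤ cutValue H′ cX cY C D + 𝟙 (not (C x₀) ∧ not (D y₀))
      cut-H cX cY C D = ≤-trans (+-monoʳ-≤ (∑ (λ x → cX x * 𝟙 (C x)) + ∑ (λ y → cY y * 𝟙 (D y)))
        (≤-trans (split (uncov H C D) (uncov H′ C D) cov) (+-monoʳ-≤ ∣ uncov H′ C D ∣ᴱ (𝟙-≤ {0} (∧-snd {H x₀ y₀})))))
        (≤-reflexive (sym (+-assoc (∑ (λ x → cX x * 𝟙 (C x)) + ∑ (λ y → cY y * 𝟙 (D y))) ∣ uncov H′ C D ∣ᴱ _)))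
        where
        cov : ∀ x y → uncov H C D x y ≡ true → uncov H′ C D x y ≡ true ⊎ (x ≡ x₀ × y ≡ y₀ × uncov H C D x₀ y₀ ≡ true)
        cov x y e with H′⊆ x y (∧-fst e)
        ... | inj₁ h = inj₁ (∧-intro h (∧-snd {H x y} e))
        ... | inj₂ (refl , refl) = inj₂ (refl , refl , e)

      cut-cap : ∀ cX cY C D → cutValue H′ cX cY C D ≤ cutValue H′ (dec cX) (decY cY) C D + (𝟙 (C x₀) + 𝟙 (D y₀))
      cut-cap cX cY C D = lin 7 (λ p q r p′ q′ s t → K 1 · p ≼ p′ :+ s ⇒ K 1 · q ≼ q′ :+ t ⇒
          ⊢ 1 · p :+ q :+ r ≼ p′ :+ q′ :+ r :+ (s :+ t)) refl
          (∑ (λ x → cX x * 𝟙 (C x))) (∑ (λ y → cY y * 𝟙 (D y))) (∣ uncov H′ C D ∣ᴱ) (∑ (λ x → dec cX x * 𝟙 (C x))) (∑ (λ y → decY cY y * 𝟙 (D y)))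
          (𝟙 (C x₀)) (𝟙 (D y₀)) (cap x₀ cX C) (cap y₀ cY D)
        where
        cap : ∀ {n} (i₀ : Fin n) (c : Fin n → ℕ) (C : Fin n → Bool) →
          ∑ (λ x → c x * 𝟙 (C x)) ≤ ∑ (λ x → (c x ∸ 𝟙 (x == i₀)) * 𝟙 (C x)) + 𝟙 (C i₀)
        cap i₀ c C = ≤-trans (∑-mono (λ x → pt (c x) (𝟙 (x == i₀)) (𝟙 (C x)))) (≤-reflexive
          (trans (∑-+ (λ x → (c x ∸ 𝟙 (x == i₀)) * 𝟙 (C x)) _) (cong (∑ (λ x → (c x ∸ 𝟙 (x == i₀)) * 𝟙 (C x)) +_) (∑-point i₀ (λ x → 𝟙 (C x))))))
          where
          pt : ∀ c d e → c * e ≤ (c ∸ d) * e + d * e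
          pt c d e = ≤-trans (*-monoˡ-≤ e (≤-trans (m≤n+m∸n c d) (≤-reflexive (+-comm d (c ∸ d)))))
            (≤-reflexive (*-distribʳ-+ e (c ∸ d) d))

      extend : ∀ {cX cY ν} → 1 ≤ cX x₀ → 1 ≤ cY y₀ → BMatching H′ (dec cX) (decY cY) ν → BMatching H cX cY (suc ν)
      extend {cX} {cY} {ν} p q M = record
        { F = F⁺
        ; F⊆H = ⊆
        ; degX≤ = λ x → ≤-trans (rowle x) (≤-trans (+-monoˡ-≤ _ (M.degX≤ x)) (back cX x₀ p x))
        ; degY≤ = λ y → ≤-trans (colle y) (≤-trans (+-monoˡ-≤ _ (M.degY≤ y)) (back cY y₀ q y))
        ; size = ≤-trans (s≤s M.size) (≤-trans (≤-reflexive (trans (+-comm 1 ∣ M.F ∣ᴱ) (sym (trans (∑-+₂ (λ x y → 𝟙 (M.F x y)) _)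
            (cong (∣ M.F ∣ᴱ +_) (δ-sum (λ _ _ → 1))))))) (∑-mono₂ lower)) }
        where
        module M = BMatching M
        F⁺ : E
        F⁺ x y = M.F x y ∨ δ x y
        ⊆ : ∀ x y → F⁺ x y ≡ true → H x y ≡ true
        ⊆ x y e with ∨-case {M.F x y} e
        ... | inj₁ f = ∧-fst (M.F⊆H x y f)
        ... | inj₂ d with ==-true x x₀ (∧-fst d) | ==-true y y₀ (∧-snd {x == x₀} d)
        ... | refl | refl = e₀
        lower : ∀ x y → 𝟙 (M.F x y) + 𝟙 (x == x₀) * (𝟙 (y == y₀) * 1) ≤ 𝟙 (F⁺ x y)
        lower x y with M.F x y in e | x == x₀ in e₁ | y == y₀ in e₂
        ... | true | true | true = ⊥-elim (true≢false (∧-snd {H x y} (M.F⊆H x y e)) (cong not (∧-intro e₁ e₂)))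
        ... | true | true | false = ≤-refl
        ... | true | false | _ = ≤-refl
        ... | false | true | true = ≤-refl
        ... | false | true | false = ≤-refl
        ... | false | false | _ = ≤-refl
        back : ∀ {n} (c : Fin n → ℕ) i₀ → 1 ≤ c i₀ → ∀ i → c i ∸ 𝟙 (i == i₀) + 𝟙 (i == i₀) ≤ c i
        back c i₀ h i with i Fin.≟ i₀
        ... | yes refl = ≤-reflexive (m∸n+n≡m h)
        ... | no _ = ≤-reflexive (+-identityʳ _)
        rowle : ∀ x → # (F⁺ x) ≤ # (M.F x) + 𝟙 (x == x₀)
        rowle x = ≤-trans (∑-mono {g = λ y → 𝟙 (M.F x y) + 𝟙 (y == y₀) * 𝟙 (x == x₀)} (λ y → pt (M.F x y) (x == x₀) (y == y₀))) (≤-reflexive (trans (∑-+ (λ y → 𝟙 (M.F x y)) _)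
          (cong (# (M.F x) +_) (∑-point y₀ (λ _ → 𝟙 (x == x₀))))))
          where
          pt : ∀ f d e → 𝟙 (f ∨ (d ∧ e)) ≤ 𝟙 f + 𝟙 e * 𝟙 d
          pt true d e = s≤s z≤n
          pt false true true = ≤-refl
          pt false true false = ≤-refl
          pt false false e = z≤n
        colle : ∀ y → # (λ x → F⁺ x y) ≤ # (λ x → M.F x y) + 𝟙 (y == y₀)
        colle y = ≤-trans (∑-mono {g = λ x → 𝟙 (M.F x y) + 𝟙 (x == x₀) * 𝟙 (y == y₀)} (λ x → pt (M.F x y) (x == x₀) (y == y₀))) (≤-reflexive (trans (∑-+ (λ x → 𝟙 (M.F x y)) _)
          (cong (# (λ x → M.F x y) +_) (∑-point x₀ (λ _ → 𝟙 (y == y₀))))))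
          where
          pt : ∀ f d e → 𝟙 (f ∨ (d ∧ e)) ≤ 𝟙 f + 𝟙 d * 𝟙 e
          pt true d e = s≤s z≤n
          pt false true true = ≤-refl
          pt false true false = ≤-refl
          pt false false e = z≤n

      grow : ∀ {cX cY ν} → BMatching H′ cX cY ν → BMatching H cX cY ν
      grow M = record { F = M.F ; F⊆H = λ x y f → ∧-fst (M.F⊆H x y f) ; degX≤ = M.degX≤ ; degY≤ = M.degY≤ ; size = M.size }
        where module M = BMatching M

      -- A vertex of capacity zero joins the cover for free and thereby covers the deleted edge.
      addX : ∀ cX cY C D → cX x₀ ≡ 0 → cutValue H cX cY (λ x → C x ∨ (x == x₀)) D ≤ cutValue H′ cX cY C D
      addX cX cY C D z = +-mono-≤ (+-monoˡ-≤ _ (∑-mono pt)) (∑-mono₂ λ x y → 𝟙-≤ {0} (cov x y))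
        where
        pt : ∀ x → cX x * 𝟙 (C x ∨ (x == x₀)) ≤ cX x * 𝟙 (C x)
        pt x with C x
        ... | true = ≤-refl
        ... | false with x Fin.≟ x₀
        ... | yes refl rewrite z = z≤n
        ... | no _ = ≤-refl
        cov : ∀ x y → uncov H (λ x → C x ∨ (x == x₀)) D x y ≡ true → uncov H′ C D x y ≡ true
        cov x y e with C x | x == x₀ | H x y
        ... | false | false | true = e
        cov x y () | true | _ | true
        cov x y () | false | true | true

      addY : ∀ cX cY C D → cY y₀ ≡ 0 → cutValue H cX cY C (λ y → D y ∨ (y == y₀)) ≤ cutValue H′ cX cY C D
      addY cX cY C D z = +-mono-≤ (+-monoʳ-≤ (∑ (λ x → cX x * 𝟙 (C x))) (∑-mono pt)) (∑-mono₂ λ x y → 𝟙-≤ {0} (cov x y))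
        where
        pt : ∀ y → cY y * 𝟙 (D y ∨ (y == y₀)) ≤ cY y * 𝟙 (D y)
        pt y with D y
        ... | true = ≤-refl
        ... | false with y Fin.≟ y₀
        ... | yes refl rewrite z = z≤n
        ... | no _ = ≤-refl
        cov : ∀ x y → uncov H C (λ y → D y ∨ (y == y₀)) x y ≡ true → uncov H′ C D x y ≡ true
        cov x y e with C x | D y | x == x₀ | y == y₀ | H x y
        ... | false | false | true | false | true = refl
        ... | false | false | false | false | true = refl
        cov x y () | true | _ | _ | _ | true
        cov x y () | false | true | _ | _ | true
        cov x y () | false | false | _ | true | true

  findEdge : (H : E) → (∃ λ x → ∃ λ y → H x y ≡ true) ⊎ (∀ x y → H x y ≡ false)
  findEdge H with search (λ x → 1 ≤ᵇ # (H x))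
  ... | inj₁ (x , e) = let y , h = #-ex₁ (H x) (≤ᵇ-true e) in inj₁ (x , y , h)
  ... | inj₂ f = inj₂ none
    where
    none : ∀ x y → H x y ≡ false
    none x y with H x y in e
    ... | false = refl
    ... | true = ⊥-elim (true≢false (≤ᵇ-intro (#-member (H x) y e)) (f x))

  -- Max-flow min-cut for simple b-matchings.  If neither deleting the edge x₀y₀ nor using it succeeds, the
  -- two small cuts so obtained are uncrossed into one for H.
  b-matching-duality : ∀ m (H : E) cX cY ν → ∣ H ∣ᴱ ≤ m →
    BMatching H cX cY ν ⊎ (Σ (Fin a → Bool) λ C → Σ (Fin b → Bool) λ D → cutValue H cX cY C D < ν)
  b-matching-duality m H cX cY zero _ = inj₁ (record { F = λ _ _ → false ; F⊆H = λ _ _ () ; degX≤ = λ x → ≤-trans (≤-reflexive (∑-0 b)) z≤n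
    ; degY≤ = λ y → ≤-trans (≤-reflexive (∑-0 a)) z≤n ; size = z≤n })
  b-matching-duality m H cX cY (suc ν) ≤m with findEdge H
  ... | inj₂ none = inj₂ ((λ _ → false) , (λ _ → false) , s≤s (≤-trans (≤-reflexive (cong₂ _+_ (cong₂ _+_
      (trans (∑-cong (λ x → *-zeroʳ (cX x))) (∑-0 a)) (trans (∑-cong (λ y → *-zeroʳ (cY y))) (∑-0 b)))
      (trans (∑-cong (λ x → trans (∑-cong (λ y → cong (λ t → 𝟙 (t ∧ true)) (none x y))) (∑-0 b))) (∑-0 a)))) z≤n))
  b-matching-duality zero H cX cY (suc ν) ≤m | inj₁ (x₀ , y₀ , e₀) = ⊥-elim (<⇒≱ (≤-trans (#-member (H x₀) y₀ e₀) (∑-member (λ x → # (H x)) x₀)) ≤m)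
  b-matching-duality (suc m) H cX cY (suc ν) ≤m | inj₁ (x₀ , y₀ , e₀) = go (cX x₀) (cY y₀) refl refl
    where
    open Edge H x₀ y₀ e₀
    Cut : E → ℕ → Set
    Cut H ν = Σ (Fin a → Bool) λ C → Σ (Fin b → Bool) λ D → cutValue H cX cY C D < ν
    go : ∀ p q → cX x₀ ≡ p → cY y₀ ≡ q → BMatching H cX cY (suc ν) ⊎ Cut H (suc ν)
    go p q ep eq with b-matching-duality m H′ cX cY (suc ν) (fewer ≤m)
    go p q ep eq | inj₁ M = inj₁ (grow M)
    go zero q ep eq | inj₂ (C , D , <ν) = inj₂ ((λ x → C x ∨ (x == x₀)) , D , ≤-trans (s≤s (addX cX cY C D ep)) <ν)
    go (suc p) zero ep eq | inj₂ (C , D , <ν) = inj₂ (C , (λ y → D y ∨ (y == y₀)) , ≤-trans (s≤s (addY cX cY C D eq)) <ν)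
    go (suc p) (suc q) ep eq | inj₂ (C , D , <ν) with b-matching-duality m H′ (dec cX) (decY cY) ν (fewer ≤m)
    ... | inj₁ M = inj₁ (extend (subst (1 ≤_) (sym ep) (s≤s z≤n)) (subst (1 ≤_) (sym eq) (s≤s z≤n)) M)
    ... | inj₂ (C′ , D′ , <ν′) with C x₀ in ec | D y₀ in ed
    -- The first cut meets an end of the edge, so restoring the edge leaves its value unchanged.
    ... | true | d = inj₂ (C , D , ≤-trans (s≤s (≤-trans (cut-H cX cY C D) (≤-trans (+-monoʳ-≤ _ (≤-reflexive (cong (λ t → 𝟙 (not t ∧ not (D y₀))) ec))) (≤-reflexive (+-identityʳ _))))) <ν)
    ... | false | true = inj₂ (C , D , ≤-trans (s≤s (≤-trans (cut-H cX cY C D) (≤-trans (+-monoʳ-≤ _ (≤-reflexive (cong₂ (λ s t → 𝟙 (not s ∧ not t)) ec ed))) (≤-reflexive (+-identityʳ _))))) <ν)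
    ... | false | false with C′ x₀ in ec′ | D′ y₀ in ed′
    -- Restoring both capacities raises the second cut by 2, to at most ν + 1; the first has value
    -- at most ν. Both uncrossed cuts meet the edge, because its ends lie in `C′` and `D′`. Their
    -- values add up to at most 2ν + 1, so one of them is at most ν.
    ... | true | true = pick (suc ν ≤? cutValue H cX cY (λ x → C x ∨ C′ x) (λ y → D y ∧ D′ y))
      where
      c₁ : cutValue H cX cY (λ x → C x ∨ C′ x) (λ y → D y ∧ D′ y) ≤ cutValue H′ cX cY (λ x → C x ∨ C′ x) (λ y → D y ∧ D′ y)
      c₁ = ≤-trans (cut-H cX cY _ _) (≤-trans (+-monoʳ-≤ _ (≤-reflexive (cong (λ t → 𝟙 (not t ∧ not (D y₀ ∧ D′ y₀))) (∨-inr {C x₀} ec′)))) (≤-reflexive (+-identityʳ _)))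
      c₂ : cutValue H cX cY (λ x → C x ∧ C′ x) (λ y → D y ∨ D′ y) ≤ cutValue H′ cX cY (λ x → C x ∧ C′ x) (λ y → D y ∨ D′ y)
      c₂ = ≤-trans (cut-H cX cY _ _) (≤-trans (+-monoʳ-≤ _ (≤-trans (≤-reflexive (cong (λ t → 𝟙 (not (C x₀ ∧ C′ x₀) ∧ not t)) (∨-inr {D y₀} ed′))) (𝟙-≤ {0} (∧-snd {not (C x₀ ∧ C′ x₀)})))) (≤-reflexive (+-identityʳ _)))
      c₃ : cutValue H′ cX cY C′ D′ ≤ suc ν
      c₃ = ≤-trans (cut-cap cX cY C′ D′) (≤-trans (+-monoʳ-≤ _ (≤-reflexive (cong₂ (λ s t → 𝟙 s + 𝟙 t) ec′ ed′))) (≤-trans (≤-reflexive (+-comm _ 2)) (s≤s <ν′)))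
      pick : Dec _ → BMatching H cX cY (suc ν) ⊎ Cut H (suc ν)
      pick (no ¬p) = inj₂ (_ , _ , ≰⇒> ¬p)
      pick (yes p) = inj₂ (_ , _ , lin 6 (λ u v u′ v′ c n → K 1 · Suc n ≼ u ⇒ K 1 · u ≼ u′ ⇒ K 1 · v ≼ v′ ⇒ K 1 · u′ :+ v′ ≼ c :+ Suc n ⇒ K 1 · Suc c ≼ Suc n ⇒ ⊢ 1 · Suc v ≼ Suc n) refl
        _ _ _ _ _ ν p c₁ c₂ (≤-trans (uncross H′ cX cY C D C′ D′) (+-monoʳ-≤ _ c₃)) <ν)
    -- At most one end is chosen: either one unit of capacity or the uncovered edge has to be paid,
    -- never both, so the second cut is itself good enough for `H`.
    ... | true | false = inj₂ (C′ , D′ , once (cong₂ (λ s t → 𝟙 s + 𝟙 t + 𝟙 (not s ∧ not t)) ec′ ed′))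
      where
      once : 𝟙 (C′ x₀) + 𝟙 (D′ y₀) + 𝟙 (not (C′ x₀) ∧ not (D′ y₀)) ≡ 1 → cutValue H cX cY C′ D′ < suc ν
      once h = lin 6 (λ u v w s t n → K 1 · u ≼ v :+ t ⇒ K 1 · v ≼ w :+ s ⇒ K 1 · s :+ t ≼ K 1 ⇒ K 1 · Suc w ≼ n ⇒ ⊢ 1 · Suc u ≼ Suc n) refl
        _ _ _ _ _ ν (cut-H cX cY C′ D′) (cut-cap cX cY C′ D′) (≤-reflexive h) <ν′
    ... | false | true = inj₂ (C′ , D′ , once (cong₂ (λ s t → 𝟙 s + 𝟙 t + 𝟙 (not s ∧ not t)) ec′ ed′))
      where
      once : 𝟙 (C′ x₀) + 𝟙 (D′ y₀) + 𝟙 (not (C′ x₀) ∧ not (D′ y₀)) ≡ 1 → cutValue H cX cY C′ D′ < suc ν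
      once h = lin 6 (λ u v w s t n → K 1 · u ≼ v :+ t ⇒ K 1 · v ≼ w :+ s ⇒ K 1 · s :+ t ≼ K 1 ⇒ K 1 · Suc w ≼ n ⇒ ⊢ 1 · Suc u ≼ Suc n) refl
        _ _ _ _ _ ν (cut-H cX cY C′ D′) (cut-cap cX cY C′ D′) (≤-reflexive h) <ν′
    ... | false | false = inj₂ (C′ , D′ , once (cong₂ (λ s t → 𝟙 s + 𝟙 t + 𝟙 (not s ∧ not t)) ec′ ed′))
      where
      once : 𝟙 (C′ x₀) + 𝟙 (D′ y₀) + 𝟙 (not (C′ x₀) ∧ not (D′ y₀)) ≡ 1 → cutValue H cX cY C′ D′ < suc ν
      once h = lin 6 (λ u v w s t n → K 1 · u ≼ v :+ t ⇒ K 1 · v ≼ w :+ s ⇒ K 1 · s :+ t ≼ K 1 ⇒ K 1 · Suc w ≼ n ⇒ ⊢ 1 · Suc u ≼ Suc n) refl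
        _ _ _ _ _ ν (cut-H cX cY C′ D′) (cut-cap cX cY C′ D′) (≤-reflexive h) <ν′

-- Splitting a set equitably with respect to many subsets

-- The argument uses only monotonicity and additivity of the sum over the sets, so one splitting
-- lemma serves the vertices of a graph as well as the product index set of the reserve.
record Summation (J : Set) : Set where
  field
    sumJ : (J → ℕ) → ℕ
    sumJ-mono : ∀ {f g} → (∀ j → f j ≤ g j) → sumJ f ≤ sumJ g
    sumJ-+ : ∀ f g → sumJ (λ j → f j + g j) ≡ sumJ f + sumJ g

  sumJ-cong : ∀ {f g} → (∀ j → f j ≡ g j) → sumJ f ≡ sumJ g
  sumJ-cong h = ≤-antisym (sumJ-mono (λ j → ≤-reflexive (h j))) (sumJ-mono (λ j → ≤-reflexive (sym (h j))))

  sumJ-0 : sumJ (λ _ → 0) ≡ 0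
  sumJ-0 = +-cancelˡ-≡ (sumJ (λ _ → 0)) _ _ (trans (sym (sumJ-+ (λ _ → 0) (λ _ → 0))) (sym (+-identityʳ _)))

  sumJ-* : ∀ c f → sumJ (λ j → c * f j) ≡ c * sumJ f
  sumJ-* zero f = sumJ-0
  sumJ-* (suc c) f = trans (sumJ-+ f (λ j → c * f j)) (cong (sumJ f +_) (sumJ-* c f))

  sumJ-∑ : ∀ {n} (f : Fin n → J → ℕ) → ∑ (λ i → sumJ (f i)) ≡ sumJ (λ j → ∑ (λ i → f i j))
  sumJ-∑ {zero} f = sym sumJ-0
  sumJ-∑ {suc n} f = trans (cong (sumJ (f zero) +_) (sumJ-∑ (λ i → f (suc i)))) (sym (sumJ-+ (f zero) _))

finSummation : ∀ n → Summation (Fin n)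
finSummation n = record { sumJ = ∑ ; sumJ-mono = ∑-mono ; sumJ-+ = ∑-+ }

productSummation : ∀ {I J} → Summation I → Summation J → Summation (I × J)
productSummation SI SJ = record
  { sumJ = λ f → I.sumJ (λ i → J.sumJ (λ j → f (i , j)))
  ; sumJ-mono = λ h → I.sumJ-mono (λ i → J.sumJ-mono (λ j → h (i , j)))
  ; sumJ-+ = λ f g → trans (I.sumJ-cong (λ i → J.sumJ-+ (λ j → f (i , j)) (λ j → g (i , j)))) (I.sumJ-+ _ _) }
  where
  module I = Summation SI
  module J = Summation SJ

𝟙-∧ : ∀ a b → 𝟙 (a ∧ b) ≡ 𝟙 a * 𝟙 b
𝟙-∧ true b = sym (+-identityʳ _)
𝟙-∧ false b = refl

𝟙-idem : ∀ a → 𝟙 a * 𝟙 a ≡ 𝟙 a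
𝟙-idem true = refl
𝟙-idem false = refl

==-sym : ∀ {n} (i j : Fin n) → (i == j) ≡ (j == i)
==-sym i j with i Fin.≟ j | j Fin.≟ i
... | yes _ | yes _ = refl
... | no _ | no _ = refl
... | yes refl | no ¬p = ⊥-elim (¬p refl)
... | no ¬p | yes refl = ⊥-elim (¬p refl)

∑-point′ : ∀ {n} (i : Fin n) (h : Fin n → ℕ) → ∑ (λ j → 𝟙 (i == j) * h j) ≡ h i
∑-point′ i h = trans (∑-cong (λ j → cong (λ b → 𝟙 b * h j) (==-sym i j))) (∑-point i h)

-- The part of each point is chosen to minimise the growth of Σ cnt², which is at most the average growth.
module Splitting {J : Set} (SJ : Summation J) (t : ℕ) (0<t : 0 < t) where
  open Summation SJ

  cnt : ∀ {n} → (J → Fin n → Bool) → (Fin n → Fin t) → J → Fin t → ℕ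
  cnt A c j a = # (λ y → A j y ∧ (c y == a))

  cnt-total : ∀ {n} (A : J → Fin n → Bool) c j → ∑ (cnt A c j) ≡ # (A j)
  cnt-total A c j = trans (∑-swap (λ a y → 𝟙 (A j y ∧ (c y == a)))) (∑-cong λ y →
    trans (∑-cong (λ a → trans (𝟙-∧ (A j y) (c y == a)) (*-comm (𝟙 (A j y)) _))) (∑-point′ (c y) (λ _ → 𝟙 (A j y))))

  energy : ∀ {n} → (J → Fin n → Bool) → (Fin n → Fin t) → ℕ
  energy A c = sumJ (λ j → ∑ (λ a → cnt A c j a * cnt A c j a))

  private
    sq : ∀ p q r → (p * q + r) * (p * q + r) ≡ (p * p) * (q * q) + 2 * ((p * q) * r) + r * r
    sq = solve-∀
    sq′ : ∀ p r → (p + r) * (p + r) ≡ p * p + 2 * (p * r) + r * r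
    sq′ = solve-∀
    re : ∀ e a n → e * (a * n) ≡ a * (e * n)
    re = solve-∀

  -- This is the value expected of a uniformly random colouring: two distinct points of `A j` agree
  -- with probability 1/t, and the last sum accounts for the pairs of equal points.
  splitting : ∀ {n} (A : J → Fin n → Bool) → ∃ λ c →
    t * energy A c ≤ sumJ (λ j → # (A j) * # (A j)) + t * sumJ (λ j → # (A j))
  splitting {zero} A = (λ ()) , ≤-trans (≤-reflexive (trans (cong (t *_) (trans (sumJ-cong (λ j → ∑-0 t)) sumJ-0)) (*-zeroʳ t))) z≤n
  splitting {suc n} A with splitting (λ j y → A j (suc y))
  ... | c′ , ih = c , bound
    where
    A′ : J → Fin n → Bool
    A′ j y = A j (suc y)
    α : J → ℕ
    α j = 𝟙 (A j zero)
    m′ : J → ℕ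
    m′ j = # (A′ j)
    g : Fin t → ℕ
    g a = sumJ (λ j → α j * cnt A′ c′ j a)
    min = ∑-min 0<t g
    c₀ = proj₁ min
    c : Fin (suc n) → Fin t
    c zero = c₀
    c (suc y) = c′ y
    g≤ : t * g c₀ ≤ sumJ (λ j → α j * m′ j)
    g≤ = ≤-trans (proj₂ min) (≤-reflexive (trans (sumJ-∑ (λ a j → α j * cnt A′ c′ j a))
      (sumJ-cong (λ j → trans (∑-*ˡ (α j) (cnt A′ c′ j)) (cong (α j *_) (cnt-total A′ c′ j))))))
    row : ∀ j → ∑ (λ a → cnt A c j a * cnt A c j a) ≡ α j + 2 * (α j * cnt A′ c′ j c₀) + ∑ (λ a → cnt A′ c′ j a * cnt A′ c′ j a)
    row j = trans (∑-cong (λ a → trans (cong (λ z → (z + N a) * (z + N a)) (𝟙-∧ (A j zero) (c₀ == a))) (trans (sq (α j) (ε a) (N a))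
        (cong (_+ N a * N a) (cong₂ _+_ (trans (cong₂ _*_ (𝟙-idem (A j zero)) (𝟙-idem (c₀ == a))) (*-comm (α j) (ε a)))
          (trans (cong (2 *_) (trans (*-assoc (α j) (ε a) (N a)) (re (α j) (ε a) (N a)))) (re 2 (ε a) (α j * N a))))))))
      (trans (∑-+ (λ a → ε a * α j + ε a * (2 * (α j * N a))) (λ a → N a * N a)) (cong (_+ ∑ (λ a → N a * N a))
      (trans (∑-+ (λ a → ε a * α j) (λ a → ε a * (2 * (α j * N a)))) (cong₂ _+_ (∑-point′ c₀ (λ _ → α j)) (∑-point′ c₀ (λ a → 2 * (α j * N a)))))))
      where
      N : Fin t → ℕ
      N a = cnt A′ c′ j a
      ε : Fin t → ℕ
      ε a = 𝟙 (c₀ == a)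
    Σα = sumJ α
    lhs : energy A c ≡ Σα + 2 * g c₀ + energy A′ c′
    lhs = trans (sumJ-cong row) (trans (sumJ-+ (λ j → α j + 2 * (α j * cnt A′ c′ j c₀)) _) (cong (_+ energy A′ c′)
      (trans (sumJ-+ α _) (cong (Σα +_) (sumJ-* 2 (λ j → α j * cnt A′ c′ j c₀))))))
    rhs : sumJ (λ j → # (A j) * # (A j)) ≡ Σα + 2 * sumJ (λ j → α j * m′ j) + sumJ (λ j → m′ j * m′ j)
    rhs = trans (sumJ-cong (λ j → trans (sq′ (α j) (m′ j)) (cong (λ z → z + 2 * (α j * m′ j) + m′ j * m′ j) (𝟙-idem (A j zero)))))
      (trans (sumJ-+ (λ j → α j + 2 * (α j * m′ j)) (λ j → m′ j * m′ j)) (cong (_+ sumJ (λ j → m′ j * m′ j))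
      (trans (sumJ-+ α (λ j → 2 * (α j * m′ j))) (cong (Σα +_) (sumJ-* 2 (λ j → α j * m′ j))))))
    bound : t * energy A c ≤ sumJ (λ j → # (A j) * # (A j)) + t * sumJ (λ j → # (A j))
    bound = subst₂ (λ l r → t * l ≤ r) (sym lhs) (sym (cong₂ (λ u w → u + t * w) rhs (sumJ-+ α m′))) (lin 7 (λ t s g e x y z →
      K 2 · t :* g ≼ x ⇒ K 1 · t :* e ≼ y :+ t :* z ⇒
      ⊢ 1 · t :* (s :+ K 2 :* g :+ e) ≼ (s :+ K 2 :* x :+ y) :+ t :* (s :+ z)) refl
      t Σα (g c₀) (energy A′ c′) (sumJ (λ j → α j * m′ j)) (sumJ (λ j → m′ j * m′ j)) (sumJ m′) g≤ ih)

  dev : ∀ {n} → (J → Fin n → Bool) → (Fin n → Fin t) → J → Fin t → ℕ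
  dev A c j a = ∣ t * cnt A c j a - # (A j) ∣

  ∣-∣-sq : ∀ a b → ∣ a - b ∣ * ∣ a - b ∣ + 2 * (a * b) ≡ a * a + b * b
  ∣-∣-sq zero b = +-identityʳ _
  ∣-∣-sq (suc a) zero = cong (suc a * suc a +_) (cong (2 *_) (*-zeroʳ a))
  ∣-∣-sq (suc a) (suc b) = trans (f ∣ a - b ∣ a b) (trans (cong (_+ (2 + 2 * a + 2 * b)) (∣-∣-sq a b)) (h a b))
    where
    f : ∀ d a b → d * d + 2 * (suc a * suc b) ≡ d * d + 2 * (a * b) + (2 + 2 * a + 2 * b)
    f = solve-∀
    h : ∀ a b → a * a + b * b + (2 + 2 * a + 2 * b) ≡ suc a * suc a + suc b * suc b
    h = solve-∀

  -- The counts of a set add up to its size, so the squared deviations sum to t² times the energy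
  -- less t times the squared sizes. The main terms of `splitting` cancel, and a second moment bound
  -- remains.
  equitable : ∀ {n} (A : J → Fin n → Bool) → ∃ λ c →
    sumJ (λ j → ∑ (λ a → dev A c j a * dev A c j a)) ≤ t * t * sumJ (λ j → # (A j))
  equitable A = c , lin 5 (λ t d e s m → K 1 · d :+ t :* s ≼ t :* t :* e ⇒ t · t :* e ≼ s :+ t :* m ⇒ ⊢ 1 · d ≼ t :* t :* m) refl
      t (sumJ (λ j → ∑ (λ a → dev A c j a * dev A c j a))) (energy A c) (sumJ (λ j → # (A j) * # (A j))) (sumJ (λ j → # (A j)))
      (≤-reflexive total) (proj₂ sp)
    where
    sp = splitting A
    c = proj₁ sp
    N : J → Fin t → ℕ
    N = cnt A c
    M : J → ℕ
    M j = # (A j)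
    r₁ : ∀ t n m → (t * n) * (t * n) + m * m ≡ (t * t) * (n * n) + m * m
    r₁ = solve-∀
    r₂ : ∀ t n m → 2 * ((t * n) * m) ≡ (2 * t * m) * n
    r₂ = solve-∀
    row : ∀ j → ∑ (λ a → dev A c j a * dev A c j a) + t * (M j * M j) ≡ t * t * ∑ (λ a → N j a * N j a)
    row j = +-cancelʳ-≡ (t * (M j * M j)) _ _ (trans (r₃ (∑ (λ a → dev A c j a * dev A c j a)) t (M j)) (trans
      (cong (∑ (λ a → dev A c j a * dev A c j a) +_) (sym (trans (∑-cong (λ a → r₂ t (N j a) (M j))) (trans (∑-*ˡ (2 * t * M j) (N j)) (cong (2 * t * M j *_) (cnt-total A c j))))))
      (trans (sym (∑-+ (λ a → dev A c j a * dev A c j a) (λ a → 2 * ((t * N j a) * M j))))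
      (trans (∑-cong (λ a → trans (∣-∣-sq (t * N j a) (M j)) (r₁ t (N j a) (M j))))
      (trans (∑-+ (λ a → (t * t) * (N j a * N j a)) (λ _ → M j * M j)) (cong₂ _+_ (∑-*ˡ (t * t) (λ a → N j a * N j a)) (∑-const t (M j * M j))))))))
      where
      r₃ : ∀ d t m → d + t * (m * m) + t * (m * m) ≡ d + 2 * t * m * m
      r₃ = solve-∀
    total : sumJ (λ j → ∑ (λ a → dev A c j a * dev A c j a)) + t * sumJ (λ j → M j * M j) ≡ t * t * energy A c
    total = trans (cong (sumJ (λ j → ∑ (λ a → dev A c j a * dev A c j a)) +_) (sym (sumJ-* t (λ j → M j * M j))))
      (trans (sym (sumJ-+ _ _)) (trans (sumJ-cong row) (sumJ-* (t * t) (λ j → ∑ (λ a → N j a * N j a)))))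

-- Lists without repetition

module _ {A : Set} where

  unique-∷ : ∀ {x : A} {xs} → x ∉ xs → Unique xs → Unique (x ∷ xs)
  unique-∷ h u = All.¬Any⇒All¬ _ h ∷ u

  unique-∉ : ∀ {x : A} {xs} → Unique (x ∷ xs) → x ∉ xs
  unique-∉ (h ∷ _) = All.All¬⇒¬Any h

  unique-++⁻ : ∀ (xs : List A) {ys} → Unique (xs ++ ys) → Unique xs × Unique ys × Disjoint xs ys
  unique-++⁻ [] u = [] , u , λ { (() , _) }
  unique-++⁻ (x ∷ xs) (h ∷ u) with unique-++⁻ xs u
  ... | p , q , d = (All.++⁻ˡ xs h ∷ p) , q , λ { (here refl , j) → All.All¬⇒¬Any (All.++⁻ʳ xs h) j ; (there i , j) → d (i , j) }

  unique-resp-↭ : ∀ {xs ys : List A} → xs ↭ ys → Unique xs → Unique ys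
  unique-resp-↭ p = PermSetoid.Unique-resp-↭ (setoid A) (↭⇒↭ₛ p)

take-⊆ : ∀ {A : Set} i (xs : List A) {x} → x ∈ take i xs → x ∈ xs
take-⊆ (suc i) (x ∷ xs) (here e) = here e
take-⊆ (suc i) (x ∷ xs) (there h) = there (take-⊆ i xs h)

elems : ∀ {n} → (Fin n → Bool) → List (Fin n)
elems {zero} P = []
elems {suc n} P = if P zero then zero ∷ map suc (elems (λ i → P (suc i))) else map suc (elems (λ i → P (suc i)))

elems-length : ∀ {n} (P : Fin n → Bool) → length (elems P) ≡ # P
elems-length {zero} P = refl
elems-length {suc n} P with P zero
... | true = cong suc (trans (length-map suc (elems (λ i → P (suc i)))) (elems-length (λ i → P (suc i))))
... | false = trans (length-map suc (elems (λ i → P (suc i)))) (elems-length (λ i → P (suc i)))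

elems-sound : ∀ {n} (P : Fin n → Bool) {i} → i ∈ elems P → P i ≡ true
elems-sound {suc n} P h with P zero in e
elems-sound {suc n} P (here refl) | true = e
elems-sound {suc n} P (there h) | true with ∈-map⁻ suc h
... | j , h′ , refl = elems-sound (λ i → P (suc i)) h′
elems-sound {suc n} P h | false with ∈-map⁻ suc h
... | j , h′ , refl = elems-sound (λ i → P (suc i)) h′

elems-complete : ∀ {n} (P : Fin n → Bool) {i} → P i ≡ true → i ∈ elems P
elems-complete {suc n} P {zero} h rewrite h = here refl
elems-complete {suc n} P {suc i} h with P zero
... | true = there (∈-map⁺ suc (elems-complete (λ i → P (suc i)) h))
... | false = ∈-map⁺ suc (elems-complete (λ i → P (suc i)) h)

elems-unique : ∀ {n} (P : Fin n → Bool) → Unique (elems P)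
elems-unique {zero} P = []
elems-unique {suc n} P with P zero | Unique.map⁺ {f = suc} (λ { refl → refl }) (elems-unique (λ i → P (suc i)))
... | true | u = unique-∷ (λ h → case (∈-map⁻ suc h)) u
  where
  case : ∀ {xs : List (Fin n)} → (∃ λ y → y ∈ xs × (Fin.zero {n}) ≡ suc y) → ⊥
  case (_ , _ , ())
... | false | u = u

#-remove : ∀ {n} (P : Fin n → Bool) x → P x ≡ true → suc (# (λ i → P i ∧ not (i == x))) ≤ # P
#-remove P x h = ≤-trans (≤-reflexive (+-comm 1 _)) (≤-trans (+-monoʳ-≤ (# (λ i → P i ∧ not (i == x))) (#-member (_== x) x (==-refl x)))
  (#-disj {P = λ i → P i ∧ not (i == x)} {R = P} {Q = _== x} (λ i → ∧-fst) (λ i e → subst (λ j → P j ≡ true) (sym (==-true i x e)) h)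
    (λ i e e′ → true≢false e′ (not-false (∧-snd {P i} e)))))

unique-length : ∀ {n} {xs : List (Fin n)} (P : Fin n → Bool) → Unique xs → (∀ {x} → x ∈ xs → P x ≡ true) → length xs ≤ # P
unique-length P [] h = z≤n
unique-length {xs = x ∷ xs} P u@(_ ∷ u′) h = ≤-trans (s≤s (unique-length (λ i → P i ∧ not (i == x)) u′ λ {y} y∈ →
  ∧-intro (h (there y∈)) (not-true (does-no (y Fin.≟ x) λ { refl → unique-∉ u y∈ })))) (#-remove P x (h (here refl)))

-- Weighted König theorem and disjoint paths in layered digraphs

module _ {N : ℕ} where

  -- A cut of value below ν would account for all the weight at no more than Δ per unit: a chosen
  -- row or column carries at most Δ, and so does a single uncovered entry. The total would then be
  -- less than Δν.
  weighted-König : ∀ (w : Fin N → Fin N → ℕ) Δ ν → (∀ u → ∑ (w u) ≤ Δ) → (∀ v → ∑ (λ u → w u v) ≤ Δ) → 0 < Δ →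
    Δ * ν ≤ ∑ (λ u → ∑ (w u)) → BMatching (λ u v → 1 ≤ᵇ w u v) (λ _ → 1) (λ _ → 1) ν
  weighted-König w Δ ν row col Δ>0 total with b-matching-duality _ (λ u v → 1 ≤ᵇ w u v) (λ _ → 1) (λ _ → 1) ν ≤-refl
  ... | inj₁ M = M
  ... | inj₂ (C , D , lt) = ⊥-elim (<⇒≱ (*-monoʳ-< Δ {{Data.Nat.>-nonZero Δ>0}} lt) (≤-trans total (≤-trans (∑-mono₂ pt) (≤-trans (≤-reflexive sums) (
        ≤-trans (+-mono-≤ (+-mono-≤ (∑-mono rowC) (∑-mono colD)) ≤-refl) (≤-reflexive fin))))))
    where
    U : Fin N → Fin N → Bool
    U = uncov (λ u v → 1 ≤ᵇ w u v) C D
    w≤Δ : ∀ u v → w u v ≤ Δ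
    w≤Δ u v = ≤-trans (∑-member (w u) v) (row u)
    pt : ∀ u v → w u v ≤ 𝟙 (C u) * w u v + 𝟙 (D v) * w u v + Δ * 𝟙 (U u v)
    pt u v with C u | D v | 1 ≤ᵇ w u v in e
    ... | true | d | _ = ≤-trans (≤-reflexive (sym (+-identityʳ _))) (≤-trans (m≤m+n _ _) (m≤m+n _ _))
    ... | false | true | _ = ≤-trans (≤-reflexive (sym (+-identityʳ _))) (m≤m+n _ _)
    ... | false | false | true = ≤-trans (w≤Δ u v) (≤-reflexive (sym (*-identityʳ Δ)))
    ... | false | false | false = ≤-trans (≤-pred (≤ᵇ-false e)) z≤n
    rowC : ∀ u → 𝟙 (C u) * ∑ (w u) ≤ Δ * (1 * 𝟙 (C u))
    rowC u = ≤-trans (*-monoʳ-≤ (𝟙 (C u)) (row u)) (≤-reflexive (trans (*-comm (𝟙 (C u)) Δ) (cong (Δ *_) (sym (*-identityˡ _)))))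
    colD : ∀ v → 𝟙 (D v) * ∑ (λ u → w u v) ≤ Δ * (1 * 𝟙 (D v))
    colD v = ≤-trans (*-monoʳ-≤ (𝟙 (D v)) (col v)) (≤-reflexive (trans (*-comm (𝟙 (D v)) Δ) (cong (Δ *_) (sym (*-identityˡ _)))))
    sums : ∑ (λ u → ∑ (λ v → 𝟙 (C u) * w u v + 𝟙 (D v) * w u v + Δ * 𝟙 (U u v)))
         ≡ ∑ (λ u → 𝟙 (C u) * ∑ (w u)) + ∑ (λ v → 𝟙 (D v) * ∑ (λ u → w u v)) + Δ * ∣ U ∣ᴱ
    sums = trans (∑-+₂ (λ u v → 𝟙 (C u) * w u v + 𝟙 (D v) * w u v) (λ u v → Δ * 𝟙 (U u v))) (cong₂ _+_
      (trans (∑-+₂ (λ u v → 𝟙 (C u) * w u v) (λ u v → 𝟙 (D v) * w u v)) (cong₂ _+_ (∑-cong (λ u → ∑-*ˡ (𝟙 (C u)) (w u)))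
        (trans (∑-swap (λ u v → 𝟙 (D v) * w u v)) (∑-cong (λ v → ∑-*ˡ (𝟙 (D v)) (λ u → w u v))))))
      (trans (∑-cong (λ u → ∑-*ˡ Δ (λ v → 𝟙 (U u v)))) (∑-*ˡ Δ (λ u → ∑ (λ v → 𝟙 (U u v))))))
    fin : ∑ (λ u → Δ * (1 * 𝟙 (C u))) + ∑ (λ v → Δ * (1 * 𝟙 (D v))) + Δ * ∣ U ∣ᴱ
        ≡ Δ * cutValue (λ u v → 1 ≤ᵇ w u v) (λ _ → 1) (λ _ → 1) C D
    fin = trans (cong (_+ Δ * ∣ U ∣ᴱ) (cong₂ _+_ (∑-*ˡ Δ (λ u → 1 * 𝟙 (C u))) (∑-*ˡ Δ (λ u → 1 * 𝟙 (D u)))))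
      (trans (cong (_+ Δ * ∣ U ∣ᴱ) (sym (*-distribˡ-+ Δ (∑ (λ u → 1 * 𝟙 (C u))) (∑ (λ u → 1 * 𝟙 (D u)))))) (sym (*-distribˡ-+ Δ _ ∣ U ∣ᴱ)))

module Layered {N : ℕ} (lay : Fin N → ℕ) (last : ℕ) (arc : Fin N → Fin N → Bool)
  (arc-lay : ∀ u v → arc u v ≡ true → lay v ≡ suc (lay u) × lay u < last) where

  data Chain : ℕ → Fin N → List (Fin N) → Set where
    start : ∀ {u} → lay u ≡ 0 → Chain 0 u (u ∷ [])
    step : ∀ {l u v vs} → Chain l u vs → arc u v ≡ true → Chain (suc l) v (v ∷ vs)

  chain-lay : ∀ {l u vs} → Chain l u vs → lay u ≡ l
  chain-lay (start e) = e
  chain-lay (step {u = u} {v} c a) = trans (proj₁ (arc-lay u v a)) (cong suc (chain-lay c))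

  chain-head : ∀ {l u vs} → Chain l u vs → u ∈ vs
  chain-head (start _) = here refl
  chain-head (step _ _) = here refl

  chain-≤ : ∀ {l u vs z} → Chain l u vs → z ∈ vs → lay z ≤ l
  chain-≤ c@(start e) (here refl) = ≤-reflexive e
  chain-≤ c@(step _ _) (here refl) = ≤-reflexive (chain-lay c)
  chain-≤ (step c _) (there h) = ≤-trans (chain-≤ c h) (n≤1+n _)

  mid : Fin N → Bool
  mid u = (1 ≤ᵇ lay u) ∧ (suc (lay u) ≤ᵇ last)

  first : Fin N → Bool
  first u = lay u ≤ᵇ 0

  record ChainSystem (l s : ℕ) : Set where
    field
      chains : List (List (Fin N))
      isChain : ∀ {vs} → vs ∈ chains → ∃ λ u → Chain l u vs
      unique : Unique (concat chains)
      enough : s ≤ length chains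

  -- A split vertex matched to itself is unused; every other vertex entered by a chain is left by it unless
  -- its out-copy is unmatched.
  module _ (t : ℕ) (σ : Fin N → ℕ) (Δ : ℕ) (0<Δ : 0 < Δ) (0<last : 0 < last)
    (out : ∀ u → t * # (arc u) + 𝟙 (mid u) * σ u ≤ Δ)
    (inn : ∀ v → t * # (λ u → arc u v) + 𝟙 (mid v) * σ v ≤ Δ)
    (s : ℕ) (total : Δ * (# mid + s) ≤ t * ∣ arc ∣ᴱ + ∑ (λ u → 𝟙 (mid u) * σ u)) where

    private
      w : Fin N → Fin N → ℕ
      w u v = t * 𝟙 (arc u v) + 𝟙 (v == u) * (𝟙 (mid u) * σ u)

      w-row : ∀ u → ∑ (w u) ≡ t * # (arc u) + 𝟙 (mid u) * σ u
      w-row u = trans (∑-+ (λ v → t * 𝟙 (arc u v)) _) (cong₂ _+_ (∑-*ˡ t (λ v → 𝟙 (arc u v))) (∑-point u (λ _ → 𝟙 (mid u) * σ u)))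

      w-col : ∀ v → ∑ (λ u → w u v) ≡ t * # (λ u → arc u v) + 𝟙 (mid v) * σ v
      w-col v = trans (∑-+ (λ u → t * 𝟙 (arc u v)) _) (cong₂ _+_ (∑-*ˡ t (λ u → 𝟙 (arc u v))) (∑-point′ v (λ u → 𝟙 (mid u) * σ u)))

      matching : BMatching (λ u v → 1 ≤ᵇ w u v) (λ _ → 1) (λ _ → 1) (# mid + s)
      matching = weighted-König w Δ (# mid + s) (λ u → ≤-trans (≤-reflexive (w-row u)) (out u)) (λ v → ≤-trans (≤-reflexive (w-col v)) (inn v)) 0<Δ
        (≤-trans total (≤-reflexive (sym (trans (∑-cong w-row) (trans (∑-+ (λ u → t * # (arc u)) (λ u → 𝟙 (mid u) * σ u)) (cong (_+ _) (∑-*ˡ t (λ u → # (arc u)))))))))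

      module Mt = BMatching matching
      M = Mt.F

      M-cases : ∀ u v → M u v ≡ true → arc u v ≡ true ⊎ (v ≡ u × mid u ≡ true)
      M-cases u v e with pos (arc u v) (v == u) (mid u) (σ u) (≤ᵇ-true {1} (Mt.F⊆H u v e))
        where
        pos : ∀ a c m s → 1 ≤ t * 𝟙 a + 𝟙 c * (𝟙 m * s) → a ≡ true ⊎ (c ≡ true × m ≡ true)
        pos true _ _ _ _ = inj₁ refl
        pos false true true _ _ = inj₂ (refl , refl)
        pos false true false _ h = ⊥-elim (<⇒≱ h (≤-reflexive (trans (+-identityʳ _) (*-zeroʳ t))))
        pos false false _ _ h = ⊥-elim (<⇒≱ h (≤-reflexive (trans (+-identityʳ _) (*-zeroʳ t))))
      ... | inj₁ a = inj₁ a
      ... | inj₂ (c , m) = inj₂ (==-true v u c , m)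

      M-col : ∀ u u′ v → M u v ≡ true → M u′ v ≡ true → u ≡ u′
      M-col u u′ v e e′ with u Fin.≟ u′
      ... | yes p = p
      ... | no ¬p = ⊥-elim (<⇒≱ (≤-trans (s≤s (#-member (λ i → M i v ∧ not (i == u)) u′ (∧-intro e′ (not-true (does-no (u′ Fin.≟ u) λ q → ¬p (sym q)))))) (#-remove (λ i → M i v) u e)) (Mt.degY≤ v))

      M-row : ∀ u v → M u v ≡ true → lay u < last
      M-row u v e with M-cases u v e
      ... | inj₁ a = proj₂ (arc-lay u v a)
      ... | inj₂ (_ , m) = ≤ᵇ-true (∧-snd {1 ≤ᵇ lay u} m)

      idle : ℕ → Fin N → Bool
      idle l u = (suc (lay u) ≤ᵇ l) ∧ (# (M u) ≤ᵇ 0)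

      -- Out-copies are matched only before the last layer, where `first` and `mid` are all there
      -- is. As # mid + s of them are matched, the surplus s over # mid limits the idle ones; later
      -- every lost chain is charged to one of these.
      idle-bound : # (idle last) + s ≤ # first
      idle-bound = lin 7 (λ i s f m b g z → K 1 · i :+ g ≼ b ⇒ K 1 · b ≼ f :+ m ⇒ K 1 · m :+ s ≼ z ⇒ K 1 · z ≼ g ⇒ ⊢ 1 · i :+ s ≼ f) refl
        (# (idle last)) s (# first) (# mid) (# (λ u → suc (lay u) ≤ᵇ last)) (# (λ u → 1 ≤ᵇ # (M u))) ∣ M ∣ᴱ
        (#-disj {P = idle last} {R = λ u → suc (lay u) ≤ᵇ last} {Q = λ u → 1 ≤ᵇ # (M u)} (λ u → ∧-fst) busy
          (λ u p q → <⇒≱ (≤ᵇ-true {1} q) (≤ᵇ-true {# (M u)} (∧-snd {suc (lay u) ≤ᵇ last} p))))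
        (#-∪ {P = λ u → suc (lay u) ≤ᵇ last} {Q = first} {R = mid} early)
        Mt.size
        (∑-mono (λ u → le1 (Mt.degX≤ u)))
        where
        busy : ∀ u → (1 ≤ᵇ # (M u)) ≡ true → (suc (lay u) ≤ᵇ last) ≡ true
        busy u e with #-ex₁ (M u) (≤ᵇ-true e)
        ... | v , m = ≤ᵇ-intro (M-row u v m)
        early : ∀ u → (suc (lay u) ≤ᵇ last) ≡ true → first u ≡ true ⊎ mid u ≡ true
        early u e with lay u
        ... | zero = inj₁ refl
        ... | suc l = inj₂ e
        le1 : ∀ {m} → m ≤ 1 → m ≤ 𝟙 (1 ≤ᵇ m)
        le1 {zero} _ = z≤n
        le1 {suc zero} _ = s≤s z≤n
        le1 {suc (suc m)} (s≤s ())

      -- Keeps a chain from stopping at a loop: once a vertex is entered from a lower layer, its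
      -- in-copy is taken and it cannot be matched to itself. On layer 0 loops are excluded by
      -- `mid`.
      Entered : ℕ → Fin N → Set
      Entered l h = l ≡ 0 ⊎ (∃ λ u → M u h ≡ true × lay u < lay h)

      Good : ℕ → List (Fin N) → Set
      Good l vs = ∃ λ u → Chain l u vs × Entered l u

      record Step (l : ℕ) (cs : List (List (Fin N))) : Set where
        field
          cs′ : List (List (Fin N))
          ds : List (Fin N)
          good : ∀ {vs} → vs ∈ cs′ → Good (suc l) vs
          uniq : Unique (concat cs′)
          origin : ∀ {z} → z ∈ concat cs′ → z ∈ concat cs ⊎ (∃ λ h → M h z ≡ true × h ∈ concat cs × lay z ≡ suc l)
          len : length cs ≡ length cs′ + length ds
          uniq-ds : Unique ds
          ds⊆ : ∀ {z} → z ∈ ds → z ∈ concat cs × lay z ≡ l × # (M z) ≤ 0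

      concat-lay : ∀ {l z} (cs : List (List (Fin N))) → (∀ {vs} → vs ∈ cs → Good l vs) → z ∈ concat cs → lay z ≤ l
      concat-lay (c ∷ cs) g z∈ with ∈-++⁻ c z∈
      ... | inj₁ h = chain-≤ (proj₁ (proj₂ (g (here refl)))) h
      ... | inj₂ h = concat-lay cs (λ i → g (there i)) h

      -- A chain whose head has no match is dropped and its head recorded in `ds`. The others are
      -- prolonged; distinct heads get distinct successors because a column of the matching holds at
      -- most one edge, and `origin` carries this information through the induction.
      advance : ∀ l → l < last → (cs : List (List (Fin N))) → (∀ {vs} → vs ∈ cs → Good l vs) → Unique (concat cs) → Step l cs
      advance l l<last [] g u = record { cs′ = [] ; ds = [] ; good = λ () ; uniq = [] ; origin = λ () ; len = refl ; uniq-ds = [] ; ds⊆ = λ () }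
      advance l l<last (c ∷ cs) g u with unique-++⁻ c u
      ... | uc , ucs , dis with advance l l<last cs (λ i → g (there i)) ucs | g (here refl)
      ... | rec | h , ch , ent with search (M h)
      ... | inj₂ none = record
        { cs′ = cs′ ; ds = h ∷ ds ; good = good ; uniq = uniq
        ; origin = λ z∈ → weaken (origin z∈)
        ; len = trans (cong suc len) (sym (+-suc (length cs′) (length ds)))
        ; uniq-ds = unique-∷ (λ h∈ → dis (chain-head ch , proj₁ (ds⊆ h∈))) uniq-ds
        ; ds⊆ = λ { (here refl) → ∈-++⁺ˡ (chain-head ch) , chain-lay ch , ≤-reflexive (#-none none)
                  ; (there i) → let a , b = ds⊆ i in ∈-++⁺ʳ c a , b } }
        where
        open Step rec
        weaken : ∀ {z} → z ∈ concat cs ⊎ (∃ λ h → M h z ≡ true × h ∈ concat cs × lay z ≡ suc l) →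
          z ∈ c ++ concat cs ⊎ (∃ λ h → M h z ≡ true × h ∈ c ++ concat cs × lay z ≡ suc l)
        weaken (inj₁ i) = inj₁ (∈-++⁺ʳ c i)
        weaken (inj₂ (h , m , i , e)) = inj₂ (h , m , ∈-++⁺ʳ c i , e)
      ... | inj₁ (v , m) = record
        { cs′ = (v ∷ c) ∷ cs′ ; ds = ds
        ; good = λ { (here refl) → v , step ch arc-hv , inj₂ (h , m , subst (lay h <_) (sym lay-v) (n<1+n (lay h))) ; (there i) → good i }
        ; uniq = unique-∷ v∉ (Unique.++⁺ uc uniq λ { (i , j) → c∩ i j })
        ; origin = orig
        ; len = cong suc len ; uniq-ds = uniq-ds
        ; ds⊆ = λ i → let a , b = ds⊆ i in ∈-++⁺ʳ c a , b }
        where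
        open Step rec
        self : Entered l h → ¬ (v ≡ h × mid h ≡ true)
        self (inj₁ l≡0) (_ , md) = <⇒≱ (≤ᵇ-true {1} (∧-fst md)) (≤-reflexive (trans (chain-lay ch) l≡0))
        self (inj₂ (u′ , m′ , lt)) (v≡h , _) = <⇒≢ lt (cong lay (M-col u′ h h m′ (subst (λ z → M h z ≡ true) v≡h m)))
        arc-hv : arc h v ≡ true
        arc-hv with M-cases h v m
        ... | inj₁ a = a
        ... | inj₂ s = ⊥-elim (self ent s)
        lay-v : lay v ≡ suc (lay h)
        lay-v = proj₁ (arc-lay h v arc-hv)
        lay-v′ : lay v ≡ suc l
        lay-v′ = trans lay-v (cong suc (chain-lay ch))
        c∩ : ∀ {z} → z ∈ c → z ∈ concat cs′ → ⊥
        c∩ i j with origin j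
        ... | inj₁ k = dis (i , k)
        ... | inj₂ (_ , _ , _ , e) = <⇒≱ (≤-reflexive (sym e)) (chain-≤ ch i)
        v∉ : v ∉ c ++ concat cs′
        v∉ i with ∈-++⁻ c i
        ... | inj₁ j = <⇒≱ (≤-reflexive (sym lay-v′)) (chain-≤ ch j)
        ... | inj₂ j with origin j
        ... | inj₁ k = <⇒≱ (≤-reflexive (sym lay-v′)) (concat-lay cs (λ i → g (there i)) k)
        ... | inj₂ (h′ , m′ , k , _) = dis (subst (_∈ c) (M-col h h′ v m m′) (chain-head ch) , k)
        orig : ∀ {z} → z ∈ v ∷ (c ++ concat cs′) → z ∈ c ++ concat cs ⊎ (∃ λ h → M h z ≡ true × h ∈ c ++ concat cs × lay z ≡ suc l)
        orig (here refl) = inj₂ (h , m , ∈-++⁺ˡ (chain-head ch) , lay-v′)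
        orig (there i) with ∈-++⁻ c i
        ... | inj₁ j = inj₁ (∈-++⁺ˡ j)
        ... | inj₂ j with origin j
        ... | inj₁ k = inj₁ (∈-++⁺ʳ c k)
        ... | inj₂ (h′ , m′ , k , e) = inj₂ (h′ , m′ , ∈-++⁺ʳ c k , e)

      record Level (l : ℕ) : Set where
        field
          chains : List (List (Fin N))
          good : ∀ {vs} → vs ∈ chains → Good l vs
          uniq : Unique (concat chains)
          enough : # first ≤ length chains + # (idle l)

      singletons : List (Fin N) → List (List (Fin N))
      singletons = map [_]

      concat-singletons : ∀ xs → concat (singletons xs) ≡ xs
      concat-singletons [] = refl
      concat-singletons (x ∷ xs) = cong (x ∷_) (concat-singletons xs)

      level : ∀ l → l ≤ last → Level l
      level zero _ = record
        { chains = singletons (elems first)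
        ; good = λ i → base i
        ; uniq = subst Unique (sym (concat-singletons (elems first))) (elems-unique first)
        ; enough = ≤-trans (≤-reflexive (sym (trans (length-map [_] (elems first)) (elems-length first)))) (m≤m+n _ _) }
        where
        base : ∀ {vs} → vs ∈ singletons (elems first) → Good 0 vs
        base i with ∈-map⁻ [_] i
        ... | u , j , refl = u , start (n≤0⇒n≡0 (≤ᵇ-true (elems-sound first j))) , inj₁ refl
      level (suc l) l<last = record { chains = cs′ ; good = good ; uniq = uniq
        -- Chains dropped now end in idle vertices of layer l. These are new, since `idle l` sees
        -- only lower layers.
        ; enough = lin 6 (λ f c c′ d i j → K 1 · f ≼ c :+ i ⇒ K 1 · c ≼ c′ :+ d ⇒ K 1 · d :+ i ≼ j ⇒ ⊢ 1 · f ≼ c′ :+ j) refl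
            (# first) (length L.chains) (length cs′) (length ds) (# (idle l)) (# (idle (suc l))) L.enough (≤-reflexive len)
            (≤-trans (+-monoˡ-≤ (# (idle l)) (unique-length now uniq-ds λ z∈ → let _ , e , h = ds⊆ z∈ in ∧-intro (does-intro (_ Data.Nat.≟ l) e) (≤ᵇ-intro h)))
              (#-disj {P = now} {R = idle (suc l)} {Q = idle l}
                (λ u e → ∧-intro (≤ᵇ-intro (s≤s (≤-reflexive (does-true (lay u Data.Nat.≟ l) (∧-fst e))))) (∧-snd {does (lay u Data.Nat.≟ l)} e))
                (λ u e → ∧-intro {suc (lay u) ≤ᵇ suc l} (≤ᵇ-intro (≤-trans (≤ᵇ-true {suc (lay u)} {l} (∧-fst e)) (n≤1+n l))) (∧-snd {suc (lay u) ≤ᵇ l} e))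
                (λ u e e′ → <⇒≢ (≤ᵇ-true {suc (lay u)} {l} (∧-fst e′)) (does-true (lay u Data.Nat.≟ l) (∧-fst e))))) }
        where
        module L = Level (level l (<⇒≤ l<last))
        open Step (advance l l<last L.chains L.good L.uniq)
        now : Fin N → Bool
        now u = does (lay u Data.Nat.≟ l) ∧ (# (M u) ≤ᵇ 0)

    chainSystem : ChainSystem last s
    chainSystem = record
      { chains = L.chains ; isChain = λ i → let u , c , _ = L.good i in u , c ; unique = L.uniq
      ; enough = lin 4 (λ s f c i → K 1 · i :+ s ≼ f ⇒ K 1 · f ≼ c :+ i ⇒ ⊢ 1 · s ≼ c) refl
          s (# first) (length L.chains) (# (idle last)) idle-bound L.enough }
      where module L = Level (level last ≤-refl)

∑-⊎ : ∀ m {n} (f : Fin (m + n) → ℕ) → ∑ f ≡ ∑ (λ i → f (i ↑ˡ n)) + ∑ (λ j → f (m ↑ʳ j))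
∑-⊎ zero f = refl
∑-⊎ (suc m) f = trans (cong (f zero +_) (∑-⊎ m (λ i → f (suc i)))) (sym (+-assoc (f zero) _ _))

-- Paths alternating between X and Y in which some connections x – x′ are still to be realised (viaQ)

module MixedPaths {n : ℕ} (Q H : Fin n → Fin n → Bool) where

  data MPath : Fin n → Fin n → List (Fin n) → List (Fin n) → ℕ → Set where
    stop : ∀ {x} → MPath x x (x ∷ []) [] 0
    viaY : ∀ {x x′ z y xs ys q} → H x y ≡ true → H x′ y ≡ true → MPath x′ z xs ys q → MPath x z (x ∷ xs) (y ∷ ys) q
    viaQ : ∀ {x x′ z xs ys q} → Q x x′ ≡ true → MPath x′ z xs ys q → MPath x z (x ∷ xs) ys (suc q)

  record Item (t : ℕ) : Set where
    field
      {from to} : Fin n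
      xs ys : List (Fin n)
      path : MPath from to xs ys 0
      len : length xs ≡ t
      xs-H : ∀ {x} → x ∈ xs → ∃ λ y → H x y ≡ true
      ys-H : ∀ {y} → y ∈ ys → ∃ λ x → H x y ≡ true

-- Disjoint paths through all layers of a graph of bounded degree

module ForestLemma {n : ℕ} (F : Fin n → Fin n → Bool) (b t t₁ θ s A₀ : ℕ) (t≡ : t ≡ suc t₁) (0<t₁ : 0 < t₁)
  (degX≤ : ∀ x → # (F x) ≤ b) (degY≤ : ∀ y → # (λ x → F x y) ≤ b)
  (0<b : 0 < b) (s≤ : s ≤ n + n)
  (atyp-num : t * t * ((n + n) * b) < suc A₀ * (θ * θ))
  (num : t * b * s + (3 * t + 1) * (θ * (n + n)) + (t * (t + 1) + 1) * (b * A₀) ≤ ∣ F ∣ᴱ)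
  where

  private
    N = n + n
    last = 2 * t₁

    0<t : 0 < t
    0<t = subst (0 <_) (sym t≡) (s≤s z≤n)

    0<last : 0 < last
    0<last = ≤-trans 0<t₁ (m≤m+n t₁ _)

    FS : Fin n ⊎ Fin n → Fin n ⊎ Fin n → Bool
    FS (inj₁ x) (inj₂ y) = F x y
    FS (inj₂ y) (inj₁ x) = F x y
    FS (inj₁ _) (inj₁ _) = false
    FS (inj₂ _) (inj₂ _) = false

    FU : Fin N → Fin N → Bool
    FU u v = FS (splitAt n u) (splitAt n v)

    FS-sym : ∀ u v → FS u v ≡ FS v u
    FS-sym (inj₁ x) (inj₂ y) = refl
    FS-sym (inj₂ y) (inj₁ x) = refl
    FS-sym (inj₁ _) (inj₁ _) = refl
    FS-sym (inj₂ _) (inj₂ _) = refl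

    FU-sym : ∀ u v → FU u v ≡ FU v u
    FU-sym u v = FS-sym (splitAt n u) (splitAt n v)

    degS : ∀ u → # (λ v → FS u (splitAt n v)) ≤ b
    degS (inj₁ x) = ≤-trans (≤-reflexive (trans (∑-⊎ n _) (cong₂ _+_
      (trans (∑-cong (λ i → cong (λ z → 𝟙 (FS (inj₁ x) z)) (splitAt-↑ˡ n i n))) (∑-0 n))
      (∑-cong (λ i → cong (λ z → 𝟙 (FS (inj₁ x) z)) (splitAt-↑ʳ n n i)))))) (degX≤ x)
    degS (inj₂ y) = ≤-trans (≤-reflexive (trans (∑-⊎ n _) (trans (cong₂ _+_
      (∑-cong (λ i → cong (λ z → 𝟙 (FS (inj₂ y) z)) (splitAt-↑ˡ n i n)))
      (trans (∑-cong (λ i → cong (λ z → 𝟙 (FS (inj₂ y) z)) (splitAt-↑ʳ n n i))) (∑-0 n))) (+-identityʳ _)))) (degY≤ y)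

    deg : Fin N → ℕ
    deg u = # (FU u)

    deg≤ : ∀ u → deg u ≤ b
    deg≤ u = degS (splitAt n u)

    deg-col : ∀ v → # (λ u → FU u v) ≡ deg v
    deg-col v = ∑-cong (λ u → cong 𝟙 (FU-sym u v))

    open Splitting (finSummation N) t 0<t using (dev; cnt; equitable)

    abstract
      parts : ∃ λ c → ∑ (λ u → ∑ (λ a → dev FU c u a * dev FU c u a)) ≤ t * t * ∑ (λ u → # (FU u))
      parts = equitable FU

    c : Fin N → Fin t
    c = proj₁ parts

    -- The parts of X and Y with number a become the layers 2a and 2a + 1. As `last` is 2t₁, a full
    -- chain begins and ends in X and meets X exactly t times; part t₁ of Y lies beyond the last
    -- layer.
    layS : Fin n ⊎ Fin n → ℕ → ℕ
    layS (inj₁ _) a = 2 * a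
    layS (inj₂ _) a = suc (2 * a)

    lay : Fin N → ℕ
    lay u = layS (splitAt n u) (toℕ (c u))

    dev² : Fin N → ℕ
    dev² u = ∑ (λ a → dev FU c u a * dev FU c u a)

    atyp : Fin N → Bool
    atyp u = suc (θ * θ) ≤ᵇ dev² u

    -- Chebyshev's inequality: the total squared deviation granted by `equitable` is at most t²
    -- times the sum of the degrees.
    atyp-bound : # atyp ≤ A₀
    atyp-bound = ≤-pred (*-cancelʳ-< (θ * θ) (# atyp) (suc A₀) (≤-trans (s≤s (≤-trans (≤-reflexive (sym (∑-*ʳ (θ * θ) (λ u → 𝟙 (atyp u)))))
      (≤-trans (∑-mono pt) (≤-trans (proj₂ parts) (*-monoʳ-≤ (t * t) (∑-≤-const deg b deg≤)))))) atyp-num))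
      where
      pt : ∀ u → 𝟙 (atyp u) * (θ * θ) ≤ dev² u
      pt u with atyp u in e
      ... | false = z≤n
      ... | true = ≤-trans (≤-reflexive (+-identityʳ _)) (<⇒≤ (≤ᵇ-true {suc (θ * θ)} e))

    sq-≤ : ∀ {a b} → a * a ≤ b * b → a ≤ b
    sq-≤ {a} {b} h with a ≤? b
    ... | yes p = p
    ... | no ¬p = ⊥-elim (<⇒≱ (*-mono-< (≰⇒> ¬p) (≰⇒> ¬p)) h)

    dev≤ : ∀ u a → atyp u ≡ false → dev FU c u a ≤ θ
    dev≤ u a e = sq-≤ (≤-trans (∑-member (λ a → dev FU c u a * dev FU c u a) a) (≤-pred (≤ᵇ-false {suc (θ * θ)} e)))

    up : ∀ u a → atyp u ≡ false → t * cnt FU c u a ≤ deg u + θ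
    up u a e = ≤-trans (m≤n+∣m-n∣ (t * cnt FU c u a) (deg u)) (+-monoʳ-≤ (deg u) (dev≤ u a e))

    down : ∀ u a → atyp u ≡ false → deg u ≤ t * cnt FU c u a + θ
    down u a e = ≤-trans (m≤n+∣n-m∣ (deg u) (t * cnt FU c u a)) (+-monoʳ-≤ _ (dev≤ u a e))

    consec : Fin N → Fin N → Bool
    consec u v = does (lay v Data.Nat.≟ suc (lay u)) ∧ (suc (lay u) ≤ᵇ last)

    arc : Fin N → Fin N → Bool
    arc u v = (FU u v ∧ consec u v) ∧ (not (atyp u) ∧ not (atyp v))

    arc-lay : ∀ u v → arc u v ≡ true → lay v ≡ suc (lay u) × lay u < last
    arc-lay u v e = does-true (lay v Data.Nat.≟ suc (lay u)) (∧-fst e′) , ≤ᵇ-true (∧-snd {does (lay v Data.Nat.≟ suc (lay u))} e′)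
      where e′ = ∧-snd {FU u v} (∧-fst {FU u v ∧ consec u v} e)

    open Layered lay last arc arc-lay

    a₀ : Fin t
    a₀ = fromℕ< 0<t

    dbl : ∀ m → 2 * suc m ≡ suc (suc (2 * m))
    dbl = solve-∀

    nextPart prevPart : Fin n ⊎ Fin n → ℕ → ℕ
    nextPart (inj₁ _) m = m
    nextPart (inj₂ _) m = suc m
    -- Layer 0 has no predecessor. Truncation to part 0 merely keeps the value below `t`, and the
    -- claim made about it is vacuous there.
    prevPart (inj₁ _) m = m ∸ 1
    prevPart (inj₂ _) m = m

    next-lay : ∀ su m sv m′ → FS su sv ≡ true → (layS sv m′ ≡ suc (layS su m) → m′ ≡ nextPart su m) × (m′ ≡ nextPart su m → layS sv m′ ≡ suc (layS su m))
    next-lay (inj₁ _) m (inj₂ _) m′ _ = (λ h → *-cancelˡ-≡ m′ m 2 (suc-injective h)) , cong (λ z → suc (2 * z))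
    next-lay (inj₂ _) m (inj₁ _) m′ _ = (λ h → *-cancelˡ-≡ m′ (suc m) 2 (trans h (sym (dbl m)))) , (λ h → trans (cong (2 *_) h) (dbl m))

    prev-lay : ∀ sv m su m′ → FS sv su ≡ true → layS sv m ≡ suc (layS su m′) → m′ ≡ prevPart sv m
    prev-lay (inj₂ _) m (inj₁ _) m′ _ h = *-cancelˡ-≡ m′ m 2 (sym (suc-injective h))
    prev-lay (inj₁ _) (suc m) (inj₂ _) m′ _ h = *-cancelˡ-≡ m′ m 2 (suc-injective (suc-injective (sym (trans (sym (dbl m)) h))))

    next<t : ∀ su m → m < t → layS su m < last → nextPart su m < t
    next<t (inj₁ _) m lt _ = lt
    next<t (inj₂ _) m _ lt = subst (suc m <_) (sym t≡) (s≤s (*-cancelˡ-< 2 m t₁ (<⇒≤ lt)))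

    prev<t : ∀ su m → m < t → prevPart su m < t
    prev<t (inj₁ _) m lt = ≤-trans (s≤s (m∸n≤m m 1)) lt
    prev<t (inj₂ _) m lt = lt

    nxt : ∀ u → lay u < last → ∃ λ a → ∀ v → FU u v ≡ true → (lay v ≡ suc (lay u) → c v ≡ a) × (c v ≡ a → lay v ≡ suc (lay u))
    nxt u lt = fromℕ< a<t , λ v e → let p , q = next-lay (splitAt n u) (toℕ (c u)) (splitAt n v) (toℕ (c v)) e in
        (λ h → toℕ-injective (trans (p h) (sym (toℕ-fromℕ< a<t)))) , λ h → q (trans (cong toℕ h) (toℕ-fromℕ< a<t))
      where a<t = next<t (splitAt n u) (toℕ (c u)) (toℕ<n (c u)) lt

    prv : ∀ v → ∃ λ a → ∀ u → FU v u ≡ true → lay v ≡ suc (lay u) → c u ≡ a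
    prv v = fromℕ< a<t , λ u e h → toℕ-injective (trans (prev-lay (splitAt n v) (toℕ (c v)) (splitAt n u) (toℕ (c u)) e h) (sym (toℕ-fromℕ< a<t)))
      where a<t = prev<t (splitAt n v) (toℕ (c v)) (toℕ<n (c v))

    -- The loop weight tops the degree up to b. All rows and columns then sum to at most b + θ, and
    -- those of typical middle vertices come close to it, so little is lost in König's theorem
    -- although the degrees in F vary.
    σ : Fin N → ℕ
    σ u = b ∸ deg u

    cap : ∀ m z u → m ≤ 𝟙 z * (deg u + θ) → m + 𝟙 (mid u) * σ u ≤ b + θ
    cap m z u h = ≤-trans (+-mono-≤ (≤-trans h (go z)) (≤-trans (*-monoˡ-≤ (σ u) (𝟙≤1 (mid u))) (≤-reflexive (*-identityˡ _))))
        (lin 4 (λ d θ s b → K 1 · d :+ s ≼ b ⇒ ⊢ 1 · (d :+ θ) :+ s ≼ b :+ θ) refl (deg u) θ (σ u) b (≤-reflexive (m+[n∸m]≡n (deg≤ u))))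
      where
      go : ∀ z → 𝟙 z * (deg u + θ) ≤ deg u + θ
      go true = ≤-reflexive (*-identityˡ _)
      go false = z≤n

    out : ∀ u → t * # (arc u) + 𝟙 (mid u) * σ u ≤ b + θ
    out u = cap _ (not (atyp u)) u bound
      where
      bound : t * # (arc u) ≤ 𝟙 (not (atyp u)) * (deg u + θ)
      bound with atyp u in e
      ... | true = ≤-reflexive (trans (cong (t *_) (#-none (λ v → trans (∧-zeroʳ (FU u v ∧ consec u v)) refl))) (*-zeroʳ t))
      ... | false with suc (lay u) ≤? last
      ... | yes lt = ≤-trans (*-monoʳ-≤ t (#-⊆ {Q = λ v → FU u v ∧ (c v == a)} λ v h → ∧-intro (∧-fst (∧-fst {FU u v ∧ consec u v} h))
            (does-intro (c v Fin.≟ a) (proj₁ (na v (∧-fst (∧-fst {FU u v ∧ consec u v} h))) (does-true (lay v Data.Nat.≟ suc (lay u)) (∧-fst (∧-snd {FU u v} (∧-fst {FU u v ∧ consec u v} h))))))))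
          (≤-trans (up u a e) (≤-reflexive (sym (*-identityˡ _))))
        where
        a = proj₁ (nxt u lt)
        na = proj₂ (nxt u lt)
      ... | no ¬lt = ≤-trans (≤-reflexive (trans (cong (t *_) (#-none none)) (*-zeroʳ t))) z≤n
        where
        none : ∀ v → (FU u v ∧ consec u v) ∧ not (atyp v) ≡ false
        none v with (FU u v ∧ consec u v) ∧ not (atyp v) in h
        ... | false = refl
        ... | true = ⊥-elim (¬lt (≤ᵇ-true (∧-snd {does (lay v Data.Nat.≟ suc (lay u))} (∧-snd {FU u v} (∧-fst {FU u v ∧ consec u v} h)))))

    inn : ∀ v → t * # (λ u → arc u v) + 𝟙 (mid v) * σ v ≤ b + θ
    inn v = cap _ (not (atyp v)) v bound
      where
      a = proj₁ (prv v)
      pa = proj₂ (prv v)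
      bound : t * # (λ u → arc u v) ≤ 𝟙 (not (atyp v)) * (deg v + θ)
      bound with atyp v in e
      ... | true = ≤-reflexive (trans (cong (t *_) (#-none none)) (*-zeroʳ t))
        where
        none : ∀ u → (FU u v ∧ consec u v) ∧ (not (atyp u) ∧ false) ≡ false
        none u with FU u v ∧ consec u v | not (atyp u)
        ... | true | true = refl
        ... | true | false = refl
        ... | false | _ = refl
      ... | false = ≤-trans (*-monoʳ-≤ t (#-⊆ {Q = λ u → FU v u ∧ (c u == a)} λ u h →
            let f = trans (sym (FU-sym u v)) (∧-fst (∧-fst {FU u v ∧ consec u v} h)) in
            ∧-intro f (does-intro (c u Fin.≟ a) (pa u f (does-true (lay v Data.Nat.≟ suc (lay u)) (∧-fst (∧-snd {FU u v} (∧-fst {FU u v ∧ consec u v} h))))))))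
          (≤-trans (up v a e) (≤-reflexive (sym (*-identityˡ _))))

    early : Fin N → Bool
    early u = suc (lay u) ≤ᵇ last

    -- A typical vertex has about deg u / t neighbours in the next layer, and only the atypical ones
    -- among them are not reached by arcs. An atypical vertex has no arcs, and its whole degree is
    -- written off.
    lossy : ∀ u → 𝟙 (early u) * deg u ≤ t * # (arc u) + (t * # (λ v → FU u v ∧ atyp v) + (θ + b * 𝟙 (atyp u)))
    lossy u with early u in ee
    ... | false = z≤n
    ... | true with atyp u in e
    ... | true = lin 4 (λ d b x y → K 1 · d ≼ b ⇒ ⊢ 1 · K 1 :* d ≼ x :+ (y :+ b :* K 1)) refl
          (deg u) b (t * # (λ v → (FU u v ∧ (does (lay v Data.Nat.≟ suc (lay u)) ∧ true)) ∧ false)) (t * # (λ v → FU u v ∧ atyp v) + θ) (deg≤ u)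
      |> λ h → ≤-trans h (≤-reflexive (asc (t * # (λ v → (FU u v ∧ (does (lay v Data.Nat.≟ suc (lay u)) ∧ true)) ∧ false)) (t * # (λ v → FU u v ∧ atyp v)) θ (b * 1)))
      where
      asc : ∀ x y z w → x + (y + z + w) ≡ x + (y + (z + w))
      asc = solve-∀
    ... | false = lin 7 (λ d t k a m θ b → K 1 · d ≼ t :* k :+ θ ⇒ t · k ≼ a :+ m ⇒ ⊢ 1 · K 1 :* d ≼ t :* a :+ (t :* m :+ (θ :+ b :* K 0))) refl
          (deg u) t (cnt FU c u a) (# (λ v → (FU u v ∧ (does (lay v Data.Nat.≟ suc (lay u)) ∧ true)) ∧ not (atyp v))) (# (λ v → FU u v ∧ atyp v)) θ b
          (down u a e) (#-∪ {P = λ v → FU u v ∧ (c v == a)} {Q = λ v → (FU u v ∧ (does (lay v Data.Nat.≟ suc (lay u)) ∧ true)) ∧ not (atyp v)} cases)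
      where
      a = proj₁ (nxt u (≤ᵇ-true ee))
      na = proj₂ (nxt u (≤ᵇ-true ee))
      cases : ∀ v → FU u v ∧ (c v == a) ≡ true → ((FU u v ∧ (does (lay v Data.Nat.≟ suc (lay u)) ∧ true)) ∧ not (atyp v) ≡ true) ⊎ (FU u v ∧ atyp v ≡ true)
      cases v h with atyp v
      ... | true = inj₂ (∧-intro (∧-fst h) refl)
      ... | false = inj₁ (∧-intro {FU u v ∧ (does (lay v Data.Nat.≟ suc (lay u)) ∧ true)} (∧-intro {FU u v} (∧-fst h) (∧-intro (does-intro (lay v Data.Nat.≟ suc (lay u)) (proj₂ (na v (∧-fst h)) (==-true (c v) a (∧-snd {FU u v} h)))) refl)) refl)

    D₁ = ∑ (λ u → 𝟙 (first u) * deg u)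
    Dm = ∑ (λ u → 𝟙 (mid u) * deg u)
    Σσ = ∑ (λ u → 𝟙 (mid u) * σ u)

    early-sum : ∑ (λ u → 𝟙 (early u) * deg u) ≡ D₁ + Dm
    early-sum = trans (∑-cong pt) (∑-+ (λ u → 𝟙 (first u) * deg u) (λ u → 𝟙 (mid u) * deg u))
      where
      pt : ∀ u → 𝟙 (early u) * deg u ≡ 𝟙 (first u) * deg u + 𝟙 (mid u) * deg u
      pt u with lay u
      ... | zero = trans (cong (λ z → 𝟙 z * deg u) (≤ᵇ-intro {1} 0<last)) (sym (+-identityʳ _))
      ... | suc l = refl

    mid-sum : Dm + Σσ ≡ b * # mid
    mid-sum = trans (sym (∑-+ (λ u → 𝟙 (mid u) * deg u) (λ u → 𝟙 (mid u) * σ u))) (trans (∑-cong (λ u →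
      trans (sym (*-distribˡ-+ (𝟙 (mid u)) (deg u) (σ u))) (trans (cong (𝟙 (mid u) *_) (m+[n∸m]≡n (deg≤ u))) (*-comm (𝟙 (mid u)) b)))) (∑-*ˡ b (λ u → 𝟙 (mid u))))

    atyp-edges : ∑ (λ u → # (λ v → FU u v ∧ atyp v)) ≤ b * # atyp
    atyp-edges = ≤-trans (≤-reflexive (∑-swap (λ u v → 𝟙 (FU u v ∧ atyp v)))) (≤-trans (∑-mono col) (≤-reflexive (∑-*ˡ b (λ v → 𝟙 (atyp v)))))
      where
      col : ∀ v → ∑ (λ u → 𝟙 (FU u v ∧ atyp v)) ≤ b * 𝟙 (atyp v)
      col v = ≤-trans (≤-reflexive (trans (∑-cong (λ u → 𝟙-∧ (FU u v) (atyp v))) (∑-*ʳ (𝟙 (atyp v)) (λ u → 𝟙 (FU u v)))))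
        (*-monoˡ-≤ (𝟙 (atyp v)) (≤-trans (≤-reflexive (deg-col v)) (deg≤ v)))

    total₁ : D₁ + Dm ≤ t * ∣ arc ∣ᴱ + (t * (b * A₀) + (N * θ + b * A₀))
    total₁ = ≤-trans (≤-reflexive (sym early-sum)) (≤-trans (∑-mono lossy) (≤-trans (≤-reflexive eq) (+-monoʳ-≤ (t * ∣ arc ∣ᴱ)
      (+-mono-≤ (*-monoʳ-≤ t (≤-trans atyp-edges (*-monoʳ-≤ b atyp-bound))) (+-monoʳ-≤ (N * θ) (*-monoʳ-≤ b atyp-bound))))))
      where
      eq : ∑ (λ u → t * # (arc u) + (t * # (λ v → FU u v ∧ atyp v) + (θ + b * 𝟙 (atyp u))))
        ≡ t * ∣ arc ∣ᴱ + (t * ∑ (λ u → # (λ v → FU u v ∧ atyp v)) + (N * θ + b * # atyp))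
      eq = trans (∑-+ (λ u → t * # (arc u)) _) (cong₂ _+_ (∑-*ˡ t (λ u → # (arc u)))
        (trans (∑-+ (λ u → t * # (λ v → FU u v ∧ atyp v)) _) (cong₂ _+_ (∑-*ˡ t (λ u → # (λ v → FU u v ∧ atyp v)))
        (trans (∑-+ (λ _ → θ) (λ u → b * 𝟙 (atyp u))) (cong₂ _+_ (∑-const N θ) (∑-*ˡ b (λ u → 𝟙 (atyp u))))))))

    -- Counted from Y: a typical vertex has at least (deg - θ)/t of its neighbours in part 0 of X,
    -- which is layer 0. So the first layer carries nearly a 1/t fraction of the edges.
    first-sum : ∣ F ∣ᴱ ≤ t * D₁ + (N * θ + b * A₀)
    first-sum = ≤-trans (≤-reflexive (∑-swap (λ x y → 𝟙 (F x y)))) (≤-trans (∑-mono {g = λ y → t * # (λ u → FU u (n ↑ʳ y) ∧ first u) + (θ + b * 𝟙 (atyp (n ↑ʳ y)))} pt)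
        (≤-trans (≤-trans (m≤n+m _ _) (≤-reflexive (sym (∑-⊎ n (λ v → t * # (λ u → FU u v ∧ first u) + (θ + b * 𝟙 (atyp v)))))))
        (≤-trans (≤-reflexive eq) (+-monoʳ-≤ (t * D₁) (+-monoʳ-≤ (N * θ) (*-monoʳ-≤ b atyp-bound))))))
      where
      eq : ∑ (λ v → t * # (λ u → FU u v ∧ first u) + (θ + b * 𝟙 (atyp v))) ≡ t * D₁ + (N * θ + b * # atyp)
      eq = trans (∑-+ (λ v → t * # (λ u → FU u v ∧ first u)) _) (cong₂ _+_ (trans (∑-*ˡ t (λ v → # (λ u → FU u v ∧ first u))) (cong (t *_)
          (trans (∑-swap (λ v u → 𝟙 (FU u v ∧ first u))) (∑-cong (λ u → trans (∑-cong (λ v → 𝟙-∧ (FU u v) (first u))) (trans (∑-*ʳ (𝟙 (first u)) (λ v → 𝟙 (FU u v))) (*-comm _ (𝟙 (first u)))))))))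
        (trans (∑-+ (λ _ → θ) (λ u → b * 𝟙 (atyp u))) (cong₂ _+_ (∑-const N θ) (∑-*ˡ b (λ u → 𝟙 (atyp u))))))
      degY : ∀ y → deg (n ↑ʳ y) ≡ # (λ x → F x y)
      degY y rewrite splitAt-↑ʳ n n y = trans (∑-⊎ n _) (trans (cong₂ _+_
        (∑-cong (λ i → cong (λ z → 𝟙 (FS (inj₂ y) z)) (splitAt-↑ˡ n i n)))
        (trans (∑-cong (λ i → cong (λ z → 𝟙 (FS (inj₂ y) z)) (splitAt-↑ʳ n n i))) (∑-0 n))) (+-identityʳ _))
      zero-first : ∀ y u → FU (n ↑ʳ y) u ∧ (c u == a₀) ≡ true → FU u (n ↑ʳ y) ∧ first u ≡ true
      zero-first y u h = ∧-intro (trans (FU-sym u (n ↑ʳ y)) (∧-fst h)) (≤ᵇ-intro (≤-reflexive (lay0 (trans (cong (λ z → FS z (splitAt n u)) (sym (splitAt-↑ʳ n n y))) (∧-fst h))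
          (==-true (c u) a₀ (∧-snd {FU (n ↑ʳ y) u} h)))))
        where
        lay0 : FS (inj₂ y) (splitAt n u) ≡ true → c u ≡ a₀ → lay u ≡ 0
        lay0 e h with splitAt n u
        ... | inj₁ x = cong (2 *_) (trans (cong toℕ h) (toℕ-fromℕ< 0<t))
      pt : ∀ y → # (λ x → F x y) ≤ t * # (λ u → FU u (n ↑ʳ y) ∧ first u) + (θ + b * 𝟙 (atyp (n ↑ʳ y)))
      pt y with atyp (n ↑ʳ y) in e
      ... | true = ≤-trans (degY≤ y) (≤-trans (≤-trans (≤-reflexive (sym (*-identityʳ b))) (m≤n+m _ θ)) (m≤n+m _ (t * # (λ u → FU u (n ↑ʳ y) ∧ first u))))
      ... | false = lin 6 (λ d θ t k f b → K 1 · d ≼ t :* k :+ θ ⇒ t · k ≼ f ⇒ ⊢ 1 · d ≼ t :* f :+ (θ :+ b :* K 0)) refl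
          (# (λ x → F x y)) θ t (cnt FU c (n ↑ʳ y) a₀) (# (λ u → FU u (n ↑ʳ y) ∧ first u)) b
          (≤-trans (≤-reflexive (sym (degY y))) (down (n ↑ʳ y) a₀ e)) (#-⊆ (zero-first y))

    -- By `mid-sum` degrees and loops of the middle layers make up exactly b * # mid, so the room
    -- for s chains comes from the first layer, where D₁ is about ∣F∣/t. Multiplied by t, the errors
    -- are (3t + 1)θN from deviations and (t(t + 1) + 1)bA₀ from atypical vertices, as in `num`.
    total : (b + θ) * (# mid + s) ≤ t * ∣ arc ∣ᴱ + Σσ
    total = lin 13 (λ b θ m s t a σ D₁ Dm N A F ba →
        K 1 · F ≼ t :* D₁ :+ (N :* θ :+ ba) ⇒ t · D₁ :+ Dm ≼ t :* a :+ (t :* ba :+ (N :* θ :+ ba)) ⇒ t · b :* m ≼ Dm :+ σ ⇒ t :* θ · m ≼ N ⇒ t :* θ · s ≼ N ⇒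
        K 1 · t :* b :* s :+ (K 3 :* t :+ K 1) :* (θ :* N) :+ (t :* (t :+ K 1) :+ K 1) :* ba ≼ F ⇒
        ⊢ 1 · t :* ((b :+ θ) :* (m :+ s)) ≼ t :* (t :* a :+ σ)) refl
        b θ (# mid) s t ∣ arc ∣ᴱ Σσ D₁ Dm N A₀ ∣ F ∣ᴱ (b * A₀)
        first-sum total₁ (≤-reflexive (sym mid-sum)) (#-≤n mid) s≤ num
      |> *-cancelˡ-≤ t {{Data.Nat.>-nonZero 0<t}}

    system : ChainSystem last s
    system = chainSystem t σ (b + θ) (≤-trans 0<b (m≤m+n b θ)) 0<last out inn s total

    leftsS : Fin n ⊎ Fin n → List (Fin n) → List (Fin n)
    leftsS (inj₁ x) xs = x ∷ xs
    leftsS (inj₂ y) xs = xs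

    rightsS : Fin n ⊎ Fin n → List (Fin n) → List (Fin n)
    rightsS (inj₁ x) ys = ys
    rightsS (inj₂ y) ys = y ∷ ys

    lefts rights : List (Fin N) → List (Fin n)
    lefts [] = []
    lefts (u ∷ us) = leftsS (splitAt n u) (lefts us)
    rights [] = []
    rights (u ∷ us) = rightsS (splitAt n u) (rights us)

    lefts-++ : ∀ us vs → lefts (us ++ vs) ≡ lefts us ++ lefts vs
    lefts-++ [] vs = refl
    lefts-++ (u ∷ us) vs with splitAt n u
    ... | inj₁ x = cong (x ∷_) (lefts-++ us vs)
    ... | inj₂ y = lefts-++ us vs

    rights-++ : ∀ us vs → rights (us ++ vs) ≡ rights us ++ rights vs
    rights-++ [] vs = refl
    rights-++ (u ∷ us) vs with splitAt n u
    ... | inj₁ x = rights-++ us vs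
    ... | inj₂ y = cong (y ∷_) (rights-++ us vs)

    concat-lefts : ∀ cs → concat (map lefts cs) ≡ lefts (concat cs)
    concat-lefts [] = refl
    concat-lefts (c ∷ cs) = trans (cong (lefts c ++_) (concat-lefts cs)) (sym (lefts-++ c (concat cs)))

    concat-rights : ∀ cs → concat (map rights cs) ≡ rights (concat cs)
    concat-rights [] = refl
    concat-rights (c ∷ cs) = trans (cong (rights c ++_) (concat-rights cs)) (sym (rights-++ c (concat cs)))

    ∈-lefts : ∀ {x} us → x ∈ lefts us → (x ↑ˡ n) ∈ us
    ∈-lefts (u ∷ us) h with splitAt n u in e
    ∈-lefts (u ∷ us) (here refl) | inj₁ x = here (splitAt⁻¹-↑ˡ e)
    ∈-lefts (u ∷ us) (there h) | inj₁ x = there (∈-lefts us h)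
    ... | inj₂ y = there (∈-lefts us h)

    ∈-rights : ∀ {y} us → y ∈ rights us → (n ↑ʳ y) ∈ us
    ∈-rights (u ∷ us) h with splitAt n u in e
    ... | inj₁ x = there (∈-rights us h)
    ∈-rights (u ∷ us) (here refl) | inj₂ y = here (splitAt⁻¹-↑ʳ e)
    ∈-rights (u ∷ us) (there h) | inj₂ y = there (∈-rights us h)

    unique-lefts : ∀ us → Unique us → Unique (lefts us)
    unique-lefts [] _ = []
    unique-lefts (u ∷ us) un@(_ ∷ un′) with splitAt n u in e
    ... | inj₁ x = unique-∷ (λ h → unique-∉ un (subst (_∈ us) (splitAt⁻¹-↑ˡ e) (∈-lefts us h))) (unique-lefts us un′)
    ... | inj₂ y = unique-lefts us un′

    unique-rights : ∀ us → Unique us → Unique (rights us)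
    unique-rights [] _ = []
    unique-rights (u ∷ us) un@(_ ∷ un′) with splitAt n u in e
    ... | inj₁ x = unique-rights us un′
    ... | inj₂ y = unique-∷ (λ h → unique-∉ un (subst (_∈ us) (splitAt⁻¹-↑ʳ e) (∈-rights us h))) (unique-rights us un′)

    arc-F : ∀ {u v} → arc u v ≡ true → FU u v ≡ true
    arc-F {u} {v} e = ∧-fst (∧-fst {FU u v ∧ consec u v} e)

  module Convert (Q : Fin n → Fin n → Bool) where
    open MixedPaths Q F

    private
      -- A chain of one vertex yields no edge at x. That every vertex of the path has an edge is
      -- therefore stated conditionally, and `hasEdge` supplies the condition for full chains.
      Conv : ℕ → Fin n → List (Fin N) → Set
      Conv l x vs = ∃ λ z → MPath x z (lefts vs) (rights vs) 0 × 2 * length (lefts vs) ≡ 2 + l ×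
        ((∃ λ y → F x y ≡ true) → ∀ {x′} → x′ ∈ lefts vs → ∃ λ y → F x′ y ≡ true) × (∀ {y} → y ∈ rights vs → ∃ λ x → F x y ≡ true)

      conv : ∀ {l u vs x} → Chain l u vs → splitAt n u ≡ inj₁ x → Conv l x vs
      conv {x = x} (start {u} _) e rewrite e = x , stop , refl , (λ { f (here refl) → f }) , λ ()
      conv {x = x} (step {u = u} {v} ch a) e with splitAt n u in eu | arc-F {u} {v} a
      ... | inj₁ x₁ | f = ⊥-elim (true≢false f (cong (FS (inj₁ x₁)) e))
      ... | inj₂ y | f = two ch eu (trans (sym (cong (FS (inj₂ y)) e)) f)
        where
        two : ∀ {l u vs} → Chain l u vs → splitAt n u ≡ inj₂ y → F x y ≡ true → Conv (suc l) x (v ∷ vs)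
        two {u = u} (start l0) eu′ _ with splitAt n u | l0
        two (start l0) refl _ | inj₂ y | ()
        two (step {l} {u′} {u} {vs} ch′ a′) eu′ fxy with splitAt n u′ in eu″ | arc-F {u′} {u} a′
        ... | inj₂ y′ | f′ = ⊥-elim (true≢false f′ (cong (FS (inj₂ y′)) eu′))
        ... | inj₁ x′ | f′ with conv ch′ eu″ | trans (sym (cong (FS (inj₁ x′)) eu′)) f′
        ... | z , p , len , mx , my | fx′y rewrite e | eu′ = z , viaY fxy fx′y p , trans (*-suc 2 _) (cong (2 +_) len)
          , (λ { f (here refl) → f ; f (there i) → mx (y , fx′y) i })
          , (λ { (here refl) → x , fxy ; (there i) → my i })

      item : ∀ {vs} → (∃ λ u → Chain last u vs) → Σ (Item t) λ i → Item.xs i ≡ lefts vs × Item.ys i ≡ rights vs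
      item {vs} (u , ch) with splitAt n u in e
      ... | inj₂ y = ⊥-elim (even≢odd t₁ (toℕ (c u)) (trans (sym (chain-lay ch)) (cong (λ z → layS z (toℕ (c u))) e)))
      ... | inj₁ x with conv ch e
      ... | z , p , len , mx , my = record { xs = lefts vs ; ys = rights vs ; path = p
          ; len = *-cancelˡ-≡ _ _ 2 (trans len (trans (sym (*-suc 2 t₁)) (cong (2 *_) (sym t≡)))) ; xs-H = mx (hasEdge 0<last ch e) ; ys-H = my } , refl , refl
        where
        hasEdge : ∀ {l u vs x} → 0 < l → Chain l u vs → splitAt n u ≡ inj₁ x → ∃ λ y → F x y ≡ true
        hasEdge {x = x} _ (step {u = u} {v} _ a) e with splitAt n u in eu | arc-F {u} {v} a
        ... | inj₁ x₁ | f = ⊥-elim (true≢false f (cong (FS (inj₁ x₁)) e))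
        ... | inj₂ y | f = y , trans (sym (cong (FS (inj₂ y)) e)) f

      items : ∀ cs → (∀ {vs} → vs ∈ cs → ∃ λ u → Chain last u vs) →
        Σ (List (Item t)) λ is → map Item.xs is ≡ map lefts cs × map Item.ys is ≡ map rights cs × length is ≡ length cs
      items [] _ = [] , refl , refl , refl
      items (c ∷ cs) g with item (g (here refl)) | items cs (λ i → g (there i))
      ... | i , e₁ , e₂ | is , h₁ , h₂ , h₃ = i ∷ is , cong₂ _∷_ e₁ h₁ , cong₂ _∷_ e₂ h₂ , cong suc h₃

    private
      forest₀ : Σ (List (Item t)) λ is → Unique (concat (map Item.xs is)) × Unique (concat (map Item.ys is)) × s ≤ length is
      forest₀ = is , subst Unique (sym (trans (cong concat e₁) (concat-lefts chains))) (unique-lefts (concat chains) unique)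
                  , subst Unique (sym (trans (cong concat e₂) (concat-rights chains))) (unique-rights (concat chains) unique)
                  , ≤-trans enough (≤-reflexive (sym e₃))
        where
        open ChainSystem system
        its = items chains isChain
        is = proj₁ its
        e₁ = proj₁ (proj₂ its)
        e₂ = proj₁ (proj₂ (proj₂ its))
        e₃ = proj₂ (proj₂ (proj₂ its))

    abstract
      forest : Σ (List (Item t)) λ is → Unique (concat (map Item.xs is)) × Unique (concat (map Item.ys is)) × s ≤ length is
      forest = forest₀

mem : ∀ {n} → List (Fin n) → Fin n → Bool
mem [] x = false
mem (y ∷ ys) x = (x == y) ∨ mem ys x

mem-true : ∀ {n} (ys : List (Fin n)) {x} → mem ys x ≡ true → x ∈ ys
mem-true (y ∷ ys) {x} e with ∨-case {x == y} e
... | inj₁ h = here (==-true x y h)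
... | inj₂ h = there (mem-true ys h)

mem-intro : ∀ {n} {ys : List (Fin n)} {x} → x ∈ ys → mem ys x ≡ true
mem-intro {x = x} (here refl) = ∨-inl (==-refl x)
mem-intro {ys = y ∷ ys} {x} (there h) = ∨-inr {x == y} (mem-intro h)

mem-false : ∀ {n} {ys : List (Fin n)} {x} → mem ys x ≡ false → x ∉ ys
mem-false e h = true≢false (mem-intro h) e

mem-no : ∀ {n} (ys : List (Fin n)) {x} → x ∉ ys → mem ys x ≡ false
mem-no ys {x} h with mem ys x in e
... | false = refl
... | true = ⊥-elim (h (mem-true ys e))

#-mem : ∀ {n} (ys : List (Fin n)) → # (mem ys) ≤ length ys
#-mem {n} [] = ≤-reflexive (∑-0 n)
#-mem (y ∷ ys) = ≤-trans (#-∪ {Q = _== y} {R = mem ys} (λ i e → ∨-case e)) (+-mono-≤ (≤-trans (∑-mono {g = λ i → 𝟙 (i == y) * 1} (λ i → ≤-reflexive (sym (*-identityʳ _)))) (≤-reflexive (∑-point y (λ _ → 1)))) (#-mem ys))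

-- Connected dominating sets and cliques in the linking graph

ram : ℕ → ℕ → ℕ
ram zero c = 0
ram (suc a) zero = 0
ram (suc a) (suc c) = suc (ram a (suc c) + ram (suc a) c)

module QGraph {n : ℕ} (Q : Fin n → Fin n → Bool) (Q-sym : ∀ x y → Q x y ≡ Q y x) where

  Indep Clique : List (Fin n) → Set
  Indep = AllPairs (λ x y → Q x y ≡ false)
  Clique = AllPairs (λ x y → Q x y ≡ true)

  _⊑_ : List (Fin n) → (Fin n → Bool) → Set
  xs ⊑ V = ∀ {x} → x ∈ xs → V x ≡ true

  -- `Indep` does not ask for distinct entries, so distinctness never has to be shown where the
  -- bound is applied; `rich-bound` provides it in this stronger form.
  IndepBound : (Fin n → Bool) → ℕ → Set
  IndepBound V f = ∀ xs → xs ⊑ V → Indep xs → length xs ≤ f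

  data QPath : Fin n → Fin n → List (Fin n) → Set where
    stop : ∀ {x} → QPath x x (x ∷ [])
    _∷_ : ∀ {x y z ys} → Q x y ≡ true → QPath y z ys → QPath x z (x ∷ ys)

  snoc : ∀ {x y z xs} → QPath x y xs → Q y z ≡ true → QPath x z (xs ++ z ∷ [])
  snoc stop e = e ∷ stop
  snoc (d ∷ p) e = d ∷ snoc p e

  data Conn : List (Fin n) → Set where
    [_]ᶜ : ∀ x → Conn (x ∷ [])
    add : ∀ {x y xs} → y ∈ xs → Q x y ≡ true → x ∉ xs → Conn xs → Conn (x ∷ xs)

  conn-unique : ∀ {xs} → Conn xs → Unique xs
  conn-unique [ x ]ᶜ = [] ∷ []
  conn-unique (add _ _ h c) = unique-∷ h (conn-unique c)

  conn-path : ∀ {L l l′} → Conn L → l ∈ L → l′ ∈ L → ∃ λ ps → QPath l l′ ps × Unique ps × (∀ {x} → x ∈ ps → x ∈ L)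
  conn-path [ x ]ᶜ (here refl) (here refl) = _ , stop , ([] ∷ []) , λ i → i
  conn-path (add y∈ q h c) (here refl) (here refl) = _ , stop , ([] ∷ []) , λ { (here refl) → here refl }
  conn-path (add y∈ q h c) (here refl) (there j) with conn-path c y∈ j
  ... | ps , p , u , s = _ , q ∷ p , unique-∷ (λ i → h (s i)) u , λ { (here refl) → here refl ; (there i) → there (s i) }
  conn-path (add {x} {y} y∈ q h c) (there i) (here refl) with conn-path c i y∈
  ... | ps , p , u , s = _ , snoc p (trans (Q-sym y x) q) , Unique.++⁺ u ([] ∷ []) (λ { (i , here refl) → h (s i) }) , mem′
    where
    mem′ : ∀ {z} → z ∈ ps ++ x ∷ [] → z ∈ x ∷ _
    mem′ i with ∈-++⁻ ps i
    ... | inj₁ j = there (s j)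
    ... | inj₂ (here refl) = here refl
  conn-path (add y∈ q h c) (there i) (there j) with conn-path c i j
  ... | ps , p , u , s = ps , p , u , λ k → there (s k)

  dom : List (Fin n) → Fin n → Bool
  dom [] v = false
  dom (l ∷ ls) v = ((v == l) ∨ Q v l) ∨ dom ls v

  dom-true : ∀ L {v} → dom L v ≡ true → v ∈ L ⊎ (∃ λ l → l ∈ L × Q v l ≡ true)
  dom-true (l ∷ L) {v} e with ∨-case {(v == l) ∨ Q v l} e
  ... | inj₁ h with ∨-case {v == l} h
  ...   | inj₁ g = inj₁ (here (==-true v l g))
  ...   | inj₂ g = inj₂ (l , here refl , g)
  dom-true (l ∷ L) {v} e | inj₂ h with dom-true L h
  ... | inj₁ i = inj₁ (there i)
  ... | inj₂ (l′ , i , q) = inj₂ (l′ , there i , q)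

  dom-∈ : ∀ {L v} → v ∈ L → dom L v ≡ true
  dom-∈ {v = v} (here refl) = ∨-inl (∨-inl (==-refl v))
  dom-∈ {l ∷ L} {v} (there i) = ∨-inr {(v == l) ∨ Q v l} (dom-∈ i)

  dom-Q : ∀ {L v l} → l ∈ L → Q v l ≡ true → dom L v ≡ true
  dom-Q {v = v} {l} (here refl) q = ∨-inl (∨-inr {v == l} q)
  dom-Q {l′ ∷ L} {v} (there i) q = ∨-inr {(v == l′) ∨ Q v l′} (dom-Q i q)

  record Separation (V : Fin n → Bool) : Set where
    field
      A : Fin n → Bool
      {a b} : Fin n
      a∈ : V a ∧ A a ≡ true
      b∈ : V b ∧ not (A b) ≡ true
      sep : ∀ x y → V x ∧ A x ≡ true → V y ∧ not (A y) ≡ true → Q x y ≡ false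

  -- The factor 2 in `small`: every absorbed vertex is accompanied by at most one connecting vertex.
  record ConnectedDominating (V : Fin n → Bool) (f : ℕ) : Set where
    field
      L : List (Fin n)
      conn : Conn L
      L⊑V : L ⊑ V
      small : length L ≤ 2 * f
      dominates : ∀ {v} → V v ≡ true → v ∉ L → ∃ λ l → l ∈ L × Q v l ≡ true

  -- Each undominated vertex absorbed into L is nonadjacent to L, so the absorbed vertices stay independent.
  connectedDominating : ∀ V f v₀ → V v₀ ≡ true → IndepBound V f → ConnectedDominating V f ⊎ Separation V
  connectedDominating V f v₀ Vv₀ bound = go f (v₀ ∷ []) [ v₀ ]ᶜ (v₀ ∷ []) ([] ∷ []) (λ i → i) (λ { (here refl) → Vv₀ }) (s≤s z≤n) (here refl) (≤-reflexive (+-comm 1 f))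
    where
    go : ∀ g L → Conn L → ∀ ws → Indep ws → (∀ {x} → x ∈ ws → x ∈ L) → L ⊑ V → length L ≤ 2 * length ws → v₀ ∈ L → f < g + length ws →
      ConnectedDominating V f ⊎ Separation V
    go g L c ws ind ws⊆L L⊑V len v₀∈ fuel with search (λ v → V v ∧ not (dom L v))
    ... | inj₂ none = inj₁ (record { L = L ; conn = c ; L⊑V = L⊑V
          ; small = ≤-trans len (*-monoʳ-≤ 2 (bound ws (λ i → L⊑V (ws⊆L i)) ind))
          ; dominates = λ {v} Vv v∉ → domin v Vv v∉ })
      where
      domin : ∀ v → V v ≡ true → v ∉ L → ∃ λ l → l ∈ L × Q v l ≡ true
      domin v Vv v∉ with dom L v in e
      ... | true with dom-true L e
      ...   | inj₁ i = ⊥-elim (v∉ i)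
      ...   | inj₂ r = r
      domin v Vv v∉ | false = ⊥-elim (true≢false (∧-intro Vv (not-true e)) (none v))
    ... | inj₁ (b , b∈) with findEdge (λ a w → (V a ∧ dom L a) ∧ ((V w ∧ not (dom L w)) ∧ Q a w))
    -- No link leaves the dominated set, so it is one side of a separation, with v₀ inside and b
    -- outside.
    ... | inj₂ none = inj₂ (record { A = dom L ; a∈ = ∧-intro Vv₀ (dom-∈ v₀∈) ; b∈ = b∈ ; sep = sep′ })
      where
      sep′ : ∀ x y → V x ∧ dom L x ≡ true → V y ∧ not (dom L y) ≡ true → Q x y ≡ false
      sep′ x y hx hy with Q x y in e
      ... | false = refl
      ... | true = ⊥-elim (true≢false (∧-intro hx (∧-intro hy e)) (none x y))
    ... | inj₁ (a , w , e) = grow g fuel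
      where
      Va = ∧-fst {V a} (∧-fst {V a ∧ dom L a} e)
      da = ∧-snd {V a} (∧-fst {V a ∧ dom L a} e)
      Vw = ∧-fst {V w} (∧-fst {V w ∧ not (dom L w)} (∧-snd {V a ∧ dom L a} e))
      dw = not-false (∧-snd {V w} (∧-fst {V w ∧ not (dom L w)} (∧-snd {V a ∧ dom L a} e)))
      Qaw = ∧-snd {V w ∧ not (dom L w)} (∧-snd {V a ∧ dom L a} e)
      w∉L : w ∉ L
      w∉L i = true≢false (dom-∈ i) dw
      w-ind : ∀ {x} → x ∈ ws → Q w x ≡ false
      w-ind {x} i with Q w x in q
      ... | false = refl
      ... | true = ⊥-elim (true≢false (dom-Q (ws⊆L i) q) dw)
      ind′ : Indep (w ∷ ws)
      ind′ = All.tabulate w-ind ∷ ind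
      len′ : suc (length L) ≤ 2 * suc (length ws)
      len′ = ≤-trans (s≤s len) (≤-trans (n≤1+n _) (≤-reflexive (sym (*-suc 2 (length ws)))))
      grow : ∀ g → f < g + length ws → ConnectedDominating V f ⊎ Separation V
      grow zero fuel = ⊥-elim (<⇒≱ fuel (≤-trans (n≤1+n _) (bound (w ∷ ws) (λ { (here refl) → Vw ; (there i) → L⊑V (ws⊆L i) }) ind′)))
      grow (suc g) fuel with dom-true L da
      ... | inj₁ a∈L = go g (w ∷ L) (add a∈L (trans (Q-sym w a) Qaw) w∉L c) (w ∷ ws) ind′ (λ { (here refl) → here refl ; (there i) → there (ws⊆L i) })
            (λ { (here refl) → Vw ; (there i) → L⊑V i }) len′ (there v₀∈) (≤-trans fuel (≤-reflexive (sym (+-suc g (length ws)))))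
      ... | inj₂ (l , l∈ , Qal) with mem L a in ma
      ...   | true = go g (w ∷ L) (add (mem-true L ma) (trans (Q-sym w a) Qaw) w∉L c) (w ∷ ws) ind′ (λ { (here refl) → here refl ; (there i) → there (ws⊆L i) })
            (λ { (here refl) → Vw ; (there i) → L⊑V i }) len′ (there v₀∈) (≤-trans fuel (≤-reflexive (sym (+-suc g (length ws)))))
      ...   | false = go g (w ∷ a ∷ L) (add (here refl) (trans (Q-sym w a) Qaw) w∉aL (add l∈ Qal (mem-false ma) c)) (w ∷ ws) ind′
            (λ { (here refl) → here refl ; (there i) → there (there (ws⊆L i)) })
            (λ { (here refl) → Vw ; (there (here refl)) → Va ; (there (there i)) → L⊑V i })
            (≤-trans (s≤s (s≤s len)) (≤-reflexive (sym (*-suc 2 (length ws))))) (there (there v₀∈)) (≤-trans fuel (≤-reflexive (sym (+-suc g (length ws)))))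
        where
        w∉aL : w ∉ a ∷ L
        w∉aL (here refl) = true≢false da dw
        w∉aL (there i) = w∉L i

  private
    record Part (x : Fin n) (xs : List (Fin n)) : Set where
      field
        ys zs : List (Fin n)
        len : length xs ≡ length ys + length zs
        ys⊆ : ∀ {y} → y ∈ ys → y ∈ xs × Q x y ≡ false
        zs⊆ : ∀ {y} → y ∈ zs → y ∈ xs × Q x y ≡ true
        uys : Unique xs → Unique ys
        uzs : Unique xs → Unique zs

    part : ∀ x xs → Part x xs
    part x [] = record { ys = [] ; zs = [] ; len = refl ; ys⊆ = λ () ; zs⊆ = λ () ; uys = λ _ → [] ; uzs = λ _ → [] }
    part x (y ∷ xs) with Q x y in e
    ... | false = record { ys = y ∷ ys ; zs = zs ; len = cong suc len ; ys⊆ = λ { (here refl) → here refl , e ; (there i) → let p , q = ys⊆ i in there p , q }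
          ; zs⊆ = λ i → let p , q = zs⊆ i in there p , q ; uys = λ { u@(_ ∷ u′) → unique-∷ (λ i → unique-∉ u (proj₁ (ys⊆ i))) (uys u′) } ; uzs = λ { (_ ∷ u′) → uzs u′ } }
      where open Part (part x xs)
    ... | true = record { ys = ys ; zs = y ∷ zs ; len = trans (cong suc len) (sym (+-suc (length ys) (length zs))) ; ys⊆ = λ i → let p , q = ys⊆ i in there p , q
          ; zs⊆ = λ { (here refl) → here refl , e ; (there i) → let p , q = zs⊆ i in there p , q } ; uys = λ { (_ ∷ u′) → uys u′ }
          ; uzs = λ { u@(_ ∷ u′) → unique-∷ (λ i → unique-∉ u (proj₁ (zs⊆ i))) (uzs u′) } }
      where open Part (part x xs)

  -- The recursion of Erdős and Szekeres: the first vertex splits the others into non-neighbours and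
  -- neighbours, and one of these parts is large enough for the induction. The extra 1 in `ram` is
  -- that vertex.
  ramsey : ∀ a c xs → Unique xs → ram a c ≤ length xs →
    (∃ λ ys → (∀ {y} → y ∈ ys → y ∈ xs) × Indep ys × length ys ≡ a) ⊎ (∃ λ ys → (∀ {y} → y ∈ ys → y ∈ xs) × Clique ys × Unique ys × length ys ≡ c)
  ramsey zero c xs u h = inj₁ ([] , (λ ()) , [] , refl)
  ramsey (suc a) zero xs u h = inj₂ ([] , (λ ()) , [] , [] , refl)
  ramsey (suc a) (suc c) (x ∷ xs) u@(_ ∷ u′) (s≤s h) with ram a (suc c) ≤? length (Part.ys (part x xs))
  ... | yes p with ramsey a (suc c) ys (uys u′) p
    where open Part (part x xs)
  ...   | inj₁ (is , s , ind , l) = inj₁ (x ∷ is , (λ { (here refl) → here refl ; (there i) → there (proj₁ (Part.ys⊆ (part x xs) (s i))) })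
            , All.tabulate (λ i → proj₂ (Part.ys⊆ (part x xs) (s i))) ∷ ind , cong suc l)
  ...   | inj₂ (is , s , cl , ui , l) = inj₂ (is , (λ i → there (proj₁ (Part.ys⊆ (part x xs) (s i)))) , cl , ui , l)
  ramsey (suc a) (suc c) (x ∷ xs) u@(_ ∷ u′) (s≤s h) | no ¬p with ramsey (suc a) c zs (uzs u′) enough
    where
    open Part (part x xs)
    enough : ram (suc a) c ≤ length zs
    enough = lin 5 (λ r s l y z → K 1 · r :+ s ≼ l ⇒ K 1 · l ≼ y :+ z ⇒ K 1 · Suc y ≼ r ⇒ ⊢ 1 · s ≼ z) refl
      (ram a (suc c)) (ram (suc a) c) (length xs) (length ys) (length zs) h (≤-reflexive len) (≰⇒> ¬p)
  ... | inj₁ (is , s , ind , l) = inj₁ (is , (λ i → there (proj₁ (Part.zs⊆ (part x xs) (s i)))) , ind , l)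
  ... | inj₂ (is , s , cl , ui , l) = inj₂ (x ∷ is , (λ { (here refl) → here refl ; (there i) → there (proj₁ (Part.zs⊆ (part x xs) (s i))) })
      , All.tabulate (λ i → proj₂ (Part.zs⊆ (part x xs) (s i))) ∷ cl , unique-∷ (λ i → unique-∉ u (proj₁ (Part.zs⊆ (part x xs) (s i)))) ui , cong suc l)

  _∖_ : (Fin n → Bool) → List (Fin n) → Fin n → Bool
  (V ∖ W) x = V x ∧ not (mem W x)

  indepBound-⊆ : ∀ {V V′ f} → (∀ x → V′ x ≡ true → V x ≡ true) → IndepBound V f → IndepBound V′ f
  indepBound-⊆ h b xs s = b xs (λ i → h _ (s i))

  Links : List (Fin n) → Fin n → Fin n → Set
  Links L e e′ = ∃ λ l → ∃ λ l′ → ∃ λ ps → Q e l ≡ true × QPath l l′ ps × Q l′ e′ ≡ true × Unique ps × (∀ {x} → x ∈ ps → x ∈ L)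

  record Layers (V : Fin n → Bool) (f j : ℕ) (W : List (Fin n)) : Set where
    field
      Ls : List (List (Fin n))
      count : length Ls ≡ j
      uniq : Unique (concat Ls)
      avoid : ∀ {x} → x ∈ concat Ls → V x ≡ true × x ∉ W
      small : length (concat Ls) ≤ j * (2 * f)
      links : ∀ {L} → L ∈ Ls → ∀ e e′ → (V ∖ (concat Ls ++ W)) e ≡ true → (V ∖ (concat Ls ++ W)) e′ ≡ true → Links L e e′

  record Obstruction (V : Fin n → Bool) (w : ℕ) : Set where
    field
      W : List (Fin n)
      W-small : length W ≤ w
      obstructed : (∀ x → (V ∖ W) x ≡ false) ⊎ Separation (V ∖ W)

  -- Each set is found after deletion of the earlier ones, which makes them disjoint. A vertex
  -- outside all of them was present at every stage and is dominated by every set; this gives the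
  -- links. If a stage fails, the few vertices deleted so far form the `W` of the obstruction.
  layers : ∀ V f → IndepBound V f → ∀ j W → Layers V f j W ⊎ Obstruction V (j * (2 * f) + length W)
  layers V f bound zero W = inj₁ (record { Ls = [] ; count = refl ; uniq = [] ; avoid = λ () ; small = z≤n ; links = λ () })
  layers V f bound (suc j) W with search (V ∖ W)
  ... | inj₂ none = inj₂ (record { W = W ; W-small = m≤n+m _ (suc j * (2 * f)) ; obstructed = inj₁ none })
  ... | inj₁ (v₀ , h) with connectedDominating (V ∖ W) f v₀ h (indepBound-⊆ {V} (λ x → ∧-fst) bound)
  ... | inj₂ sep = inj₂ (record { W = W ; W-small = m≤n+m _ (suc j * (2 * f)) ; obstructed = inj₂ sep })
  ... | inj₁ cd with layers V f bound j (ConnectedDominating.L cd ++ W)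
  ... | inj₂ ob = inj₂ (record { W = O.W ; obstructed = O.obstructed ; W-small = lin 5 (λ w j f l w′ → K 1 · w ≼ j :+ l ⇒ K 1 · l ≼ f :+ w′ ⇒ ⊢ 1 · w ≼ f :+ j :+ w′) refl
        (length O.W) (j * (2 * f)) (2 * f) (length (C.L ++ W)) (length W) O.W-small (≤-trans (≤-reflexive (length-++ C.L)) (+-monoˡ-≤ (length W) C.small)) })
    where
    module O = Obstruction ob
    module C = ConnectedDominating cd
  ... | inj₁ ly = inj₁ (record
        { Ls = C.L ∷ Y.Ls ; count = cong suc Y.count
        ; uniq = Unique.++⁺ (conn-unique C.conn) Y.uniq (λ { (i , j) → proj₂ (Y.avoid j) (∈-++⁺ˡ i) })
        ; avoid = av
        ; small = ≤-trans (≤-reflexive (length-++ C.L)) (+-mono-≤ C.small Y.small)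
        ; links = lk })
    where
    module C = ConnectedDominating cd
    module Y = Layers ly
    av : ∀ {x} → x ∈ C.L ++ concat Y.Ls → V x ≡ true × x ∉ W
    av i with ∈-++⁻ C.L i
    ... | inj₁ k = ∧-fst (C.L⊑V k) , mem-false (not-false (∧-snd {V _} (C.L⊑V k)))
    ... | inj₂ k = proj₁ (Y.avoid k) , λ z → proj₂ (Y.avoid k) (∈-++⁺ʳ C.L z)
    shuffle : ∀ e → (V ∖ ((C.L ++ concat Y.Ls) ++ W)) e ≡ true → V e ≡ true × e ∉ C.L × e ∉ concat Y.Ls × e ∉ W
    shuffle e h = ∧-fst h , (λ i → out (∈-++⁺ˡ (∈-++⁺ˡ i))) , (λ i → out (∈-++⁺ˡ (∈-++⁺ʳ C.L i))) , (λ i → out (∈-++⁺ʳ (C.L ++ concat Y.Ls) i))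
      where out = mem-false (not-false (∧-snd {V e} h))
    lk : ∀ {L} → L ∈ C.L ∷ Y.Ls → ∀ e e′ → (V ∖ ((C.L ++ concat Y.Ls) ++ W)) e ≡ true → (V ∖ ((C.L ++ concat Y.Ls) ++ W)) e′ ≡ true → Links L e e′
    lk (here refl) e e′ he he′ with shuffle e he | shuffle e′ he′
    ... | Ve , e∉ , _ , e∉W | Ve′ , e′∉ , _ , e′∉W with C.dominates (∧-intro Ve (not-true (mem-no W e∉W))) e∉ | C.dominates (∧-intro Ve′ (not-true (mem-no W e′∉W))) e′∉
    ... | l , l∈ , q | l′ , l′∈ , q′ with conn-path C.conn l∈ l′∈
    ... | ps , p , u , s = l , l′ , ps , q , p , trans (Q-sym l′ e′) q′ , u , s
    lk (there i) e e′ he he′ = Y.links i e e′ (conv e he) (conv e′ he′)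
      where
      conv : ∀ e → (V ∖ ((C.L ++ concat Y.Ls) ++ W)) e ≡ true → (V ∖ (concat Y.Ls ++ (C.L ++ W))) e ≡ true
      conv e h with shuffle e h
      ... | Ve , a , b , c = ∧-intro Ve (not-true (mem-no (concat Y.Ls ++ (C.L ++ W)) notin))
        where
        notin : e ∉ concat Y.Ls ++ (C.L ++ W)
        notin i with ∈-++⁻ (concat Y.Ls) i
        ... | inj₁ k = b k
        ... | inj₂ k with ∈-++⁻ C.L k
        ...   | inj₁ z = a z
        ...   | inj₂ z = c z

-- Cycles as closed alternating paths

module _ {n : ℕ} (G : Fin n → Fin n → Bool) where

  data RPath : Fin n → Fin n → List (Fin n) → List (Fin n) → Set where
    stop : ∀ {x} → RPath x x (x ∷ []) []
    step : ∀ {x x′ y z xs ys} → G x y ≡ true → G x′ y ≡ true → RPath x′ z xs ys → RPath x z (x ∷ xs) (y ∷ ys)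

  record Cyc (k : ℕ) : Set where
    field
      {u z y} : Fin n
      {xs ys} : List (Fin n)
      path : RPath u z xs ys
      zy : G z y ≡ true
      uy : G u y ≡ true
      uniq-xs : Unique xs
      uniq-ys : Unique (y ∷ ys)
      len : length xs ≡ k

-- Joining path pieces through the reserve

module Assembly {n : ℕ} (G : Fin n → Fin n → Bool) (R : Fin n → Bool) (B : ℕ) where

  common : Fin n → Fin n → Fin n → Bool
  common x x′ y = R y ∧ (G x y ∧ G x′ y)

  Q : Fin n → Fin n → Bool
  Q x x′ = B ≤ᵇ # (common x x′)

  Q-sym : ∀ x x′ → Q x x′ ≡ Q x′ x
  Q-sym x x′ = cong (B ≤ᵇ_) (∑-cong (λ y → cong 𝟙 (comm (R y) (G x y) (G x′ y))))
    where
    comm : ∀ a b c → a ∧ (b ∧ c) ≡ a ∧ (c ∧ b)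
    comm false b c = refl
    comm true false false = refl
    comm true false true = refl
    comm true true false = refl
    comm true true true = refl

  open QGraph Q Q-sym public

  pick : ∀ x x′ us → Q x x′ ≡ true → length us < B → ∃ λ y → R y ≡ true × G x y ≡ true × G x′ y ≡ true × y ∉ us
  pick x x′ us q lt with #-ex (common x x′) (mem us) (≤-trans (s≤s (#-mem us)) (≤-trans lt (≤ᵇ-true q)))
  ... | y , h , m = y , ∧-fst h , ∧-fst (∧-snd {R y} h) , ∧-snd {G x y} (∧-snd {R y} h) , mem-false m

  module _ (F : Fin n → Fin n → Bool) (F⊆G : ∀ x y → F x y ≡ true → G x y ≡ true) (F∩R : ∀ x y → F x y ≡ true → R y ≡ false) where

    open MixedPaths Q F

    record Realised (x z : Fin n) (xs ys us : List (Fin n)) (q : ℕ) : Set where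
      field
        {zs rs} : List (Fin n)
        path : RPath G x z xs zs
        perm : zs ↭ ys ++ rs
        len : length rs ≡ q
        rs-R : ∀ {y} → y ∈ rs → R y ≡ true × y ∉ us
        rs-uniq : Unique rs

    -- Greedy choice: `us` lists the reserve vertices already taken, and `length us + q ≤ B`
    -- guarantees at each link a common neighbour outside the list.
    realise : ∀ {x z xs ys q} us → MPath x z xs ys q → length us + q ≤ B → Realised x z xs ys us q
    realise us stop _ = record { path = stop ; perm = ↭-refl ; len = refl ; rs-R = λ () ; rs-uniq = [] }
    realise us (viaY {x} {x′} {y = y} h h′ p) le = record { path = step (F⊆G x y h) (F⊆G x′ y h′) path ; perm = prep y perm ; len = len ; rs-R = rs-R ; rs-uniq = rs-uniq }
      where open Realised (realise us p le)
    realise us (viaQ {x} {x′} {ys = ys} {q} e p) le with pick x x′ us e (≤-trans (≤-trans (s≤s (m≤m+n (length us) q)) (≤-reflexive (sym (+-suc (length us) q)))) le)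
    ... | y , Ry , g , g′ , y∉ = record
        { path = step g g′ path ; perm = ↭-trans (prep y perm) (↭-sym (shift y ys rs)) ; len = cong suc len
        ; rs-R = λ { (here refl) → Ry , y∉ ; (there i) → let a , b = rs-R i in a , λ j → b (there j) }
        ; rs-uniq = unique-∷ (λ i → proj₂ (rs-R i) (here refl)) rs-uniq }
      where open Realised (realise (y ∷ us) p (≤-trans (≤-reflexive (sym (+-suc (length us) q))) le))

    MPath-ys : ∀ {x z xs ys q} → MPath x z xs ys q → ∀ {y} → y ∈ ys → R y ≡ false
    MPath-ys (viaY {x} {y = y} h _ p) (here refl) = F∩R x y h
    MPath-ys (viaY _ _ p) (there i) = MPath-ys p i
    MPath-ys (viaQ _ p) i = MPath-ys p i

    -- The closing link takes a reserve vertex too, hence `suc q ≤ B`. Reserve vertices cannot clash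
    -- with `ys`, since edges of F avoid R.
    close : ∀ {x z xs ys q k} → MPath x z xs ys q → Q z x ≡ true → Unique xs → Unique ys → suc q ≤ B → length xs ≡ k → Cyc G k
    close {x} {z} {xs} {ys} {q} p e ux uy le lenk with realise [] p (<⇒≤ le)
    ... | r with pick z x (Realised.rs r) e (subst (_< B) (sym (Realised.len r)) le)
    ... | y , Ry , gz , gx , y∉ = record { path = path ; zy = gz ; uy = gx ; uniq-xs = ux ; len = lenk
        ; uniq-ys = unique-resp-↭ (prep y (↭-sym perm)) (unique-∷ fresh (Unique.++⁺ uy rs-uniq (λ { (i , j) → true≢false (proj₁ (rs-R j)) (MPath-ys p i) }))) }
      where
      open Realised r
      fresh : y ∉ ys ++ rs
      fresh i with ∈-++⁻ ys i
      ... | inj₁ j = true≢false Ry (MPath-ys p j)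
      ... | inj₂ j = y∉ j

    appendQ : ∀ {x y z w xs xs′ ys ys′ q q′} → MPath x y xs ys q → Q y z ≡ true → MPath z w xs′ ys′ q′ → MPath x w (xs ++ xs′) (ys ++ ys′) (q + suc q′)
    appendQ stop e p′ = viaQ e p′
    appendQ (viaY h h′ p) e p′ = viaY h h′ (appendQ p e p′)
    appendQ (viaQ d p) e p′ = viaQ d (appendQ p e p′)

    snocY : ∀ {x z w y xs ys q} → MPath x z xs ys q → F z y ≡ true → F w y ≡ true → MPath x w (xs ++ w ∷ []) (ys ++ y ∷ []) q
    snocY stop h h′ = viaY h h′ stop
    snocY (viaY g g′ p) h h′ = viaY g g′ (snocY p h h′)
    snocY (viaQ d p) h h′ = viaQ d (snocY p h h′)

    snocQ : ∀ {x z w xs ys q} → MPath x z xs ys q → Q z w ≡ true → MPath x w (xs ++ w ∷ []) ys (suc q)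
    snocQ stop e = viaQ e stop
    snocQ (viaY g g′ p) e = viaY g g′ (snocQ p e)
    snocQ (viaQ d p) e = viaQ d (snocQ p e)

    reverseM : ∀ {x z xs ys q} → MPath x z xs ys q → ∃ λ xs′ → ∃ λ ys′ → MPath z x xs′ ys′ q × xs′ ↭ xs × ys′ ↭ ys
    reverseM stop = _ , _ , stop , ↭-refl , ↭-refl
    reverseM (viaY {x} {y = y} h h′ p) with reverseM p
    ... | xs′ , ys′ , p′ , px , py = _ , _ , snocY p′ h′ h , ↭-trans (++-comm xs′ (x ∷ [])) (prep x px) , ↭-trans (++-comm ys′ (y ∷ [])) (prep y py)
    reverseM (viaQ {x} {x′} e p) with reverseM p
    ... | xs′ , ys′ , p′ , px , py = _ , _ , snocQ p′ (trans (Q-sym x′ x) e) , ↭-trans (++-comm xs′ (x ∷ [])) (prep x px) , py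

    last-∈ : ∀ {x z xs ys q} → MPath x z xs ys q → z ∈ xs
    last-∈ stop = here refl
    last-∈ (viaY _ _ p) = there (last-∈ p)
    last-∈ (viaQ _ p) = there (last-∈ p)

    first-∈ : ∀ {x z xs ys q} → MPath x z xs ys q → x ∈ xs
    first-∈ stop = here refl
    first-∈ (viaY _ _ p) = here refl
    first-∈ (viaQ _ p) = here refl

    record Piece : Set where
      field
        {from to} : Fin n
        xs ys : List (Fin n)
        q : ℕ
        path : MPath from to xs ys q
    open Piece

    Xs Ys : List Piece → List (Fin n)
    Xs ps = concat (map xs ps)
    Ys ps = concat (map ys ps)

    qs : List Piece → ℕ
    qs [] = 0
    qs (p ∷ ps) = q p + qs ps

    Xs-↭ : ∀ {ps ps′} → ps ↭ ps′ → Xs ps ↭ Xs ps′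
    Xs-↭ ↭.refl = ↭-refl
    Xs-↭ (prep p h) = ++⁺ˡ (xs p) (Xs-↭ h)
    Xs-↭ (↭.swap p p′ h) = ↭-trans (shifts (xs p) (xs p′)) (++⁺ˡ (xs p′) (++⁺ˡ (xs p) (Xs-↭ h)))
    Xs-↭ (↭.trans h h′) = ↭-trans (Xs-↭ h) (Xs-↭ h′)

    Ys-↭ : ∀ {ps ps′} → ps ↭ ps′ → Ys ps ↭ Ys ps′
    Ys-↭ ↭.refl = ↭-refl
    Ys-↭ (prep p h) = ++⁺ˡ (ys p) (Ys-↭ h)
    Ys-↭ (↭.swap p p′ h) = ↭-trans (shifts (ys p) (ys p′)) (++⁺ˡ (ys p′) (++⁺ˡ (ys p) (Ys-↭ h)))
    Ys-↭ (↭.trans h h′) = ↭-trans (Ys-↭ h) (Ys-↭ h′)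

    qs-↭ : ∀ {ps ps′} → ps ↭ ps′ → qs ps ≤ qs ps′
    qs-↭ ↭.refl = ≤-refl
    qs-↭ (prep p h) = +-monoʳ-≤ (q p) (qs-↭ h)
    qs-↭ {p ∷ p′ ∷ ps} {_ ∷ _ ∷ ps′} (↭.swap p p′ h) = lin 4 (λ a b c d → K 1 · c ≼ d ⇒ ⊢ 1 · a :+ (b :+ c) ≼ b :+ (a :+ d)) refl (q p) (q p′) (qs ps) (qs ps′) (qs-↭ h)
    qs-↭ (↭.trans h h′) = ≤-trans (qs-↭ h) (qs-↭ h′)

    findPair : ∀ ps → Indep (map to ps) ⊎ (∃ λ a → ∃ λ b → ∃ λ rest → Q (to a) (to b) ≡ true × ps ↭ a ∷ b ∷ rest)
    findPair [] = inj₁ []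
    findPair (p ∷ ps) with partner ps
      where
      partner : ∀ ps → All (λ z → Q (to p) z ≡ false) (map to ps) ⊎ (∃ λ b → ∃ λ rest → Q (to p) (to b) ≡ true × ps ↭ b ∷ rest)
      partner [] = inj₁ []
      partner (b ∷ ps) with Q (to p) (to b) in e
      ... | true = inj₂ (b , ps , e , ↭-refl)
      ... | false with partner ps
      ... | inj₁ h = inj₁ (e ∷ h)
      ... | inj₂ (b′ , rest , e′ , h) = inj₂ (b′ , b ∷ rest , e′ , ↭-trans (prep b h) (↭.swap b b′ ↭-refl))
    ... | inj₂ (b , rest , e , h) = inj₂ (p , b , rest , e , prep p h)
    ... | inj₁ h with findPair ps
    ... | inj₁ i = inj₁ (h ∷ i)
    ... | inj₂ (a , b , rest , e , h′) = inj₂ (a , b , p ∷ rest , e , ↭-trans (prep p h′) (↭-trans (↭.swap p a ↭-refl) (prep a (↭.swap p b ↭-refl))))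

    module _ {V : Fin n → Bool} {f : ℕ} (bound : IndepBound V f) where

      ends-⊑ : ∀ ps → Xs ps ⊑ V → map to ps ⊑ V
      ends-⊑ (p ∷ ps) h (here refl) = h (∈-++⁺ˡ (last-∈ (path p)))
      ends-⊑ (p ∷ ps) h (there i) = ends-⊑ ps (λ j → h (∈-++⁺ʳ (xs p) j)) i

      -- Pieces are inserted one at a time into a family of at most f. If this makes f + 1, their
      -- final ends are too many to be independent, so two are linked and their pieces merge at the
      -- price of one link. Thus at most one link per piece is added.
      join : ∀ ps → Xs ps ⊑ V → ∃ λ ps′ → length ps′ ≤ f × Xs ps′ ↭ Xs ps × Ys ps′ ↭ Ys ps × qs ps′ ≤ qs ps + length ps
      join [] _ = [] , z≤n , ↭-refl , ↭-refl , z≤n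
      join (p ∷ ps) h with join ps (λ j → h (∈-++⁺ʳ (xs p) j))
      ... | ps′ , l , px , py , ql with suc (length ps′) ≤? f
      ... | yes l′ = p ∷ ps′ , l′ , ++⁺ˡ (xs p) px , ++⁺ˡ (ys p) py
          , lin 4 (λ a b c d → K 1 · a ≼ b :+ c ⇒ ⊢ 1 · d :+ a ≼ d :+ b :+ (Suc c)) refl (qs ps′) (qs ps) (length ps) (q p) ql
      ... | no ¬l with findPair (p ∷ ps′)
      ... | inj₁ ind = ⊥-elim (¬l (≤-trans (≤-reflexive (sym (length-map to (p ∷ ps′)))) (bound _ (ends-⊑ (p ∷ ps′) λ i → h (∈-resp-↭ (++⁺ˡ (xs p) px) i)) ind)))
      -- The link joins the two final ends, so the second piece is traversed backwards.
      ... | inj₂ (a , b , rest , e , perm) with reverseM (path b)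
      ... | xb , yb , pb , hx , hy = new ∷ rest , ≤-pred (≤-trans (≤-reflexive (sym (↭-length perm))) (s≤s l))
          , ↭-trans (↭-trans (subst (λ z → z ↭ xs a ++ (xs b ++ Xs rest)) (sym (++-assoc (xs a) xb (Xs rest))) (++⁺ˡ (xs a) (++⁺ʳ (Xs rest) hx))) (↭-sym (Xs-↭ perm))) (++⁺ˡ (xs p) px)
          , ↭-trans (↭-trans (subst (λ z → z ↭ ys a ++ (ys b ++ Ys rest)) (sym (++-assoc (ys a) yb (Ys rest))) (++⁺ˡ (ys a) (++⁺ʳ (Ys rest) hy))) (↭-sym (Ys-↭ perm))) (++⁺ˡ (ys p) py)
          , lin 7 (λ qa qb r p m s l → K 1 · qa :+ (qb :+ r) ≼ p :+ m ⇒ K 1 · m ≼ s :+ l ⇒ ⊢ 1 · (qa :+ Suc qb) :+ r ≼ (p :+ s) :+ Suc l) refl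
              (q a) (q b) (qs rest) (q p) (qs ps′) (qs ps) (length ps) (qs-↭ (↭-sym perm)) ql
        where
        new : Piece
        new = record { xs = xs a ++ xb ; ys = ys a ++ yb ; q = q a + suc (q b) ; path = appendQ (path a) e pb }

    fromQPath : ∀ {l l′ ps} → QPath l l′ ps → ∃ λ q → MPath l l′ ps [] q × suc q ≡ length ps
    fromQPath stop = 0 , stop , refl
    fromQPath (e ∷ p) with fromQPath p
    ... | q , m , h = suc q , viaQ e m , cong suc h

    sublist-length : ∀ {ps L : List (Fin n)} → Unique ps → (∀ {x} → x ∈ ps → x ∈ L) → length ps ≤ length L
    sublist-length {ps} {L} u s = ≤-trans (unique-length (mem L) u (λ i → mem-intro (s i))) (#-mem L)

    module _ {U : Fin n → Bool} where

      -- `lc` counts the vertices visited in dominating sets. It depends on the paths found there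
      -- and cannot be prescribed; the clique compensates for it later.
      record Tail (e u : Fin n) (ps : List Piece) (Ls : List (List (Fin n))) : Set where
        field
          {l l′} : Fin n
          {txs} : List (Fin n)
          {tq lc} : ℕ
          el : Q e l ≡ true
          tpath : MPath l l′ txs (Ys ps) tq
          l′u : Q l′ u ≡ true
          uniq : Unique txs
          inside : ∀ {x} → x ∈ txs → x ∈ concat Ls ⊎ x ∈ Xs ps
          len : length txs ≡ length (Xs ps) + lc
          lc≤ : lc ≤ length (concat Ls)
          tq≤ : suc tq ≤ qs ps + lc + length ps

      -- One dominating set is spent before each piece and one more after the last, whence
      -- `length ps < length Ls`. Spending a fresh set each time keeps the connections disjoint.
      chain : ∀ ps Ls e u → length ps < length Ls → U e ≡ true → U u ≡ true → Unique (concat Ls) → Unique (Xs ps) → Xs ps ⊑ U →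
        (∀ {x} → x ∈ concat Ls → U x ≡ false) → (∀ {L} → L ∈ Ls → ∀ e e′ → U e ≡ true → U e′ ≡ true → Links L e e′) → Tail e u ps Ls
      chain [] (L ∷ Ls) e u _ Ue Uu uL _ _ _ lk with lk (here refl) e u Ue Uu
      ... | l , l′ , ps , el , p , l′u , up , s with fromQPath p
      ... | q , m , h = record { el = el ; tpath = m ; l′u = l′u ; uniq = up ; inside = λ i → inj₁ (∈-++⁺ˡ (s i)) ; len = refl
          ; lc≤ = ≤-trans (sublist-length up s) (≤-trans (m≤m+n _ _) (≤-reflexive (sym (length-++ L)))) ; tq≤ = ≤-reflexive (trans h (sym (+-identityʳ (length ps)))) }
      chain (p ∷ ps) (L ∷ Ls) e u (s≤s lt) Ue Uu uL uX X⊑ L∩ lk with unique-++⁻ L uL | unique-++⁻ (xs p) uX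
      ... | _ , uLs , dL | up , uXs , dX with lk (here refl) e (from p) Ue (X⊑ (∈-++⁺ˡ (first-∈ (path p))))
           | chain ps Ls (to p) u lt (X⊑ (∈-++⁺ˡ (last-∈ (path p)))) Uu uLs uXs (λ i → X⊑ (∈-++⁺ʳ (xs p) i)) (λ i → L∩ (∈-++⁺ʳ L i)) (λ i → lk (there i))
      ... | l , l′ , ws , el , w , l′p , uw , sw | T with fromQPath w
      ... | qw , mw , hw = record { el = el ; tpath = appendQ mw l′p (appendQ (path p) T.el T.tpath) ; l′u = T.l′u
          ; uniq = Unique.++⁺ uw (Unique.++⁺ up T.uniq dis₁) dis₂
          ; inside = ins
          ; lc = length ws + T.lc
          ; len = trans lens (trans (cong (λ z → length ws + (length (xs p) + z)) T.len)
              (trans (regroup (length ws) (length (xs p)) (length (Xs ps)) T.lc) (cong (_+ (length ws + T.lc)) (sym (length-++ (xs p))))))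
          ; lc≤ = ≤-trans (+-mono-≤ (sublist-length uw sw) T.lc≤) (≤-reflexive (sym (length-++ L)))
          ; tq≤ = lin 7 (λ qw w qp tq s c r → K 1 · Suc qw ≼ w ⇒ K 1 · Suc tq ≼ s :+ c :+ r ⇒ ⊢ 1 · Suc (qw :+ Suc (qp :+ Suc tq)) ≼ (qp :+ s) :+ (w :+ c) :+ Suc r) refl
                qw (length ws) (q p) T.tq (qs ps) T.lc (length ps) (≤-reflexive hw) T.tq≤ }
        where
        module T = Tail T
        regroup : ∀ a b c z → a + (b + (c + z)) ≡ (b + c) + (a + z)
        regroup = solve-∀
        lens : length (ws ++ (xs p ++ T.txs)) ≡ length ws + (length (xs p) + length T.txs)
        lens = trans (length-++ ws) (cong (length ws +_) (length-++ (xs p)))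
        dis₁ : Disjoint (xs p) T.txs
        dis₁ (i , j) with T.inside j
        ... | inj₁ k = true≢false (X⊑ (∈-++⁺ˡ i)) (L∩ (∈-++⁺ʳ L k))
        ... | inj₂ k = dX (i , k)
        dis₂ : Disjoint ws (xs p ++ T.txs)
        dis₂ (i , j) with ∈-++⁻ (xs p) j
        ... | inj₁ k = true≢false (X⊑ (∈-++⁺ˡ k)) (L∩ (∈-++⁺ˡ (sw i)))
        ... | inj₂ k with T.inside k
        ...   | inj₁ z = dL (sw i , z)
        ...   | inj₂ z = true≢false (X⊑ (∈-++⁺ʳ (xs p) z)) (L∩ (∈-++⁺ˡ (sw i)))
        ins : ∀ {x} → x ∈ ws ++ (xs p ++ T.txs) → x ∈ L ++ concat Ls ⊎ x ∈ xs p ++ Xs ps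
        ins i with ∈-++⁻ ws i
        ... | inj₁ j = inj₁ (∈-++⁺ˡ (sw j))
        ... | inj₂ j with ∈-++⁻ (xs p) j
        ...   | inj₁ k = inj₂ (∈-++⁺ˡ k)
        ...   | inj₂ k with T.inside k
        ...     | inj₁ z = inj₁ (∈-++⁺ʳ L z)
        ...     | inj₂ z = inj₂ (∈-++⁺ʳ (xs p) z)

-- Cycles of prescribed length from pieces, dominating sets and a clique

module LeafCycle {n : ℕ} (G : Fin n → Fin n → Bool) (R : Fin n → Bool) (B : ℕ)
  (F : Fin n → Fin n → Bool) (F⊆G : ∀ x y → F x y ≡ true → G x y ≡ true) (F∩R : ∀ x y → F x y ≡ true → R y ≡ false) where

  open Assembly G R B
  open MixedPaths Q F
  open Piece

  cliquePath : ∀ {v} x ws → All (λ w → Q x w ≡ true) ws → Clique ws → All (λ w → Q v w ≡ true) ws → Q x v ≡ true → QPath x v (x ∷ ws ++ v ∷ [])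
  cliquePath x [] _ _ _ e = e ∷ stop
  cliquePath {v} x (w ∷ ws) (a ∷ _) (c ∷ cs) (b ∷ bs) _ = a ∷ cliquePath w ws c cs bs (trans (Q-sym w v) b)

  module _ {u v : Fin n} {ws : List (Fin n)} (cl : Clique (u ∷ v ∷ ws)) (uq : Unique (u ∷ v ∷ ws)) where

    -- In a clique every number of inner vertices can be realised, which makes the number of
    -- x-vertices of the final cycle adjustable one by one.
    subPath : ∀ i → i ≤ length ws → ∃ λ xs → ∃ λ q → MPath u v xs [] q × suc q ≡ 2 + i × length xs ≡ 2 + i × Unique xs × (∀ {x} → x ∈ xs → x ∈ u ∷ v ∷ ws)
    subPath i le with fromQPath F F⊆G F∩R (cliquePath u (take i ws) (All.take⁺ i (All.tail (AllPairs.head cl))) (AllPairs.take⁺ i (AllPairs.tail (AllPairs.tail cl)))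
      (All.take⁺ i (AllPairs.head (AllPairs.tail cl))) (All.head (AllPairs.head cl)))
    ... | q , m , h = u ∷ take i ws ++ v ∷ [] , q , m , trans h len , len
        , unique-∷ u-out (Unique.++⁺ (AllPairs.take⁺ i uw′) ([] ∷ []) (λ { (p , here refl) → All.All¬⇒¬Any v∉ (take-⊆ i ws p) }))
        , λ { (here refl) → here refl ; (there p) → inside p }
      where
      u≢v = All.head (AllPairs.head uq)
      u∉ = All.tail (AllPairs.head uq)
      v∉ = AllPairs.head (AllPairs.tail uq)
      uw′ = AllPairs.tail (AllPairs.tail uq)
      len : suc (length (take i ws ++ v ∷ [])) ≡ 2 + i
      len = cong suc (trans (length-++ (take i ws)) (trans (+-comm _ 1) (cong suc (trans (length-take i ws) (m≤n⇒m⊓n≡m le)))))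
      u-out : u ∉ take i ws ++ v ∷ []
      u-out p with ∈-++⁻ (take i ws) p
      ... | inj₁ h = All.All¬⇒¬Any u∉ (take-⊆ i ws h)
      ... | inj₂ (here e) = u≢v e
      inside : ∀ {x} → x ∈ take i ws ++ v ∷ [] → x ∈ u ∷ v ∷ ws
      inside p with ∈-++⁻ (take i ws) p
      ... | inj₁ h = there (there (take-⊆ i ws h))
      ... | inj₂ (here refl) = there (here refl)

    vu : Q v u ≡ true
    vu = trans (Q-sym v u) (All.head (AllPairs.head cl))

    cliqueCycle : ∀ k → 2 ≤ k → k ≤ 2 + length ws → k ≤ B → Cyc G k
    cliqueCycle (suc (suc i)) _ (s≤s (s≤s le)) kB with subPath i le
    ... | xs , q , m , hq , hl , ux , _ = close F F⊆G F∩R m vu ux [] (subst (_≤ B) (sym hq) kB) hl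
    cliqueCycle (suc zero) (s≤s ()) _ _

    -- The cycle runs from u through the clique to v and returns through the pieces and the
    -- dominating sets. The lower bound on k allows for all vertices of the dominating sets being
    -- visited, the upper bound for hardly any; the last hypothesis weighs the number of links
    -- against `B`.
    longCycle : ∀ {V f} → IndepBound V f → (ly : Layers V f (suc f) []) →
      (∀ {x} → x ∈ u ∷ v ∷ ws → (V ∖ (concat (Layers.Ls ly) ++ [])) x ≡ true) →
      ∀ ps → Unique (Xs F F⊆G F∩R ps) → Unique (Ys F F⊆G F∩R ps) →
      (∀ {x} → x ∈ Xs F F⊆G F∩R ps → (V ∖ (concat (Layers.Ls ly) ++ [])) x ≡ true × x ∉ u ∷ v ∷ ws) →
      qs F F⊆G F∩R ps ≡ 0 →
      ∀ k → length (Xs F F⊆G F∩R ps) + (suc f * (2 * f) + 2) ≤ k → k ≤ length (Xs F F⊆G F∩R ps) + (2 + length ws) →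
      length ps + k + f ≤ B + length (Xs F F⊆G F∩R ps) → Cyc G k
    longCycle {V} {f} bound ly clU ps uX uY XU q0 k k≥ k≤ kB with join F F⊆G F∩R bound ps (λ i → ∧-fst (proj₁ (XU i)))
    ... | ps′ , lf , px , py , ql = close F F⊆G F∩R (appendQ F F⊆G F∩R m T.el T.tpath) T.l′u
          (Unique.++⁺ ux T.uniq dis) (unique-resp-↭ (↭-sym py) uY) qB total
      where
      module Y = Layers ly
      U = V ∖ (concat Y.Ls ++ [])
      X′ = Xs F F⊆G F∩R ps′
      XU′ : ∀ {x} → x ∈ X′ → U x ≡ true × x ∉ u ∷ v ∷ ws
      XU′ i = XU (∈-resp-↭ px i)
      L∩ : ∀ {x} → x ∈ concat Y.Ls → U x ≡ false
      L∩ {x} i with V x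
      ... | false = refl
      ... | true = cong not (mem-intro {ys = concat Y.Ls ++ []} (∈-++⁺ˡ i))
      tl : Tail F F⊆G F∩R {U} v u ps′ Y.Ls
      tl = chain F F⊆G F∩R {U} ps′ Y.Ls v u (≤-trans (s≤s lf) (≤-reflexive (sym Y.count))) (clU (there (here refl))) (clU (here refl)) Y.uniq
        (unique-resp-↭ (↭-sym px) uX) (λ i → proj₁ (XU′ i)) L∩ Y.links
      module T = Tail tl
      lenX : length X′ ≡ length (Xs F F⊆G F∩R ps)
      lenX = ↭-length px
      x₀ = length (Xs F F⊆G F∩R ps)
      lc≤ : T.lc ≤ suc f * (2 * f)
      lc≤ = ≤-trans T.lc≤ Y.small
      enough : 2 + (x₀ + T.lc) ≤ k
      enough = lin 4 (λ x l c k → K 1 · l ≼ c ⇒ K 1 · x :+ (c :+ K 2) ≼ k ⇒ ⊢ 1 · K 2 :+ (x :+ l) ≼ k) refl x₀ T.lc (suc f * (2 * f)) k lc≤ k≥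
      -- The clique path receives whatever the tail leaves missing to k.
      i = k ∸ (2 + (x₀ + T.lc))
      i≡ : 2 + (x₀ + T.lc) + i ≡ k
      i≡ = m+[n∸m]≡n enough
      i≤ : i ≤ length ws
      i≤ = lin 5 (λ x l i k w → K 1 · K 2 :+ (x :+ l) :+ i ≼ k ⇒ K 1 · k ≼ x :+ (K 2 :+ w) ⇒ ⊢ 1 · i ≼ w) refl x₀ T.lc i k (length ws) (≤-reflexive i≡) k≤
      sp = subPath i i≤
      xs₀ = proj₁ sp
      q₀ = proj₁ (proj₂ sp)
      m : MPath u v xs₀ [] q₀
      m = proj₁ (proj₂ (proj₂ sp))
      hq = proj₁ (proj₂ (proj₂ (proj₂ sp)))
      hl = proj₁ (proj₂ (proj₂ (proj₂ (proj₂ sp))))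
      ux = proj₁ (proj₂ (proj₂ (proj₂ (proj₂ (proj₂ sp)))))
      ins : ∀ {x} → x ∈ xs₀ → x ∈ u ∷ v ∷ ws
      ins = proj₂ (proj₂ (proj₂ (proj₂ (proj₂ (proj₂ sp)))))
      dis : Disjoint xs₀ T.txs
      dis (p , p′) with T.inside p′
      ... | inj₁ h = true≢false (clU (ins p)) (L∩ h)
      ... | inj₂ h = proj₂ (XU′ h) (ins p)
      regroup : ∀ i x l → 2 + i + (x + l) ≡ 2 + (x + l) + i
      regroup = solve-∀
      total : length (xs₀ ++ T.txs) ≡ k
      total = trans (length-++ xs₀) (trans (cong₂ _+_ hl (trans T.len (cong (_+ T.lc) lenX))) (trans (regroup i x₀ T.lc) i≡))
      qB : suc (q₀ + suc T.tq) ≤ B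
      -- The clique part and the dominating sets need one link per vertex, k - x₀ in all. Merging
      -- the pieces took at most `length ps` links, and passing the remaining pieces takes at most f
      -- more.
      qB = lin 12 (λ q t i s c r p f k B x s₀ → K 1 · Suc q ≼ K 2 :+ i ⇒ K 1 · Suc t ≼ s :+ c :+ r ⇒ K 1 · r ≼ f ⇒ K 1 · s ≼ s₀ :+ p ⇒ K 1 · s₀ ≼ K 0 ⇒
              K 1 · K 2 :+ (x :+ c) :+ i ≼ k ⇒ K 1 · p :+ k :+ f ≼ B :+ x ⇒ ⊢ 1 · Suc (q :+ Suc t) ≼ B) refl
            q₀ T.tq i (qs F F⊆G F∩R ps′) T.lc (length ps′) (length ps) f k B x₀ (qs F F⊆G F∩R ps)
            (≤-reflexive hq) T.tq≤ lf ql (≤-reflexive q0) (≤-reflexive i≡) kB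

-- Recursive decomposition along sparse cuts

Label : Set
Label = List Bool

_≟ᴸ_ : (l l′ : Label) → Dec (l ≡ l′)
_≟ᴸ_ = ≡-dec _≟ᴮ_

-- After deleting few edges, the components (labels) of G between V and Y have small vertex covers.
record Struct {n : ℕ} (G : Fin n → Fin n → Bool) (V Y : Fin n → Bool) (del cov : ℕ) : Set where
  field
    H : Fin n → Fin n → Bool
    H⊆ : ∀ x y → H x y ≡ true → G x y ∧ (V x ∧ Y y) ≡ true
    deleted : ∣ (λ x y → (G x y ∧ (V x ∧ Y y)) ∧ not (H x y)) ∣ᴱ ≤ del
    rX rY : Fin n → Label
    C D : Fin n → Bool
    same : ∀ x y → H x y ≡ true → rX x ≡ rY y
    covered : ∀ x y → H x y ≡ true → C x ∨ D y ≡ true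
    small : ∀ l → # (λ x → does (rX x ≟ᴸ l) ∧ C x) + # (λ y → does (rY y ≟ᴸ l) ∧ D y) ≤ cov

module _ {n : ℕ} where

  E-∪ : ∀ {P P′ P″ : Fin n → Fin n → Bool} → (∀ x y → P x y ≡ true → P′ x y ≡ true ⊎ P″ x y ≡ true) → ∣ P ∣ᴱ ≤ ∣ P′ ∣ᴱ + ∣ P″ ∣ᴱ
  E-∪ {P′ = P′} {P″} h = ≤-trans (∑-mono (λ x → #-∪ (h x))) (≤-reflexive (∑-+ (λ x → # (P′ x)) (λ x → # (P″ x))))

  E-rows : ∀ (P : Fin n → Fin n → Bool) S → (∀ x y → P x y ≡ true → S x ≡ true) → ∣ P ∣ᴱ ≤ # S * n
  E-rows P S h = ≤-trans (∑-mono row) (≤-reflexive (∑-*ʳ n (λ x → 𝟙 (S x))))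
    where
    row : ∀ x → # (P x) ≤ 𝟙 (S x) * n
    row x with S x in e
    ... | true = ≤-trans (#-≤n (P x)) (≤-reflexive (sym (*-identityˡ n)))
    ... | false = ≤-reflexive (#-none none)
      where
      none : ∀ y → P x y ≡ false
      none y with P x y in e′
      ... | false = refl
      ... | true = ⊥-elim (true≢false (h x y e′) e)

module Decomposition {n : ℕ} (G : Fin n → Fin n → Bool) (R : Fin n → Bool) (B k p t t₁ θ A₀ z τ cnt₀ : ℕ)
  (t≡ : t ≡ suc t₁) (0<t₁ : 0 < t₁) (0<B : 0 < B) (2≤k : 2 ≤ k) (k<n : k < n) (z≤ : z ≤ n) where

  open Assembly G R B

  -- `c₁` bounds the vertices of p + 1 dominating sets together with the two ends of the clique
  -- path; the t further clique vertices in `c` absorb the rounding to a multiple of t. `w₁` bounds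
  -- the vertices discarded at one node: dominating sets, clique, and a remainder too small for
  -- Ramsey's theorem. `D₀` bounds the edges lost there, at discarded vertices, across the cut or
  -- outside a cover.
  c₁ c w₁ D₀ : ℕ
  c₁ = suc p * (2 * p) + 2
  c = c₁ + t
  w₁ = suc p * (2 * p) + c + ram (suc p) c
  D₀ = w₁ * n + n * (τ + cnt₀) + B * (n + n)

  del : ℕ → ℕ
  del zero = D₀
  del (suc f) = D₀ + (del f + del f)

  module _ (atyp-num : t * t * ((n + n) * B) < suc A₀ * (θ * θ))
    (slack : (3 * t + 1) * (θ * (n + n)) + (t * (t + 1) + 1) * (B * A₀) ≤ B * z)
    (reserve : ∀ s → t * s ≤ n → s + (c₁ + t) + p ≤ B)
    (sparse : ∑ (λ x → ∑ (λ x′ → 𝟙 (not (Q x x′)) * # (λ y → G x y ∧ G x′ y))) < suc cnt₀ * (τ * τ)) where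

    private
      GVY : (V Y : Fin n → Bool) → Fin n → Fin n → Bool
      GVY V Y x y = G x y ∧ (V x ∧ Y y)

    trivial : ∀ V Y S → (∀ x → V x ≡ true → S x ≡ true) → ∀ d → # S * n ≤ d → Struct G V Y d (k + z)
    trivial V Y S V⊆S d h = record { H = λ _ _ → false ; H⊆ = λ _ _ () ; deleted = ≤-trans (E-rows _ S (λ x y e → V⊆S x (∧-fst (∧-snd {G x y} (∧-fst {GVY V Y x y} e))))) h
      ; rX = λ _ → [] ; rY = λ _ → [] ; C = λ _ → false ; D = λ _ → false ; same = λ _ _ () ; covered = λ _ _ ()
      ; small = λ l → ≤-trans (≤-reflexive (cong₂ _+_ (#-none {n} {P = λ _ → does ([] ≟ᴸ l) ∧ false} (λ _ → ∧-zeroʳ (does ([] ≟ᴸ l)))) (#-none {n} {P = λ _ → does ([] ≟ᴸ l) ∧ false} (λ _ → ∧-zeroʳ (does ([] ≟ᴸ l)))))) z≤n }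

    module Leaf (V Y : Fin n → Bool) (bound : IndepBound V p) (Y∩R : ∀ y → Y y ≡ true → R y ≡ false)
      (ly : Layers V p (suc p) []) {u v : Fin n} {ws : List (Fin n)} (cl : Clique (u ∷ v ∷ ws)) (uq : Unique (u ∷ v ∷ ws))
      (clU : ∀ {x} → x ∈ u ∷ v ∷ ws → (V ∖ (concat (Layers.Ls ly) ++ [])) x ≡ true) (len : 2 + length ws ≡ c) where

      private
        module Ly = Layers ly
        W = (concat Ly.Ls ++ []) ++ (u ∷ v ∷ ws)

        H₀ : Fin n → Fin n → Bool
        H₀ x y = GVY V Y x y ∧ not (mem W x)

        W-small : length W ≤ w₁
        W-small = ≤-trans (≤-reflexive (trans (length-++ (concat Ly.Ls ++ [])) (cong₂ _+_ (cong length (++-identityʳ (concat Ly.Ls))) len)))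
          (≤-trans (+-monoˡ-≤ c Ly.small) (m≤m+n _ (ram (suc p) c)))

        -- The uniform capacity B serves two ends: dividing by it bounds the cover by k + z, and the
        -- uncovered edges, fewer than B(k + z) ≤ 2Bn, are few enough to be deleted.
        cutStruct : ∀ C D → cutValue H₀ (λ _ → B) (λ _ → B) C D < B * (k + z) → ∀ d → w₁ * n + B * (n + n) ≤ d → Struct G V Y d (k + z)
        cutStruct C D lt d dh = record
          { H = λ x y → H₀ x y ∧ (C x ∨ D y)
          ; H⊆ = λ x y e → ∧-fst {GVY V Y x y} (∧-fst {H₀ x y} e)
          ; deleted = ≤-trans (E-∪ {P′ = λ x y → GVY V Y x y ∧ mem W x} {P″ = uncov H₀ C D} cases)
              (≤-trans (+-mono-≤ (≤-trans (E-rows _ (mem W) (λ x y e → ∧-snd {GVY V Y x y} e)) (*-monoˡ-≤ n (≤-trans (#-mem W) W-small)))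
                (≤-trans (m≤n+m _ _) (<⇒≤ (≤-trans lt (*-monoʳ-≤ B (+-mono-≤ (<⇒≤ k<n) z≤)))))) dh)
          ; rX = λ _ → [] ; rY = λ _ → [] ; C = C ; D = D ; same = λ _ _ _ → refl ; covered = λ x y e → ∧-snd {H₀ x y} e
          ; small = λ l → ≤-trans (+-mono-≤ (#-⊆ {n} {P = λ x → does ([] ≟ᴸ l) ∧ C x} {Q = C} (λ x → ∧-snd {does ([] ≟ᴸ l)})) (#-⊆ {n} {P = λ y → does ([] ≟ᴸ l) ∧ D y} {Q = D} (λ x → ∧-snd {does ([] ≟ᴸ l)}))) (<⇒≤ CD) }
          where
          CD : # C + # D < k + z
          CD = *-cancelˡ-< B _ _ (≤-trans (s≤s (≤-trans (≤-reflexive (trans (*-distribˡ-+ B (# C) (# D)) (cong₂ _+_ (sym (∑-*ˡ B (λ x → 𝟙 (C x)))) (sym (∑-*ˡ B (λ y → 𝟙 (D y))))))) (m≤m+n _ _))) lt)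
          cases : ∀ x y → GVY V Y x y ∧ not (H₀ x y ∧ (C x ∨ D y)) ≡ true → (GVY V Y x y ∧ mem W x ≡ true) ⊎ uncov H₀ C D x y ≡ true
          cases x y e with GVY V Y x y | mem W x | C x | D y
          ... | true | true | _ | _ = inj₁ refl
          ... | true | false | false | false = inj₂ refl
          cases x y () | true | false | true | _
          cases x y () | true | false | false | true

        module Long (M : BMatching H₀ (λ _ → B) (λ _ → B) (B * (k + z))) (c<k : c < k) where
          module M = BMatching M
          F = M.F
          F-all : ∀ x y → F x y ≡ true → G x y ≡ true × V x ≡ true × Y y ≡ true × x ∉ W
          F-all x y f = ∧-fst {G x y} g , ∧-fst {V x} (∧-snd {G x y} g) , ∧-snd {V x} (∧-snd {G x y} g) , mem-false (not-false (∧-snd {GVY V Y x y} h))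
            where
            h = M.F⊆H x y f
            g = ∧-fst {GVY V Y x y} h
          F⊆G : ∀ x y → F x y ≡ true → G x y ≡ true
          F⊆G x y f = proj₁ (F-all x y f)
          F∩R : ∀ x y → F x y ≡ true → R y ≡ false
          F∩R x y f = Y∩R y (proj₁ (proj₂ (proj₂ (F-all x y f))))
          instance
            t-nonZero : Data.Nat.NonZero t
            t-nonZero = subst Data.Nat.NonZero (sym t≡) _
          -- The paths contribute ts vertices of X, with ts the largest multiple of t up to k - c₁.
          -- What is missing to k then lies between c₁ and c₁ + t = c, which is the range in which
          -- the clique can adjust.
          d = k ∸ c₁
          s = d / t
          c₁≤k : c₁ ≤ k
          c₁≤k = ≤-trans (m≤m+n c₁ t) (<⇒≤ c<k)
          s-lo : t * s ≤ d
          s-lo = ≤-trans (≤-reflexive (*-comm t s)) (m/n*n≤m d t)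
          s-hi : d ≤ t * s + t
          s-hi = ≤-trans (≤-reflexive (m≡m%n+[m/n]*n d t)) (≤-trans (+-mono-≤ (<⇒≤ (m%n<n d t)) (≤-reflexive (*-comm s t))) (≤-reflexive (+-comm t (t * s))))
          d≤k : d ≤ k
          d≤k = m∸n≤m k c₁
          s≤ts : s ≤ t * s
          s≤ts = ≤-trans (≤-reflexive (sym (*-identityˡ s))) (*-monoˡ-≤ s (subst (1 ≤_) (sym t≡) (s≤s z≤n)))
          num : t * B * s + (3 * t + 1) * (θ * (n + n)) + (t * (t + 1) + 1) * (B * A₀) ≤ ∣ F ∣ᴱ
          num = lin 9 (λ t B s a b k z F ts → B · t :* s ≼ k ⇒ K 1 · a :+ b ≼ B :* z ⇒ K 1 · B :* (k :+ z) ≼ F ⇒ ⊢ 1 · t :* B :* s :+ a :+ b ≼ F) refl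
            t B s ((3 * t + 1) * (θ * (n + n))) ((t * (t + 1) + 1) * (B * A₀)) k z ∣ F ∣ᴱ (t * s) (≤-trans s-lo d≤k) slack M.size
          module FL = ForestLemma F B t t₁ θ s A₀ t≡ 0<t₁ M.degX≤ M.degY≤ 0<B
            (≤-trans s≤ts (≤-trans s-lo (≤-trans d≤k (≤-trans (<⇒≤ k<n) (m≤m+n n n))))) atyp-num num
          open FL.Convert Q using (forest)
          open MixedPaths Q F using (module Item)
          Item = MixedPaths.Item Q F t
          open Assembly.Piece
          open LeafCycle G R B F F⊆G F∩R
          piece : Item → Piece F F⊆G F∩R
          piece i = record { xs = Item.xs i ; ys = Item.ys i ; q = 0 ; path = Item.path i }
          unique-take : ∀ (g : Item → List (Fin n)) (js : List Item) → Unique (concat (map g js)) → Unique (concat (map g (take s js)))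
          unique-take g js u = proj₁ (unique-++⁻ (concat (map g (take s js))) (subst Unique (trans (cong (λ js → concat (map g js)) (sym (take++drop≡id s js)))
            (trans (cong concat (map-++ g (take s js) (drop s js))) (sym (concat-++ (map g (take s js)) (map g (drop s js)))))) u))
          X≡ : ∀ js → Xs F F⊆G F∩R (map piece js) ≡ concat (map Item.xs js)
          X≡ [] = refl
          X≡ (j ∷ js) = cong (Item.xs j ++_) (X≡ js)
          Y≡ : ∀ js → Ys F F⊆G F∩R (map piece js) ≡ concat (map Item.ys js)
          Y≡ [] = refl
          Y≡ (j ∷ js) = cong (Item.ys j ++_) (Y≡ js)
          q≡ : ∀ js → qs F F⊆G F∩R (map piece js) ≡ 0
          q≡ [] = refl
          q≡ (j ∷ js) = q≡ js
          lenX : ∀ js → length (Xs F F⊆G F∩R (map piece js)) ≡ t * length js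
          lenX [] = sym (*-zeroʳ t)
          lenX (j ∷ js) = trans (length-++ (Item.xs j)) (trans (cong₂ _+_ (Item.len j) (lenX js)) (sym (*-suc t (length js))))
          Xs-F : ∀ js {x} → x ∈ Xs F F⊆G F∩R (map piece js) → ∃ λ y → F x y ≡ true
          Xs-F (j ∷ js) i with ∈-++⁻ (Item.xs j) i
          ... | inj₁ h = Item.xs-H j h
          ... | inj₂ h = Xs-F js h
          d≡ : c₁ + d ≡ k
          d≡ = m+[n∸m]≡n c₁≤k
          module _ (is : List Item) (len-is : length is ≡ s) where
            ps = map piece is
            XU : ∀ {x} → x ∈ Xs F F⊆G F∩R ps → (V ∖ (concat Ly.Ls ++ [])) x ≡ true × x ∉ u ∷ v ∷ ws
            XU {x} i = let y , f = Xs-F is i in let _ , Vx , _ , x∉ = F-all x y f in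
              ∧-intro Vx (not-true (mem-no (concat Ly.Ls ++ []) (λ h → x∉ (∈-++⁺ˡ h)))) , λ h → x∉ (∈-++⁺ʳ (concat Ly.Ls ++ []) h)
            lenX′ : length (Xs F F⊆G F∩R ps) ≡ t * s
            lenX′ = trans (lenX is) (cong (t *_) len-is)
            cycleFrom : Unique (concat (map Item.xs is)) → Unique (concat (map Item.ys is)) → Cyc G k
            cycleFrom uX uY = longCycle cl uq bound ly clU ps (subst Unique (sym (X≡ is)) uX) (subst Unique (sym (Y≡ is)) uY) XU (q≡ is) k
              (≤-trans (+-monoˡ-≤ c₁ (≤-reflexive lenX′)) (≤-trans (+-monoˡ-≤ c₁ s-lo) (≤-reflexive (trans (+-comm d c₁) d≡))))
              (≤-trans (≤-trans (≤-reflexive (sym d≡)) (≤-trans (+-monoʳ-≤ c₁ s-hi) (≤-reflexive (regroup c₁ (t * s) t)))) (≤-reflexive (cong₂ _+_ (sym lenX′) (sym len))))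
              (≤-trans (lin 9 (λ l s k f B x c d t → K 1 · l ≼ s ⇒ K 1 · s :+ (c :+ t) :+ f ≼ B ⇒ K 1 · k ≼ c :+ d ⇒ K 1 · d ≼ x :+ t ⇒ ⊢ 1 · l :+ k :+ f ≼ B :+ x) refl
                (length ps) s k p B (t * s) c₁ d t (≤-reflexive (trans (length-map piece is) len-is)) (reserve s (≤-trans s-lo (≤-trans d≤k (<⇒≤ k<n)))) (≤-reflexive (sym d≡)) s-hi)
                (+-monoʳ-≤ B (≤-reflexive (sym lenX′))))
              where
              regroup : ∀ c x t → c + (x + t) ≡ x + (c + t)
              regroup = solve-∀
          cycle : Cyc G k
          cycle = let is , uX , uY , s≤ = forest in
            cycleFrom (take s is) (trans (length-take s is) (m≤n⇒m⊓n≡m s≤)) (unique-take Item.xs is uX) (unique-take Item.ys is uY)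

      leaf : ∀ d → w₁ * n + B * (n + n) ≤ d → Cyc G k ⊎ Struct G V Y d (k + z)
      leaf d dh with b-matching-duality _ H₀ (λ _ → B) (λ _ → B) (B * (k + z)) ≤-refl
      ... | inj₂ (C , D , lt) = inj₂ (cutStruct C D lt d dh)
      ... | inj₁ M with k ≤? c
      ... | no c<k = inj₁ (Long.cycle M (≰⇒> c<k))
      -- A short cycle fits into the clique. With F empty all its connections go through the
      -- reserve.
      ... | yes k≤c = inj₁ (LeafCycle.cliqueCycle G R B (λ _ _ → false) (λ _ _ ()) (λ _ _ ()) cl uq k 2≤k (≤-trans k≤c (≤-reflexive (sym len)))
            (≤-trans k≤c (≤-trans (m≤m+n c p) (reserve 0 (≤-trans (≤-reflexive (*-zeroʳ t)) z≤n)))))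

    module Node (V Y : Fin n → Bool) (W : List (Fin n)) (W≤ : length W ≤ w₁) (S : Separation (V ∖ W)) where
      open Separation S
      V₁ V₂ Y₁ Y₂ : Fin n → Bool
      V₁ x = (V ∖ W) x ∧ A x
      V₂ x = (V ∖ W) x ∧ not (A x)
      d₁ d₂ : Fin n → ℕ
      d₁ y = # (λ x → G x y ∧ V₁ x)
      d₂ y = # (λ x → G x y ∧ V₂ x)
      Y₁ y = Y y ∧ (d₂ y ≤ᵇ d₁ y)
      Y₂ y = Y y ∧ not (d₂ y ≤ᵇ d₁ y)

      -- No link crosses the separation, so the vertex b of the other side extends every independent
      -- set of V₁. As the same holds for V₂, the depth of the recursion is at most p.
      bound₁ : ∀ {f} → IndepBound V (suc f) → IndepBound V₁ f
      bound₁ bd xs s ind = ≤-pred (bd (b ∷ xs) (λ { (here refl) → ∧-fst {V b} (∧-fst {(V ∖ W) b} b∈) ; (there i) → ∧-fst {V _} (∧-fst {(V ∖ W) _} (s i)) })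
        (All.tabulate (λ {x} i → trans (Q-sym b x) (sep x b (s i) b∈)) ∷ ind))

      bound₂ : ∀ {f} → IndepBound V (suc f) → IndepBound V₂ f
      bound₂ bd xs s ind = ≤-pred (bd (a ∷ xs) (λ { (here refl) → ∧-fst {V a} (∧-fst {(V ∖ W) a} a∈) ; (there i) → ∧-fst {V _} (∧-fst {(V ∖ W) _} (s i)) })
        (All.tabulate (λ {x} i → sep a x a∈ (s i)) ∷ ind))

      heavy : Fin n → Bool
      heavy y = (τ ≤ᵇ d₁ y) ∧ (τ ≤ᵇ d₂ y)

      -- A product counts the pairs in V₁ × V₂ with common neighbour y, and by the separation all
      -- these pairs are unlinked.
      products : ∑ (λ y → d₁ y * d₂ y) ≤ ∑ (λ x → ∑ (λ x′ → 𝟙 (not (Q x x′)) * # (λ y → G x y ∧ G x′ y)))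
      products = ≤-trans (≤-reflexive (trans (∑-cong (λ y → trans (sym (∑-*ʳ (d₂ y) (λ x → 𝟙 (G x y ∧ V₁ x)))) (∑-cong (λ x → sym (∑-*ˡ (𝟙 (G x y ∧ V₁ x)) (λ x′ → 𝟙 (G x′ y ∧ V₂ x′)))))))
          (trans (∑-swap (λ y x → ∑ (λ x′ → 𝟙 (G x y ∧ V₁ x) * 𝟙 (G x′ y ∧ V₂ x′)))) (∑-cong (λ x → ∑-swap (λ y x′ → 𝟙 (G x y ∧ V₁ x) * 𝟙 (G x′ y ∧ V₂ x′)))))))
        (∑-mono₂ (λ x x′ → ≤-trans (∑-mono (λ y → pt x x′ y)) (≤-reflexive (∑-*ˡ (𝟙 (not (Q x x′))) (λ y → 𝟙 (G x y ∧ G x′ y))))))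
        where
        pt : ∀ x x′ y → 𝟙 (G x y ∧ V₁ x) * 𝟙 (G x′ y ∧ V₂ x′) ≤ 𝟙 (not (Q x x′)) * 𝟙 (G x y ∧ G x′ y)
        pt x x′ y with V₁ x in e₁ | V₂ x′ in e₂
        ... | true | true rewrite sep x x′ e₁ e₂ with G x y | G x′ y
        ...   | true | true = ≤-refl
        ...   | true | false = z≤n
        ...   | false | _ = z≤n
        pt x x′ y | true | false with G x y | G x′ y
        ...   | true | true = z≤n
        ...   | true | false = z≤n
        ...   | false | _ = z≤n
        pt x x′ y | false | _ with G x y
        ...   | true = z≤n
        ...   | false = z≤n

      heavy-few : # heavy ≤ cnt₀
      heavy-few = ≤-pred (*-cancelʳ-< (τ * τ) (# heavy) (suc cnt₀) (≤-trans (s≤s (≤-trans (≤-reflexive (sym (∑-*ʳ (τ * τ) (λ y → 𝟙 (heavy y)))))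
        (≤-trans (∑-mono pt) products))) sparse))
        where
        pt : ∀ y → 𝟙 (heavy y) * (τ * τ) ≤ d₁ y * d₂ y
        pt y with heavy y in e
        ... | false = z≤n
        ... | true = ≤-trans (≤-reflexive (*-identityˡ (τ * τ))) (*-mono-≤ (≤ᵇ-true {τ} {d₁ y} (∧-fst {τ ≤ᵇ d₁ y} e)) (≤ᵇ-true {τ} {d₂ y} (∧-snd {τ ≤ᵇ d₁ y} e)))

      cross : Fin n → Fin n → Bool
      cross x y = (G x y ∧ V₁ x) ∧ Y₂ y ∨ (G x y ∧ V₂ x) ∧ Y₁ y

      -- Y is divided by majority, so y loses only the smaller of its two degrees. This is below τ
      -- unless y is heavy, and heavy vertices are few because each adds at least τ² to the sum of
      -- products.
      cross-few : ∣ cross ∣ᴱ ≤ n * (τ + cnt₀)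
      cross-few = ≤-trans (≤-reflexive (∑-swap (λ x y → 𝟙 (cross x y)))) (≤-trans (∑-mono col) (≤-trans (≤-reflexive (trans (∑-+ (λ _ → τ) (λ y → 𝟙 (heavy y) * n)) (cong₂ _+_ (∑-const n τ) (∑-*ʳ n (λ y → 𝟙 (heavy y))))))
          (≤-trans (+-monoʳ-≤ (n * τ) (≤-trans (*-monoˡ-≤ n heavy-few) (≤-reflexive (*-comm cnt₀ n)))) (≤-reflexive (sym (*-distribˡ-+ n τ cnt₀))))))
        where
        bnd : ∀ y m → m ≤ d₁ y → m ≤ d₂ y → m ≤ n → m ≤ τ + 𝟙 (heavy y) * n
        bnd y m h₁ h₂ hn with τ ≤ᵇ d₁ y in e₁ | τ ≤ᵇ d₂ y in e₂
        ... | true | true = ≤-trans hn (≤-trans (≤-reflexive (sym (*-identityˡ n))) (m≤n+m _ τ))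
        ... | true | false = ≤-trans (≤-trans h₂ (<⇒≤ (≤ᵇ-false e₂))) (m≤m+n τ _)
        ... | false | _ = ≤-trans (≤-trans h₁ (<⇒≤ (≤ᵇ-false e₁))) (m≤m+n τ _)
        col : ∀ y → # (λ x → cross x y) ≤ τ + 𝟙 (heavy y) * n
        col y with d₂ y ≤ᵇ d₁ y in e
        ... | true = bnd y _ (≤-trans small₂ (≤ᵇ-true e)) small₂ (#-≤n (λ x → (G x y ∧ V₁ x) ∧ (Y y ∧ false) ∨ (G x y ∧ V₂ x) ∧ (Y y ∧ true)))
          where
          small₂ : # (λ x → (G x y ∧ V₁ x) ∧ (Y y ∧ false) ∨ (G x y ∧ V₂ x) ∧ (Y y ∧ true)) ≤ d₂ y
          small₂ = #-⊆ {P = λ x → (G x y ∧ V₁ x) ∧ (Y y ∧ false) ∨ (G x y ∧ V₂ x) ∧ (Y y ∧ true)} {Q = λ x → G x y ∧ V₂ x} λ x h → go (G x y ∧ V₁ x) (G x y ∧ V₂ x) (Y y) h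
            where
            go : ∀ a b c → a ∧ (c ∧ false) ∨ b ∧ (c ∧ true) ≡ true → b ≡ true
            go _ true _ _ = refl
            go true false true ()
            go true false false ()
            go false false _ ()
        ... | false = bnd y _ small₁ (≤-trans small₁ (<⇒≤ (≤ᵇ-false {d₂ y} e))) (#-≤n (λ x → (G x y ∧ V₁ x) ∧ (Y y ∧ true) ∨ (G x y ∧ V₂ x) ∧ (Y y ∧ false)))
          where
          small₁ : # (λ x → (G x y ∧ V₁ x) ∧ (Y y ∧ true) ∨ (G x y ∧ V₂ x) ∧ (Y y ∧ false)) ≤ d₁ y
          small₁ = #-⊆ {P = λ x → (G x y ∧ V₁ x) ∧ (Y y ∧ true) ∨ (G x y ∧ V₂ x) ∧ (Y y ∧ false)} {Q = λ x → G x y ∧ V₁ x} λ x h → go (G x y ∧ V₁ x) (G x y ∧ V₂ x) (Y y) h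
            where
            go : ∀ a b c → a ∧ (c ∧ true) ∨ b ∧ (c ∧ false) ≡ true → a ≡ true
            go true _ _ _ = refl
            go false true true ()
            go false true false ()
            go false false _ ()

      -- A bit is put in front of every label, so that labels are addresses of leaves in the
      -- recursion tree and the covers of different leaves are never added up. This is why `cov`
      -- does not grow.
      merge : ∀ {δ₁ δ₂ cov} → Struct G V₁ Y₁ δ₁ cov → Struct G V₂ Y₂ δ₂ cov → ∀ d → w₁ * n + n * (τ + cnt₀) + (δ₁ + δ₂) ≤ d → Struct G V Y d cov
      merge {δ₁} {δ₂} {cov} S₁ S₂ d dh = record
        { H = λ x y → S₁.H x y ∨ S₂.H x y
        ; H⊆ = λ x y e → [ sub₁ x y , sub₂ x y ]′ (∨-case {S₁.H x y} e)
        ; deleted = ≤-trans (E-∪ {P′ = λ x y → GVY V Y x y ∧ mem W x} {P″ = rest} cs₁) (≤-trans (+-mono-≤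
              (≤-trans (E-rows _ (mem W) (λ x y e → ∧-snd {GVY V Y x y} e)) (*-monoˡ-≤ n (≤-trans (#-mem W) W≤)))
              (≤-trans (E-∪ {P′ = cross} {P″ = rest′} cs₂) (+-mono-≤ cross-few (≤-trans (E-∪ {P′ = gone S₁} {P″ = gone S₂} cs₃) (+-mono-≤ S₁.deleted S₂.deleted)))))
              (≤-trans (≤-reflexive (sym (+-assoc (w₁ * n) _ _))) dh))
        ; rX = λ x → if A x then true ∷ S₁.rX x else false ∷ S₂.rX x
        ; rY = λ y → if d₂ y ≤ᵇ d₁ y then true ∷ S₁.rY y else false ∷ S₂.rY y
        ; C = λ x → if A x then S₁.C x else S₂.C x
        ; D = λ y → if d₂ y ≤ᵇ d₁ y then S₁.D y else S₂.D y
        ; same = sm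
        ; covered = cv
        ; small = λ { [] → ≤-trans (≤-reflexive (cong₂ _+_ (#-none (λ x → nil (A x) (S₁.rX x) (S₂.rX x) _)) (#-none (λ y → nil (d₂ y ≤ᵇ d₁ y) (S₁.rY y) (S₂.rY y) _)))) z≤n
                    ; (true ∷ l) → ≤-trans (+-mono-≤ (#-⊆ (λ x → left (A x) (S₁.rX x) (S₂.rX x) l (S₁.C x) (S₂.C x))) (#-⊆ (λ y → left (d₂ y ≤ᵇ d₁ y) (S₁.rY y) (S₂.rY y) l (S₁.D y) (S₂.D y)))) (S₁.small l)
                    ; (false ∷ l) → ≤-trans (+-mono-≤ (#-⊆ (λ x → right (A x) (S₁.rX x) (S₂.rX x) l (S₁.C x) (S₂.C x))) (#-⊆ (λ y → right (d₂ y ≤ᵇ d₁ y) (S₁.rY y) (S₂.rY y) l (S₁.D y) (S₂.D y)))) (S₂.small l) } }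
        where
        module S₁ = Struct S₁
        module S₂ = Struct S₂
        gone : ∀ {V Y d c} → Struct G V Y d c → Fin n → Fin n → Bool
        gone {V} {Y} S x y = GVY V Y x y ∧ not (Struct.H S x y)
        sub₁ : ∀ x y → S₁.H x y ≡ true → GVY V Y x y ≡ true
        sub₁ x y h with S₁.H⊆ x y h
        ... | e = ∧-intro (∧-fst {G x y} e) (∧-intro (∧-fst {V x} (∧-fst {(V ∖ W) x} (∧-fst {V₁ x} (∧-snd {G x y} e)))) (∧-fst {Y y} (∧-snd {V₁ x} (∧-snd {G x y} e))))
        sub₂ : ∀ x y → S₂.H x y ≡ true → GVY V Y x y ≡ true
        sub₂ x y h with S₂.H⊆ x y h
        ... | e = ∧-intro (∧-fst {G x y} e) (∧-intro (∧-fst {V x} (∧-fst {(V ∖ W) x} (∧-fst {V₂ x} (∧-snd {G x y} e)))) (∧-fst {Y y} (∧-snd {V₂ x} (∧-snd {G x y} e))))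
        rest rest′ : Fin n → Fin n → Bool
        rest x y = (G x y ∧ ((V ∖ W) x ∧ Y y)) ∧ not (S₁.H x y ∨ S₂.H x y)
        rest′ x y = rest x y ∧ not (cross x y)
        cs₁ : ∀ x y → GVY V Y x y ∧ not (S₁.H x y ∨ S₂.H x y) ≡ true → GVY V Y x y ∧ mem W x ≡ true ⊎ rest x y ≡ true
        cs₁ x y e with G x y | V x | Y y | mem W x
        ... | true | true | true | true = inj₁ refl
        ... | true | true | true | false = inj₂ e
        cs₁ x y () | true | true | false | _
        cs₁ x y () | true | false | _ | _
        cs₁ x y () | false | _ | _ | _
        cs₂ : ∀ x y → rest x y ≡ true → cross x y ≡ true ⊎ rest′ x y ≡ true
        cs₂ x y e with cross x y
        ... | true = inj₁ refl
        ... | false = inj₂ (∧-intro e refl)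
        cs₃ : ∀ x y → rest′ x y ≡ true → gone S₁ x y ≡ true ⊎ gone S₂ x y ≡ true
        cs₃ x y e = bl (G x y) ((V ∖ W) x) (A x) (Y y) (d₂ y ≤ᵇ d₁ y) (S₁.H x y) (S₂.H x y) e
          where
          bl : ∀ g v a y d h₁ h₂ → ((g ∧ (v ∧ y)) ∧ not (h₁ ∨ h₂)) ∧ not ((g ∧ (v ∧ a)) ∧ (y ∧ not d) ∨ (g ∧ (v ∧ not a)) ∧ (y ∧ d)) ≡ true →
            (g ∧ ((v ∧ a) ∧ (y ∧ d))) ∧ not h₁ ≡ true ⊎ (g ∧ ((v ∧ not a) ∧ (y ∧ not d))) ∧ not h₂ ≡ true
          bl true true true true true false false _ = inj₁ refl
          bl true true false true false false false _ = inj₂ refl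
          bl false v a y d h₁ h₂ ()
          bl true false a y d h₁ h₂ ()
          bl true true a false d h₁ h₂ ()
          bl true true a true d true h₂ ()
          bl true true a true d false true ()
          bl true true true true false false false ()
          bl true true false true true false false ()
        side₁ : ∀ x y → S₁.H x y ≡ true → A x ≡ true × (d₂ y ≤ᵇ d₁ y) ≡ true
        side₁ x y h = ∧-snd {(V ∖ W) x} (∧-fst {V₁ x} (∧-snd {G x y} (S₁.H⊆ x y h))) , ∧-snd {Y y} (∧-snd {V₁ x} (∧-snd {G x y} (S₁.H⊆ x y h)))
        side₂ : ∀ x y → S₂.H x y ≡ true → A x ≡ false × (d₂ y ≤ᵇ d₁ y) ≡ false
        side₂ x y h = not-false (∧-snd {(V ∖ W) x} (∧-fst {V₂ x} (∧-snd {G x y} (S₂.H⊆ x y h)))) , not-false (∧-snd {Y y} (∧-snd {V₂ x} (∧-snd {G x y} (S₂.H⊆ x y h))))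
        sm : ∀ x y → S₁.H x y ∨ S₂.H x y ≡ true → (if A x then true ∷ S₁.rX x else false ∷ S₂.rX x) ≡ (if d₂ y ≤ᵇ d₁ y then true ∷ S₁.rY y else false ∷ S₂.rY y)
        sm x y e = [ (λ h → if-true₂ _≡_ (side₁ x y h) (cong (true ∷_) (S₁.same x y h))) , (λ h → if-false₂ _≡_ (side₂ x y h) (cong (false ∷_) (S₂.same x y h))) ]′ (∨-case {S₁.H x y} e)
        cv : ∀ x y → S₁.H x y ∨ S₂.H x y ≡ true → (if A x then S₁.C x else S₂.C x) ∨ (if d₂ y ≤ᵇ d₁ y then S₁.D y else S₂.D y) ≡ true
        cv x y e = [ (λ h → if-true₂ (λ c d → c ∨ d ≡ true) (side₁ x y h) (S₁.covered x y h)) , (λ h → if-false₂ (λ c d → c ∨ d ≡ true) (side₂ x y h) (S₂.covered x y h)) ]′ (∨-case {S₁.H x y} e)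
        nil : ∀ a (r₁ r₂ : Label) e → does ((if a then true ∷ r₁ else false ∷ r₂) ≟ᴸ []) ∧ e ≡ false
        nil true _ _ _ = refl
        nil false _ _ _ = refl
        left : ∀ a (r₁ r₂ l : Label) e₁ e₂ → does ((if a then true ∷ r₁ else false ∷ r₂) ≟ᴸ (true ∷ l)) ∧ (if a then e₁ else e₂) ≡ true → does (r₁ ≟ᴸ l) ∧ e₁ ≡ true
        left true r₁ r₂ l e₁ e₂ h = ∧-intro (does-intro (r₁ ≟ᴸ l) (tl (does-true ((true ∷ r₁) ≟ᴸ (true ∷ l)) (∧-fst {does ((true ∷ r₁) ≟ᴸ (true ∷ l))} h)))) (∧-snd {does ((true ∷ r₁) ≟ᴸ (true ∷ l))} h)
          where
          tl : _≡_ {A = Label} (true ∷ r₁) (true ∷ l) → r₁ ≡ l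
          tl refl = refl
        left false r₁ r₂ l e₁ e₂ ()
        right : ∀ a (r₁ r₂ l : Label) e₁ e₂ → does ((if a then true ∷ r₁ else false ∷ r₂) ≟ᴸ (false ∷ l)) ∧ (if a then e₁ else e₂) ≡ true → does (r₂ ≟ᴸ l) ∧ e₂ ≡ true
        right false r₁ r₂ l e₁ e₂ h = ∧-intro (does-intro (r₂ ≟ᴸ l) (tl (does-true ((false ∷ r₂) ≟ᴸ (false ∷ l)) (∧-fst {does ((false ∷ r₂) ≟ᴸ (false ∷ l))} h)))) (∧-snd {does ((false ∷ r₂) ≟ᴸ (false ∷ l))} h)
          where
          tl : _≡_ {A = Label} (false ∷ r₂) (false ∷ l) → r₂ ≡ l
          tl refl = refl
        right true r₁ r₂ l e₁ e₂ ()

    private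
      D₀-parts : ∀ f → D₀ ≤ del f
      D₀-parts zero = ≤-refl
      D₀-parts (suc f) = m≤m+n D₀ _

      W₀ : ℕ
      W₀ = suc p * (2 * p) + 0

      W₀≤ : ∀ {w} → w ≤ W₀ → w ≤ w₁
      W₀≤ h = ≤-trans h (≤-trans (≤-reflexive (+-identityʳ _)) (≤-trans (m≤m+n _ c) (m≤m+n _ _)))

    -- The recursion is on the bound f for independent sets, while dominating sets and cliques are
    -- sought with the fixed p, so that all nodes share the same constants.
    decompose : ∀ f V Y → f ≤ p → IndepBound V f → (∀ y → Y y ≡ true → R y ≡ false) → Cyc G k ⊎ Struct G V Y (del f) (k + z)
    decompose f V Y f≤p bound Y∩R with layers V p (λ xs s i → ≤-trans (bound xs s i) f≤p) (suc p) []
    ... | inj₂ ob with Obstruction.obstructed ob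
    ...   | inj₁ none = inj₂ (trivial V Y (mem W) V⊆W (del f) (≤-trans (*-monoˡ-≤ n (≤-trans (#-mem W) (W₀≤ (Obstruction.W-small ob)))) (≤-trans (≤-trans (m≤m+n _ _) (m≤m+n _ _)) (D₀-parts f))))
      where
      W = Obstruction.W ob
      V⊆W : ∀ x → V x ≡ true → mem W x ≡ true
      V⊆W x Vx with mem W x | none x
      ... | true | _ = refl
      ... | false | h rewrite Vx = ⊥-elim (true≢false refl h)
    ...   | inj₂ S = node f f≤p bound
      where
      open Node V Y (Obstruction.W ob) (W₀≤ (Obstruction.W-small ob)) S
      node : ∀ f → f ≤ p → IndepBound V f → Cyc G k ⊎ Struct G V Y (del f) (k + z)
      node zero f≤p bound = ⊥-elim (<⇒≱ (s≤s z≤n) (bound (Separation.a S ∷ []) (λ { (here refl) → ∧-fst {V _} (∧-fst {(V ∖ Obstruction.W ob) _} (Separation.a∈ S)) }) ([] ∷ [])))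
      node (suc f) f≤p bound with decompose f V₁ Y₁ (<⇒≤ f≤p) (bound₁ bound) (λ y h → Y∩R y (∧-fst {Y y} h))
      ... | inj₁ cy = inj₁ cy
      ... | inj₂ S₁ with decompose f V₂ Y₂ (<⇒≤ f≤p) (bound₂ bound) (λ y h → Y∩R y (∧-fst {Y y} h))
      ... | inj₁ cy = inj₁ cy
      ... | inj₂ S₂ = inj₂ (merge S₁ S₂ (del (suc f)) (+-monoˡ-≤ (del f + del f) (m≤m+n (w₁ * n + n * (τ + cnt₀)) (B * (n + n)))))
    decompose f V Y f≤p bound Y∩R | inj₁ ly = dispatch (ram (suc p) c ≤? length rest)
      where
      module Ly = Layers ly
      U : Fin n → Bool
      U = V ∖ (concat Ly.Ls ++ [])
      rest = elems U
      dispatch : Dec (ram (suc p) c ≤ length rest) → Cyc G k ⊎ Struct G V Y (del f) (k + z)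
      dispatch (no ¬h) = inj₂ (trivial V Y (λ x → mem (concat Ly.Ls ++ []) x ∨ U x) V⊆ (del f)
          (≤-trans (*-monoˡ-≤ n (≤-trans (#-∪ {Q = mem (concat Ly.Ls ++ [])} {R = U} (λ x → ∨-case)) (≤-trans (+-mono-≤ (≤-trans (#-mem (concat Ly.Ls ++ [])) (≤-trans (≤-reflexive (cong length (++-identityʳ (concat Ly.Ls)))) Ly.small))
              (≤-trans (≤-reflexive (sym (elems-length U))) (<⇒≤ (≰⇒> ¬h)))) (+-monoˡ-≤ (ram (suc p) c) (m≤m+n _ c))))) (≤-trans (≤-trans (m≤m+n _ _) (m≤m+n _ _)) (D₀-parts f))))
        where
        V⊆ : ∀ x → V x ≡ true → mem (concat Ly.Ls ++ []) x ∨ U x ≡ true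
        V⊆ x Vx with mem (concat Ly.Ls ++ []) x
        ... | true = refl
        ... | false = ∧-intro Vx refl
      dispatch (yes h) with ramsey (suc p) c rest (elems-unique U) h
      ... | inj₁ (is , s , ind , l) = ⊥-elim (<⇒≱ (≤-reflexive (sym l)) (≤-trans (bound is (λ i → ∧-fst {V _} (elems-sound U (s i))) ind) f≤p))
      ... | inj₂ (cs , s , cl , uq , l) = pieces cs cl uq (λ i → elems-sound U (s i)) l
        where
        pieces : ∀ cs → Clique cs → Unique cs → (∀ {x} → x ∈ cs → U x ≡ true) → length cs ≡ c → Cyc G k ⊎ Struct G V Y (del f) (k + z)
        pieces [] _ _ _ l = ⊥-elim (<⇒≱ (≤-trans (s≤s (s≤s z≤n)) (≤-trans (m≤n+m 2 (suc p * (2 * p))) (m≤m+n c₁ t))) (≤-trans (≤-reflexive (sym l)) (z≤n {1})))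
        pieces (_ ∷ []) _ _ _ l = ⊥-elim (<⇒≱ (≤-trans (m≤n+m 2 (suc p * (2 * p))) (m≤m+n c₁ t)) (≤-reflexive (sym l)))
        pieces (u ∷ v ∷ ws) cl uq clU l = Leaf.leaf V Y (λ xs s i → ≤-trans (bound xs s i) f≤p) Y∩R ly cl uq clU l (del f)
          (≤-trans (+-monoˡ-≤ (B * (n + n)) (m≤m+n (w₁ * n) (n * (τ + cnt₀)))) (D₀-parts f))

-- Independent sets of the linking graph

module IndependentSets {n : ℕ} (G : Fin n → Fin n → Bool) (R : Fin n → Bool) (B D p : ℕ)
  (2pB≤D : 2 * (p * B) ≤ D) (2R<pD : 2 * # R < suc p * D) where

  open Assembly G R B

  nbr : Fin n → Fin n → Bool
  nbr x y = R y ∧ G x y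

  rich : Fin n → Bool
  rich x = D ≤ᵇ # (nbr x)

  union : List (Fin n) → Fin n → Bool
  union [] y = false
  union (x ∷ xs) y = nbr x y ∨ union xs y

  overlap≤ : ∀ x xs → All (λ x′ → Q x x′ ≡ false) xs → # (λ y → nbr x y ∧ union xs y) ≤ length xs * B
  overlap≤ x [] _ = ≤-reflexive (#-none λ y → ∧-zeroʳ (nbr x y))
  overlap≤ x (x′ ∷ xs) (q ∷ qs) = ≤-trans (#-∪ {Q = common x x′} {R = λ y → nbr x y ∧ union xs y} (λ y → cases (R y) (G x y) (G x′ y) (union xs y)))
    (+-mono-≤ (<⇒≤ (≤ᵇ-false {B} q)) (overlap≤ x xs qs))
    where
    cases : ∀ r g g′ u → (r ∧ g) ∧ ((r ∧ g′) ∨ u) ≡ true → r ∧ (g ∧ g′) ≡ true ⊎ (r ∧ g) ∧ u ≡ true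
    cases true true true u _ = inj₁ refl
    cases true true false true _ = inj₂ refl

  -- A new neighbourhood of size at least D meets each of the at most p earlier ones in fewer than B
  -- vertices. It loses at most pB ≤ D/2 and adds at least D/2 to the union.
  union-grows : ∀ xs → length xs ≤ suc p → xs ⊑ rich → Indep xs → length xs * D ≤ 2 * # (union xs)
  union-grows [] _ _ _ = z≤n
  union-grows (x ∷ xs) (s≤s l≤p) r (q ∷ ind) = lin 8 (λ D l N u u′ o B p → K 1 · l :* D ≼ K 2 :* u ⇒ K 2 · D ≼ N ⇒ K 2 · N :+ u ≼ u′ :+ o ⇒ K 2 · o ≼ l :* B ⇒ K 2 :* B · l ≼ p ⇒ K 1 · K 2 :* (p :* B) ≼ D ⇒
      ⊢ 1 · D :+ l :* D ≼ K 2 :* u′) refl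
      D (length xs) (# (nbr x)) (# (union xs)) (# (union (x ∷ xs))) (# (λ y → nbr x y ∧ union xs y)) B p
      (union-grows xs (≤-trans l≤p (n≤1+n p)) (λ i → r (there i)) ind) (≤ᵇ-true (r (here refl)))
      (≤-trans (≤-reflexive (sym (∑-+ (λ y → 𝟙 (nbr x y)) (λ y → 𝟙 (union xs y))))) (≤-trans (∑-mono (λ y → pt (nbr x y) (union xs y)))
        (≤-reflexive (∑-+ (λ y → 𝟙 (nbr x y ∨ union xs y)) (λ y → 𝟙 (nbr x y ∧ union xs y))))))
      (overlap≤ x xs q) l≤p 2pB≤D
    where
    pt : ∀ a b → 𝟙 a + 𝟙 b ≤ 𝟙 (a ∨ b) + 𝟙 (a ∧ b)
    pt true true = ≤-refl
    pt true false = ≤-refl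
    pt false b = ≤-reflexive (sym (+-identityʳ _))

  union⊆R : ∀ xs y → union xs y ≡ true → R y ≡ true
  union⊆R (x ∷ xs) y e with ∨-case {nbr x y} e
  ... | inj₁ h = ∧-fst {R y} h
  ... | inj₂ h = union⊆R xs y h

  rich-bound : IndepBound rich p
  rich-bound xs s ind with length xs ≤? p
  ... | yes h = h
  ... | no ¬h = ⊥-elim (<⇒≱ 2R<pD (≤-trans (subst (λ l → l * D ≤ 2 * # (union (take (suc p) xs))) len
        (union-grows (take (suc p) xs) (≤-reflexive len) (λ i → s (take-⊆ (suc p) xs i)) (AllPairs.take⁺ (suc p) ind)))
        (*-monoʳ-≤ 2 (#-⊆ (union⊆R (take (suc p) xs))))))
    where
    len : length (take (suc p) xs) ≡ suc p
    len = trans (length-take (suc p) xs) (m≤n⇒m⊓n≡m (≰⇒> ¬h))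

-- Choice of the reserve

module Reserve {n : ℕ} (G : Fin n → Fin n → Bool) (t : ℕ) (0<t : 0 < t) (0<n : 0 < n) where

  private
    -- One index set for codegrees, degrees and the whole of Y. Neighbourhoods are repeated for
    -- every x′ and Y for every pair, so that dividing the common second moment bound by n and by n²
    -- leaves each family a bound of its own scale.
    J : Set
    J = Fin n × (Fin n × Fin 3)

    SJ : Summation J
    SJ = productSummation (finSummation n) (productSummation (finSummation n) (finSummation 3))

    codegᴮ : Fin n → Fin n → Fin n → Bool
    codegᴮ x x′ y = G x y ∧ G x′ y

    A : J → Fin n → Bool
    A (x , x′ , zero) = codegᴮ x x′
    A (x , x′ , suc zero) = G x
    A (x , x′ , suc (suc zero)) = λ _ → true

    open Splitting SJ t 0<t
    open Summation SJ

    abstract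
      parts : ∃ λ c → sumJ (λ j → ∑ (λ a → dev A c j a * dev A c j a)) ≤ t * t * sumJ (λ j → # (A j))
      parts = equitable A

    c = proj₁ parts

    a₀ : Fin t
    a₀ = fromℕ< 0<t

  R : Fin n → Bool
  R y = c y == a₀

  private
    dv : (Fin n → Bool) → ℕ
    dv P = ∣ t * # (λ y → P y ∧ R y) - # P ∣

    N³ : ℕ
    N³ = t * t * (n * (n * (3 * n)))

    total : ∑ (λ x → ∑ (λ x′ → dv (codegᴮ x x′) * dv (codegᴮ x x′) + (dv (G x) * dv (G x) + dv (λ _ → true) * dv (λ _ → true)))) ≤ N³
    total = ≤-trans (∑-mono₂ λ x x′ → ≤-trans (+-mono-≤ (one (x , x′ , zero)) (+-mono-≤ (one (x , x′ , suc zero)) (one (x , x′ , suc (suc zero))))) (≤-reflexive (three (λ i → ∑ (λ a → dev A c (x , x′ , i) a * dev A c (x , x′ , i) a)))))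
      (≤-trans (proj₂ parts) (*-monoʳ-≤ (t * t) (∑-≤-const _ (n * (3 * n)) λ x → ∑-≤-const _ (3 * n) λ x′ → ∑-≤-const _ n (λ i → #-≤n (A (x , x′ , i))))))
      where
      one : ∀ j → dev A c j a₀ * dev A c j a₀ ≤ ∑ (λ a → dev A c j a * dev A c j a)
      one j = ∑-member (λ a → dev A c j a * dev A c j a) a₀
      three : ∀ (f : Fin 3 → ℕ) → f zero + (f (suc zero) + f (suc (suc zero))) ≡ ∑ f
      three f = cong (f zero +_) (cong (f (suc zero) +_) (sym (+-identityʳ _)))

    total₀ : ∑ (λ x → ∑ (λ x′ → dv (codegᴮ x x′) * dv (codegᴮ x x′))) ≤ N³
    total₀ = ≤-trans (∑-mono₂ {f = λ x x′ → dv (codegᴮ x x′) * dv (codegᴮ x x′)} (λ x x′ → m≤m+n _ (dv (G x) * dv (G x) + dv (λ _ → true) * dv (λ _ → true)))) total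

    total₁ : ∑ (λ x → dv (G x) * dv (G x)) ≤ t * t * (n * (3 * n))
    total₁ = *-cancelˡ-≤ n {{Data.Nat.>-nonZero 0<n}} (≤-trans (≤-reflexive (trans (sym (∑-*ˡ n (λ x → dv (G x) * dv (G x)))) (∑-cong (λ x → sym (∑-const n (dv (G x) * dv (G x)))))))
      (≤-trans (∑-mono₂ (λ x x′ → ≤-trans (m≤m+n _ (dv (λ _ → true) * dv (λ _ → true))) (m≤n+m _ (dv (codegᴮ x x′) * dv (codegᴮ x x′))))) (≤-trans total (≤-reflexive (re t n (n * (3 * n)))))))
      where
      re : ∀ t n m → t * t * (n * m) ≡ n * (t * t * m)
      re = solve-∀

    total₂ : dv (λ _ → true) * dv (λ _ → true) ≤ t * t * (3 * n)
    total₂ = *-cancelˡ-≤ n {{Data.Nat.>-nonZero 0<n}} (*-cancelˡ-≤ n {{Data.Nat.>-nonZero 0<n}} (≤-trans (≤-reflexive (trans (cong (n *_) (sym (∑-const n (dv (λ _ → true) * dv (λ _ → true))))) (sym (∑-const n _))))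
      (≤-trans (∑-mono₂ (λ x x′ → ≤-trans (m≤n+m _ (dv (G x) * dv (G x))) (m≤n+m _ (dv (codegᴮ x x′) * dv (codegᴮ x x′))))) (≤-trans total (≤-reflexive (re t n (3 * n)))))))
      where
      re : ∀ t n m → t * t * (n * (n * m)) ≡ n * (n * (t * t * m))
      re = solve-∀

    dv-lo : ∀ P → # P ≤ t * # (λ y → P y ∧ R y) + dv P
    dv-lo P = m≤n+∣n-m∣ (# P) (t * # (λ y → P y ∧ R y))

    dv-hi : ∀ P → t * # (λ y → P y ∧ R y) ≤ # P + dv P
    dv-hi P = m≤n+∣m-n∣ (t * # (λ y → P y ∧ R y)) (# P)

    flip-R : ∀ (P : Fin n → Bool) → # (λ y → P y ∧ R y) ≤ # (λ y → R y ∧ P y)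
    flip-R P = #-⊆ (λ y h → ∧-intro (∧-snd {P y} h) (∧-fst {P y} h))

  -- A larger R would deviate from its share by at least n, whereas the square of this deviation is
  -- at most 3t²n.
  size : 3 * (t * t) < n → t * # R ≤ 2 * n
  size lt with t * # R ≤? 2 * n
  ... | yes h = h
  ... | no ¬h = ⊥-elim (<⇒≱ (*-monoʳ-< n {{Data.Nat.>-nonZero 0<n}} lt) (lin 3 (λ n d t → d :+ n · n ≼ d ⇒ K 1 · d :* d ≼ t :* t :* (K 3 :* n) ⇒ ⊢ 1 · n :* n ≼ n :* (K 3 :* (t :* t))) refl
        n (dv (λ _ → true)) t big total₂))
    where
    big : n ≤ dv (λ _ → true)
    big = lin 4 (λ n d r m → K 1 · Suc (K 2 :* n) ≼ r ⇒ K 1 · r ≼ m :+ d ⇒ K 1 · m ≼ n ⇒ ⊢ 1 · n ≼ d) refl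
      n (dv (λ _ → true)) (t * # R) (# {n} (λ _ → true)) (≰⇒> ¬h) (dv-hi (λ _ → true)) (#-≤n {n} (λ _ → true))

  module _ (D a : ℕ) (num : 3 * (n * n) < suc a * (D * D)) where

    poor : Fin n → Bool
    poor x = (2 * (t * D) ≤ᵇ # (G x)) ∧ not (D ≤ᵇ # (λ y → R y ∧ G x y))

    -- Chebyshev's inequality: a poor vertex has degree at least 2tD but fewer than D neighbours in
    -- R, so its deviation is at least tD.
    poor-few : # poor ≤ a
    poor-few = ≤-pred (*-cancelʳ-< (D * D) (# poor) (suc a) (≤-trans (s≤s (*-cancelˡ-≤ (t * t) {{Data.Nat.>-nonZero (*-mono-≤ 0<t 0<t)}} (≤-trans (≤-reflexive (re t (# poor) D))
        (≤-trans (≤-reflexive (sym (∑-*ʳ (t * D * (t * D)) (λ x → 𝟙 (poor x))))) (≤-trans (∑-mono pt) (≤-trans total₁ (≤-reflexive (cong (t * t *_) (re′ n))))))))) num))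
      where
      re : ∀ t p D → t * t * (p * (D * D)) ≡ p * (t * D * (t * D))
      re = solve-∀
      re′ : ∀ n → n * (3 * n) ≡ 3 * (n * n)
      re′ = solve-∀
      pt : ∀ x → 𝟙 (poor x) * (t * D * (t * D)) ≤ dv (G x) * dv (G x)
      pt x with poor x in e
      ... | false = z≤n
      ... | true = ≤-trans (≤-reflexive (*-identityˡ _)) (*-mono-≤ dv≥ dv≥)
        where
        dv≥ : t * D ≤ dv (G x)
        dv≥ = lin 6 (λ t D g r r′ d → K 1 · K 2 :* (t :* D) ≼ g ⇒ K 1 · g ≼ t :* r :+ d ⇒ t · r ≼ r′ ⇒ t · r′ ≼ D ⇒ ⊢ 1 · t :* D ≼ d) refl
          t D (# (G x)) (# (λ y → G x y ∧ R y)) (# (λ y → R y ∧ G x y)) (dv (G x)) (≤ᵇ-true {2 * (t * D)} (∧-fst e)) (dv-lo (G x)) (flip-R (G x))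
          (<⇒≤ (≤ᵇ-false {D} (not-false (∧-snd {2 * (t * D) ≤ᵇ # (G x)} e))))

  module _ (B : ℕ) where
    open Assembly G R B using (Q)

    private
      bad : Fin n → Fin n → Bool
      bad x x′ = not (Q x x′) ∧ (2 * (t * B) ≤ᵇ # (codegᴮ x x′))

    -- An unlinked pair of codegree at least 2tB deviates by at least tB, so the second moment
    -- limits the number b of such pairs; every other unlinked pair contributes less than 2tB. This
    -- is what makes the cut along a separation sparse.
    sparsity : ∃ λ b → b * (B * B) ≤ 3 * (n * (n * n)) ×
      ∑ (λ x → ∑ (λ x′ → 𝟙 (not (Q x x′)) * # (λ y → G x y ∧ G x′ y))) ≤ n * (n * (2 * (t * B))) + b * n
    sparsity = ∣ bad ∣ᴱ
      , *-cancelˡ-≤ (t * t) {{Data.Nat.>-nonZero (*-mono-≤ 0<t 0<t)}} (≤-trans (≤-reflexive (re t ∣ bad ∣ᴱ B)) (≤-trans (≤-reflexive (sym (trans (∑-cong (λ x → ∑-*ʳ (t * B * (t * B)) (λ x′ → 𝟙 (bad x x′)))) (∑-*ʳ (t * B * (t * B)) (λ x → # (bad x))))))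
          (≤-trans (∑-mono₂ pt) (≤-trans total₀ (≤-reflexive (cong (t * t *_) (re′ n)))))))
      , ≤-trans (∑-mono₂ pt′) (≤-reflexive (trans (∑-+₂ (λ _ _ → 2 * (t * B)) (λ x x′ → 𝟙 (bad x x′) * n)) (cong₂ _+_ (trans (∑-cong {n} (λ x → ∑-const n (2 * (t * B)))) (∑-const n _))
          (trans (∑-cong (λ x → ∑-*ʳ n (λ x′ → 𝟙 (bad x x′)))) (∑-*ʳ n (λ x → # (bad x)))))))
      where
      re : ∀ t p D → t * t * (p * (D * D)) ≡ p * (t * D * (t * D))
      re = solve-∀
      re′ : ∀ n → n * (n * (3 * n)) ≡ 3 * (n * (n * n))
      re′ = solve-∀
      pt : ∀ x x′ → 𝟙 (bad x x′) * (t * B * (t * B)) ≤ dv (codegᴮ x x′) * dv (codegᴮ x x′)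
      pt x x′ with bad x x′ in e
      ... | false = z≤n
      ... | true = ≤-trans (≤-reflexive (*-identityˡ _)) (*-mono-≤ dv≥ dv≥)
        where
        dv≥ : t * B ≤ dv (codegᴮ x x′)
        dv≥ = lin 6 (λ t D g r r′ d → K 1 · K 2 :* (t :* D) ≼ g ⇒ K 1 · g ≼ t :* r :+ d ⇒ t · r ≼ r′ ⇒ t · r′ ≼ D ⇒ ⊢ 1 · t :* D ≼ d) refl
          t B (# (codegᴮ x x′)) (# (λ y → codegᴮ x x′ y ∧ R y)) (# (λ y → R y ∧ codegᴮ x x′ y)) (dv (codegᴮ x x′)) (≤ᵇ-true {2 * (t * B)} (∧-snd {not (Q x x′)} e)) (dv-lo (codegᴮ x x′)) (flip-R (codegᴮ x x′))
          (<⇒≤ (≤ᵇ-false {B} (not-false (∧-fst {not (Q x x′)} e))))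
      pt′ : ∀ x x′ → 𝟙 (not (Q x x′)) * # (λ y → G x y ∧ G x′ y) ≤ 2 * (t * B) + 𝟙 (bad x x′) * n
      pt′ x x′ with not (Q x x′)
      ... | false = z≤n
      ... | true with 2 * (t * B) ≤ᵇ # (codegᴮ x x′) in e
      ... | true = ≤-trans (≤-reflexive (*-identityˡ _)) (≤-trans (#-≤n (codegᴮ x x′)) (≤-trans (≤-reflexive (sym (*-identityˡ n))) (m≤n+m _ (2 * (t * B)))))
      ... | false = ≤-trans (≤-reflexive (*-identityˡ _)) (≤-trans (<⇒≤ (≤ᵇ-false {2 * (t * B)} e)) (m≤m+n _ 0))

-- The removal statement and its constants

everything : ∀ {n} → Fin n → Bool
everything _ = true

widen : ∀ {n} {G : Fin n → Fin n → Bool} {V Y d c} → Struct G V Y d c → Struct G everything everything (d + ∣ (λ x y → G x y ∧ not (V x ∧ Y y)) ∣ᴱ) c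
widen {G = G} {V} {Y} S = record { H = H ; H⊆ = λ x y h → ∧-intro (∧-fst {G x y} (H⊆ x y h)) refl
    ; deleted = ≤-trans (E-∪ {P′ = λ x y → (G x y ∧ (V x ∧ Y y)) ∧ not (H x y)} {P″ = λ x y → G x y ∧ not (V x ∧ Y y)} cs) (+-monoˡ-≤ _ deleted)
    ; rX = rX ; rY = rY ; C = C ; D = D ; same = same ; covered = covered ; small = small }
  where
  open Struct S
  cs : ∀ x y → (G x y ∧ true) ∧ not (H x y) ≡ true → (G x y ∧ (V x ∧ Y y)) ∧ not (H x y) ≡ true ⊎ G x y ∧ not (V x ∧ Y y) ≡ true
  cs x y e with G x y | V x ∧ Y y
  ... | true | true = inj₁ e
  ... | true | false = inj₂ refl

outside-few : ∀ {n} (G : Fin n → Fin n → Bool) (V R : Fin n → Bool) d a (poor : Fin n → Bool) → # poor ≤ a →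
  (∀ x → V x ≡ false → d ≤ # (G x) → poor x ≡ true) → ∣ (λ x y → G x y ∧ not (V x ∧ not (R y))) ∣ᴱ ≤ (n * d + a * n) + # R * n
outside-few {n} G V R d a poor poor≤ h = ≤-trans (E-∪ {P′ = λ x y → G x y ∧ not (V x)} {P″ = λ x y → R y} cs) (+-mono-≤ rows cols)
  where
  cs : ∀ x y → G x y ∧ not (V x ∧ not (R y)) ≡ true → G x y ∧ not (V x) ≡ true ⊎ R y ≡ true
  cs x y e with G x y | V x | R y
  ... | true | false | _ = inj₁ refl
  ... | true | true | true = inj₂ refl
  cols : ∣ (λ (x y : Fin n) → R y) ∣ᴱ ≤ # R * n
  cols = ≤-reflexive (trans (∑-const n (# R)) (*-comm n (# R)))
  row : ∀ x → # (λ y → G x y ∧ not (V x)) ≤ d + 𝟙 (poor x) * n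
  row x with V x in ev | d ≤? # (G x)
  ... | true | _ = ≤-trans (≤-reflexive (#-none (λ y → ∧-zeroʳ (G x y)))) z≤n
  ... | false | yes le rewrite h x ev le = ≤-trans (#-≤n (λ y → G x y ∧ true)) (≤-trans (≤-reflexive (sym (*-identityˡ n))) (m≤n+m _ d))
  ... | false | no gt = ≤-trans (#-⊆ {Q = G x} (λ y → ∧-fst)) (≤-trans (<⇒≤ (≰⇒> gt)) (m≤m+n d _))
  rows : ∣ (λ x y → G x y ∧ not (V x)) ∣ᴱ ≤ n * d + a * n
  rows = ≤-trans (∑-mono row) (≤-trans (≤-reflexive (trans (∑-+ (λ _ → d) (λ x → 𝟙 (poor x) * n)) (cong₂ _+_ (∑-const n d) (∑-*ʳ n (λ x → 𝟙 (poor x))))))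
    (+-monoʳ-≤ (n * d) (*-monoˡ-≤ n poor≤)))

-- Quantities proportional to n are taken as exact multiples of v, the rounded quotient of n by m;
-- what the rounding loses is at most a factor of 2.
quotient : ∀ m v₀ n → 1 ≤ m → 1 ≤ v₀ → v₀ * m ≤ n → ∃ λ v → v₀ ≤ v × m * v ≤ n × n ≤ 2 * (m * v)
quotient m v₀ n 1≤m 1≤v₀ v₀m≤n = n / m , v₀≤v , ≤-trans (≤-reflexive (*-comm m (n / m))) (m/n*n≤m n m) ,
  ≤-trans (≤-reflexive (m≡m%n+[m/n]*n n m))
    (lin 3 (λ r q m → K 1 · r ≼ m ⇒ m · K 1 ≼ q ⇒ ⊢ 1 · r :+ q :* m ≼ K 2 :* (m :* q)) refl (n % m) (n / m) m (<⇒≤ (m%n<n n m)) (≤-trans 1≤v₀ v₀≤v))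
  where
  instance
    m≢0 : Data.Nat.NonZero m
    m≢0 = Data.Nat.>-nonZero 1≤m
  v₀≤v : v₀ ≤ n / m
  v₀≤v = ≤-trans (≤-reflexive (sym (m*n/n≡m v₀ m))) (/-monoˡ-≤ m v₀m≤n)

trivial : ∀ {n} (G : Fin n → Fin n → Bool) k → n ≤ k → Struct G everything everything 0 k
trivial {n} G k n≤k = record
  { H = G ; H⊆ = λ x y h → ∧-intro h refl ; deleted = ≤-reflexive (trans (∑-cong (λ x → #-none (λ y → none (G x y)))) (∑-0 n))
  ; rX = λ _ → [] ; rY = λ _ → [] ; C = everything ; D = λ _ → false ; same = λ _ _ _ → refl ; covered = λ _ _ _ → refl
  ; small = λ l → ≤-trans (+-mono-≤ (#-≤n {n} (λ x → does ([] ≟ᴸ l) ∧ true)) (≤-reflexive (#-none {n} {P = λ y → does ([] ≟ᴸ l) ∧ false} (λ _ → ∧-zeroʳ (does ([] ≟ᴸ l)))))) (≤-trans (≤-reflexive (+-identityʳ n)) n≤k) }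
  where
  none : ∀ g → (g ∧ true) ∧ not g ≡ false
  none true = refl
  none false = refl

-- The hierarchy of constants, chosen in this order: 1/e ≫ 1/t₀ ≫ 1/p ≫ 1/τ₀ ≫ 1/β ≫ 1/t ≫ 1/θ₀ ≫ 1/n.
module Constants (e t₀ p Nn τ₀ D₀ β t t₁ θ₀ A a w : ℕ)
  (1≤e : 1 ≤ e) (t₀≡ : t₀ ≡ 16 * e) (p≡ : p ≡ 128 * e) (Nn≡ : Nn ≡ 2 ^ suc p) (τ₀≡ : τ₀ ≡ 4096 * (e * e) * (t₀ * t₀ * t₀) * (Nn * Nn)) (D₀≡ : D₀ ≡ Nn * τ₀)
  (β≡ : β ≡ 16 * e * t₀ * D₀) (t≡ : t ≡ 8 * β) (t≡₁ : t ≡ suc t₁) (0<t₁ : 0 < t₁) (θ₀≡ : θ₀ ≡ 8 * e * (3 * t + 1)) (A≡ : A ≡ 4 * (t * t) * β * (θ₀ * θ₀)) (a≡ : a ≡ 3072 * (e * e) * (t₀ * t₀))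
  (w≡ : w ≡ suc p * (2 * p) + (suc p * (2 * p) + 2 + t) + ram (suc p) (suc p * (2 * p) + 2 + t))
  (1≤Nn : 1 ≤ Nn) (p<Nn : p < Nn) (1≤β : 1 ≤ β) (1≤θ₀ : 1 ≤ θ₀) (2≤τ₀ : 2 ≤ τ₀) where

  -- Every lower bound on v that some estimate needs, added up: for the size of R, the sparsity, the
  -- supply of reserve vertices, the slack, and the vertices discarded and poor in the edge budget.
  v₀ : ℕ
  v₀ = 1 + (3 * (t₀ * t₀) + 1) + 12 * (β * β) + 4 * (suc p * (2 * p) + 2 + t + p) + 4 * e * ((t * (t + 1) + 1) * A) + e + 8 * e * Nn * w + 8 * e * a

  module Sizes {n : ℕ} (G : Fin n → Fin n → Bool) (k : ℕ) (2≤k : 2 ≤ k) (k<n : k < n) (v z : ℕ) (v₀≤v : v₀ ≤ v)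
    (ez≤n : e * z ≤ n) (n≤2ez : n ≤ 2 * (e * z)) (lo : β * (θ₀ * v) ≤ n) (hi : n ≤ 2 * (β * (θ₀ * v))) where

    B D τ : ℕ
    B = θ₀ * v
    D = D₀ * B
    τ = τ₀ * B

    v≤B : v ≤ B
    v≤B = lin 2 (λ θ v → v · K 1 ≼ θ ⇒ ⊢ 1 · v ≼ θ :* v) refl θ₀ v 1≤θ₀

    B≤n : B ≤ n
    B≤n = lin 3 (λ β B n → B · K 1 ≼ β ⇒ K 1 · β :* B ≼ n ⇒ ⊢ 1 · B ≼ n) refl β B n 1≤β lo

    private
      x₁ x₂ x₃ x₄ x₅ x₆ : ℕ
      x₁ = 3 * (t₀ * t₀) + 1
      x₂ = 12 * (β * β)
      x₃ = 4 * (suc p * (2 * p) + 2 + t + p)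
      x₄ = 4 * e * ((t * (t + 1) + 1) * A)
      x₅ = 8 * e * Nn * w
      x₆ = 8 * e * a

      each : ∀ {x y} → x ≤ y → y ≤ v₀ → x ≤ v
      each h g = ≤-trans h (≤-trans g v₀≤v)

      s₆ s₅ s₄ s₃ s₂ s₁ : ℕ
      s₁ = 1 + x₁
      s₂ = s₁ + x₂
      s₃ = s₂ + x₃
      s₄ = s₃ + x₄
      s₅ = s₄ + e
      s₆ = s₅ + x₅

      l₆ : s₆ ≤ v₀
      l₆ = m≤m+n s₆ x₆
      l₅ : s₅ ≤ v₀
      l₅ = ≤-trans (m≤m+n s₅ x₅) l₆
      l₄ : s₄ ≤ v₀
      l₄ = ≤-trans (m≤m+n s₄ e) l₅
      l₃ : s₃ ≤ v₀
      l₃ = ≤-trans (m≤m+n s₃ x₄) l₄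
      l₂ : s₂ ≤ v₀
      l₂ = ≤-trans (m≤m+n s₂ x₃) l₃
      l₁ : s₁ ≤ v₀
      l₁ = ≤-trans (m≤m+n s₁ x₂) l₂

    1≤v : 1 ≤ v
    1≤v = each (m≤m+n 1 x₁) l₁
    x₁≤v : x₁ ≤ v
    x₁≤v = each (m≤n+m x₁ 1) l₁
    x₂≤v : x₂ ≤ v
    x₂≤v = each (m≤n+m x₂ s₁) l₂
    x₃≤v : x₃ ≤ v
    x₃≤v = each (m≤n+m x₃ s₂) l₃
    x₄≤v : x₄ ≤ v
    x₄≤v = each (m≤n+m x₄ s₃) l₄
    x₅≤v : x₅ ≤ v
    x₅≤v = each (m≤n+m x₅ s₅) l₆
    x₆≤v : x₆ ≤ v
    x₆≤v = each (m≤n+m x₆ s₆) ≤-refl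

    v≤n : v ≤ n
    v≤n = ≤-trans v≤B B≤n

    1≤B : 1 ≤ B
    1≤B = ≤-trans 1≤v v≤B

    0<n : 0 < n
    0<n = ≤-trans 1≤v v≤n

    1≤t₀ : 1 ≤ t₀
    1≤t₀ = ≤-trans (≤-trans 1≤e (m≤m+n e (15 * e))) (≤-reflexive (sym t₀≡))

    open Reserve G t₀ 1≤t₀ 0<n

    R-size : t₀ * # R ≤ 2 * n
    R-size = size (≤-trans (≤-reflexive (+-comm 1 (3 * (t₀ * t₀)))) (≤-trans x₁≤v v≤n))

    1≤D : 1 ≤ D
    1≤D = lin 4 (λ N τ D B → B · D ≼ D ⇒ B :* N · K 2 ≼ τ ⇒ K 2 :* B · K 1 ≼ N ⇒ K 2 · K 1 ≼ B ⇒ ⊢ 1 · K 1 ≼ N :* τ :* B) refl Nn τ₀ D₀ B ≤-refl 2≤τ₀ 1≤Nn 1≤B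
      |> subst (λ z → 1 ≤ z * B) (sym D₀≡)

    n≤D : n ≤ 32 * e * t₀ * D
    n≤D = ≤-trans hi (≤-reflexive (trans (cong (λ β → 2 * (β * B)) β≡) (re e t₀ D₀ B)))
      where
      re : ∀ e t D B → 2 * (16 * e * t * D * B) ≡ 32 * e * t * (D * B)
      re = solve-∀

    2pB≤D : 2 * (p * B) ≤ D
    2pB≤D = ≤-trans (lin 4 (λ p N τ B → B :* τ · p ≼ N ⇒ p :* B · K 2 ≼ τ ⇒ ⊢ 1 · K 2 :* (p :* B) ≼ N :* τ :* B) refl p Nn τ₀ B (<⇒≤ p<Nn) 2≤τ₀)
      (≤-reflexive (cong (_* B) (sym D₀≡)))

    2R<pD : 2 * # R < suc p * D
    2R<pD = ≤-trans (s≤s (≤-trans R≤ (≤-reflexive (cong (_* D) (sym p≡))))) (≤-trans (+-monoˡ-≤ (p * D) 1≤D) ≤-refl)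
      where
      -- The origin of p = 128e: twice the size of R is at most 4n/t₀, and n ≤ 32 e t₀ D.
      R≤ : 2 * # R ≤ 128 * e * D
      R≤ = *-cancelˡ-≤ t₀ {{Data.Nat.>-nonZero 1≤t₀}} (lin 5 (λ t r n e D → K 2 · t :* r ≼ K 2 :* n ⇒ K 4 · n ≼ K 32 :* e :* t :* D ⇒ ⊢ 1 · t :* (K 2 :* r) ≼ t :* (K 128 :* e :* D)) refl
        t₀ (# R) n e D R-size n≤D)

    poor-num : 3 * (n * n) < suc a * (D * D)
    -- The constant in a: 3072 = 3 · 32², again from n ≤ 32 e t₀ D.
    poor-num = ≤-trans (s≤s (≤-trans (lin 4 (λ n e t D → K 3 :* n :+ K 3 :* (K 32 :* e :* t :* D) · n ≼ K 32 :* e :* t :* D ⇒ ⊢ 1 · K 3 :* (n :* n) ≼ K 3072 :* (e :* e) :* (t :* t) :* (D :* D)) refl n e t₀ D n≤D)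
      (≤-reflexive (cong (_* (D * D)) (sym a≡))))) (+-monoˡ-≤ (a * (D * D)) (*-mono-≤ 1≤D 1≤D))

    sp = sparsity B
    bd = proj₁ sp

    open Assembly G R B using (Q)

    bd≤ : bd ≤ 12 * (β * β) * n
    bd≤ = *-cancelʳ-≤ _ _ (B * B) {{Data.Nat.>-nonZero (*-mono-≤ 1≤B 1≤B)}} (lin 4 (λ b n β B → K 1 · b :* (B :* B) ≼ K 3 :* (n :* (n :* n)) ⇒ K 3 :* n :* n :+ K 6 :* n :* β :* B · n ≼ K 2 :* (β :* B) ⇒
      ⊢ 1 · b :* (B :* B) ≼ K 12 :* (β :* β) :* n :* (B :* B)) refl bd n β B (proj₁ (proj₂ sp)) hi)

    1≤τ : 1 ≤ τ
    1≤τ = *-mono-≤ (≤-trans (s≤s z≤n) 2≤τ₀) 1≤B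

    β≡′ : β ≡ 16 * e * t₀ * (Nn * τ₀)
    β≡′ = trans β≡ (cong (16 * e * t₀ *_) D₀≡)

    -- The sum is at most 3t₀Bn², and n ≤ 2βB turns this into 12t₀β²B³. Since β = 16 e t₀ Nn τ₀,
    -- that is 3072 e² t₀³ Nn² τ₀² B³, quadratic in τ₀; so the choice of τ₀ makes it at most τ³.
    sparse : ∑ (λ x → ∑ (λ x′ → 𝟙 (not (Q x x′)) * # (λ y → G x y ∧ G x′ y))) < suc τ * (τ * τ)
    sparse = ≤-trans (s≤s (≤-trans step₁ (≤-trans step₂ step₃))) (+-monoˡ-≤ (τ * (τ * τ)) (*-mono-≤ 1≤τ 1≤τ))
      where
      Σ₀ = ∑ (λ x → ∑ (λ x′ → 𝟙 (not (Q x x′)) * # (λ y → G x y ∧ G x′ y)))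
      step₁ : Σ₀ ≤ n * n * (3 * t₀ * B)
      step₁ = lin 6 (λ s n t B b β → K 1 · s ≼ n :* (n :* (K 2 :* (t :* B))) :+ b :* n ⇒ n · b ≼ K 12 :* (β :* β) :* n ⇒ n :* n · K 12 :* (β :* β) ≼ B ⇒ n :* n :* B · K 1 ≼ t ⇒ ⊢ 1 · s ≼ n :* n :* (K 3 :* t :* B)) refl
        Σ₀ n t₀ B bd β (proj₂ (proj₂ sp)) bd≤ (≤-trans x₂≤v v≤B) 1≤t₀
      step₂ : n * n * (3 * t₀ * B) ≤ 12 * t₀ * β * β * (B * B * B)
      step₂ = lin 4 (λ n t B β → K 3 :* t :* B :* n :+ K 6 :* t :* B :* β :* B · n ≼ K 2 :* (β :* B) ⇒ ⊢ 1 · n :* n :* (K 3 :* t :* B) ≼ K 12 :* t :* β :* β :* (B :* B :* B)) refl n t₀ B β hi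
      step₃ : 12 * t₀ * β * β * (B * B * B) ≤ τ * (τ * τ)
      step₃ = lin 6 (λ t β B e N τ → K 12 :* t :* β :* (B :* B :* B) :+ K 192 :* e :* t :* t :* N :* τ :* (B :* B :* B) · β ≼ K 16 :* e :* t :* (N :* τ) ⇒
          τ :* τ :* (B :* B :* B) · K 4096 :* (e :* e) :* (t :* t :* t) :* (N :* N) ≼ τ ⇒ ⊢ 1 · K 12 :* t :* β :* β :* (B :* B :* B) ≼ τ :* B :* (τ :* B :* (τ :* B))) refl
        t₀ β B e Nn τ₀ (≤-reflexive β≡′) (≤-reflexive (sym τ₀≡))

    -- From t = 8β and n ≤ 2βB it follows that s ≤ B/4: paths with many vertices are few, so the
    -- links between them do not exhaust the reserve.
    reserve : ∀ s → t * s ≤ n → s + (suc p * (2 * p) + 2 + t) + p ≤ B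
    reserve s h = lin 3 (λ s c B → K 1 · K 4 :* s ≼ B ⇒ K 1 · K 4 :* c ≼ B ⇒ ⊢ 4 · s :+ c ≼ B) refl s (suc p * (2 * p) + 2 + t + p) B 4s≤B (≤-trans x₃≤v v≤B)
      |> ≤-trans (≤-reflexive (+-assoc s (suc p * (2 * p) + 2 + t) p))
      where
      4s≤B : 4 * s ≤ B
      4s≤B = *-cancelˡ-≤ β {{Data.Nat.>-nonZero 1≤β}} (lin 5 (λ β s n B t → K 1 · t :* s ≼ n ⇒ s · K 8 :* β ≼ t ⇒ K 1 · n ≼ K 2 :* (β :* B) ⇒ ⊢ 2 · β :* (K 4 :* s) ≼ β :* B) refl
        β s n B t h (≤-reflexive (sym t≡)) hi)

    atyp-num : t * t * ((n + n) * B) < suc A * (v * v)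
    atyp-num = ≤-trans (s≤s (≤-trans (lin 5 (λ t n θ v β → K 2 :* t :* t :* θ :* v · n ≼ K 2 :* (β :* (θ :* v)) ⇒ ⊢ 1 · t :* t :* ((n :+ n) :* (θ :* v)) ≼ K 4 :* (t :* t) :* β :* (θ :* θ) :* (v :* v)) refl t n θ₀ v β hi)
      (≤-reflexive (cong (_* (v * v)) (sym A≡))))) (+-monoˡ-≤ (A * (v * v)) (*-mono-≤ 1≤v 1≤v))

    -- Each summand is at most Bz/2: the first because θ₀ = 8e(3t + 1) and n ≤ 2ez, the second
    -- because its factor besides B is a constant and z grows with n.
    slack : (3 * t + 1) * (v * (n + n)) + (t * (t + 1) + 1) * (B * A) ≤ B * z
    slack = lin 8 (λ t v n y e z B θ → K 4 :* v :* (K 3 :* t :+ K 1) · n ≼ K 2 :* (e :* z) ⇒ B · K 2 :* y ≼ z ⇒ v :* z · K 8 :* e :* (K 3 :* t :+ K 1) ≼ θ ⇒ z · θ :* v ≼ B ⇒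
        ⊢ 2 · (K 3 :* t :+ K 1) :* (v :* (n :+ n)) :+ B :* y ≼ B :* z) refl
        t v n ((t * (t + 1) + 1) * A) e z B θ₀ n≤2ez y≤z (≤-reflexive (sym θ₀≡)) ≤-refl
      |> ≤-trans (+-monoʳ-≤ ((3 * t + 1) * (v * (n + n))) (lin 3 (λ c A B → ⊢ 1 · c :* (B :* A) ≼ B :* (c :* A)) refl (t * (t + 1) + 1) A B))
      where
      y≤z : 2 * ((t * (t + 1) + 1) * A) ≤ z
      y≤z = *-cancelˡ-≤ e {{Data.Nat.>-nonZero 1≤e}} (lin 4 (λ e y z n → K 1 · K 4 :* e :* y ≼ n ⇒ K 1 · n ≼ K 2 :* (e :* z) ⇒ ⊢ 2 · e :* (K 2 :* y) ≼ e :* z) refl e ((t * (t + 1) + 1) * A) z n (≤-trans x₄≤v v≤n) n≤2ez)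

    open IndependentSets G R B D p 2pB≤D 2R<pD using (rich; rich-bound)

    V Y : Fin n → Bool
    V = rich
    Y y = not (R y)

    z≤n′ : z ≤ n
    z≤n′ = ≤-trans (lin 2 (λ e z → z · K 1 ≼ e ⇒ ⊢ 1 · z ≼ e :* z) refl e z 1≤e) ez≤n

    Δ : ℕ
    Δ = Decomposition.D₀ G R B k p t t₁ v A z τ τ t≡₁ 0<t₁ 1≤B 2≤k k<n z≤n′

    del : ℕ → ℕ
    del = Decomposition.del G R B k p t t₁ v A z τ τ t≡₁ 0<t₁ 1≤B 2≤k k<n z≤n′

    -- `del f` is Δ times the number 2^(f+1) - 1 of nodes of the tree; the Δ on the left lets
    -- doubling close the induction.
    del-bound : ∀ f → Δ + del f ≤ 2 ^ suc f * Δ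
    del-bound zero = ≤-reflexive (cong (Δ +_) (sym (+-identityʳ Δ)))
    del-bound (suc f) = lin 3 (λ d l P → K 2 · d :+ l ≼ P :* d ⇒ ⊢ 1 · d :+ (d :+ (l :+ l)) ≼ (K 2 :* P) :* d) refl Δ (del f) (2 ^ suc f) (del-bound f)

    del≤ : del p ≤ Nn * (w * n + n * (τ + τ) + B * (n + n))
    del≤ = ≤-trans (≤-trans (m≤n+m (del p) Δ) (del-bound p)) (≤-reflexive (cong₂ _*_ (sym Nn≡) (cong (λ w → w * n + n * (τ + τ) + B * (n + n)) (sym w≡))))

    outside : Fin n → Fin n → Bool
    outside x y = G x y ∧ not (V x ∧ Y y)

    few : ∣ outside ∣ᴱ ≤ (n * (2 * (t₀ * D)) + a * n) + # R * n
    few = outside-few G V R (2 * (t₀ * D)) a (poor D a poor-num) (poor-few D a poor-num) (λ x e h → ∧-intro (≤ᵇ-intro h) (not-true e))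

    -- Six error terms, each at most n²/8 after multiplication by e. For R this is the choice t₀ =
    -- 16e; for the thresholds D, τ and B it is β = 16 e t₀ D₀; for discarded and poor vertices it
    -- is the size of n.
    budget : e * (del p + ∣ outside ∣ᴱ) ≤ n * n
    budget = lin 13 (λ e d o N w n τ B t D a r M → K 16 :* e · d ≼ N :* (w :* n :+ n :* (τ :+ τ) :+ B :* (n :+ n)) ⇒ K 16 :* e · o ≼ (n :* (K 2 :* (t :* D)) :+ a :* n) :+ r :* n ⇒
          K 32 :* e :* N :* n · B ≼ τ ⇒ K 2 :* n · K 8 :* e :* N :* w ≼ n ⇒ K 2 :* n · K 8 :* e :* a ≼ n ⇒ K 2 :* n · K 16 :* e :* t :* D ≼ n ⇒ n · M ≼ K 2 :* n ⇒ n · K 16 :* e :* r ≼ M ⇒ K 4 :* n · K 16 :* e :* N :* τ ≼ n ⇒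
          ⊢ 16 · e :* (d :+ o) ≼ n :* n) refl
          e (del p) ∣ outside ∣ᴱ Nn w n τ B t₀ D a (# R) (t₀ * # R) del≤ few B≤τ (≤-trans x₅≤v v≤n) (≤-trans x₆≤v v≤n) D≤ R-size (≤-reflexive (cong (_* # R) (sym t₀≡))) τ≤
      where
      B≤τ : B ≤ τ
      B≤τ = ≤-trans (≤-reflexive (sym (*-identityˡ B))) (*-monoˡ-≤ B (≤-trans (s≤s z≤n) 2≤τ₀))
      D≤ : 16 * e * t₀ * D ≤ n
      D≤ = ≤-trans (≤-reflexive (trans (sym (*-assoc (16 * e * t₀) D₀ B)) (cong (_* B) (sym β≡)))) lo
      τ≤ : 16 * e * Nn * τ ≤ n
      τ≤ = ≤-trans (lin 5 (λ e N τ B t → K 16 :* e :* N :* τ :* B · K 1 ≼ t ⇒ ⊢ 1 · K 16 :* e :* N :* (τ :* B) ≼ K 16 :* e :* t :* (N :* τ :* B)) refl e Nn τ₀ B t₀ 1≤t₀)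
        (≤-trans (≤-reflexive (cong (λ D → 16 * e * t₀ * (D * B)) (sym D₀≡))) D≤)

    result : Cyc G k ⊎ (∃ λ d → e * d ≤ n * n × Struct G everything everything d (k + z))
    result = map₂ (λ S → del p + ∣ outside ∣ᴱ , budget , widen S) (Decomposition.decompose G R B k p t t₁ v A z τ τ t≡₁ 0<t₁ 1≤B 2≤k k<n z≤n′ atyp-num slack reserve sparse p V Y ≤-refl rich-bound (λ y h → not-false h))

  M : ℕ
  M = β * θ₀

  fromSizes : ∀ {n} (G : Fin n → Fin n → Bool) k → 2 ≤ k → k < n →
    (∃ λ v → v₀ ≤ v × M * v ≤ n × n ≤ 2 * (M * v)) → (∃ λ z → 1 ≤ z × e * z ≤ n × n ≤ 2 * (e * z)) →
    Cyc G k ⊎ (∃ λ d → ∃ λ c → e * d ≤ n * n × e * c ≤ e * k + n × Struct G everything everything d c)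
  fromSizes {n} G k 2≤k k<n (v , v₀≤v , lo , hi) (z , _ , ez≤n , n≤2ez) = map₂
    (λ (d , h , S) → d , k + z , h , ≤-trans (≤-reflexive (*-distribˡ-+ e k z)) (+-monoʳ-≤ (e * k) ez≤n) , S)
    (Sizes.result G k 2≤k k<n v z v₀≤v ez≤n n≤2ez (subst (_≤ n) (*-assoc β θ₀ v) lo) (subst (λ m → n ≤ 2 * m) (*-assoc β θ₀ v) hi))

  components : ∃ λ n₀ → ∀ n → n₀ ≤ n → ∀ (G : Fin n → Fin n → Bool) k → 2 ≤ k →
    Cyc G k ⊎ (∃ λ d → ∃ λ c → e * d ≤ n * n × e * c ≤ e * k + n × Struct G everything everything d c)
  components = v₀ * M + e , λ n large G k 2≤k → bySize G k 2≤k large (suc k ≤? n)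
    where
    bySize : ∀ {n} (G : Fin n → Fin n → Bool) k → 2 ≤ k → v₀ * M + e ≤ n → Dec (suc k ≤ n) →
      Cyc G k ⊎ (∃ λ d → ∃ λ c → e * d ≤ n * n × e * c ≤ e * k + n × Struct G everything everything d c)
    bySize {n} G k _ _ (no k≥n) = inj₂ (0 , k , ≤-trans (≤-reflexive (*-zeroʳ e)) z≤n , m≤m+n _ n , trivial G k (≤-pred (≰⇒> k≥n)))
    bySize {n} G k 2≤k large (yes k<n) = fromSizes G k 2≤k k<n
      (quotient M v₀ n (*-mono-≤ 1≤β 1≤θ₀) (s≤s z≤n) (≤-trans (m≤m+n _ e) large))
      (quotient e 1 n 1≤e ≤-refl (≤-trans (≤-reflexive (*-identityˡ e)) (≤-trans (m≤n+m e _) large)))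

n<2^n : ∀ n → n < 2 ^ n
n<2^n zero = s≤s z≤n
n<2^n (suc n) = ≤-trans (+-mono-≤ (≤-trans (s≤s z≤n) (n<2^n n)) (n<2^n n)) (≤-reflexive (cong (2 ^ n +_) (sym (+-identityʳ _))))

private
  -- The constants are handed over together with equations, so inside `Constants` they are variables
  -- and powers such as 2 ^ suc p are never evaluated.
  removal′ : ∀ e → 1 ≤ e → ∃ λ n₀ → ∀ n → n₀ ≤ n → ∀ (G : Fin n → Fin n → Bool) k → 2 ≤ k →
    Cyc G k ⊎ (∃ λ d → ∃ λ c → e * d ≤ n * n × e * c ≤ e * k + n × Struct G everything everything d c)
  removal′ e 1≤e = Constants.components e t₀ p Nn τ₀ D₀ β t (t ∸ 1) θ₀ A a w 1≤e refl refl refl refl refl refl refl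
    (sym (m+[n∸m]≡n (≤-trans (s≤s z≤n) 2≤t))) (∸-monoˡ-≤ 1 2≤t) refl refl refl refl 1≤Nn p<Nn 1≤β 1≤θ₀ 2≤τ₀
    where
    t₀ = 16 * e
    p = 128 * e
    Nn = 2 ^ suc p
    τ₀ = 4096 * (e * e) * (t₀ * t₀ * t₀) * (Nn * Nn)
    D₀ = Nn * τ₀
    β = 16 * e * t₀ * D₀
    t = 8 * β
    θ₀ = 8 * e * (3 * t + 1)
    A = 4 * (t * t) * β * (θ₀ * θ₀)
    a = 3072 * (e * e) * (t₀ * t₀)
    w = suc p * (2 * p) + (suc p * (2 * p) + 2 + t) + ram (suc p) (suc p * (2 * p) + 2 + t)
    1≤t₀ : 1 ≤ t₀
    1≤t₀ = *-mono-≤ {1} {16} (s≤s z≤n) 1≤e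
    p<Nn : p < Nn
    p<Nn = ≤-trans (n<2^n p) (m≤m+n (2 ^ p) _)
    1≤Nn : 1 ≤ Nn
    1≤Nn = ≤-trans (s≤s z≤n) p<Nn
    2≤τ₀ : 2 ≤ τ₀
    2≤τ₀ = *-mono-≤ {2} {_} {1} (*-mono-≤ {2} {_} {1} (*-mono-≤ {2} {4096} {1} (s≤s (s≤s z≤n)) (*-mono-≤ 1≤e 1≤e)) (*-mono-≤ (*-mono-≤ 1≤t₀ 1≤t₀) 1≤t₀)) (*-mono-≤ 1≤Nn 1≤Nn)
    1≤β : 1 ≤ β
    1≤β = *-mono-≤ {1} {_} {1} (*-mono-≤ 1≤t₀ 1≤t₀) (*-mono-≤ 1≤Nn (≤-trans (s≤s z≤n) 2≤τ₀))
    2≤t : 2 ≤ t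
    2≤t = *-mono-≤ {2} {8} {1} (s≤s (s≤s z≤n)) 1≤β
    1≤θ₀ : 1 ≤ θ₀
    1≤θ₀ = *-mono-≤ {1} {_} {1} (*-mono-≤ {1} {8} (s≤s z≤n) 1≤e) (m≤n+m 1 (3 * t))

abstract
  removal : ∀ e → 1 ≤ e → ∃ λ n₀ → ∀ n → n₀ ≤ n → ∀ (G : Fin n → Fin n → Bool) k → 2 ≤ k →
    Cyc G k ⊎ (∃ λ d → ∃ λ c → e * d ≤ n * n × e * c ≤ e * k + n × Struct G everything everything d c)
  removal = removal′

-- Two-coloured bipartite graphs of large minimum degree

infix 4 _≐_
abstract
  _≐_ : Label → Label → Bool
  l ≐ l′ = does (l ≟ᴸ l′)

  ≐-true : ∀ {l l′} → (l ≐ l′) ≡ true → l ≡ l′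
  ≐-true {l} {l′} = does-true (l ≟ᴸ l′)

  ≐-intro : ∀ {l l′} → l ≡ l′ → (l ≐ l′) ≡ true
  ≐-intro {l} {l′} = does-intro (l ≟ᴸ l′)

  ≐-false : ∀ {l l′} → (l ≐ l′) ≡ false → l ≢ l′
  ≐-false {l} {l′} = does-false (l ≟ᴸ l′)

  ≐-no : ∀ {l l′} → l ≢ l′ → (l ≐ l′) ≡ false
  ≐-no {l} {l′} = does-no (l ≟ᴸ l′)

-- All deletions are already accounted for in q, so edges respect labels and covers without
-- exception. The aim is that this is impossible when 4q < M and k₁ + k₂ < M.
record Config (M q k₁ k₂ : ℕ) : Set where
  field
    E₁ E₂ : Fin M → Fin M → Bool
    nonX : ∀ x → # (λ y → not (E₁ x y ∨ E₂ x y)) ≤ q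
    nonY : ∀ y → # (λ x → not (E₁ x y ∨ E₂ x y)) ≤ q
    r₁X r₁Y r₂X r₂Y : Fin M → Label
    C₁ D₁ C₂ D₂ : Fin M → Bool
    same₁ : ∀ x y → E₁ x y ≡ true → r₁X x ≡ r₁Y y
    same₂ : ∀ x y → E₂ x y ≡ true → r₂X x ≡ r₂Y y
    cov₁ : ∀ x y → E₁ x y ≡ true → C₁ x ∨ D₁ y ≡ true
    cov₂ : ∀ x y → E₂ x y ≡ true → C₂ x ∨ D₂ y ≡ true
    small₁ : ∀ l → # (λ x → (r₁X x ≐ l) ∧ C₁ x) + # (λ y → (r₁Y y ≐ l) ∧ D₁ y) ≤ k₁
    small₂ : ∀ l → # (λ x → (r₂X x ≐ l) ∧ C₂ x) + # (λ y → (r₂Y y ≐ l) ∧ D₂ y) ≤ k₂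

-- Together with `recolour` this supplies the symmetries by which later cases are reduced to one
-- another.
transpose : ∀ {M q k₁ k₂} → Config M q k₁ k₂ → Config M q k₁ k₂
transpose c = record
  { E₁ = λ x y → E₁ y x ; E₂ = λ x y → E₂ y x ; nonX = nonY ; nonY = nonX
  ; r₁X = r₁Y ; r₁Y = r₁X ; r₂X = r₂Y ; r₂Y = r₂X ; C₁ = D₁ ; D₁ = C₁ ; C₂ = D₂ ; D₂ = C₂
  ; same₁ = λ x y e → sym (same₁ y x e) ; same₂ = λ x y e → sym (same₂ y x e)
  ; cov₁ = λ x y e → ∨-flip (C₁ y) (cov₁ y x e) ; cov₂ = λ x y e → ∨-flip (C₂ y) (cov₂ y x e)
  ; small₁ = λ l → ≤-trans (≤-reflexive (+-comm (# (λ y → (r₁Y y ≐ l) ∧ D₁ y)) _)) (small₁ l)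
  ; small₂ = λ l → ≤-trans (≤-reflexive (+-comm (# (λ y → (r₂Y y ≐ l) ∧ D₂ y)) _)) (small₂ l) }
  where
  open Config c
  ∨-flip : ∀ a {b} → a ∨ b ≡ true → b ∨ a ≡ true
  ∨-flip true {true} _ = refl
  ∨-flip true {false} _ = refl
  ∨-flip false e = ∨-inl e

recolour : ∀ {M q k₁ k₂} → Config M q k₁ k₂ → Config M q k₂ k₁
recolour c = record
  { E₁ = E₂ ; E₂ = E₁ ; nonX = λ x → ≤-trans (#-⊆ (λ y → flip (E₁ x y) (E₂ x y))) (nonX x) ; nonY = λ y → ≤-trans (#-⊆ (λ x → flip (E₁ x y) (E₂ x y))) (nonY y)
  ; r₁X = r₂X ; r₁Y = r₂Y ; r₂X = r₁X ; r₂Y = r₁Y ; C₁ = C₂ ; D₁ = D₂ ; C₂ = C₁ ; D₂ = D₁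
  ; same₁ = same₂ ; same₂ = same₁ ; cov₁ = cov₂ ; cov₂ = cov₁ ; small₁ = small₂ ; small₂ = small₁ }
  where
  open Config c
  flip : ∀ a b → not (b ∨ a) ≡ true → not (a ∨ b) ≡ true
  flip false false _ = refl
  flip false true ()
  flip true false ()
  flip true true ()

⊥-≤ : ∀ {A : Set} → 1 ≤ 0 → A
⊥-≤ ()

module Neighbours {M q k₁ k₂ : ℕ} (c : Config M q k₁ k₂) where
  open Config c

  nbrsX : ∀ x (P T : Fin M → Bool) → (∀ y → P y ≡ true → E₁ x y ≡ true ⊎ E₂ x y ≡ true → T y ≡ true) → # P ≤ # T + q
  nbrsX x P T h = ≤-trans (#-∪ {Q = T} {R = λ y → not (E₁ x y ∨ E₂ x y)} cs) (+-monoʳ-≤ (# T) (nonX x))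
    where
    cs : ∀ y → P y ≡ true → T y ≡ true ⊎ not (E₁ x y ∨ E₂ x y) ≡ true
    cs y p with E₁ x y ∨ E₂ x y in e
    ... | true = inj₁ (h y p (∨-case {E₁ x y} e))
    ... | false = inj₂ refl

  nbrsY : ∀ y (P T : Fin M → Bool) → (∀ x → P x ≡ true → E₁ x y ≡ true ⊎ E₂ x y ≡ true → T x ≡ true) → # P ≤ # T + q
  nbrsY y P T h = ≤-trans (#-∪ {Q = T} {R = λ x → not (E₁ x y ∨ E₂ x y)} cs) (+-monoʳ-≤ (# T) (nonY y))
    where
    cs : ∀ x → P x ≡ true → T x ≡ true ⊎ not (E₁ x y ∨ E₂ x y) ≡ true
    cs x p with E₁ x y ∨ E₂ x y in e
    ... | true = inj₁ (h x p (∨-case {E₁ x y} e))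
    ... | false = inj₂ refl

  adjᴮ : Fin M → Fin M → Bool
  adjᴮ x y = E₁ x y ∨ E₂ x y

  existsY : ∀ y (P : Fin M → Bool) → q < # P → ∃ λ x → P x ≡ true × (E₁ x y ≡ true ⊎ E₂ x y ≡ true)
  existsY y P lt with #-ex P (λ x → not (adjᴮ x y)) (≤-trans (s≤s (nonY y)) lt)
  ... | x , p , a = x , p , ∨-case (not-false⁻ a)

  commonY : ∀ y y′ (P : Fin M → Bool) → 2 * q < # P → ∃ λ x → P x ≡ true × (E₁ x y ≡ true ⊎ E₂ x y ≡ true) × (E₁ x y′ ≡ true ⊎ E₂ x y′ ≡ true)
  commonY y y′ P lt with existsY y′ (λ x → P x ∧ adjᴮ x y) (lin 3 (λ q p a → K 1 · Suc (K 2 :* q) ≼ p ⇒ K 1 · p ≼ a :+ q ⇒ ⊢ 1 · Suc q ≼ a) refl q (# P) (# (λ x → P x ∧ adjᴮ x y)) lt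
      (nbrsY y P (λ x → P x ∧ adjᴮ x y) (λ x p e → ∧-intro p (either e))))
    where
    either : ∀ {x} → E₁ x y ≡ true ⊎ E₂ x y ≡ true → adjᴮ x y ≡ true
    either (inj₁ e) = ∨-inl e
    either {x} (inj₂ e) = ∨-inr {E₁ x y} e
  ... | x , p , e′ = x , ∧-fst {P x} p , ∨-case (∧-snd {P x} p) , e′

  -- With `Sᶜ`, one cover of each colour. Whatever the labels, the two sets together have at most k₁
  -- + k₂ < M elements; most contradictions below consist in making them too large.
  Pᶜ : Label → Label → Fin M → Bool
  Pᶜ i j x = ((r₁X x ≐ i) ∧ C₁ x) ∨ ((r₂X x ≐ j) ∧ C₂ x)

  Sᶜ : Label → Label → Fin M → Bool
  Sᶜ i j y = ((r₁Y y ≐ i) ∧ D₁ y) ∨ ((r₂Y y ≐ j) ∧ D₂ y)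

  c₁ d₁ c₂ d₂ : Label → ℕ
  c₁ l = # (λ x → (r₁X x ≐ l) ∧ C₁ x)
  d₁ l = # (λ y → (r₁Y y ≐ l) ∧ D₁ y)
  c₂ l = # (λ x → (r₂X x ≐ l) ∧ C₂ x)
  d₂ l = # (λ y → (r₂Y y ≐ l) ∧ D₂ y)

  P≤ : ∀ i j → # (Pᶜ i j) ≤ c₁ i + c₂ j
  P≤ i j = #-∪ {Q = λ x → (r₁X x ≐ i) ∧ C₁ x} {R = λ x → (r₂X x ≐ j) ∧ C₂ x} (λ x → ∨-case)

  S≤ : ∀ i j → # (Sᶜ i j) ≤ d₁ i + d₂ j
  S≤ i j = #-∪ {Q = λ y → (r₁Y y ≐ i) ∧ D₁ y} {R = λ y → (r₂Y y ≐ j) ∧ D₂ y} (λ x → ∨-case)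

  cellX cellY : Label → Label → Fin M → Bool
  cellX i j x = (r₁X x ≐ i) ∧ (r₂X x ≐ j)
  cellY i j y = (r₁Y y ≐ i) ∧ (r₂Y y ≐ j)

  BigX BigY : Label → Label → Set
  BigX i j = M ≤ 2 * # (cellX i j)
  BigY i j = M ≤ 2 * # (cellY i j)

  cover₁Y : ∀ x y {i} → E₁ x y ≡ true → r₁X x ≡ i ⊎ r₁Y y ≡ i → (r₁X x ≐ i) ∧ C₁ x ≡ false → (r₁Y y ≐ i) ∧ D₁ y ≡ true
  cover₁Y x y {i} e h f with lab h
    where
    lab : r₁X x ≡ i ⊎ r₁Y y ≡ i → r₁X x ≡ i × r₁Y y ≡ i
    lab (inj₁ p) = p , trans (sym (same₁ x y e)) p
    lab (inj₂ p) = trans (same₁ x y e) p , p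
  ... | px , py with ∨-case {C₁ x} (cov₁ x y e)
  ... | inj₁ cx = ⊥-elim (true≢false (∧-intro (≐-intro px) cx) f)
  ... | inj₂ dy = ∧-intro (≐-intro py) dy

  cover₂Y : ∀ x y {j} → E₂ x y ≡ true → r₂X x ≡ j ⊎ r₂Y y ≡ j → (r₂X x ≐ j) ∧ C₂ x ≡ false → (r₂Y y ≐ j) ∧ D₂ y ≡ true
  cover₂Y x y {j} e h f with lab h
    where
    lab : r₂X x ≡ j ⊎ r₂Y y ≡ j → r₂X x ≡ j × r₂Y y ≡ j
    lab (inj₁ p) = p , trans (sym (same₂ x y e)) p
    lab (inj₂ p) = trans (same₂ x y e) p , p
  ... | px , py with ∨-case {C₂ x} (cov₂ x y e)
  ... | inj₁ cx = ⊥-elim (true≢false (∧-intro (≐-intro px) cx) f)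
  ... | inj₂ dy = ∧-intro (≐-intro py) dy

∨-falseˡ : ∀ {a b} → a ∨ b ≡ false → a ≡ false
∨-falseˡ {false} _ = refl

∨-falseʳ : ∀ {a b} → a ∨ b ≡ false → b ≡ false
∨-falseʳ {false} e = e

-- Large cells cannot exist on both sides

module Saturated {M q k₁ k₂ : ℕ} (c : Config M q k₁ k₂) (4q<M : 4 * q < M) (k<M : k₁ + k₂ < M) where
  open Config c
  open Neighbours c
  module Tr = Neighbours (transpose c)

  PS< : ∀ i j → # (Pᶜ i j) + # (Sᶜ i j) < M
  PS< i j = ≤-trans (s≤s (lin 8 (λ P S a b e f k l → K 1 · P ≼ a :+ e ⇒ K 1 · S ≼ b :+ f ⇒ K 1 · a :+ b ≼ k ⇒ K 1 · e :+ f ≼ l ⇒ ⊢ 1 · P :+ S ≼ k :+ l) refl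
    (# (Pᶜ i j)) (# (Sᶜ i j)) (c₁ i) (d₁ i) (c₂ j) (d₂ j) k₁ k₂ (P≤ i j) (S≤ i j) (small₁ i) (small₂ j))) k<M

  uncoveredY : ∀ i j y → r₁Y y ≡ i → r₂Y y ≡ j → Sᶜ i j y ≡ false → M ≤ # (Pᶜ i j) + q
  uncoveredY i j y h₁ h₂ f = ≤-trans (#-all {P = λ _ → true} (λ _ → refl)) (nbrsY y (λ _ → true) (Pᶜ i j) λ
    { x _ (inj₁ e) → ∨-inl (Tr.cover₁Y y x e (inj₁ h₁) (∨-falseˡ f))
    ; x _ (inj₂ e) → ∨-inr {(r₁X x ≐ i) ∧ C₁ x} (Tr.cover₂Y y x e (inj₁ h₂) (∨-falseʳ {(r₁Y y ≐ i) ∧ D₁ y} f)) })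

  -- If y is uncovered, its neighbours, at least M - q of them, all lie in P. Since P is not
  -- everything, some x lies outside it, and the neighbours of x in the cell, at least M/2 - q of
  -- them, all lie in S. Together these exceed M.
  saturated : ∀ i j → BigY i j → ∀ y → cellY i j y ≡ true → Sᶜ i j y ≡ true
  saturated i j big y cy with Sᶜ i j y in f
  ... | true = refl
  ... | false with #-ex (λ _ → true) (Pᶜ i j) (≤-trans (s≤s (m≤m+n _ (# (Sᶜ i j)))) (≤-trans (PS< i j) (#-all {P = λ _ → true} (λ _ → refl))))
  ... | x , _ , xf = ⊥-≤ (lin 5 (λ M P S W q → K 2 · M ≼ P :+ q ⇒ K 1 · M ≼ K 2 :* W ⇒ K 2 · W ≼ S :+ q ⇒ K 2 · Suc (P :+ S) ≼ M ⇒ K 1 · Suc (K 4 :* q) ≼ M ⇒ ⊢ 1 · K 1 ≼ K 0) refl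
      M (# (Pᶜ i j)) (# (Sᶜ i j)) (# (cellY i j)) q
      (uncoveredY i j y (≐-true (∧-fst cy)) (≐-true (∧-snd {r₁Y y ≐ i} cy)) f) big
      (nbrsX x (cellY i j) (Sᶜ i j) λ
        { w cw (inj₁ e) → ∨-inl (cover₁Y x w e (inj₂ (≐-true (∧-fst cw))) (∨-falseˡ xf))
        ; w cw (inj₂ e) → ∨-inr {(r₁Y w ≐ i) ∧ D₁ w} (cover₂Y x w e (inj₂ (≐-true (∧-snd {r₁Y w ≐ i} cw))) (∨-falseʳ {(r₁X x ≐ i) ∧ C₁ x} xf)) })
      (PS< i j) 4q<M)

module BigCells {M q k₁ k₂ : ℕ} (c : Config M q k₁ k₂) (4q<M : 4 * q < M) (k<M : k₁ + k₂ < M) where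
  open Config c
  open Neighbours c
  open Saturated c 4q<M k<M
  module Tr′ = Neighbours (transpose c)
  module St = Saturated (transpose c) 4q<M k<M

  sameCell : ∀ i p → BigX i p → BigY i p → ⊥
  sameCell i p bx by = ⊥-≤ (lin 5 (λ M P S U W → K 1 · M ≼ K 2 :* U ⇒ K 1 · M ≼ K 2 :* W ⇒ K 2 · U ≼ P ⇒ K 2 · W ≼ S ⇒ K 2 · Suc (P :+ S) ≼ M ⇒ ⊢ 1 · K 1 ≼ K 0) refl
    M (# (Pᶜ i p)) (# (Sᶜ i p)) (# (cellX i p)) (# (cellY i p)) bx by (#-⊆ (St.saturated i p bx)) (#-⊆ (saturated i p by)) (PS< i p))

  search-in : ∀ (P T : Fin M → Bool) → (∃ λ x → P x ≡ true × T x ≡ false) ⊎ (∀ x → P x ≡ true → T x ≡ true)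
  search-in P T with search (λ x → P x ∧ not (T x))
  ... | inj₁ (x , e) = inj₁ (x , ∧-fst e , not-false (∧-snd {P x} e))
  ... | inj₂ h = inj₂ all
    where
    all : ∀ x → P x ≡ true → T x ≡ true
    all x p with T x | h x
    ... | true | _ = refl
    ... | false | g rewrite p = ⊥-elim (true≢false refl g)

  -- Sets are tested for an uncovered vertex one after another. If there is none, the set lies in
  -- the cover at once. If there is one, and the labels leave a single colour for its edges into
  -- another set, then it forces that set into the cover up to q vertices. Either way the covers
  -- become too large.
  sharedLabel : ∀ i p s → p ≢ s → BigX i p → BigY i s → ⊥
  sharedLabel i p s p≢s bx by = go (search-in U C₁) (search-in W D₁)
    where
    U = cellX i p
    W = cellY i s
    V T Yip : Fin M → Bool
    V y = not (r₂Y y ≐ p)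
    T y = (r₂Y y ≐ p) ∧ not (r₁Y y ≐ i)
    Yip = cellY i p
    U₁ : ∀ {x} → U x ≡ true → r₁X x ≡ i
    U₁ h = ≐-true (∧-fst h)
    U₂ : ∀ {x} → U x ≡ true → r₂X x ≡ p
    U₂ {x} h = ≐-true (∧-snd {r₁X x ≐ i} h)
    W₁ : ∀ {y} → W y ≡ true → r₁Y y ≡ i
    W₁ h = ≐-true (∧-fst h)
    W₂ : ∀ {y} → W y ≡ true → r₂Y y ≡ s
    W₂ {y} h = ≐-true (∧-snd {r₁Y y ≐ i} h)
    W⊆S : # W ≤ # (Sᶜ i s)
    W⊆S = #-⊆ (saturated i s by)
    U⊆P : # U ≤ # (Pᶜ i p)
    U⊆P = #-⊆ (St.saturated i p bx)
    collision : ∀ m n → # U ≤ m → # W ≤ n → m + n < M → ⊥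
    collision m n h g lt = ⊥-≤ (lin 5 (λ M m n U W → K 1 · M ≼ K 2 :* U ⇒ K 1 · M ≼ K 2 :* W ⇒ K 2 · U ≼ m ⇒ K 2 · W ≼ n ⇒ K 2 · Suc (m :+ n) ≼ M ⇒ ⊢ 1 · K 1 ≼ K 0) refl M m n (# U) (# W) bx by h g lt)
    W⊆V : # W ≤ # V
    W⊆V = #-⊆ (λ y h → not-true (≐-no (λ e → p≢s (trans (sym e) (W₂ {y} h)))))
    total : M ≤ # V + (# Yip + # T)
    total = ≤-trans (#-all {P = λ _ → true} (λ _ → refl)) (≤-trans (#-∪ {Q = V} {R = λ y → r₂Y y ≐ p} cs) (+-monoʳ-≤ (# V) (#-∪ {Q = Yip} {R = T} cs′)))
      where
      cs : ∀ y → true ≡ true → V y ≡ true ⊎ (r₂Y y ≐ p) ≡ true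
      cs y _ with r₂Y y ≐ p
      ... | true = inj₂ refl
      ... | false = inj₁ refl
      cs′ : ∀ y → (r₂Y y ≐ p) ≡ true → Yip y ≡ true ⊎ T y ≡ true
      cs′ y e with r₁Y y ≐ i
      ... | true = inj₁ e
      ... | false = inj₂ (∧-intro e refl)
    go : (∃ λ x → U x ≡ true × C₁ x ≡ false) ⊎ (∀ x → U x ≡ true → C₁ x ≡ true) → (∃ λ y → W y ≡ true × D₁ y ≡ false) ⊎ (∀ y → W y ≡ true → D₁ y ≡ true) → ⊥
    -- If C₁ contains U, so does `Pᶜ i s`, while W lies in `Sᶜ i s` by saturation: together at least
    -- M. In the next case D₁ contains W, and `Pᶜ i p` and `Sᶜ i p` play these roles.
    go (inj₂ all) _ = collision (# (Pᶜ i s)) (# (Sᶜ i s)) (#-⊆ (λ x h → ∨-inl (∧-intro (∧-fst {r₁X x ≐ i} h) (all x h)))) W⊆S (PS< i s)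
    go (inj₁ _) (inj₂ all) = collision (# (Pᶜ i p)) (# (Sᶜ i p)) U⊆P (#-⊆ (λ y h → ∨-inl (∧-intro (∧-fst {r₁Y y ≐ i} h) (all y h)))) (PS< i p)
    go (inj₁ (x′ , Ux′ , cx′)) (inj₁ (y′ , Wy′ , dy′)) = rest (search-in T D₂) (search-in U C₂)
      where
      VD : Fin M → Bool
      VD y = V y ∧ ((r₁Y y ≐ i) ∧ D₁ y)
      V≤ : # V ≤ # VD + q
      -- Edges from x′ into V have colour 1, as colour 2 would transfer the label p. Since x′ is not
      -- in C₁, their ends are in D₁.
      V≤ = nbrsX x′ V VD λ
        { y v (inj₁ e) → ∧-intro v (cover₁Y x′ y e (inj₁ (U₁ {x′} Ux′)) (∧-falseʳ (r₁X x′ ≐ i) cx′))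
        ; y v (inj₂ e) → ⊥-elim (≐-false (not-false v) (trans (sym (same₂ x′ y e)) (U₂ {x′} Ux′))) }
      U≤c₁ : # U ≤ c₁ i + q
      U≤c₁ = nbrsY y′ U (λ x → (r₁X x ≐ i) ∧ C₁ x) λ
        { x u (inj₁ e) → Tr′.cover₁Y y′ x e (inj₁ (W₁ {y′} Wy′)) (∧-falseʳ (r₁Y y′ ≐ i) dy′)
        ; x u (inj₂ e) → ⊥-elim (p≢s (trans (sym (U₂ {x} u)) (trans (same₂ x y′ e) (W₂ {y′} Wy′)))) }
      VD≤S : # VD ≤ # (Sᶜ i p)
      VD≤S = #-⊆ (λ y h → ∨-inl (∧-snd {V y} h))
      -- Otherwise P has at least M - q elements, while S already contains VD, which has at least
      -- M/2 - q.
      Yip⊆S : ∀ y → Yip y ≡ true → Sᶜ i p y ≡ true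
      Yip⊆S y h with Sᶜ i p y in f
      ... | true = refl
      ... | false = ⊥-≤ (lin 7 (λ M P S W q V VD → K 2 · M ≼ P :+ q ⇒ K 1 · M ≼ K 2 :* W ⇒ K 2 · W ≼ V ⇒ K 2 · V ≼ VD :+ q ⇒ K 2 · VD ≼ S ⇒ K 2 · Suc (P :+ S) ≼ M ⇒ K 1 · Suc (K 4 :* q) ≼ M ⇒ ⊢ 1 · K 1 ≼ K 0) refl
          M (# (Pᶜ i p)) (# (Sᶜ i p)) (# W) q (# V) (# VD) (uncoveredY i p y (≐-true (∧-fst h)) (≐-true (∧-snd {r₁Y y ≐ i} h)) f) by W⊆V V≤ VD≤S (PS< i p) 4q<M)
      union : ∀ (Z : Fin M → Bool) → (∀ y → Z y ≡ true → T y ∧ D₂ y ≡ true) → # VD + (# Yip + # Z) ≤ # (Sᶜ i p)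
      union Z Z⊆ = ≤-trans (+-monoʳ-≤ (# VD) (#-disj {P = Yip} {R = λ y → (r₂Y y ≐ p) ∧ Sᶜ i p y} {Q = Z}
          (λ y h → ∧-intro (∧-snd {r₁Y y ≐ i} h) (Yip⊆S y h))
          (λ y h → ∧-intro (∧-fst (∧-fst {T y} (Z⊆ y h))) (∨-inr {(r₁Y y ≐ i) ∧ D₁ y} (∧-intro (∧-fst (∧-fst {T y} (Z⊆ y h))) (∧-snd {T y} (Z⊆ y h)))))
          (λ y h h′ → true≢false (∧-fst h) (not-false (∧-snd {r₂Y y ≐ p} (∧-fst {T y} (Z⊆ y h′)))))))
        (#-disj {P = VD} {R = Sᶜ i p} {Q = λ y → (r₂Y y ≐ p) ∧ Sᶜ i p y} (λ y h → ∨-inl (∧-snd {V y} h)) (λ y h → ∧-snd {r₂Y y ≐ p} h)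
          (λ y h h′ → true≢false (∧-fst {r₂Y y ≐ p} h′) (not-false (∧-fst {V y} h))))
      rest : (∃ λ y → T y ≡ true × D₂ y ≡ false) ⊎ (∀ y → T y ≡ true → D₂ y ≡ true) → (∃ λ x → U x ≡ true × C₂ x ≡ false) ⊎ (∀ x → U x ≡ true → C₂ x ≡ true) → ⊥
      rest (inj₂ all) _ = ⊥-≤ (lin 9 (λ M V VD Y T S P U q → K 2 · M ≼ V :+ (Y :+ T) ⇒ K 2 · V ≼ VD :+ q ⇒ K 2 · VD :+ (Y :+ T) ≼ S ⇒ K 1 · M ≼ K 2 :* U ⇒ K 2 · U ≼ P ⇒ K 2 · Suc (P :+ S) ≼ M ⇒ K 1 · Suc (K 4 :* q) ≼ M ⇒ ⊢ 1 · K 1 ≼ K 0) refl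
          M (# V) (# VD) (# Yip) (# T) (# (Sᶜ i p)) (# (Pᶜ i p)) (# U) q total V≤ (union T (λ y h → ∧-intro h (all y h))) bx U⊆P (PS< i p) 4q<M)
      rest (inj₁ (y″ , Ty″ , dy″)) alt = fin alt
        where
        -- The uncovered y″ has second label p but not first label i, so its edges into U have
        -- colour 2.
        U≤c₂ : # U ≤ c₂ p + q
        U≤c₂ = nbrsY y″ U (λ x → (r₂X x ≐ p) ∧ C₂ x) λ
          { x u (inj₁ e) → ⊥-elim (≐-false (not-false (∧-snd {r₂Y y″ ≐ p} Ty″)) (trans (sym (same₁ x y″ e)) (U₁ {x} u)))
          ; x u (inj₂ e) → Tr′.cover₂Y y″ x e (inj₂ (U₂ {x} u)) (∧-falseʳ (r₂Y y″ ≐ p) dy″) }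
        VD≤d₁ : # VD ≤ d₁ i
        VD≤d₁ = #-⊆ (λ y h → ∧-snd {V y} h)
        fin : (∃ λ x → U x ≡ true × C₂ x ≡ false) ⊎ (∀ x → U x ≡ true → C₂ x ≡ true) → ⊥
        -- Here c₂ p is at least M/2, and c₁ i and d₁ i are at least M/2 - q each, too much for the
        -- two covers.
        fin (inj₂ all) = ⊥-≤ (lin 12 (λ M U W V VD q c e d f k l → K 2 · M ≼ K 2 :* U ⇒ K 1 · M ≼ K 2 :* W ⇒ K 2 · W ≼ V ⇒ K 2 · V ≼ VD :+ q ⇒ K 2 · VD ≼ d ⇒ K 2 · U ≼ c :+ q ⇒ K 2 · U ≼ e ⇒
              K 2 · c :+ d ≼ k ⇒ K 2 · e :+ f ≼ l ⇒ K 2 · Suc (k :+ l) ≼ M ⇒ K 1 · Suc (K 4 :* q) ≼ M ⇒ ⊢ 1 · K 1 ≼ K 0) refl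
            M (# U) (# W) (# V) (# VD) q (c₁ i) (c₂ p) (d₁ i) (d₂ p) k₁ k₂ bx by W⊆V V≤ VD≤d₁ U≤c₁ (#-⊆ (λ x h → ∧-intro (∧-snd {r₁X x ≐ i} h) (all x h))) (small₁ i) (small₂ p) k<M 4q<M)
        -- Now D₂ contains T up to q vertices, so S has at least M - 2q elements, and c₁ i + c₂ p is
        -- at least M - 2q as well.
        fin (inj₁ (x , Ux , cx)) = ⊥-≤ (lin 15 (λ M U V VD Y T TD S q c e d f k l → K 1 · M ≼ V :+ (Y :+ T) ⇒ K 1 · V ≼ VD :+ q ⇒ K 1 · T ≼ TD :+ q ⇒ K 1 · VD :+ (Y :+ TD) ≼ S ⇒ K 1 · S ≼ d :+ f ⇒ K 1 · U ≼ c :+ q ⇒ K 1 · U ≼ e :+ q ⇒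
              K 1 · M ≼ K 2 :* U ⇒ K 1 · c :+ d ≼ k ⇒ K 1 · e :+ f ≼ l ⇒ K 1 · Suc (k :+ l) ≼ M ⇒ K 1 · Suc (K 4 :* q) ≼ M ⇒ ⊢ 1 · K 1 ≼ K 0) refl
            M (# U) (# V) (# VD) (# Yip) (# T) (# (λ y → T y ∧ D₂ y)) (# (Sᶜ i p)) q (c₁ i) (c₂ p) (d₁ i) (d₂ p) k₁ k₂ total V≤ T≤ (union (λ y → T y ∧ D₂ y) (λ y h → h)) (S≤ i p) U≤c₁ U≤c₂ bx (small₁ i) (small₂ p) k<M 4q<M)
          where
          T≤ : # T ≤ # (λ y → T y ∧ D₂ y) + q
          T≤ = nbrsX x T (λ y → T y ∧ D₂ y) λ
            { y h (inj₁ e) → ⊥-elim (≐-false (not-false (∧-snd {r₂Y y ≐ p} h)) (trans (sym (same₁ x y e)) (U₁ {x} Ux)))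
            ; y h (inj₂ e) → ∧-intro h (∧-snd {r₂Y y ≐ p} (cover₂Y x y e (inj₁ (U₂ {x} Ux)) (∧-falseʳ (r₂X x ≐ p) cx))) }

module Contradiction {M q k₁ k₂ : ℕ} (c : Config M q k₁ k₂) (4q<M : 4 * q < M) (k<M : k₁ + k₂ < M) where
  open Config c
  open Neighbours c
  open BigCells c 4q<M k<M using (sameCell; sharedLabel)

  2q<half : ∀ {m} → M ≤ 2 * m → 2 * q < m
  2q<half {m} h = *-cancelˡ-< 2 (2 * q) m (lin 3 (λ M q m → K 1 · M ≼ K 2 :* m ⇒ K 1 · Suc (K 4 :* q) ≼ M ⇒ ⊢ 1 · Suc (K 2 :* (K 2 :* q)) ≼ K 2 :* m) refl M q m h 4q<M)

  q<half : ∀ {m} → M ≤ 2 * m → q < m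
  q<half h = ≤-trans (s≤s (m≤m+n q _)) (2q<half h)

  -- Cells that differ in both labels have no edges between them, against q < M/2. If they share
  -- only the second label, recolouring reduces to `sharedLabel`.
  no-big-cells : ∀ i p j s → BigX i p → BigY j s → ⊥
  no-big-cells i p j s bx by with i ≟ᴸ j | p ≟ᴸ s
  ... | yes refl | yes refl = sameCell i p bx by
  ... | yes refl | no p≢s = sharedLabel i p s p≢s bx by
  ... | no i≢j | yes refl = BigCells.sharedLabel (recolour c) 4q<M (≤-trans (s≤s (≤-reflexive (+-comm k₂ k₁))) k<M) p i j i≢j
        (≤-trans bx (*-monoʳ-≤ 2 (#-⊆ (λ x h → ∧-intro (∧-snd {r₁X x ≐ i} h) (∧-fst {r₁X x ≐ i} h)))))
        (≤-trans by (*-monoʳ-≤ 2 (#-⊆ (λ y h → ∧-intro (∧-snd {r₁Y y ≐ j} h) (∧-fst {r₁Y y ≐ j} h)))))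
  ... | no i≢j | no p≢s with #-ex₁ (cellY j s) (≤-trans (s≤s z≤n) (q<half by))
  ... | y , cy = <⇒≱ (q<half bx) (≤-trans (nbrsY y (cellX i p) (λ _ → false) apart) (≤-reflexive (cong (_+ q) (∑-0 M))))
    where
    apart : ∀ x → cellX i p x ≡ true → E₁ x y ≡ true ⊎ E₂ x y ≡ true → false ≡ true
    apart x cx (inj₁ e) = ⊥-elim (i≢j (trans (sym (≐-true (∧-fst cx))) (trans (same₁ x y e) (≐-true (∧-fst cy)))))
    apart x cx (inj₂ e) = ⊥-elim (p≢s (trans (sym (≐-true (∧-snd {r₁X x ≐ i} cx))) (trans (same₂ x y e) (≐-true (∧-snd {r₁Y y ≐ j} cy)))))

  -- All edges between X′ and Y′ have colour 2. Any two vertices of Y′ have a common neighbour in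
  -- the large set X′, so Y′ has one label l. Both sets are larger than the cover of l, and an
  -- uncovered vertex on either side forces the other set into the cover up to q; so their sizes add
  -- up to at most k₂ + 2q.
  block-half : ∀ (X′ Y′ : Fin M → Bool) → (∀ x y → X′ x ≡ true → Y′ y ≡ true → E₁ x y ≡ true → ⊥) → M + k₂ < # X′ + # Y′ → k₂ < # X′ → k₂ < # Y′ → M ≤ 2 * # X′ → ⊥
  block-half X′ Y′ only big bx by half with #-ex₁ Y′ (≤-trans (s≤s z≤n) by)
  ... | y₀ , Yy₀ = finish
    where
    l = r₂Y y₀
    label : ∀ y → Y′ y ≡ true → r₂Y y ≡ l
    label y Yy with commonY y₀ y X′ (2q<half half)
    ... | x , Xx , e₀ , e = trans (sym (two y Yy e)) (two y₀ Yy₀ e₀)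
      where
      two : ∀ y → Y′ y ≡ true → E₁ x y ≡ true ⊎ E₂ x y ≡ true → r₂X x ≡ r₂Y y
      two y Yy (inj₁ e) = ⊥-elim (only x y Xx Yy e)
      two y Yy (inj₂ e) = same₂ x y e
    finish : ⊥
    finish with #-ex Y′ (λ y → (r₂Y y ≐ l) ∧ D₂ y) (≤-trans (s≤s (≤-trans (m≤n+m _ (c₂ l)) (small₂ l))) by) | #-ex X′ (λ x → (r₂X x ≐ l) ∧ C₂ x) (≤-trans (s≤s (≤-trans (m≤m+n _ (d₂ l)) (small₂ l))) bx)
    ... | y , Yy , fy | x , Xx , fx = ⊥-≤ (lin 7 (λ M q k X Y c d → K 1 · Suc (M :+ k) ≼ X :+ Y ⇒ K 1 · X ≼ c :+ q ⇒ K 1 · Y ≼ d :+ q ⇒ K 1 · c :+ d ≼ k ⇒ K 1 · Suc (K 4 :* q) ≼ M ⇒ ⊢ 1 · K 1 ≼ K 0) refl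
        M q k₂ (# X′) (# Y′) (c₂ l) (d₂ l) big
        (nbrsY y X′ (λ x → (r₂X x ≐ l) ∧ C₂ x) λ { x Xx (inj₁ e) → ⊥-elim (only x y Xx Yy e) ; x Xx (inj₂ e) → Neighbours.cover₂Y (transpose c) y x e (inj₁ (label y Yy)) fy })
        (nbrsX x Y′ (λ y → (r₂Y y ≐ l) ∧ D₂ y) λ { y Yy (inj₁ e) → ⊥-elim (only x y Xx Yy e) ; y Yy (inj₂ e) → cover₂Y x y e (inj₂ (label y Yy)) fx })
        (small₂ l) 4q<M)

-- Colours with one or two labels

module OneLabel {M q k₁ k₂ : ℕ} (c : Config M q k₁ k₂) (4q<M : 4 * q < M) (k<M : k₁ + k₂ < M) where
  open Config c
  open Neighbours c

  -- Deleting the cover of the only component, at most k₁ vertices, leaves sets without edges of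
  -- colour 1 and of total size 2M - k₁ > M + k₂. One of them has at least M/2 elements, as
  -- `block-half` requires.
  oneLabel : ∀ l → (∀ x → r₁X x ≡ l) → ⊥
  oneLabel l all = go (M ≤? 2 * # X′)
    where
    X′ Y′ CX DY : Fin M → Bool
    CX x = (r₁X x ≐ l) ∧ C₁ x
    DY y = (r₁Y y ≐ l) ∧ D₁ y
    X′ x = not (CX x)
    Y′ y = not (DY y)
    sX : # CX + # X′ ≡ M
    sX = #-compl CX
    sY : # DY + # Y′ ≡ M
    sY = #-compl DY
    only : ∀ x y → X′ x ≡ true → Y′ y ≡ true → E₁ x y ≡ true → ⊥
    only x y Xx Yy e = true≢false (cover₁Y x y e (inj₁ (all x)) (not-false Xx)) (not-false Yy)
    big : M + k₂ < # X′ + # Y′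
    big = lin 7 (λ M k l c d X Y → K 1 · M ≼ c :+ X ⇒ K 1 · M ≼ d :+ Y ⇒ K 1 · c :+ d ≼ k ⇒ K 1 · Suc (k :+ l) ≼ M ⇒ ⊢ 1 · Suc (M :+ l) ≼ X :+ Y) refl
      M k₁ k₂ (# CX) (# DY) (# X′) (# Y′) (≤-reflexive (sym sX)) (≤-reflexive (sym sY)) (small₁ l) k<M
    bx : k₂ < # X′
    bx = lin 6 (λ M k l c d X → K 1 · M ≼ c :+ X ⇒ K 1 · c :+ d ≼ k ⇒ K 1 · Suc (k :+ l) ≼ M ⇒ ⊢ 1 · Suc l ≼ X) refl M k₁ k₂ (# CX) (# DY) (# X′) (≤-reflexive (sym sX)) (small₁ l) k<M
    by : k₂ < # Y′
    by = lin 6 (λ M k l c d Y → K 1 · M ≼ d :+ Y ⇒ K 1 · c :+ d ≼ k ⇒ K 1 · Suc (k :+ l) ≼ M ⇒ ⊢ 1 · Suc l ≼ Y) refl M k₁ k₂ (# CX) (# DY) (# Y′) (≤-reflexive (sym sY)) (small₁ l) k<M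
    go : Dec (M ≤ 2 * # X′) → ⊥
    go (yes h) = Contradiction.block-half c 4q<M k<M X′ Y′ only big bx by h
    go (no ¬h) = Contradiction.block-half (transpose c) 4q<M k<M Y′ X′ (λ y x Yy Xx e → only x y Xx Yy e) (≤-trans big (≤-reflexive (+-comm (# X′) (# Y′)))) by bx
      (lin 4 (λ M k X Y → K 1 · Suc (K 2 :* X) ≼ M ⇒ K 2 · Suc (M :+ k) ≼ X :+ Y ⇒ ⊢ 1 · M ≼ K 2 :* Y) refl M k₂ (# X′) (# Y′) (≰⇒> ¬h) big)

module Labels {M q k₁ k₂ : ℕ} (c : Config M q k₁ k₂) (4q<M : 4 * q < M) (k<M : k₁ + k₂ < M) where
  open Config c
  open Neighbours c
  open OneLabel c 4q<M k<M using (oneLabel)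
  open Contradiction c 4q<M k<M using (no-big-cells; 2q<half; q<half)

  k<M′ : k₂ + k₁ < M
  k<M′ = ≤-trans (s≤s (≤-reflexive (+-comm k₂ k₁))) k<M

  differ : ∀ (r : Fin M → Label) l → (∀ x → r x ≡ l) ⊎ (∃ λ x → r x ≢ l)
  differ r l with search (λ x → not (r x ≐ l))
  ... | inj₁ (x , e) = inj₂ (x , ≐-false (not-false e))
  ... | inj₂ h = inj₁ (λ x → ≐-true (not-false⁻ (h x)))

  -- The vertex a has first label i and a second label other than j, so it sees no y whose first
  -- label is not i, as such a y has second label j. Hence there are at most q such y. With b the
  -- roles are exchanged, and at least M - 2q vertices of Y remain in the cell.
  cross-big : ∀ i j → (∀ x → r₁X x ≡ i ⊎ r₂X x ≡ j) → (∀ y → r₁Y y ≡ i ⊎ r₂Y y ≡ j) → (∃ λ x → r₁X x ≢ i) → (∃ λ x → r₂X x ≢ j) → BigY i j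
  cross-big i j hx hy (b , b≢) (a , a≢) = lin 5 (λ M C F E q → K 2 · M ≼ C :+ (F :+ E) ⇒ K 2 · F ≼ q ⇒ K 2 · E ≼ q ⇒ K 1 · Suc (K 4 :* q) ≼ M ⇒ ⊢ 1 · M ≼ K 2 :* C) refl
      M (# (cellY i j)) (# Fs) (# Es) q total (≤-trans (nbrsX a Fs (λ _ → false) a-apart) (≤-reflexive (cong (_+ q) (∑-0 M)))) (≤-trans (nbrsX b Es (λ _ → false) b-apart) (≤-reflexive (cong (_+ q) (∑-0 M)))) 4q<M
    where
    Fs Es : Fin M → Bool
    Fs y = not (r₁Y y ≐ i)
    Es y = not (r₂Y y ≐ j)
    total : M ≤ # (cellY i j) + (# Fs + # Es)
    total = ≤-trans (#-all {P = λ _ → true} (λ _ → refl)) (≤-trans (#-∪ {Q = cellY i j} {R = λ y → Fs y ∨ Es y} cs) (+-monoʳ-≤ (# (cellY i j)) (#-∪ {Q = Fs} {R = Es} (λ y → ∨-case))))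
      where
      cs : ∀ y → true ≡ true → cellY i j y ≡ true ⊎ Fs y ∨ Es y ≡ true
      cs y _ with r₁Y y ≐ i | r₂Y y ≐ j
      ... | true | true = inj₁ refl
      ... | true | false = inj₂ refl
      ... | false | _ = inj₂ refl
    a-apart : ∀ y → Fs y ≡ true → E₁ a y ≡ true ⊎ E₂ a y ≡ true → false ≡ true
    a-apart y f e with hx a | hy y
    ... | inj₂ h | _ = ⊥-elim (a≢ h)
    ... | inj₁ _ | inj₁ h = ⊥-elim (≐-false (not-false f) h)
    a-apart y f (inj₁ e) | inj₁ h | inj₂ _ = ⊥-elim (≐-false (not-false f) (trans (sym (same₁ a y e)) h))
    a-apart y f (inj₂ e) | inj₁ _ | inj₂ h = ⊥-elim (a≢ (trans (same₂ a y e) h))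
    b-apart : ∀ y → Es y ≡ true → E₁ b y ≡ true ⊎ E₂ b y ≡ true → false ≡ true
    b-apart y f e with hx b | hy y
    ... | inj₁ h | _ = ⊥-elim (b≢ h)
    ... | inj₂ _ | inj₂ h = ⊥-elim (≐-false (not-false f) h)
    b-apart y f (inj₂ e) | inj₂ h | inj₁ _ = ⊥-elim (≐-false (not-false f) (trans (sym (same₂ b y e)) h))
    b-apart y f (inj₁ e) | inj₂ _ | inj₁ h = ⊥-elim (b≢ (trans (same₁ b y e) h))

module Rows {M q k₁ k₂ : ℕ} (c : Config M q k₁ k₂) (4q<M : 4 * q < M) (k<M : k₁ + k₂ < M) where
  open Config c
  open Neighbours c
  open Labels c 4q<M k<M public
  open OneLabel c 4q<M k<M using (oneLabel)
  open Contradiction c 4q<M k<M using (no-big-cells; 2q<half; q<half)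

  cross-cover : ∀ i j → (∀ x → r₁X x ≡ i ⊎ r₂X x ≡ j) → (∀ y → r₁Y y ≡ i ⊎ r₂Y y ≡ j) → ⊥
  cross-cover i j hx hy with differ r₁X i | differ r₂X j | differ r₁Y i | differ r₂Y j
  ... | inj₁ h | _ | _ | _ = oneLabel i h
  ... | _ | inj₁ h | _ | _ = OneLabel.oneLabel (recolour c) 4q<M k<M′ j h
  ... | _ | _ | inj₁ h | _ = OneLabel.oneLabel (transpose c) 4q<M k<M i h
  ... | _ | _ | _ | inj₁ h = OneLabel.oneLabel (transpose (recolour c)) 4q<M k<M′ j h
  ... | inj₂ a | inj₂ b | inj₂ a′ | inj₂ b′ = no-big-cells i j i j (Labels.cross-big (transpose c) 4q<M k<M i j hy hx a′ b′) (cross-big i j hx hy a b)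

  rowX rowY : Label → Fin M → Bool
  rowX i x = r₁X x ≐ i
  rowY i y = r₁Y y ≐ i

  other : ∀ x y → r₁X x ≢ r₁Y y → E₁ x y ≡ true ⊎ E₂ x y ≡ true → r₂X x ≡ r₂Y y
  other x y ne (inj₁ e) = ⊥-elim (ne (same₁ x y e))
  other x y _ (inj₂ e) = same₂ x y e

  apart : ∀ {i i′} x y → i ≢ i′ → rowX i x ≡ true → r₁Y y ≡ i′ → r₁X x ≢ r₁Y y
  apart x y ne h h′ e = ne (trans (sym (≐-true h)) (trans e h′))

  colourY : ∀ {i i′} → i ≢ i′ → M ≤ 2 * # (rowX i) → ∀ y y′ → r₁Y y ≡ i′ → r₁Y y′ ≡ i′ → r₂Y y ≡ r₂Y y′
  colourY {i} ne big y y′ h h′ with commonY y y′ (rowX i) (2q<half big)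
  ... | x , r , e , e′ = trans (sym (other x y (apart x y ne r h) e)) (other x y′ (apart x y′ ne r h′) e′)

  -- Between rows with different labels all edges have colour 2. Both rows being big, they carry one
  -- common second label, which makes them big cells.
  opposite : ∀ i i′ → i ≢ i′ → M ≤ 2 * # (rowX i) → M ≤ 2 * # (rowY i′) → ⊥
  opposite i i′ ne bx by with #-ex₁ (rowY i′) (≤-trans (s≤s z≤n) (q<half by))
  ... | y₀ , h₀ = no-big-cells i j i′ j (≤-trans bx (*-monoʳ-≤ 2 (#-⊆ (λ x h → ∧-intro h (≐-intro (lx x h)))))) (≤-trans by (*-monoʳ-≤ 2 (#-⊆ (λ y h → ∧-intro h (≐-intro (lyy y h))))))
    where
    j = r₂Y y₀
    lyy : ∀ y → rowY i′ y ≡ true → r₂Y y ≡ j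
    lyy y h = colourY ne bx y y₀ (≐-true h) (≐-true h₀)
    lx : ∀ x → rowX i x ≡ true → r₂X x ≡ j
    lx x h with Neighbours.existsY (transpose c) x (rowY i′) (q<half by)
    ... | y , h′ , e = trans (other x y (apart x y ne h (≐-true h′)) e) (lyy y h′)

  -- Row i′ of Y is nearly empty, because x* could reach it only in colour 2 and has the wrong
  -- second label. So x₂ sees almost all of Y in colour 2 within row i, which creates the big cell
  -- (i, j′). It is excluded by a big cell (i, j) in X or by counting covers.
  skew : ∀ i i′ j j′ → i ≢ i′ → j ≢ j′ → (∀ x → r₁X x ≡ i ⊎ r₁X x ≡ i′) → (∀ y → r₁Y y ≡ i ⊎ r₁Y y ≡ i′) → M ≤ 2 * # (rowX i) →
    (∀ y → r₁Y y ≡ i′ → r₂Y y ≡ j) → (∀ x → r₁X x ≡ i′ → r₂X x ≡ j′) → (∃ λ x → r₁X x ≡ i′) → (∃ λ y → r₁Y y ≡ i′) → (∃ λ x → r₁X x ≡ i × r₂X x ≢ j) → ⊥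
  skew i i′ j j′ i≢ j≢ hx hy bx ly lx (x₂ , hx₂) (y₂ , hy₂) (x* , hx* , x*≢) = finish
    where
    rowsY : M ≤ # (rowY i) + # (rowY i′)
    rowsY = ≤-trans (#-all {P = λ _ → true} (λ _ → refl)) (#-∪ {Q = rowY i} {R = rowY i′} (λ y _ → either (hy y)))
      where
      either : ∀ {y} → r₁Y y ≡ i ⊎ r₁Y y ≡ i′ → rowY i y ≡ true ⊎ rowY i′ y ≡ true
      either (inj₁ h) = inj₁ (≐-intro h)
      either (inj₂ h) = inj₂ (≐-intro h)
    disjX : # (rowX i) + # (rowX i′) ≤ M
    disjX = ≤-trans (#-disj {P = rowX i} {R = λ _ → true} {Q = rowX i′} (λ _ _ → refl) (λ _ _ → refl) (λ x h h′ → i≢ (trans (sym (≐-true h)) (≐-true h′)))) (#-≤n {M} (λ _ → true))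
    few : # (rowY i′) ≤ q
    few = ≤-trans (nbrsX x* (rowY i′) (λ _ → false) (λ y h e → ⊥-elim (x*≢ (trans (other x* y (λ e → i≢ (trans (sym hx*) (trans e (≐-true h)))) e) (ly y (≐-true h)))))) (≤-reflexive (cong (_+ q) (∑-0 M)))
    bigCell : BigY i j′
    bigCell = lin 5 (λ M q C Y Y′ → K 2 · M ≼ Y :+ Y′ ⇒ K 2 · Y′ ≼ q ⇒ K 2 · Y ≼ C :+ q ⇒ K 1 · Suc (K 4 :* q) ≼ M ⇒ ⊢ 1 · M ≼ K 2 :* C) refl
      M q (# (cellY i j′)) (# (rowY i)) (# (rowY i′)) rowsY few
      (nbrsX x₂ (rowY i) (cellY i j′) (λ y h e → ∧-intro h (≐-intro (trans (sym (other x₂ y (λ e → i≢ (trans (sym (≐-true h)) (trans (sym e) hx₂))) e)) (lx x₂ hx₂))))) 4q<M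
    around : M ≤ # (cellX i j) + # (rowX i′) + q
    around = ≤-trans (#-all {P = λ _ → true} (λ _ → refl)) (≤-trans (nbrsY y₂ (λ _ → true) (λ x → cellX i j x ∨ rowX i′ x) near) (+-monoˡ-≤ q (#-∪ {Q = cellX i j} {R = rowX i′} (λ x → ∨-case))))
      where
      near : ∀ x → true ≡ true → E₁ x y₂ ≡ true ⊎ E₂ x y₂ ≡ true → cellX i j x ∨ rowX i′ x ≡ true
      near x _ e with hx x
      ... | inj₂ h = ∨-inr {cellX i j x} (≐-intro h)
      ... | inj₁ h = ∨-inl (∧-intro (≐-intro h) (≐-intro (trans (other x y₂ (λ e → i≢ (trans (sym h) (trans e hy₂))) e) (ly y₂ hy₂))))
    finish : ⊥
    finish with M ≤? 2 * # (cellX i j)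
    ... | yes big = no-big-cells i j i j′ big bigCell
    -- Then row i′ of X has more than q vertices. Every vertex of row i of Y sees it, necessarily in
    -- colour 2, so that whole row lies in the cell (i, j′).
    ... | no ¬big = ⊥-≤ (lin 7 (λ M q Y Y′ d f kk → K 2 · M ≼ Y :+ Y′ ⇒ K 2 · Y′ ≼ q ⇒ K 1 · Y ≼ d :+ q ⇒ K 1 · Y ≼ f :+ q ⇒ K 1 · d :+ f ≼ kk ⇒ K 1 · Suc kk ≼ M ⇒ K 1 · Suc (K 4 :* q) ≼ M ⇒ ⊢ 1 · K 1 ≼ K 0) refl
          M q (# (rowY i)) (# (rowY i′)) (d₁ i) (d₂ j′) (k₁ + k₂) rowsY few Y≤d₁ Y≤d₂ (+-mono-≤ (≤-trans (m≤n+m _ (c₁ i)) (small₁ i)) (≤-trans (m≤n+m _ (c₂ j′)) (small₂ j′))) k<M 4q<M)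
      where
      row′-big : q < # (rowX i′)
      row′-big = lin 4 (λ M q C X′ → K 1 · Suc (K 2 :* C) ≼ M ⇒ K 2 · M ≼ C :+ X′ :+ q ⇒ K 1 · Suc (K 4 :* q) ≼ M ⇒ ⊢ 2 · Suc q ≼ X′) refl M q (# (cellX i j)) (# (rowX i′)) (≰⇒> ¬big) around 4q<M
      Y-label : ∀ y → rowY i y ≡ true → r₂Y y ≡ j′
      Y-label y h with existsY y (rowX i′) row′-big
      ... | x , h′ , e = trans (sym (other x y (λ e → i≢ (trans (sym (≐-true h)) (trans (sym e) (≐-true h′)))) e)) (lx x (≐-true h′))
      Y≤S : # (rowY i) ≤ # (Sᶜ i j′)
      Y≤S = #-⊆ (λ y h → Saturated.saturated c 4q<M k<M i j′ bigCell y (∧-intro h (≐-intro (Y-label y h))))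
      -- By saturation the Y-side of the two covers takes up at least M - q, which leaves at most q
      -- for the X-side.
      covers : c₁ i + c₂ j′ ≤ q
      covers = lin 9 (λ M q Y Y′ S A E k l → K 1 · M ≼ Y :+ Y′ ⇒ K 1 · Y′ ≼ q ⇒ K 1 · Y ≼ S ⇒ K 1 · A :+ S ≼ k :+ l ⇒ K 1 · k :+ l ≼ M ⇒ ⊢ 1 · A ≼ q) refl
        M q (# (rowY i)) (# (rowY i′)) (# (Sᶜ i j′)) (c₁ i + c₂ j′) 0 k₁ k₂ rowsY few Y≤S
        (lin 7 (λ c e d f S k l → K 1 · S ≼ d :+ f ⇒ K 1 · c :+ d ≼ k ⇒ K 1 · e :+ f ≼ l ⇒ ⊢ 1 · c :+ e :+ S ≼ k :+ l) refl (c₁ i) (c₂ j′) (d₁ i) (d₂ j′) (# (Sᶜ i j′)) k₁ k₂ (S≤ i j′) (small₁ i) (small₂ j′)) (<⇒≤ k<M)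
      cell-big : q < # (cellX i j)
      cell-big = *-cancelˡ-< 2 q _ (lin 5 (λ M q C X X′ → K 2 · M ≼ C :+ X′ :+ q ⇒ K 1 · M ≼ K 2 :* X ⇒ K 2 · X :+ X′ ≼ M ⇒ K 1 · Suc (K 4 :* q) ≼ M ⇒ ⊢ 1 · Suc (K 2 :* q) ≼ K 2 :* C) refl M q (# (cellX i j)) (# (rowX i)) (# (rowX i′)) around bx disjX 4q<M)
      -- A vertex of the cell (i, j) outside C₁ sees row i of Y only in colour 1, since j ≢ j′;
      -- below, a vertex of row i′ outside C₂ sees it only in colour 2. The row is thus covered
      -- almost twice, which needs nearly 2M cover vertices.
      Y≤d₁ : # (rowY i) ≤ d₁ i + q
      Y≤d₁ with #-ex (cellX i j) (λ x → (r₁X x ≐ i) ∧ C₁ x) (≤-trans (s≤s (≤-trans (m≤m+n (c₁ i) (c₂ j′)) covers)) cell-big)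
      ... | x , hc , f = nbrsX x (rowY i) (λ y → (r₁Y y ≐ i) ∧ D₁ y) λ
          { y h (inj₁ e) → cover₁Y x y e (inj₂ (≐-true h)) f
          ; y h (inj₂ e) → ⊥-elim (j≢ (trans (sym (≐-true (∧-snd {r₁X x ≐ i} hc))) (trans (same₂ x y e) (Y-label y h)))) }
      Y≤d₂ : # (rowY i) ≤ d₂ j′ + q
      Y≤d₂ with #-ex (rowX i′) (λ x → (r₂X x ≐ j′) ∧ C₂ x) (≤-trans (s≤s (≤-trans (m≤n+m (c₂ j′) (c₁ i)) covers)) row′-big)
      ... | x , hc , f = nbrsX x (rowY i) (λ y → (r₂Y y ≐ j′) ∧ D₂ y) λ
          { y h (inj₁ e) → ⊥-elim (i≢ (trans (sym (≐-true h)) (trans (sym (same₁ x y e)) (≐-true hc))))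
          ; y h (inj₂ e) → cover₂Y x y e (inj₁ (lx x (≐-true hc))) f }

module TwoRows {M q k₁ k₂ : ℕ} (c : Config M q k₁ k₂) (4q<M : 4 * q < M) (k<M : k₁ + k₂ < M) where
  open Config c
  open Neighbours c
  open Rows c 4q<M k<M
  module Rt = Rows (transpose c) 4q<M k<M

  -- Big rows i force a single second label j on row i′ of Y and j′ on row i′ of X. If j = j′, the
  -- labels i and j reach every vertex. Otherwise row i is a single big cell on both sides, or some
  -- vertex of it deviates, which is the situation of `skew`.
  parallel : ∀ i i′ → i ≢ i′ → (∀ x → r₁X x ≡ i ⊎ r₁X x ≡ i′) → (∀ y → r₁Y y ≡ i ⊎ r₁Y y ≡ i′) → M ≤ 2 * # (rowX i) → M ≤ 2 * # (rowY i) → (∃ λ x → r₁X x ≡ i′) → ⊥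
  parallel i i′ ne hx hy bx by (x₂ , hx₂) with differ r₁Y i
  ... | inj₁ h = OneLabel.oneLabel (transpose c) 4q<M k<M i h
  ... | inj₂ (y₂ , y₂≢) = go (r₂Y y₂ ≟ᴸ r₂X x₂)
    where
    hy₂ : r₁Y y₂ ≡ i′
    hy₂ with hy y₂
    ... | inj₁ h = ⊥-elim (y₂≢ h)
    ... | inj₂ h = h
    j = r₂Y y₂
    j′ = r₂X x₂
    ly : ∀ y → r₁Y y ≡ i′ → r₂Y y ≡ j
    ly y h = colourY ne bx y y₂ h hy₂
    lx : ∀ x → r₁X x ≡ i′ → r₂X x ≡ j′
    lx x h = Rt.colourY ne by x x₂ h hx₂
    inRow : ∀ (r s : Fin M → Label) l → (∃ λ x → r x ≡ i × s x ≢ l) ⊎ (∀ x → r x ≡ i → s x ≡ l)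
    inRow r s l with search (λ x → (r x ≐ i) ∧ not (s x ≐ l))
    ... | inj₁ (x , e) = inj₁ (x , ≐-true (∧-fst e) , ≐-false (not-false (∧-snd {r x ≐ i} e)))
    ... | inj₂ h = inj₂ all
      where
      all : ∀ x → r x ≡ i → s x ≡ l
      all x e with s x ≐ l in f | h x
      ... | true | _ = ≐-true f
      ... | false | g = ⊥-elim (true≢false (∧-intro (≐-intro e) refl) g)
    go : Dec (j ≡ j′) → ⊥
    go (yes j≡) = cross-cover i j (λ x → ax (hx x)) (λ y → ay (hy y))
      where
      ax : ∀ {x} → r₁X x ≡ i ⊎ r₁X x ≡ i′ → r₁X x ≡ i ⊎ r₂X x ≡ j
      ax (inj₁ h) = inj₁ h
      ax {x} (inj₂ h) = inj₂ (trans (lx x h) (sym j≡))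
      ay : ∀ {y} → r₁Y y ≡ i ⊎ r₁Y y ≡ i′ → r₁Y y ≡ i ⊎ r₂Y y ≡ j
      ay (inj₁ h) = inj₁ h
      ay {y} (inj₂ h) = inj₂ (ly y h)
    go (no j≢) with inRow r₁X r₂X j | inRow r₁Y r₂Y j′
    ... | inj₁ w | _ = skew i i′ j j′ ne j≢ hx hy bx ly lx (x₂ , hx₂) (y₂ , hy₂) w
    ... | inj₂ _ | inj₁ w = Rt.skew i i′ j′ j ne (λ e → j≢ (sym e)) hy hx by lx ly (y₂ , hy₂) (x₂ , hx₂) w
    ... | inj₂ ax | inj₂ ay = Contradiction.no-big-cells c 4q<M k<M i j i j′ (≤-trans bx (*-monoʳ-≤ 2 (#-⊆ (λ x h → ∧-intro h (≐-intro (ax x (≐-true h)))))))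
        (≤-trans by (*-monoʳ-≤ 2 (#-⊆ (λ y h → ∧-intro h (≐-intro (ay y (≐-true h)))))))

  half : ∀ (r : Fin M → Label) i i′ → (∀ x → r x ≡ i ⊎ r x ≡ i′) → M ≤ 2 * # (λ x → r x ≐ i) ⊎ M ≤ 2 * # (λ x → r x ≐ i′)
  half r i i′ h with M ≤? 2 * # (λ x → r x ≐ i)
  ... | yes p = inj₁ p
  ... | no ¬p = inj₂ (lin 3 (λ M a b → K 1 · Suc (K 2 :* a) ≼ M ⇒ K 2 · M ≼ a :+ b ⇒ ⊢ 1 · M ≼ K 2 :* b) refl M (# (λ x → r x ≐ i)) (# (λ x → r x ≐ i′)) (≰⇒> ¬p)
      (≤-trans (#-all {P = λ _ → true} (λ _ → refl)) (#-∪ {Q = λ x → r x ≐ i} {R = λ x → r x ≐ i′} (λ x _ → either (h x)))))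
    where
    either : ∀ {x} → r x ≡ i ⊎ r x ≡ i′ → (r x ≐ i) ≡ true ⊎ (r x ≐ i′) ≡ true
    either (inj₁ h) = inj₁ (≐-intro h)
    either (inj₂ h) = inj₂ (≐-intro h)

  bothTwoRows : ∀ i i′ → i ≢ i′ → (∀ x → r₁X x ≡ i ⊎ r₁X x ≡ i′) → (∀ y → r₁Y y ≡ i ⊎ r₁Y y ≡ i′) → (∃ λ x → r₁X x ≡ i) → (∃ λ x → r₁X x ≡ i′) → ⊥
  bothTwoRows i i′ ne hx hy w w′ with half r₁X i i′ hx | half r₁Y i i′ hy
  ... | inj₁ bx | inj₂ by = opposite i i′ ne bx by
  ... | inj₂ bx | inj₁ by = opposite i′ i (λ e → ne (sym e)) bx by
  ... | inj₁ bx | inj₁ by = parallel i i′ ne hx hy bx by w′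
  ... | inj₂ bx | inj₂ by = parallel i′ i (λ e → ne (sym e)) (λ x → Sum.swap (hx x)) (λ y → Sum.swap (hy y)) bx by w

-- A vertex of Y outside two rows containing X has no edge of colour 1, so it may be moved to the first row.
module Relabel {M q k₁ k₂ : ℕ} (c : Config M q k₁ k₂) (i i′ : Label) (hx : ∀ x → Config.r₁X c x ≡ i ⊎ Config.r₁X c x ≡ i′) where
  open Config c

  inside : Fin M → Bool
  inside y = (r₁Y y ≐ i) ∨ (r₁Y y ≐ i′)

  relabelled : Config M q k₁ k₂
  relabelled = record
    { E₁ = E₁ ; E₂ = E₂ ; nonX = nonX ; nonY = nonY ; r₁X = r₁X ; r₂X = r₂X ; r₂Y = r₂Y ; C₁ = C₁ ; C₂ = C₂ ; D₂ = D₂ ; same₂ = same₂ ; cov₂ = cov₂ ; small₂ = small₂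
    ; r₁Y = λ y → if inside y then r₁Y y else i
    ; D₁ = λ y → inside y ∧ D₁ y
    ; same₁ = λ x y e → trans (same₁ x y e) (cong (λ b → if b then r₁Y y else i) (sym (inn x y e)))
    ; cov₁ = cv
    ; small₁ = λ l → ≤-trans (+-monoʳ-≤ (# (λ x → (r₁X x ≐ l) ∧ C₁ x)) (#-⊆ (λ y → keep l y))) (small₁ l) }
    where
    inn : ∀ x y → E₁ x y ≡ true → inside y ≡ true
    inn x y e with hx x
    ... | inj₁ h = ∨-inl (≐-intro (trans (sym (same₁ x y e)) h))
    ... | inj₂ h = ∨-inr {r₁Y y ≐ i} (≐-intro (trans (sym (same₁ x y e)) h))
    cv : ∀ x y → E₁ x y ≡ true → C₁ x ∨ (inside y ∧ D₁ y) ≡ true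
    cv x y e rewrite inn x y e = cov₁ x y e
    keep : ∀ l y → ((if inside y then r₁Y y else i) ≐ l) ∧ (inside y ∧ D₁ y) ≡ true → (r₁Y y ≐ l) ∧ D₁ y ≡ true
    keep l y h with inside y
    ... | true = h
    ... | false = ⊥-elim (true≢false (∧-snd {i ≐ l} h) refl)

  rowsY : ∀ y → Config.r₁Y relabelled y ≡ i ⊎ Config.r₁Y relabelled y ≡ i′
  rowsY y with r₁Y y ≐ i in e | r₁Y y ≐ i′ in e′
  ... | true | _ = inj₁ (≐-true e)
  ... | false | true = inj₂ (≐-true e′)
  ... | false | false = inj₁ refl

twoRows : ∀ {M q k₁ k₂} (c : Config M q k₁ k₂) → 4 * q < M → k₁ + k₂ < M → ∀ x₁ x₂ → Config.r₁X c x₁ ≢ Config.r₁X c x₂ →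
  (∀ x → Config.r₁X c x ≡ Config.r₁X c x₁ ⊎ Config.r₁X c x ≡ Config.r₁X c x₂) → ⊥
twoRows c 4q<M k<M x₁ x₂ ne hx = TwoRows.bothTwoRows relabelled 4q<M k<M _ _ ne hx rowsY (x₁ , refl) (x₂ , refl)
  where open Relabel c _ _ hx

-- Existence of large cells

module Spread {M q k₁ k₂ : ℕ} (c : Config M q k₁ k₂) (4q<M : 4 * q < M) (k<M : k₁ + k₂ < M) where
  open Config c
  open Neighbours c
  open Labels c 4q<M k<M using (differ; k<M′)

  Independent : Fin M → Fin M → Set
  Independent x x′ = r₁X x ≢ r₁X x′ × r₂X x ≢ r₂X x′

  everywhere : ∀ (y : Fin M) → 2 * q < # {M} (λ _ → true)
  everywhere _ = ≤-trans (≤-trans (s≤s (*-monoˡ-≤ q {2} {4} (s≤s (s≤s z≤n)))) 4q<M) (#-all {P = λ _ → true} (λ _ → refl))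

  -- Two of the three edges from a common neighbour have the same colour.
  triple : ∀ x₁ x₂ x₃ → Independent x₁ x₂ → Independent x₂ x₃ → Independent x₁ x₃ → ⊥
  triple x₁ x₂ x₃ (a , a′) (b , b′) (d , d′) = clash (Neighbours.existsY (transpose c) x₃ (λ y → adjᴮ x₁ y ∧ adjᴮ x₂ y) enough)
    where
    N₁ N₂ : Fin M → Bool
    N₁ y = adjᴮ x₁ y
    N₂ y = adjᴮ x₁ y ∧ adjᴮ x₂ y
    ad : ∀ x {y} → E₁ x y ≡ true ⊎ E₂ x y ≡ true → adjᴮ x y ≡ true
    ad x (inj₁ e) = ∨-inl e
    ad x {y} (inj₂ e) = ∨-inr {E₁ x y} e
    enough : q < # N₂
    enough = lin 4 (λ M q A B → K 1 · M ≼ A :+ q ⇒ K 1 · A ≼ B :+ q ⇒ K 1 · Suc (K 4 :* q) ≼ M ⇒ ⊢ 1 · Suc q ≼ B) refl M q (# N₁) (# N₂)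
      (≤-trans (#-all {P = λ _ → true} (λ _ → refl)) (nbrsX x₁ (λ _ → true) N₁ (λ y _ → ad x₁))) (nbrsX x₂ N₁ N₂ (λ y h e → ∧-intro h (ad x₂ e))) 4q<M
    clash : (∃ λ y → adjᴮ x₁ y ∧ adjᴮ x₂ y ≡ true × (E₁ x₃ y ≡ true ⊎ E₂ x₃ y ≡ true)) → ⊥
    clash (y , h , e₃) with ∨-case {E₁ x₁ y} (∧-fst {adjᴮ x₁ y} h) | ∨-case {E₁ x₂ y} (∧-snd {adjᴮ x₁ y} h) | e₃
    ... | inj₁ e | inj₁ f | _ = a (trans (same₁ x₁ y e) (sym (same₁ x₂ y f)))
    ... | inj₂ e | inj₂ f | _ = a′ (trans (same₂ x₁ y e) (sym (same₂ x₂ y f)))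
    ... | inj₁ e | _ | inj₁ g = d (trans (same₁ x₁ y e) (sym (same₁ x₃ y g)))
    ... | inj₂ e | _ | inj₂ g = d′ (trans (same₂ x₁ y e) (sym (same₂ x₃ y g)))
    ... | _ | inj₁ f | inj₁ g = b (trans (same₁ x₂ y f) (sym (same₁ x₃ y g)))
    ... | _ | inj₂ f | inj₂ g = b′ (trans (same₂ x₂ y f) (sym (same₂ x₃ y g)))

  -- Common neighbours of x and x′, at least M - 2q of them, are joined to them in different colours
  -- because both labels differ. If colours 1 and 2, in this order, never occur, all of them have 2
  -- and 1 and lie in one cell.
  between : ∀ x x′ → Independent x x′ → (∃ λ y → E₁ x y ≡ true × E₂ x′ y ≡ true) ⊎ BigY (r₁X x′) (r₂X x)
  between x x′ (a , a′) with search (λ y → E₁ x y ∧ E₂ x′ y)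
  ... | inj₁ (y , h) = inj₁ (y , ∧-fst h , ∧-snd {E₁ x y} h)
  ... | inj₂ none = inj₂ (lin 4 (λ M q A B → K 2 · M ≼ A :+ q ⇒ K 2 · A ≼ B :+ q ⇒ K 1 · Suc (K 4 :* q) ≼ M ⇒ ⊢ 1 · M ≼ K 2 :* B) refl M q (# (adjᴮ x)) (# (cellY (r₁X x′) (r₂X x)))
      (≤-trans (#-all {P = λ _ → true} (λ _ → refl)) (nbrsX x (λ _ → true) (adjᴮ x) ad)) (nbrsX x′ (adjᴮ x) (cellY (r₁X x′) (r₂X x)) inCell) 4q<M)
    where
    ad : ∀ y → true ≡ true → E₁ x y ≡ true ⊎ E₂ x y ≡ true → adjᴮ x y ≡ true
    ad y _ (inj₁ e) = ∨-inl e
    ad y _ (inj₂ e) = ∨-inr {E₁ x y} e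
    inCell : ∀ y → adjᴮ x y ≡ true → E₁ x′ y ≡ true ⊎ E₂ x′ y ≡ true → cellY (r₁X x′) (r₂X x) y ≡ true
    inCell y h e′ with ∨-case {E₁ x y} h | e′
    ... | inj₁ e | inj₁ f = ⊥-elim (a (trans (same₁ x y e) (sym (same₁ x′ y f))))
    ... | inj₂ e | inj₂ f = ⊥-elim (a′ (trans (same₂ x y e) (sym (same₂ x′ y f))))
    ... | inj₁ e | inj₂ f = ⊥-elim (true≢false (∧-intro e f) (none y))
    ... | inj₂ e | inj₁ f = ∧-intro (≐-intro (sym (same₁ x′ y f))) (≐-intro (sym (same₂ x y e)))

  -- x differs from x₀ in the first label and x′ in the second. If neither is independent of x₀,
  -- then they are independent of each other.
  independent : ∃ λ x₁ → ∃ λ x₂ → Independent x₁ x₂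
  independent with #-ex₁ {M} (λ _ → true) (≤-trans (s≤s z≤n) (≤-trans 4q<M (#-all {P = λ _ → true} (λ _ → refl))))
  ... | x₀ , _ with differ r₁X (r₁X x₀) | differ r₂X (r₂X x₀)
  ... | inj₁ h | _ = ⊥-elim (OneLabel.oneLabel c 4q<M k<M _ h)
  ... | _ | inj₁ h = ⊥-elim (OneLabel.oneLabel (recolour c) 4q<M k<M′ _ h)
  ... | inj₂ (x , ne) | inj₂ (x′ , ne′) with r₂X x ≟ᴸ r₂X x₀ | r₁X x′ ≟ᴸ r₁X x₀
  ... | no e | _ = x , x₀ , ne , e
  ... | yes _ | no e = x′ , x₀ , e , ne′
  ... | yes e | yes e′ = x , x′ , (λ h → ne (trans h e′)) , (λ h → ne′ (trans (sym h) e))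

  third : ∀ (r : Fin M → Label) l l′ → (∀ x → r x ≡ l ⊎ r x ≡ l′) ⊎ (∃ λ x → r x ≢ l × r x ≢ l′)
  third r l l′ with search (λ x → not (r x ≐ l) ∧ not (r x ≐ l′))
  ... | inj₁ (x , h) = inj₂ (x , ≐-false (not-false (∧-fst h)) , ≐-false (not-false (∧-snd {not (r x ≐ l)} h)))
  ... | inj₂ none = inj₁ all
    where
    all : ∀ x → r x ≡ l ⊎ r x ≡ l′
    all x with r x ≐ l in e | r x ≐ l′ in e′ | none x
    ... | true | _ | _ = inj₁ (≐-true e)
    ... | false | true | _ = inj₂ (≐-true e′)
    ... | false | false | ()

  -- x₁, x₂, x₃, x₄ lie in the cells (1,1), (2,2), (3,1), (2,4).
  centre : ∀ x₁ x₂ x₃ x₄ → Independent x₁ x₂ → r₁X x₃ ≢ r₁X x₁ → r₁X x₃ ≢ r₁X x₂ → r₂X x₃ ≡ r₂X x₁ → r₂X x₄ ≢ r₂X x₁ → r₂X x₄ ≢ r₂X x₂ → r₁X x₄ ≡ r₁X x₂ →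
    BigY (r₁X x₂) (r₂X x₁)
  centre x₁ x₂ x₃ x₄ (a , a′) b₁ b₂ b≡ d₁ d₂ d≡ with between x₁ x₂ (a , a′) | between x₃ x₄ ((λ e → b₂ (trans e d≡)) , (λ e → d₁ (trans (sym e) b≡)))
  ... | inj₂ big | _ = big
  ... | _ | inj₂ big = ≤-trans big (≤-reflexive (cong₂ (λ i j → 2 * # (cellY i j)) d≡ b≡))
  -- Here y lies in the cell (1,2) and y″ in (3,4). Their common neighbour x lies in the cell (1,4)
  -- or (3,2), as otherwise two distinct labels would coincide; either way x forms an independent
  -- triple with two of the given vertices.
  ... | inj₁ (y , e , e′) | inj₁ (y″ , f , f′) with commonY y y″ (λ _ → true) (everywhere y)
  ... | x , _ , g , g′ = ⊥-elim (cases g g′)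
    where
    cases : E₁ x y ≡ true ⊎ E₂ x y ≡ true → E₁ x y″ ≡ true ⊎ E₂ x y″ ≡ true → ⊥
    cases (inj₁ h) (inj₁ h′) = b₁ (trans (same₁ x₃ y″ f) (trans (sym (same₁ x y″ h′)) (trans (same₁ x y h) (sym (same₁ x₁ y e)))))
    cases (inj₂ h) (inj₂ h′) = d₂ (trans (same₂ x₄ y″ f′) (trans (sym (same₂ x y″ h′)) (trans (same₂ x y h) (sym (same₂ x₂ y e′)))))
    cases (inj₁ h) (inj₂ h′) = triple x x₃ x₂ ((λ z → b₁ (trans (sym z) X₁)) , λ z → d₁ (trans (sym X₄) (trans z b≡))) (b₂ , λ z → a′ (trans (sym b≡) z)) ((λ z → a (trans (sym X₁) z)) , λ z → d₂ (trans (sym X₄) z))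
      where
      X₁ : r₁X x ≡ r₁X x₁
      X₁ = trans (same₁ x y h) (sym (same₁ x₁ y e))
      X₄ : r₂X x ≡ r₂X x₄
      X₄ = trans (same₂ x y″ h′) (sym (same₂ x₄ y″ f′))
    cases (inj₂ h) (inj₁ h′) = triple x x₁ x₄ ((λ z → b₁ (trans (sym X₃) z)) , λ z → a′ (sym (trans (sym X₂) z))) ((λ z → a (trans z d≡)) , λ z → d₁ (sym z)) ((λ z → b₂ (trans (sym X₃) (trans z d≡))) , λ z → d₂ (trans (sym z) X₂))
      where
      X₃ : r₁X x ≡ r₁X x₃
      X₃ = trans (same₁ x y″ h′) (sym (same₁ x₃ y″ f))
      X₂ : r₂X x ≡ r₂X x₂
      X₂ = trans (same₂ x y h) (sym (same₂ x₂ y e′))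

  -- By `twoRows` each colour has a third label on X, at x₃ and x₄. As there are no independent
  -- triples, x₃ copies its second label and x₄ its first label from x₁ or x₂. Copying from
  -- different vertices leads to `centre`, copying from the same one to a triple.
  bigY : ∃ λ i → ∃ λ j → BigY i j
  bigY with independent
  ... | x₁ , x₂ , ind with third r₁X (r₁X x₁) (r₁X x₂) | third r₂X (r₂X x₁) (r₂X x₂)
  ... | inj₁ h | _ = ⊥-elim (twoRows c 4q<M k<M x₁ x₂ (proj₁ ind) h)
  ... | _ | inj₁ h = ⊥-elim (twoRows (recolour c) 4q<M k<M′ x₁ x₂ (proj₂ ind) h)
  ... | inj₂ (x₃ , p , p′) | inj₂ (x₄ , s , s′) = cases (r₂X x₃ ≟ᴸ r₂X x₁) (r₂X x₃ ≟ᴸ r₂X x₂) (r₁X x₄ ≟ᴸ r₁X x₁) (r₁X x₄ ≟ᴸ r₁X x₂)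
    where
    flip : ∀ {x x′} → Independent x x′ → Independent x′ x
    flip (a , b) = (λ e → a (sym e)) , λ e → b (sym e)
    cases : Dec (r₂X x₃ ≡ r₂X x₁) → Dec (r₂X x₃ ≡ r₂X x₂) → Dec (r₁X x₄ ≡ r₁X x₁) → Dec (r₁X x₄ ≡ r₁X x₂) → ∃ λ i → ∃ λ j → BigY i j
    cases (no n) (no n′) _ _ = ⊥-elim (triple x₁ x₂ x₃ ind ((λ e → p′ (sym e)) , λ e → n′ (sym e)) ((λ e → p (sym e)) , λ e → n (sym e)))
    cases _ _ (no n) (no n′) = ⊥-elim (triple x₁ x₂ x₄ ind ((λ e → n′ (sym e)) , λ e → s′ (sym e)) ((λ e → n (sym e)) , λ e → s (sym e)))
    cases (yes e) _ _ (yes f) = _ , _ , centre x₁ x₂ x₃ x₄ ind p p′ e s s′ f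
    cases _ (yes e) (yes f) _ = _ , _ , centre x₂ x₁ x₃ x₄ (flip ind) p′ p e s′ s f
    cases (yes e) _ (yes f) _ = ⊥-elim (triple x₄ x₃ x₂ ((λ z → p (trans (sym z) f)) , λ z → s (trans z e)) (p′ , λ z → proj₂ ind (trans (sym e) z)) ((λ z → proj₁ ind (trans (sym f) z)) , s′))
    cases _ (yes e) _ (yes f) = ⊥-elim (triple x₄ x₃ x₁ ((λ z → p′ (trans (sym z) f)) , λ z → s′ (trans z e)) (p , λ z → proj₂ ind (sym (trans (sym e) z))) ((λ z → proj₁ ind (sym (trans (sym f) z))) , s))

no-config : ∀ {M q k₁ k₂} → Config M q k₁ k₂ → 4 * q < M → k₁ + k₂ < M → ⊥
no-config c 4q<M k<M with Spread.bigY c 4q<M k<M | Spread.bigY (transpose c) 4q<M k<M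
... | i , j , by | i′ , j′ , bx = Contradiction.no-big-cells c 4q<M k<M i′ j′ i j bx by

-- From two structures to a configuration

#-injective : ∀ {M n} (f : Fin M → Fin n) → (∀ {i j} → f i ≡ f j → i ≡ j) → (P : Fin n → Bool) → # (λ i → P (f i)) ≤ # P
#-injective f inj P = ≤-trans (≤-reflexive (trans (sym (elems-length (λ i → P (f i)))) (sym (length-map f (elems (λ i → P (f i)))))))
  (unique-length P (Unique.map⁺ inj (elems-unique (λ i → P (f i)))) λ h → let i , i∈ , e = ∈-map⁻ f h in trans (cong P e) (elems-sound (λ i → P (f i)) i∈))

lookup-inj : ∀ {A : Set} (xs : List A) → Unique xs → ∀ i j → lookup xs i ≡ lookup xs j → i ≡ j
lookup-inj (x ∷ xs) u zero zero _ = refl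
lookup-inj (x ∷ xs) u zero (suc j) e = ⊥-elim (unique-∉ u (subst (_∈ xs) (sym e) (∈-lookup j)))
lookup-inj (x ∷ xs) u (suc i) zero e = ⊥-elim (unique-∉ u (subst (_∈ xs) e (∈-lookup i)))
lookup-inj (x ∷ xs) (_ ∷ u) (suc i) (suc j) e = cong suc (lookup-inj xs u i j e)

embedding : ∀ {M n} (P : Fin n → Bool) → M ≤ # P → Σ (Fin M → Fin n) λ f → (∀ {i j} → f i ≡ f j → i ≡ j) × (∀ i → P (f i) ≡ true)
embedding P le = (λ i → lookup (elems P) (inject≤ i le′))
  , (λ {i} {j} e → inject≤-injective le′ le′ i j (lookup-inj (elems P) (elems-unique P) _ _ e))
  , λ i → elems-sound P (∈-lookup (inject≤ i le′))
  where le′ = ≤-trans le (≤-reflexive (sym (elems-length P)))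

module _ {n h k₁ k₂ d₁ d₂ c₁ c₂ : ℕ} (G₁ G₂ : Fin n → Fin n → Bool) (1≤h : 1 ≤ h)
  (degX : ∀ x → (3 * h + 12) * n ≤ 4 * h * # (λ y → G₁ x y ∨ G₂ x y))
  (degY : ∀ y → (3 * h + 12) * n ≤ 4 * h * # (λ x → G₁ x y ∨ G₂ x y))
  (lengths : 2 * (h * h) * (k₁ + k₂) + 3 * suc n ≤ 2 * (h * h) * suc n)
  (large : 8 * (h * h * h) < n)
  (del₁ : 8 * (h * h * h) * d₁ ≤ n * n) (del₂ : 8 * (h * h * h) * d₂ ≤ n * n)
  (covers₁ : 8 * (h * h * h) * c₁ ≤ 8 * (h * h * h) * k₁ + n) (covers₂ : 8 * (h * h * h) * c₂ ≤ 8 * (h * h * h) * k₂ + n)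
  (S₁ : Struct G₁ everything everything d₁ c₁) (S₂ : Struct G₂ everything everything d₂ c₂) where

  private
    module S₁ = Struct S₁
    module S₂ = Struct S₂
    e = 8 * (h * h * h)

    1≤n : 1 ≤ n
    1≤n = ≤-trans (s≤s z≤n) large

    lost : Fin n → Fin n → Bool
    lost x y = (G₁ x y ∨ G₂ x y) ∧ not (S₁.H x y ∨ S₂.H x y)

    lost-few : ∣ lost ∣ᴱ ≤ d₁ + d₂
    lost-few = ≤-trans (E-∪ {P′ = λ x y → (G₁ x y ∧ true) ∧ not (S₁.H x y)} {P″ = λ x y → (G₂ x y ∧ true) ∧ not (S₂.H x y)} (λ x y → cs (G₁ x y) (G₂ x y) (S₁.H x y) (S₂.H x y)))
      (+-mono-≤ S₁.deleted S₂.deleted)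
      where
      cs : ∀ g g′ a a′ → (g ∨ g′) ∧ not (a ∨ a′) ≡ true → (g ∧ true) ∧ not a ≡ true ⊎ (g′ ∧ true) ∧ not a′ ≡ true
      cs true g′ false false _ = inj₁ refl
      cs false true false false _ = inj₂ refl
      cs true g′ true a′ ()
      cs true g′ false true ()
      cs false true true a′ ()
      cs false true false true ()

    bad : (Fin n → ℕ) → Fin n → Bool
    bad r x = suc n ≤ᵇ h * r x

    -- Each bad vertex has lost more than n/h of the at most n²/(4h³) lost edges.
    bad-few : ∀ r → ∑ r ≤ d₁ + d₂ → 4 * (h * h) * # (bad r) ≤ n
    bad-few r r≤ = *-cancelˡ-≤ (2 * h * n) {{Data.Nat.>-nonZero (*-mono-≤ {1} {2 * h} {1} (*-mono-≤ {1} {2} {1} (s≤s z≤n) 1≤h) 1≤n)}} (lin 7 (λ h n b d f s E → K 8 :* (h :* h :* h) · b :* n ≼ h :* s ⇒ K 8 :* (h :* h :* h) :* h · s ≼ d :+ f ⇒ h · K 8 :* (h :* h :* h) :* d ≼ n :* n ⇒ h · K 8 :* (h :* h :* h) :* f ≼ n :* n ⇒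
        ⊢ 1 · K 2 :* h :* n :* (K 4 :* (h :* h) :* b) ≼ K 2 :* h :* n :* n) refl h n (# (bad r)) d₁ d₂ (∑ r) 0
        (≤-trans (≤-reflexive (sym (∑-*ʳ n (λ x → 𝟙 (bad r x))))) (≤-trans (∑-mono pt) (≤-reflexive (∑-*ˡ h r)))) r≤ del₁ del₂)
      where
      pt : ∀ x → 𝟙 (bad r x) * n ≤ h * r x
      pt x with bad r x in eq
      ... | false = z≤n
      ... | true = ≤-trans (≤-reflexive (*-identityˡ n)) (<⇒≤ (≤ᵇ-true {suc n} eq))

    rowX rowY : Fin n → ℕ
    rowX x = # (lost x)
    rowY y = # (λ x → lost x y)

    ρX = # (bad rowX)
    ρY = # (bad rowY)
    ρ = ρX + ρY

    ρX-few : 4 * (h * h) * ρX ≤ n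
    ρX-few = bad-few rowX lost-few
    ρY-few : 4 * (h * h) * ρY ≤ n
    ρY-few = bad-few rowY (≤-trans (≤-reflexive (sym (∑-swap (λ x y → 𝟙 (lost x y))))) lost-few)

    ρ-few : 2 * (h * h) * ρ ≤ n
    ρ-few = lin 4 (λ h a b n → K 1 · K 4 :* (h :* h) :* a ≼ n ⇒ K 1 · K 4 :* (h :* h) :* b ≼ n ⇒ ⊢ 2 · K 2 :* (h :* h) :* (a :+ b) ≼ n) refl h ρX ρY n ρX-few ρY-few

    M = n ∸ ρ

    ρ≤n : ρ ≤ n
    ρ≤n = ≤-trans (lin 2 (λ h r → r · K 1 ≼ h ⇒ r :* h · K 1 ≼ h ⇒ ⊢ 1 · r ≼ K 2 :* (h :* h) :* r) refl h ρ 1≤h 1≤h) ρ-few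

    M≡ : ρ + M ≡ n
    M≡ = m+[n∸m]≡n ρ≤n

    -- A degree is at most n, so the degree condition at any one vertex forces 3h + 12 ≤ 4h. This
    -- makes the subtraction in `q` exact.
    12≤h : 12 ≤ h
    12≤h = *-cancelʳ-≤ 12 h n {{Data.Nat.>-nonZero 1≤n}} (lin 3 (λ h n g → K 1 · (K 3 :* h :+ K 12) :* n ≼ K 4 :* h :* g ⇒ K 4 :* h · g ≼ n ⇒ ⊢ 1 · K 12 :* n ≼ h :* n) refl h n (# (λ y → G₁ x₀ y ∨ G₂ x₀ y)) (degX x₀) (#-≤n (λ y → G₁ x₀ y ∨ G₂ x₀ y)))
      where
      x₀ = proj₁ (#-ex₁ {n} (λ _ → true) (≤-trans 1≤n (#-all {P = λ _ → true} (λ _ → refl))))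

    instance
      4h≢0 : Data.Nat.NonZero (4 * h)
      4h≢0 = Data.Nat.>-nonZero (*-mono-≤ {1} {4} {1} (s≤s z≤n) 1≤h)

    -- About n/4 - 2n/h: a degree of (3/4 + 3/h)n leaves n/4 - 3n/h non-neighbours, and a good
    -- vertex has lost at most n/h edges.
    q = (h * n ∸ 8 * n) / (4 * h)

    q-hi : 4 * h * q + 8 * n ≤ h * n
    q-hi = ≤-trans (+-monoˡ-≤ (8 * n) (≤-trans (≤-reflexive (*-comm (4 * h) q)) (m/n*n≤m (h * n ∸ 8 * n) (4 * h)))) (≤-reflexive (m∸n+n≡m (*-monoˡ-≤ n (≤-trans (m≤n+m 8 4) 12≤h))))

    q-lo : ∀ {m} → 4 * h * m + 8 * n ≤ h * n → m ≤ q
    q-lo {m} le = ≤-trans (≤-reflexive (sym (m*n/n≡m m (4 * h)))) (/-monoˡ-≤ (4 * h) (≤-trans (≤-reflexive (trans (*-comm m (4 * h)) (sym (m+n∸n≡m (4 * h * m) (8 * n))))) (∸-monoˡ-≤ (8 * n) le)))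

    missing : ∀ (g a : Fin n → Bool) → (3 * h + 12) * n ≤ 4 * h * # g → h * # (λ y → g y ∧ not (a y)) ≤ n → # (λ y → not (a y)) ≤ q
    missing g a dg lo = q-lo (lin 6 (λ h n G N L m → K 1 · (K 3 :* h :+ K 12) :* n ≼ K 4 :* h :* G ⇒ K 4 · h :* L ≼ n ⇒ K 4 :* h · G :+ N ≼ n ⇒ K 4 :* h · m ≼ N :+ L ⇒ ⊢ 1 · K 4 :* h :* m :+ K 8 :* n ≼ h :* n) refl
      h n (# g) (# (λ y → not (g y))) (# (λ y → g y ∧ not (a y))) (# (λ y → not (a y))) dg lo (≤-reflexive (#-compl g)) (#-∪ {Q = λ y → not (g y)} {R = λ y → g y ∧ not (a y)} cs))
      where
      cs : ∀ y → not (a y) ≡ true → not (g y) ≡ true ⊎ g y ∧ not (a y) ≡ true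
      cs y f with g y
      ... | true = inj₂ f
      ... | false = inj₁ refl

    good : ∀ r → M ≤ # (λ x → not (bad r x)) → Σ (Fin M → Fin n) λ f → (∀ {i j} → f i ≡ f j → i ≡ j) × (∀ i → h * r (f i) ≤ n)
    good r le = let f , inj , ok = embedding (λ x → not (bad r x)) le in f , inj , λ i → ≤-pred (≤ᵇ-false {suc n} (not-false (ok i)))

    goodX : Σ (Fin M → Fin n) λ f → (∀ {i j} → f i ≡ f j → i ≡ j) × (∀ i → h * rowX (f i) ≤ n)
    goodX = good rowX (lin 5 (λ M a b n g → K 1 · a :+ b :+ M ≼ n ⇒ K 1 · n ≼ a :+ g ⇒ ⊢ 1 · M ≼ g) refl M ρX ρY n (# (λ x → not (bad rowX x))) (≤-reflexive M≡) (≤-reflexive (sym (#-compl (bad rowX)))))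

    goodY : Σ (Fin M → Fin n) λ f → (∀ {i j} → f i ≡ f j → i ≡ j) × (∀ i → h * rowY (f i) ≤ n)
    goodY = good rowY (lin 5 (λ M a b n g → K 1 · a :+ b :+ M ≼ n ⇒ K 1 · n ≼ b :+ g ⇒ ⊢ 1 · M ≼ g) refl M ρX ρY n (# (λ y → not (bad rowY y))) (≤-reflexive M≡) (≤-reflexive (sym (#-compl (bad rowY)))))

    module Restrict (fX fY : Fin M → Fin n) (injX : ∀ {i j} → fX i ≡ fX j → i ≡ j) (injY : ∀ {i j} → fY i ≡ fY j → i ≡ j)
      (okX : ∀ i → h * rowX (fX i) ≤ n) (okY : ∀ j → h * rowY (fY j) ≤ n) where

      restrict-small : ∀ {G : Fin n → Fin n → Bool} {d c} (S : Struct G everything everything d c) l →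
        # (λ i → (Struct.rX S (fX i) ≐ l) ∧ Struct.C S (fX i)) + # (λ j → (Struct.rY S (fY j) ≐ l) ∧ Struct.D S (fY j)) ≤ c
      restrict-small S l = ≤-trans (+-mono-≤
          (≤-trans (#-⊆ (λ i → conv (Struct.rX S (fX i)) (Struct.C S (fX i)))) (#-injective fX injX (λ x → does (Struct.rX S x ≟ᴸ l) ∧ Struct.C S x)))
          (≤-trans (#-⊆ (λ j → conv (Struct.rY S (fY j)) (Struct.D S (fY j)))) (#-injective fY injY (λ y → does (Struct.rY S y ≟ᴸ l) ∧ Struct.D S y)))) (Struct.small S l)
        where
        conv : ∀ r b → (r ≐ l) ∧ b ≡ true → does (r ≟ᴸ l) ∧ b ≡ true
        conv r b h = ∧-intro (does-intro (r ≟ᴸ l) (≐-true (∧-fst h))) (∧-snd {r ≐ l} h)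

      config : Config M q c₁ c₂
      config = record
        { E₁ = λ i j → S₁.H (fX i) (fY j) ; E₂ = λ i j → S₂.H (fX i) (fY j)
        ; nonX = λ i → ≤-trans (#-injective fY injY (λ y → not (S₁.H (fX i) y ∨ S₂.H (fX i) y))) (missing (λ y → G₁ (fX i) y ∨ G₂ (fX i) y) (λ y → S₁.H (fX i) y ∨ S₂.H (fX i) y) (degX (fX i)) (okX i))
        ; nonY = λ j → ≤-trans (#-injective fX injX (λ x → not (S₁.H x (fY j) ∨ S₂.H x (fY j)))) (missing (λ x → G₁ x (fY j) ∨ G₂ x (fY j)) (λ x → S₁.H x (fY j) ∨ S₂.H x (fY j)) (degY (fY j)) (okY j))
        ; r₁X = λ i → S₁.rX (fX i) ; r₁Y = λ j → S₁.rY (fY j) ; r₂X = λ i → S₂.rX (fX i) ; r₂Y = λ j → S₂.rY (fY j)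
        ; C₁ = λ i → S₁.C (fX i) ; D₁ = λ j → S₁.D (fY j) ; C₂ = λ i → S₂.C (fX i) ; D₂ = λ j → S₂.D (fY j)
        ; same₁ = λ i j → S₁.same (fX i) (fY j) ; same₂ = λ i j → S₂.same (fX i) (fY j)
        ; cov₁ = λ i j → S₁.covered (fX i) (fY j) ; cov₂ = λ i j → S₂.covered (fX i) (fY j)
        ; small₁ = restrict-small S₁ ; small₂ = restrict-small S₂ }

    4q<M : 4 * q < M
    4q<M = *-cancelˡ-< h (4 * q) M (lin 5 (λ h q M r n → K 1 · K 4 :* h :* q :+ K 8 :* n ≼ h :* n ⇒ h · n ≼ r :+ M ⇒ K 1 · h :* r ≼ n ⇒ K 1 · K 1 ≼ n ⇒ ⊢ 1 · Suc (h :* (K 4 :* q)) ≼ h :* M) refl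
      h q M ρ n q-hi (≤-reflexive (sym M≡)) (≤-trans (lin 2 (λ h r → h :* r · K 1 ≼ h ⇒ ⊢ 1 · h :* r ≼ K 2 :* (h :* h) :* r) refl h ρ 1≤h) ρ-few) 1≤n)

    -- The lengths give k₁ + k₂ ≤ (1 - 3/(2h²))(n + 1), the covers add at most n/(4h³), and M ≥ n -
    -- n/(2h²). The gain of order n/h² outweighs the losses, and n > 8h³ makes up for the difference
    -- between n and n + 1.
    c<M : c₁ + c₂ < M
    c<M = *-cancelˡ-< e (c₁ + c₂) M (lin 9 (λ h n a b k l r M E →
        K 1 · K 8 :* (h :* h :* h) :* a ≼ K 8 :* (h :* h :* h) :* k :+ n ⇒ K 1 · K 8 :* (h :* h :* h) :* b ≼ K 8 :* (h :* h :* h) :* l :+ n ⇒ K 4 :* h · K 2 :* (h :* h) :* (k :+ l) :+ K 3 :* Suc n ≼ K 2 :* (h :* h) :* Suc n ⇒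
        K 8 :* (h :* h :* h) · n ≼ r :+ M ⇒ K 4 :* h · K 2 :* (h :* h) :* r ≼ n ⇒ K 1 · Suc (K 8 :* (h :* h :* h)) ≼ n ⇒ K 3 :* n · K 1 ≼ h ⇒ ⊢ 1 · Suc (K 8 :* (h :* h :* h) :* (a :+ b)) ≼ K 8 :* (h :* h :* h) :* M) refl
      h n c₁ c₂ k₁ k₂ ρ M 0 covers₁ covers₂ lengths (≤-reflexive (sym M≡)) ρ-few large 1≤h)

  no-two-structures : ⊥
  no-two-structures = let fX , iX , oX = goodX ; fY , iY , oY = goodY in no-config (Restrict.config fX fY iX iY oX oY) 4q<M c<M

open import Defs
open import Data.Integer using (+_; +[1+_]; -[1+_])

-- Natural numbers inside ℚ

ι-toℚᵘ : ∀ n → toℚᵘ (ℕtoℚ n) ℚᵘ.≃ mkℚᵘ (+ n) 0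
ι-toℚᵘ n = ℚ.toℚᵘ-fromℚᵘ (mkℚᵘ (+ n) 0)

ι-+ : ∀ a b → ℕtoℚ (a + b) ≡ ℕtoℚ a ℚ.+ ℕtoℚ b
ι-+ a b = ℚ.toℚᵘ-injective (ℚᵘ.≃-trans (ι-toℚᵘ (a + b)) (ℚᵘ.≃-trans (*≡* (eq (+ a) (+ b)))
  (ℚᵘ.≃-sym (ℚᵘ.≃-trans (ℚ.toℚᵘ-homo-+ (ℕtoℚ a) (ℕtoℚ b)) (ℚᵘ.+-cong (ι-toℚᵘ a) (ι-toℚᵘ b))))))
  where
  eq : ∀ x y → (x ℤ.+ y) ℤ.* (+ 1) ≡ (x ℤ.* (+ 1) ℤ.+ y ℤ.* (+ 1)) ℤ.* (+ 1)
  eq = solveℤ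

ι-* : ∀ a b → ℕtoℚ (a * b) ≡ ℕtoℚ a ℚ.* ℕtoℚ b
ι-* a b = ℚ.toℚᵘ-injective (ℚᵘ.≃-trans (ι-toℚᵘ (a * b)) (ℚᵘ.≃-trans (*≡* (cong (ℤ._* (+ 1)) (ℤ.pos-* a b)))
  (ℚᵘ.≃-sym (ℚᵘ.≃-trans (ℚ.toℚᵘ-homo-* (ℕtoℚ a) (ℕtoℚ b)) (ℚᵘ.*-cong (ι-toℚᵘ a) (ι-toℚᵘ b))))))

ι-cancel : ∀ {a b} → ℕtoℚ a ℚ.≤ ℕtoℚ b → a ≤ b
ι-cancel {a} {b} h = ℤ.drop‿+≤+ (ℤ.*-cancelʳ-≤-pos (+ a) (+ b) (+ 1) (ℚᵘ.drop-*≤* (ℚᵘ.≤-respˡ-≃ (ι-toℚᵘ a) (ℚᵘ.≤-respʳ-≃ (ι-toℚᵘ b) (ℚ.toℚᵘ-mono-≤ h)))))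

ι-mono : ∀ {a b} → a ≤ b → ℕtoℚ a ℚ.≤ ℕtoℚ b
ι-mono {a} {b} h = ℚ.toℚᵘ-cancel-≤ (ℚᵘ.≤-respˡ-≃ (ℚᵘ.≃-sym (ι-toℚᵘ a)) (ℚᵘ.≤-respʳ-≃ (ℚᵘ.≃-sym (ι-toℚᵘ b)) (ℚᵘ.*≤* (ℤ.*-monoʳ-≤-nonNeg (+ 1) (ℤ.+≤+ h)))))

ι-nonNeg : ∀ n → ℚ.NonNegative (ℕtoℚ n)
ι-nonNeg n = ℚ.nonNegative (ι-mono {0} {n} z≤n)

-- A natural bound read off the numerator, which makes the search over all admissible lengths
-- finite.
ι-bounded : ∀ ℓ q → ℕtoℚ ℓ ℚ.≤ q → ℓ ≤ ℤ.∣ ℚ.↥ q ∣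
ι-bounded ℓ q@(mkℚ num d-1 _) h = go num (ℚᵘ.drop-*≤* (ℚᵘ.≤-respˡ-≃ (ι-toℚᵘ ℓ) (ℚ.toℚᵘ-mono-≤ h)))
  where
  go : ∀ num → (+ ℓ) ℤ.* (+ suc d-1) ℤ.≤ num ℤ.* (+ 1) → ℓ ≤ ℤ.∣ num ∣
  go (+ m) le = ≤-trans (m≤m*n ℓ (suc d-1)) (ℤ.drop‿+≤+ (subst₂ ℤ._≤_ (sym (ℤ.pos-* ℓ (suc d-1))) (ℤ.*-identityʳ (+ m)) le))
  go -[1+ m ] le = ⊥-elim (neg (subst₂ ℤ._≤_ (sym (ℤ.pos-* ℓ (suc d-1))) (ℤ.*-identityʳ -[1+ m ]) le))
    where
    neg : ∀ {a} → ¬ ((+ a) ℤ.≤ -[1+ m ])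
    neg ()

fraction : ∀ η → 0ℚ ℚ.< η → ∃ λ h → ∃ λ ν → 1 ≤ h × 1 ≤ ν × ℕtoℚ h ℚ.* η ≡ ℕtoℚ ν
fraction η@(mkℚ +[1+ m ] d-1 _) _ = suc d-1 , suc m , s≤s z≤n , s≤s z≤n , ℚ.toℚᵘ-injective (ℚᵘ.≃-trans (ℚ.toℚᵘ-homo-* (ℕtoℚ (suc d-1)) η)
  (ℚᵘ.≃-trans (ℚᵘ.*-congʳ {toℚᵘ η} (ι-toℚᵘ (suc d-1))) (ℚᵘ.≃-trans (*≡* (eq (+ suc d-1) (+ suc m))) (ℚᵘ.≃-sym (ι-toℚᵘ (suc m))))))
  where
  eq : ∀ x y → (x ℤ.* y) ℤ.* (+ 1) ≡ y ℤ.* ((+ 1) ℤ.* x)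
  eq = solveℤ
fraction (mkℚ (+ 0) _ _) (ℚ.*<* (ℤ.+<+ ()))
fraction (mkℚ -[1+ _ ] _ _) (ℚ.*<* ())

-- Multiplication by 4h clears the denominators; as ν ≥ 1, the term 12ν may be lowered to 12.
degree-arith : ∀ {η h ν n g} → 1 ≤ ν → ℕtoℚ h ℚ.* η ≡ ℕtoℚ ν → ((+ 3 ℚ./ 4) ℚ.+ (+ 3 ℚ./ 1) ℚ.* η) ℚ.* ℕtoℚ n ℚ.≤ ℕtoℚ g → (3 * h + 12) * n ≤ 4 * h * g
degree-arith {η} {h} {ν} {n} {g} 1≤ν hη le = ≤-trans (*-monoˡ-≤ n (+-monoʳ-≤ (3 * h) (≤-trans (≤-reflexive (sym (*-identityʳ 12))) (*-monoʳ-≤ 12 1≤ν))))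
  (ι-cancel (subst₂ ℚ._≤_ lhs (sym (ι-* (4 * h) g)) (ℚ.*-monoˡ-≤-nonNeg (ℕtoℚ (4 * h)) {{ι-nonNeg (4 * h)}} le)))
  where
  open +-*-Solver using (solve; _:=_; con) renaming (_:+_ to _⊕_; _:*_ to _⊗_; _:-_ to _⊖_)
  ring : ∀ H E N → (ℕtoℚ 4 ℚ.* H) ℚ.* (((+ 3 ℚ./ 4) ℚ.+ (+ 3 ℚ./ 1) ℚ.* E) ℚ.* N) ≡ ((ℕtoℚ 3 ℚ.* H) ℚ.+ (ℕtoℚ 12 ℚ.* (H ℚ.* E))) ℚ.* N
  ring = solve 3 (λ H E N → (con (ℕtoℚ 4) ⊗ H) ⊗ ((con (+ 3 ℚ./ 4) ⊕ con (+ 3 ℚ./ 1) ⊗ E) ⊗ N) := ((con (ℕtoℚ 3) ⊗ H) ⊕ (con (ℕtoℚ 12) ⊗ (H ⊗ E))) ⊗ N) refl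
  lhs : ℕtoℚ (4 * h) ℚ.* (((+ 3 ℚ./ 4) ℚ.+ (+ 3 ℚ./ 1) ℚ.* η) ℚ.* ℕtoℚ n) ≡ ℕtoℚ ((3 * h + 12 * ν) * n)
  lhs = trans (cong (ℚ._* _) (ι-* 4 h)) (trans (ring (ℕtoℚ h) η (ℕtoℚ n)) (sym (trans (ι-* (3 * h + 12 * ν) n)
    (cong (ℚ._* ℕtoℚ n) (trans (ι-+ (3 * h) (12 * ν)) (cong₂ ℚ._+_ (ι-* 3 h) (trans (ι-* 12 ν) (cong (ℕtoℚ 12 ℚ.*_) (sym hη)))))))))

-- Adding the two limits eliminates α₁ and α₂, whose sum is 1. Multiplication by h² turns 3η²N into
-- 3ν²N, which is at least 3N.
length-arith : ∀ {η h ν α₁ α₂ N} k₁ k₂ → 1 ≤ ν → ℕtoℚ h ℚ.* η ≡ ℕtoℚ ν → α₁ ℚ.+ α₂ ≡ 1ℚ →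
  ℕtoℚ (k₁ * 2) ℚ.≤ ((+ 2 ℚ./ 1) ℚ.- (+ 3 ℚ./ 1) ℚ.* (η ℚ.* η)) ℚ.* α₁ ℚ.* ℕtoℚ N →
  ℕtoℚ (k₂ * 2) ℚ.≤ ((+ 2 ℚ./ 1) ℚ.- (+ 3 ℚ./ 1) ℚ.* (η ℚ.* η)) ℚ.* α₂ ℚ.* ℕtoℚ N →
  2 * (h * h) * (k₁ + k₂) + 3 * N ≤ 2 * (h * h) * N
length-arith {η} {h} {ν} {α₁} {α₂} {N} k₁ k₂ 1≤ν hη α≡1 le₁ le₂ = lin 5 (λ H k l N V → K 1 · (H :* H) :* (k :* K 2 :+ l :* K 2) :+ K 3 :* (V :* V) :* N ≼ K 2 :* (H :* H) :* N ⇒ K 3 :* V :* N :+ K 3 :* N · K 1 ≼ V ⇒ ⊢ 1 · K 2 :* (H :* H) :* (k :+ l) :+ K 3 :* N ≼ K 2 :* (H :* H) :* N) refl h k₁ k₂ N ν natural 1≤ν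
  where
  open +-*-Solver using (solve; _:=_; con) renaming (_:+_ to _⊕_; _:*_ to _⊗_; _:-_ to _⊖_)
  c = (+ 2 ℚ./ 1) ℚ.- (+ 3 ℚ./ 1) ℚ.* (η ℚ.* η)
  distr : ∀ c a b N → c ℚ.* a ℚ.* N ℚ.+ c ℚ.* b ℚ.* N ≡ c ℚ.* (a ℚ.+ b) ℚ.* N
  distr = solve 4 (λ c a b N → c ⊗ a ⊗ N ⊕ c ⊗ b ⊗ N := c ⊗ (a ⊕ b) ⊗ N) refl
  sum≤ : ℕtoℚ (k₁ * 2 + k₂ * 2) ℚ.≤ c ℚ.* ℕtoℚ N
  sum≤ = subst₂ ℚ._≤_ (sym (ι-+ (k₁ * 2) (k₂ * 2))) (trans (distr c α₁ α₂ (ℕtoℚ N)) (cong (ℚ._* ℕtoℚ N) (trans (cong (c ℚ.*_) α≡1) (ℚ.*-identityʳ c)))) (ℚ.+-mono-≤ le₁ le₂)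
  ring : ∀ H E N → (H ℚ.* H) ℚ.* (((+ 2 ℚ./ 1) ℚ.- (+ 3 ℚ./ 1) ℚ.* (E ℚ.* E)) ℚ.* N) ℚ.+ ℕtoℚ 3 ℚ.* ((H ℚ.* E) ℚ.* (H ℚ.* E)) ℚ.* N ≡ ℕtoℚ 2 ℚ.* (H ℚ.* H) ℚ.* N
  ring = solve 3 (λ H E N → (H ⊗ H) ⊗ ((con (+ 2 ℚ./ 1) ⊖ con (+ 3 ℚ./ 1) ⊗ (E ⊗ E)) ⊗ N) ⊕ con (ℕtoℚ 3) ⊗ ((H ⊗ E) ⊗ (H ⊗ E)) ⊗ N := con (ℕtoℚ 2) ⊗ (H ⊗ H) ⊗ N) refl
  scaled : ℕtoℚ (h * h) ℚ.* ℕtoℚ (k₁ * 2 + k₂ * 2) ℚ.≤ ℕtoℚ (h * h) ℚ.* (c ℚ.* ℕtoℚ N)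
  scaled = ℚ.*-monoˡ-≤-nonNeg (ℕtoℚ (h * h)) {{ι-nonNeg (h * h)}} sum≤
  VVN : ℕtoℚ (3 * (ν * ν) * N) ≡ ℕtoℚ 3 ℚ.* ((ℕtoℚ h ℚ.* η) ℚ.* (ℕtoℚ h ℚ.* η)) ℚ.* ℕtoℚ N
  VVN = trans (ι-* (3 * (ν * ν)) N) (cong (ℚ._* ℕtoℚ N) (trans (ι-* 3 (ν * ν)) (cong (ℕtoℚ 3 ℚ.*_) (trans (ι-* ν ν) (sym (cong₂ ℚ._*_ hη hη))))))
  natural : (h * h) * (k₁ * 2 + k₂ * 2) + 3 * (ν * ν) * N ≤ 2 * (h * h) * N
  natural = ι-cancel (subst₂ ℚ._≤_ (sym (trans (ι-+ ((h * h) * (k₁ * 2 + k₂ * 2)) (3 * (ν * ν) * N)) (cong (ℚ._+ ℕtoℚ (3 * (ν * ν) * N)) (ι-* (h * h) (k₁ * 2 + k₂ * 2)))))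
      (trans (cong₂ ℚ._+_ (cong (ℚ._* (c ℚ.* ℕtoℚ N)) (ι-* h h)) VVN) (trans (ring (ℕtoℚ h) η (ℕtoℚ N)) (sym (trans (ι-* (2 * (h * h)) N) (cong (ℚ._* ℕtoℚ N) (trans (ι-* 2 (h * h)) (cong (ℕtoℚ 2 ℚ.*_) (ι-* h h))))))))
      (ℚ.+-monoˡ-≤ (ℕtoℚ (3 * (ν * ν) * N)) scaled))

-- From alternating paths to cycles

module _ {n : ℕ} (G : BipGraph n) (col : Colouring n) (c : Colour) where

  data VPath : Vertex n → Vertex n → List (Vertex n) → Set where
    stop : ∀ {a} → VPath a a (a ∷ [])
    _∷_ : ∀ {a b z vs} → ColEdge G col c a b → VPath b z vs → VPath a z (a ∷ vs)

  vpath-first : ∀ {a z vs} → VPath a z vs → ∀ j → toℕ j ≡ 0 → lookup vs j ≡ a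
  vpath-first stop zero _ = refl
  vpath-first (_ ∷ _) zero _ = refl

  vpath-last : ∀ {a z vs} → VPath a z vs → ∀ i → suc (toℕ i) ≡ length vs → lookup vs i ≡ z
  vpath-last stop zero _ = refl
  vpath-last (_ ∷ stop) zero ()
  vpath-last (_ ∷ (_ ∷ _)) zero ()
  vpath-last (_ ∷ p) (suc i) e = vpath-last p i (suc-injective e)

  vpath-step : ∀ {a z vs} → VPath a z vs → ∀ i j → toℕ j ≡ suc (toℕ i) → ColEdge G col c (lookup vs i) (lookup vs j)
  vpath-step stop zero (suc ()) _
  vpath-step (e ∷ p) zero (suc j) h = subst (ColEdge G col c _) (sym (vpath-first p j (suc-injective h))) e
  vpath-step (_ ∷ p) (suc i) (suc j) h = vpath-step p i j (suc-injective h)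

  closed : ∀ {a z vs} → VPath a z vs → ColEdge G col c z a → Unique vs → 3 ≤ length vs → MonoCycle G col c (length vs)
  closed {vs = vs} p e u l = l , lookup vs , (λ {i} {j} → lookup-inj vs u i j) , λ
    { i j (inj₁ h) → vpath-step p i j h
    ; i j (inj₂ (h , h′)) → subst₂ (ColEdge G col c) (sym (vpath-last p i h′)) (sym (vpath-first p j h)) e }

  module _ (H : Fin n → Fin n → Bool) (edge : ∀ x y → H x y ≡ true → ColEdge G col c (inj₁ x) (inj₂ y)) where

    interleave : ∀ {x z xs ys} (y : Fin n) → RPath H x z xs ys → List (Vertex n)
    interleave {x} y stop = inj₁ x ∷ inj₂ y ∷ []
    interleave {x} y (step {y = y′} _ _ p) = inj₁ x ∷ inj₂ y′ ∷ interleave y p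

    interleave-path : ∀ {x z xs ys y} (p : RPath H x z xs ys) → H z y ≡ true → VPath (inj₁ x) (inj₂ y) (interleave y p)
    interleave-path {x} {y = y} stop h = edge x y h ∷ stop
    interleave-path {x} (step {x′ = x′} {y = y′} h h′ p) e = edge x y′ h ∷ (edge x′ y′ h′ ∷ interleave-path p e)

    interleave-X : ∀ {x z xs ys y w} (p : RPath H x z xs ys) → inj₁ w ∈ interleave y p → w ∈ xs
    interleave-X stop (here e) = here (inj₁-injective e)
    interleave-X stop (there (here ()))
    interleave-X (step _ _ p) (here e) = here (inj₁-injective e)
    interleave-X (step _ _ p) (there (there i)) = there (interleave-X p i)

    interleave-Y : ∀ {x z xs ys y w} (p : RPath H x z xs ys) → inj₂ w ∈ interleave y p → w ∈ y ∷ ys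
    interleave-Y stop (there (here e)) = here (inj₂-injective e)
    interleave-Y (step _ _ p) (there (here e)) = there (here (inj₂-injective e))
    interleave-Y (step _ _ p) (there (there i)) with interleave-Y p i
    ... | here e = here e
    ... | there j = there (there j)

    interleave-unique : ∀ {x z xs ys y} (p : RPath H x z xs ys) → Unique xs → Unique (y ∷ ys) → Unique (interleave y p)
    interleave-unique stop _ _ = unique-∷ (λ { (here ()) }) ([] ∷ [])
    interleave-unique {y = y} (step {y = y′} {ys = ys} _ _ p) ux@(_ ∷ ux′) uy@(_ ∷ uy′@(_ ∷ uy″)) =
      unique-∷ (λ { (there i) → unique-∉ ux (interleave-X p i) }) (unique-∷ y′-new (interleave-unique p ux′ (unique-∷ (λ i → unique-∉ uy (there i)) uy″)))
      where
      y′-new : inj₂ y′ ∉ interleave y p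
      y′-new i with interleave-Y p i
      ... | here e = unique-∉ uy (here (sym e))
      ... | there j = unique-∉ uy′ j

    interleave-length : ∀ {x z xs ys y} (p : RPath H x z xs ys) → length (interleave y p) ≡ length xs * 2
    interleave-length stop = refl
    interleave-length (step _ _ p) = cong (λ m → suc (suc m)) (interleave-length p)

    monoCycle : ∀ {k} → 2 ≤ k → Cyc H k → MonoCycle G col c (k * 2)
    monoCycle {k} 2≤k C = subst (MonoCycle G col c) len′ (closed (interleave-path path zy) (edge′ u y uy) (interleave-unique path uniq-xs uniq-ys)
        (≤-trans (≤-trans (n≤1+n 3) (*-monoˡ-≤ 2 2≤k)) (≤-reflexive (sym len′))))
      where
      open Cyc C
      len′ : length (interleave y path) ≡ k * 2
      len′ = trans (interleave-length path) (cong (_* 2) len)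
      edge′ : ∀ x y → H x y ≡ true → ColEdge G col c (inj₂ y) (inj₁ x)
      edge′ x y h = edge x y h

-- The removal statement applied to both colours

sum-allFin : ∀ n (f : Fin n → ℕ) → sumᴸ (map f (allFin n)) ≡ ∑ f
sum-allFin n f = trans (cong sumᴸ (map-tabulate id f)) (go n f)
  where
  go : ∀ n (f : Fin n → ℕ) → sumᴸ (tabulate f) ≡ ∑ f
  go zero f = refl
  go (suc n) f = cong (λ s → f zero + s) (go n (λ i → f (suc i)))

is : Colour → Colour → Bool
is red red = true
is blue blue = true
is red blue = false
is blue red = false

is-true : ∀ c d → is c d ≡ true → d ≡ c
is-true red red _ = refl
is-true blue blue _ = refl

module Coloured {n : ℕ} (G : BipGraph n) (col : Colouring n) where

  graph : Colour → Fin n → Fin n → Bool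
  graph c x y = adj G x y ∧ is c (col x y)

  graph-edge : ∀ c x y → graph c x y ≡ true → ColEdge G col c (inj₁ x) (inj₂ y)
  graph-edge c x y h = subst Data.Bool.T (sym (∧-fst h)) tt , is-true c (col x y) (∧-snd {adj G x y} h)

  indicator : ∀ x y → (if adj G x y then 1 else 0) ≡ 𝟙 (graph red x y ∨ graph blue x y)
  indicator x y with adj G x y | col x y
  ... | true | red = refl
  ... | true | blue = refl
  ... | false | _ = refl

  degX≡ : ∀ x → degX G x ≡ # (λ y → graph red x y ∨ graph blue x y)
  degX≡ x = trans (sum-allFin n _) (∑-cong (indicator x))

  degY≡ : ∀ y → degY G y ≡ # (λ x → graph red x y ∨ graph blue x y)
  degY≡ y = trans (sum-allFin n _) (∑-cong (λ x → indicator x y))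

-- Constructively, alternatives for the single k combine to one uniform alternative by searching a
-- finite range; hence the prior bound on the lengths.
scan : ∀ m {A B : ℕ → Set} → (∀ k → k ≤ m → A k ⊎ B k) → (∀ k → k ≤ m → A k) ⊎ ∃ B
scan zero {A} f with f 0 z≤n
... | inj₁ a = inj₁ λ { k k≤0 → subst A (sym (n≤0⇒n≡0 k≤0)) a }
... | inj₂ b = inj₂ (0 , b)
scan (suc m) {A} f with scan m (λ k h → f k (≤-trans h (n≤1+n m))) | f (suc m) ≤-refl
... | inj₂ b | _ = inj₂ b
... | inj₁ _ | inj₂ b = inj₂ (suc m , b)
... | inj₁ g | inj₁ a = inj₁ all
  where
  all : ∀ k → k ≤ suc m → A k
  all k h with k Data.Nat.≟ suc m
  ... | yes refl = a
  ... | no ne = g k (≤-pred (≤∧≢⇒< h ne))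

scanRange : ∀ {R A S : ℕ → Set} → (∀ k → Dec (R k)) → (∀ k → 2 ≤ k → A k ⊎ S k) → ∀ m →
  (∀ k → k ≤ m → 2 ≤ k → R k → A k) ⊎ (∃ λ k → R k × S k)
scanRange {R} {A} {S} R? f m = scan m (λ k _ → decide k (2 ≤? k) (R? k))
  where
  decide : ∀ k → Dec (2 ≤ k) → Dec (R k) → (2 ≤ k → R k → A k) ⊎ (R k × S k)
  decide k (no 2≰k) _ = inj₁ (λ 2≤k → ⊥-elim (2≰k 2≤k))
  decide k (yes _) (no out) = inj₁ (λ _ r → ⊥-elim (out r))
  decide k (yes 2≤k) (yes r) = Sum.map (λ a _ _ → a) (r ,_) (f k 2≤k)

module _ {n} (G : BipGraph n) (col : Colouring n) where
  open Coloured G col using (graph; graph-edge)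

  cycles-or : ∀ c (q : ℚ) {S : ℕ → Set} → (∀ k → 2 ≤ k → Cyc (graph c) k ⊎ S k) →
    ((ℓ : ℕ) → 2 ∣ ℓ → 4 ≤ ℓ → ℕtoℚ ℓ ℚ.≤ q → MonoCycle G col c ℓ) ⊎ (∃ λ k → ℕtoℚ (k * 2) ℚ.≤ q × S k)
  cycles-or c q f = Sum.map₁ cycles (scanRange {R = λ k → ℕtoℚ (k * 2) ℚ.≤ q} (λ k → ℕtoℚ (k * 2) ℚ.≤? q)
      (λ k 2≤k → Sum.map₁ (monoCycle G col c (graph c) (graph-edge c) 2≤k) (f k 2≤k)) ℤ.∣ ℚ.↥ q ∣)
    where
    cycles : (∀ k → k ≤ ℤ.∣ ℚ.↥ q ∣ → 2 ≤ k → ℕtoℚ (k * 2) ℚ.≤ q → MonoCycle G col c (k * 2)) →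
      (ℓ : ℕ) → 2 ∣ ℓ → 4 ≤ ℓ → ℕtoℚ ℓ ℚ.≤ q → MonoCycle G col c ℓ
    cycles all _ (divides k refl) 4≤ℓ r = all k (≤-trans (m≤m*n k 2) (ι-bounded (k * 2) q r)) (*-cancelʳ-≤ 2 k 2 4≤ℓ) r

fromRemoval : ∀ (η : ℚ) h ν n₀ N₀ → 1 ≤ h → 1 ≤ ν → ℕtoℚ h ℚ.* η ≡ ℕtoℚ ν → N₀ ≡ suc (n₀ + 8 * (h * h * h)) →
  (∀ n → n₀ ≤ n → ∀ (G : Fin n → Fin n → Bool) k → 2 ≤ k →
    Cyc G k ⊎ (∃ λ d → ∃ λ c → 8 * (h * h * h) * d ≤ n * n × 8 * (h * h * h) * c ≤ 8 * (h * h * h) * k + n × Struct G everything everything d c)) →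
  (N : ℕ) → N₀ < N →
  (α₁ α₂ : ℚ) → α₂ ℚ.< α₁ → 0ℚ ℚ.< α₂ → α₁ ℚ.+ α₂ ≡ 1ℚ →
  (G : BipGraph (N ∸ 1)) →
  MinDegree≥ G (((+ 3 ℚ./ 4) ℚ.+ (+ 3 ℚ./ 1) ℚ.* η) ℚ.* ℕtoℚ (N ∸ 1)) →
  (col : Colouring (N ∸ 1)) →
  ((ℓ : ℕ) → 2 ∣ ℓ → 4 ≤ ℓ →
  ℕtoℚ ℓ ℚ.≤ ((+ 2 ℚ./ 1) ℚ.- (+ 3 ℚ./ 1) ℚ.* (η ℚ.* η)) ℚ.* α₁ ℚ.* ℕtoℚ N →
  MonoCycle G col red ℓ)
  ⊎
  ((ℓ : ℕ) → 2 ∣ ℓ → 4 ≤ ℓ →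
  ℕtoℚ ℓ ℚ.≤ ((+ 2 ℚ./ 1) ℚ.- (+ 3 ℚ./ 1) ℚ.* (η ℚ.* η)) ℚ.* α₂ ℚ.* ℕtoℚ N →
  MonoCycle G col blue ℓ)
fromRemoval η h ν n₀ _ 1≤h 1≤ν hη refl rem (suc n) (s≤s large) α₁ α₂ _ _ α≡1 G (dX , dY) col = combine (colour red α₁) (colour blue α₂)
  where
  open Coloured G col
  limit : ℚ → ℚ
  limit α = ((+ 2 ℚ./ 1) ℚ.- (+ 3 ℚ./ 1) ℚ.* (η ℚ.* η)) ℚ.* α ℚ.* ℕtoℚ (suc n)
  Range : ℚ → ℕ → Set
  Range α ℓ = ℕtoℚ ℓ ℚ.≤ limit α
  Structure : Colour → ℕ → Set
  Structure c k = ∃ λ d → ∃ λ w → 8 * (h * h * h) * d ≤ n * n × 8 * (h * h * h) * w ≤ 8 * (h * h * h) * k + n × Struct (graph c) everything everything d w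
  Cycles : Colour → ℚ → Set
  Cycles c α = (ℓ : ℕ) → 2 ∣ ℓ → 4 ≤ ℓ → Range α ℓ → MonoCycle G col c ℓ
  colour : ∀ c α → Cycles c α ⊎ (∃ λ k → Range α (k * 2) × Structure c k)
  colour c α = cycles-or G col c (limit α) (rem n (≤-trans (m≤m+n n₀ _) (<⇒≤ large)) (graph c))
  combine : Cycles red α₁ ⊎ (∃ λ k → Range α₁ (k * 2) × Structure red k) → Cycles blue α₂ ⊎ (∃ λ k → Range α₂ (k * 2) × Structure blue k) → Cycles red α₁ ⊎ Cycles blue α₂
  combine (inj₁ r) _ = inj₁ r
  combine (inj₂ _) (inj₁ b) = inj₂ b
  combine (inj₂ (k₁ , r₁ , d₁ , w₁ , e₁ , f₁ , S₁)) (inj₂ (k₂ , r₂ , d₂ , w₂ , e₂ , f₂ , S₂)) = ⊥-elim (no-two-structures (graph red) (graph blue) 1≤h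
    (λ x → subst (λ g → (3 * h + 12) * n ≤ 4 * h * g) (degX≡ x) (degree-arith {η} {h} {ν} {n} 1≤ν hη (dX x)))
    (λ y → subst (λ g → (3 * h + 12) * n ≤ 4 * h * g) (degY≡ y) (degree-arith {η} {h} {ν} {n} 1≤ν hη (dY y)))
    (length-arith {η} {h} {ν} {α₁} {α₂} {suc n} k₁ k₂ 1≤ν hη α≡1 r₁ r₂) (≤-trans (s≤s (m≤n+m _ n₀)) large) e₁ e₂ f₁ f₂ S₁ S₂)

theorem1p6 : (η : ℚ) → 0ℚ ℚ.< η →
    Σ ℕ λ N₀ → (1 ≤ N₀) ×
    ((N : ℕ) → N₀ < N →
    (α₁ α₂ : ℚ) → α₂ ℚ.< α₁ → 0ℚ ℚ.< α₂ → α₁ ℚ.+ α₂ ≡ 1ℚ →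
    (G : BipGraph (N ∸ 1)) →
    MinDegree≥ G (((+ 3 ℚ./ 4) ℚ.+ (+ 3 ℚ./ 1) ℚ.* η) ℚ.* ℕtoℚ (N ∸ 1)) →
    (col : Colouring (N ∸ 1)) →
    ((ℓ : ℕ) → 2 ∣ ℓ → 4 ≤ ℓ →
    ℕtoℚ ℓ ℚ.≤ ((+ 2 ℚ./ 1) ℚ.- (+ 3 ℚ./ 1) ℚ.* (η ℚ.* η)) ℚ.* α₁ ℚ.* ℕtoℚ N →
    MonoCycle G col red ℓ)
    ⊎
    ((ℓ : ℕ) → 2 ∣ ℓ → 4 ≤ ℓ →
    ℕtoℚ ℓ ℚ.≤ ((+ 2 ℚ./ 1) ℚ.- (+ 3 ℚ./ 1) ℚ.* (η ℚ.* η)) ℚ.* α₂ ℚ.* ℕtoℚ N →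
    MonoCycle G col blue ℓ))
theorem1p6 η 0<η =
  let h , ν , 1≤h , 1≤ν , hη = fraction η 0<η
      -- Why h³: the lost edges are divided by n/h to count the bad vertices, and the result must
      -- stay below the gain of order n/h² in the lengths.
      n₀ , rem = removal (8 * (h * h * h)) (*-mono-≤ {1} {8} {1} (s≤s z≤n) (*-mono-≤ (*-mono-≤ 1≤h 1≤h) 1≤h))
  in suc (n₀ + 8 * (h * h * h)) , s≤s z≤n , fromRemoval η h ν n₀ _ 1≤h 1≤ν hη refl rem
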